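{- Let $T$ be a complete first-order theory and let $M$ be a saturated model of $T$. Then the following are equivalent: (1) $T$ has the independence property (IP). (2) There exist a nontrivial automorphism $\sigma$ of $M$, a subset $A\subseteq M$ and a $\sigma$-invariant (countably additive) probability measure $\mu$ on the $\sigma$-algebra $\mathcal{A}$ generated by $\mathrm{Def}(A)$ such that $(M,\mathcal{A},\mu,\sigma)$ is not a compact dynamical system. (3) The same as (2), with $A=M$ (i.e. $\mu$ is a global measure, defined on the $\sigma$-algebra generated by $\mathrm{Def}(M)$). (4) $T$ is weak wide. (5) $T$ is strong wide.
   Context: $\mathrm{Def}(A)$ denotes the family of subsets of $M$ (in a fixed sort/tuple of variables) definable with parameters from $A$; a $\sigma$-invariant measure $\mu$ on $\mathcal{A}$ satisfies $\mu(\sigma(B))=\mu(B)$ for $B\in\mathcal{A}$. A measure-preserving system $(X,\mathcal{A},\mu,\sigma)$ is a compact (almost periodic) dynamical system if for every $\epsilon>0$ and every $B\in\mathcal{A}$ there is an integer $n\ge 1$ with $\mu(\sigma^n(B)\triangle B)<\epsilon$. Subsets of $\mathbb{Z}$ are identified with binary $\mathbb{Z}$-sequences. For $I\subseteq\mathbb{Z}$ let $dns(I)=\lim_{n\to\infty}|I\cap[-n,n]|/n$ when the limit exists, and let $I_n=I+n=\{i+n:i\in I\}$. For $\epsilon>0$, $I$ is $\epsilon$-wide if for every $n\in\mathbb{Z}$, $n\neq 0$, the densities $dns(I)$ and $dns(I\cap I_n)$ exist and $dns(I)-dns(I\cap I_n)\ge\epsilon$. For a set $X$, $B\subseteq X$,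 $a\in X$ and a bijection $\sigma:X\to X$, let $\xi_{\sigma,B}(a)=\{i\in\mathbb{Z}:\sigma^i(a)\in B\}$. A formula $\phi(x,y)$ is strong wide in a model $M$ if there are $a\in M$, a tuple $c\in M$, $\sigma\in\mathrm{Aut}(M)$ and $\epsilon>0$ such that $\xi_{\sigma,U}(a)$ is $\epsilon$-wide, where $U=\phi(M,c)$. It is weak wide in $M$ if there are sequences $(a_n)_{n\in\mathbb{Z}}$ in $M$, $(c_n)_{n\in\mathbb{Z}}$ in $M^{|y|}$ and $\epsilon>0$ such that, with $U_n=\{a_i:M\models\phi(a_i,c_n)\}$, we have $U_n=\{a_{i+n}:a_i\in U_0\}$ for all $n\in\mathbb{Z}$ and $\{i:a_i\in U_0\}$ is $\epsilon$-wide. $T$ is strong (weak) wide if some formula is strong (weak) wide in some model of $T$.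
   Formalization: M is assumed not countably infinite (the countable random graph is saturated with IP, yet (2) and (3) fail there), and in "weak wide" the a_n are taken pairwise distinct (otherwise every structure with two elements is weak wide). -}

module Defs where

open import Level using (Level; _⊔_) renaming (suc to lsuc)
open import Data.Bool.Base using (Bool; T; _∧_)
open import Data.Empty.Polymorphic using () renaming (⊥ to Empty)
open import Data.Fin.Base using (Fin)
open import Data.Fin.Subset using (Subset) renaming (_∈_ to _∈ˢ_)
open import Data.Integer.Base as ℤ using (ℤ; +_; -[1+_]; 0ℤ)
open import Data.List.Base using (List; map; upTo; filterᵇ; length)
open import Data.List.Relation.Unary.All using (All)
open import Data.Nat.Base as ℕ using (ℕ; zero; suc)
import Data.Nat.Properties as ℕ
open import Data.Product.Base using (Σ; ∃; ∃₂; _×_; _,_)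
open import Data.Rational.Base as ℚ using (ℚ; 0ℚ; 1ℚ; ½)
import Data.Rational.Properties as ℚ
open import Data.Rational.Solver using (module +-*-Solver)
open import Data.Sum.Base using (_⊎_)
open import Data.Unit.Polymorphic using (⊤)
open import Data.Vec.Functional using (Vector; _∷_; _++_; [])
open import Function.Base using (_∘_)
open import Function.Bundles using (_↔_; _⇔_; module Inverse)
open import Function.Definitions using (Injective)
open import Relation.Binary.PropositionalEquality using (_≡_; _≢_; refl; sym; trans; cong; subst)
open import Relation.Nullary using (¬_)
open import Relation.Unary using (Pred; _∈_; _≐_; _⊥_; ∁; ⋃; _∪_; _∖_)

private variable
  ℓ g : Level

-- Cauchy sequences of rationals, with setoid equality _≃_.

record ℝ : Set where
  constructor mkℝ
  field
    seq    : ℕ → ℚ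
    cauchy : ∀ ε → 0ℚ ℚ.< ε →
             ∃ λ N → ∀ m n → N ℕ.≤ m → N ℕ.≤ n → ℚ.∣ seq m ℚ.- seq n ∣ ℚ.< ε

open ℝ public

private
  half-pos : ∀ ε → 0ℚ ℚ.< ε → 0ℚ ℚ.< ½ ℚ.* ε
  half-pos ε 0<ε =
    subst (ℚ._< ½ ℚ.* ε) (ℚ.*-zeroʳ ½) (ℚ.*-monoʳ-<-pos ½ 0<ε)

  halves : ∀ ε → ½ ℚ.* ε ℚ.+ ½ ℚ.* ε ≡ ε
  halves ε = trans (sym (ℚ.*-distribʳ-+ ε ½ ½)) (ℚ.*-identityˡ ε)

  interchange : ∀ a b c d → (a ℚ.+ b) ℚ.- (c ℚ.+ d) ≡ (a ℚ.- c) ℚ.+ (b ℚ.- d)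
  interchange = solve 4
    (λ a b c d → (a :+ b) :- (c :+ d) := (a :- c) :+ (b :- d)) refl
    where open +-*-Solver

  neg-sub : ∀ a b → (ℚ.- a) ℚ.- (ℚ.- b) ≡ ℚ.- (a ℚ.- b)
  neg-sub a b = sym (ℚ.neg-distrib-+ a (ℚ.- b))

fromℚ : ℚ → ℝ
fromℚ q = mkℝ (λ _ → q) λ ε 0<ε →
  0 , λ _ _ _ _ → subst (ℚ._< ε) (sym (cong ℚ.∣_∣ (ℚ.+-inverseʳ q))) 0<ε

0ℝ 1ℝ : ℝ
0ℝ = fromℚ 0ℚ
1ℝ = fromℚ 1ℚ

infixl 6 _+ᴿ_ _-ᴿ_
infix  4 _<ᴿ_ _≤ᴿ_ _≃_

_+ᴿ_ : ℝ → ℝ → ℝ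
x +ᴿ y = mkℝ (λ n → seq x n ℚ.+ seq y n) λ ε 0<ε →
  let (N₁ , p) = cauchy x (½ ℚ.* ε) (half-pos ε 0<ε)
      (N₂ , q) = cauchy y (½ ℚ.* ε) (half-pos ε 0<ε)
  in N₁ ℕ.⊔ N₂ , λ m n N≤m N≤n →
    let open ℚ.≤-Reasoning
        x-m = seq x m
        x-n = seq x n
        y-m = seq y m
        y-n = seq y n
    in begin-strict
      ℚ.∣ (x-m ℚ.+ y-m) ℚ.- (x-n ℚ.+ y-n) ∣
        ≡⟨ cong ℚ.∣_∣ (interchange x-m y-m x-n y-n) ⟩
      ℚ.∣ (x-m ℚ.- x-n) ℚ.+ (y-m ℚ.- y-n) ∣
        ≤⟨ ℚ.∣p+q∣≤∣p∣+∣q∣ (x-m ℚ.- x-n) (y-m ℚ.- y-n) ⟩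
      ℚ.∣ x-m ℚ.- x-n ∣ ℚ.+ ℚ.∣ y-m ℚ.- y-n ∣
        <⟨ ℚ.+-mono-<
             (p m n (ℕ.m⊔n≤o⇒m≤o N₁ N₂ N≤m) (ℕ.m⊔n≤o⇒m≤o N₁ N₂ N≤n))
             (q m n (ℕ.m⊔n≤o⇒n≤o N₁ N₂ N≤m) (ℕ.m⊔n≤o⇒n≤o N₁ N₂ N≤n)) ⟩
      ½ ℚ.* ε ℚ.+ ½ ℚ.* ε
        ≡⟨ halves ε ⟩
      ε ∎

-ᴿ_ : ℝ → ℝ
-ᴿ x = mkℝ (λ n → ℚ.- seq x n) λ ε 0<ε →
  let (N , p) = cauchy x ε 0<ε
  in N , λ m n N≤m N≤n →
    subst (ℚ._< ε)
      (sym (trans (cong ℚ.∣_∣ (neg-sub (seq x m) (seq x n)))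
                  (ℚ.∣-p∣≡∣p∣ (seq x m ℚ.- seq x n))))
      (p m n N≤m N≤n)

_-ᴿ_ : ℝ → ℝ → ℝ
x -ᴿ y = x +ᴿ (-ᴿ y)

_<ᴿ_ _≤ᴿ_ _≃_ : ℝ → ℝ → Set
x <ᴿ y = ∃ λ ε → 0ℚ ℚ.< ε × ∃ λ N → ∀ n → N ℕ.≤ n → seq x n ℚ.+ ε ℚ.≤ seq y n
x ≤ᴿ y = ¬ (y <ᴿ x)
x ≃ y  = ∀ ε → 0ℚ ℚ.< ε → ∃ λ N → ∀ n → N ℕ.≤ n → ℚ.∣ seq x n ℚ.- seq y n ∣ ℚ.< ε

HasLimit : (ℕ → ℝ) → ℝ → Set
HasLimit x l = ∀ ε → 0ℝ <ᴿ ε →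
  ∃ λ N → ∀ n → N ℕ.≤ n → (x n -ᴿ l) <ᴿ ε × (l -ᴿ x n) <ᴿ ε

∑< : ℕ → (ℕ → ℝ) → ℝ
∑< zero    x = 0ℝ
∑< (suc n) x = ∑< n x +ᴿ x n

-- Subsets of ℤ are binary ℤ-sequences.

-- ∣ I ∩ [-n , n] ∣
count : (ℤ → Bool) → ℕ → ℕ
count I n = length (filterᵇ I (map (λ k → + k ℤ.- + n) (upTo (suc (2 ℕ.* n)))))

-- The quotient is by n (not by 2n+1), and the sequence starts at n = 1.
HasDensity : (ℤ → Bool) → ℝ → Set
HasDensity I = HasLimit (λ n → fromℚ (+ count I (suc n) ℚ./ suc n))

shift : (ℤ → Bool) → ℤ → (ℤ → Bool)
shift I n i = I (i ℤ.- n)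

Wide : ℝ → (ℤ → Bool) → Set
Wide ε I = ∀ n → n ≢ 0ℤ →
  ∃₂ λ d d′ → HasDensity I d × HasDensity (λ i → I i ∧ shift I n i) d′ × ε ≤ᴿ (d -ᴿ d′)

-- Wideness of a set given by a predicate is wideness of its characteristic
-- sequence, which exists and is unique under excluded middle.
WidePred : ℝ → Pred ℤ ℓ → Set ℓ
WidePred ε P = ∃ λ I → (∀ i → T (I i) ⇔ P i) × Wide ε I

data Generated {X : Set ℓ} (G : Pred (Pred X ℓ) g) : Pred (Pred X ℓ) (lsuc ℓ ⊔ g) where
  gen   : ∀ {B} → B ∈ G → B ∈ Generated G
  compl : ∀ {B} → B ∈ Generated G → ∁ B ∈ Generated G
  union : ∀ {B : ℕ → Pred X ℓ} → (∀ n → B n ∈ Generated G) → ⋃ ℕ B ∈ Generated G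
  resp  : ∀ {B C} → B ≐ C → B ∈ Generated G → C ∈ Generated G

-- A measure on 𝒜 is given by a total function whose values outside 𝒜 are ignored.
record IsProbability {X : Set ℓ} (𝒜 : Pred (Pred X ℓ) g) (μ : Pred X ℓ → ℝ) : Set (lsuc ℓ ⊔ g) where
  field
    μ-cong   : ∀ {B C} → B ∈ 𝒜 → C ∈ 𝒜 → B ≐ C → μ B ≃ μ C
    nonneg   : ∀ {B} → B ∈ 𝒜 → 0ℝ ≤ᴿ μ B
    total    : μ (λ _ → ⊤) ≃ 1ℝ
    additive : ∀ (B : ℕ → Pred X ℓ) → (∀ n → B n ∈ 𝒜) → (∀ i j → i ≢ j → B i ⊥ B j) →
               HasLimit (λ n → ∑< n (μ ∘ B)) (μ (⋃ ℕ B))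

image : {X : Set ℓ} → (X → X) → Pred X ℓ → Pred X ℓ
image f B x = ∃ λ b → b ∈ B × f b ≡ x

infixl 6 _△_
_△_ : {X : Set ℓ} → Pred X ℓ → Pred X ℓ → Pred X ℓ
B △ C = (B ∖ C) ∪ (C ∖ B)

infixr 8 _^ᶻ_
_^ᶻ_ : {X : Set ℓ} → X ↔ X → ℤ → X → X
(σ ^ᶻ (+ zero))    x = x
(σ ^ᶻ (+ suc n))   x = Inverse.to σ ((σ ^ᶻ (+ n)) x)
(σ ^ᶻ -[1+ zero ]) x = Inverse.from σ x
(σ ^ᶻ -[1+ suc n ]) x = Inverse.from σ ((σ ^ᶻ -[1+ n ]) x)

Invariant : {X : Set ℓ} → Pred (Pred X ℓ) g → (Pred X ℓ → ℝ) → X ↔ X → Set (lsuc ℓ ⊔ g)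
Invariant 𝒜 μ σ = ∀ {B} → B ∈ 𝒜 →
  image (Inverse.to σ) B ∈ 𝒜 × μ (image (Inverse.to σ) B) ≃ μ B

CompactSystem : {X : Set ℓ} → Pred (Pred X ℓ) g → (Pred X ℓ → ℝ) → X ↔ X → Set (lsuc ℓ ⊔ g)
CompactSystem 𝒜 μ σ = ∀ ε → 0ℝ <ᴿ ε → ∀ B → B ∈ 𝒜 →
  ∃ λ n → 1 ℕ.≤ n × μ (image (σ ^ᶻ (+ n)) B △ B) <ᴿ ε

ξ : {X : Set ℓ} → X ↔ X → Pred X ℓ → X → Pred ℤ ℓ
ξ σ B a i = (σ ^ᶻ i) a ∈ B

record Language ℓ : Set (lsuc ℓ) where
  field
    Func : ℕ → Set ℓ
    Rel  : ℕ → Set ℓ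

open Language public

data Term (L : Language ℓ) (n : ℕ) : Set ℓ where
  var : Fin n → Term L n
  app : ∀ {k} → Func L k → Vector (Term L n) k → Term L n

-- Free variables are Fin n; `all` binds variable zero. The remaining
-- connectives are the usual classical abbreviations.
data Formula (L : Language ℓ) (n : ℕ) : Set ℓ where
  falsum : Formula L n
  equal  : Term L n → Term L n → Formula L n
  rel    : ∀ {k} → Rel L k → Vector (Term L n) k → Formula L n
  imp    : Formula L n → Formula L n → Formula L n
  all    : Formula L (suc n) → Formula L n

neg : {L : Language ℓ} {n : ℕ} → Formula L n → Formula L n
neg φ = imp φ falsum

record Structure (L : Language ℓ) : Set (lsuc ℓ) where
  field
    Carrier  : Set ℓ
    nonempty : Carrier
    func     : ∀ {k} → Func L k → Vector Carrier k → Carrier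
    relation : ∀ {k} → Rel L k → Vector Carrier k → Set ℓ

open Structure public

module _ {L : Language ℓ} where

  eval : (M : Structure L) → ∀ {n} → Vector (Carrier M) n → Term L n → Carrier M
  eval M e (var i)    = e i
  eval M e (app f ts) = func M f (λ i → eval M e (ts i))

  infix 4 _⊨_[_] _⊨_ _⊨ᵀ_ _⊩_

  _⊨_[_] : (M : Structure L) → ∀ {n} → Formula L n → Vector (Carrier M) n → Set ℓ
  M ⊨ falsum    [ e ] = Empty
  M ⊨ equal s t [ e ] = eval M e s ≡ eval M e t
  M ⊨ rel r ts  [ e ] = relation M r (λ i → eval M e (ts i))
  M ⊨ imp φ ψ   [ e ] = M ⊨ φ [ e ] → M ⊨ ψ [ e ]
  M ⊨ all φ     [ e ] = ∀ a → M ⊨ φ [ a ∷ e ]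

  Sentence : Set ℓ
  Sentence = Formula L 0

  _⊨_ : Structure L → Sentence → Set ℓ
  M ⊨ φ = M ⊨ φ [ [] ]

  Theory : Set (lsuc ℓ)
  Theory = Pred Sentence ℓ

  _⊨ᵀ_ : Structure L → Theory → Set ℓ
  M ⊨ᵀ Th = ∀ φ → φ ∈ Th → M ⊨ φ

  _⊩_ : Theory → Sentence → Set (lsuc ℓ)
  Th ⊩ φ = ∀ M → M ⊨ᵀ Th → M ⊨ φ

  Complete : Theory → Set (lsuc ℓ)
  Complete Th = (∃ λ M → M ⊨ᵀ Th) × (∀ φ → Th ⊩ φ ⊎ Th ⊩ neg φ)

  record Aut (M : Structure L) : Set ℓ where
    field
      bij          : Carrier M ↔ Carrier M
      preservesFun : ∀ {k} (f : Func L k) xs →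
                     Inverse.to bij (func M f xs) ≡ func M f (Inverse.to bij ∘ xs)
      preservesRel : ∀ {k} (r : Rel L k) xs →
                     relation M r xs ⇔ relation M r (Inverse.to bij ∘ xs)

  open Aut public

  Nontrivial : {M : Structure L} → Aut M → Set ℓ
  Nontrivial σ = ¬ (∀ x → Inverse.to (bij σ) x ≡ x)

  -- Formulas in one free variable with parameters from A.
  ParamFormula : (M : Structure L) → Pred (Carrier M) ℓ → Set ℓ
  ParamFormula M A = ∃ λ k → Formula L (suc k) × Σ (Vector (Carrier M) k) λ c → ∀ i → c i ∈ A

  Solutions : (M : Structure L) (A : Pred (Carrier M) ℓ) → ParamFormula M A → Pred (Carrier M) ℓ
  Solutions M A (_ , φ , c , _) x = M ⊨ φ [ x ∷ c ]

  Def : (M : Structure L) → Pred (Carrier M) ℓ → Pred (Pred (Carrier M) ℓ) ℓ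
  Def M A B = ∃ λ φ → B ≐ Solutions M A φ

  -- ∣A∣ < ∣M∣ for A ⊆ M
  Smaller : (M : Structure L) → Pred (Carrier M) ℓ → Set ℓ
  Smaller M A = ¬ ∃ λ (f : Carrier M → Carrier M) → Injective _≡_ _≡_ f × (∀ x → f x ∈ A)

  -- Every 1-type (finitely satisfiable set of formulas) over a set of
  -- fewer than ∣M∣ parameters is realised in M.
  Saturated : Structure L → Set (lsuc ℓ)
  Saturated M = ∀ (A : Pred (Carrier M) ℓ) → Smaller M A →
    ∀ (p : Pred (ParamFormula M A) ℓ) →
    (∀ (Φ : List (ParamFormula M A)) → All p Φ →
      ∃ λ x → All (λ φ → x ∈ Solutions M A φ) Φ) →
    ∃ λ x → ∀ φ → φ ∈ p → x ∈ Solutions M A φ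

  -- φ(x,y) with ∣x∣ = p, ∣y∣ = q shatters sets of p-tuples of every finite size.
  FormulaIP : (M : Structure L) → ∀ p q → Formula L (p ℕ.+ q) → Set ℓ
  FormulaIP M p q φ = ∀ n →
    Σ (Fin n → Vector (Carrier M) p) λ a → Σ (Subset n → Vector (Carrier M) q) λ b →
    ∀ i S → (M ⊨ φ [ a i ++ b S ]) ⇔ (i ∈ˢ S)

  IP : Theory → Set (lsuc ℓ)
  IP Th = ∃₂ λ p q → ∃ λ φ → ∃ λ M → M ⊨ᵀ Th × FormulaIP M p q φ

  NonCompactOver : (M : Structure L) → Aut M → Pred (Carrier M) ℓ → Set (lsuc ℓ)
  NonCompactOver M σ A = ∃ λ μ →
    IsProbability 𝒜 μ × Invariant 𝒜 μ (bij σ) × ¬ CompactSystem 𝒜 μ (bij σ)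
    where
    𝒜 : Pred (Pred (Carrier M) ℓ) (lsuc ℓ)
    𝒜 = Generated (Def M A)

  StrongWideFormula : (M : Structure L) → ∀ q → Formula L (suc q) → Set ℓ
  StrongWideFormula M q φ =
    Σ (Carrier M) λ a → Σ (Vector (Carrier M) q) λ c → Σ (Aut M) λ σ → Σ ℝ λ ε →
    0ℝ <ᴿ ε × WidePred ε (ξ (bij σ) (λ x → M ⊨ φ [ x ∷ c ]) a)

  -- The aᵢ are pairwise distinct. Without this, any structure with two
  -- elements u ≠ v would have a weak wide formula: take I wide, aᵢ = u for
  -- i ∈ I and aᵢ = v otherwise, φ(x,y,z) := x = y ∨ x = z, c₀ = (u,u) and
  -- cₙ with φ(M,cₙ) = {a_{i+n} : i ∈ I} ⊆ {u,v} for n ≠ 0.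
  WeakWideFormula : (M : Structure L) → ∀ q → Formula L (suc q) → Set ℓ
  WeakWideFormula M q φ =
    Σ (ℤ → Carrier M) λ a → Σ (ℤ → Vector (Carrier M) q) λ c → Σ ℝ λ ε →
    let Uₙ : ℤ → Pred (Carrier M) ℓ
        Uₙ n x = ∃ λ i → x ≡ a i × M ⊨ φ [ a i ∷ c n ]
    in Injective _≡_ _≡_ a
     × 0ℝ <ᴿ ε
     × (∀ n → Uₙ n ≐ λ x → ∃ λ i → x ≡ a (i ℤ.+ n) × a i ∈ Uₙ 0ℤ)
     × WidePred ε (λ i → a i ∈ Uₙ 0ℤ)

  StrongWide : Theory → Set (lsuc ℓ)
  StrongWide Th = ∃ λ M → M ⊨ᵀ Th × ∃₂ λ q φ → StrongWideFormula M q φ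

  WeakWide : Theory → Set (lsuc ℓ)
  WeakWide Th = ∃ λ M → M ⊨ᵀ Th × ∃₂ λ q φ → WeakWideFormula M q φ

{-# OPTIONS --safe #-}
module Submission where

-- Both directions go through VC dimension.
--
-- From a noncompact system or a wide sequence to IP: one gets infinitely many
-- translates D_n of a definable set that pairwise differ on a set of measure
-- (density) at least γ. Averaging, some point separates a fraction γ of any finite
-- list of pairs, so O(s) points separate 2^s of the D_n, and by Sauer–Shelah the
-- D_n shatter sets of every finite size.
--
-- From IP: counting types with Sauer–Shelah twice reduces to a formula θ(x; y) with
-- a single variable x. In M a Morley sequence (a_n) of a coheir keeps every finite
-- subset shattered by θ and has a_n ↦ a_{n+1} elementary, so by back and forth the
-- shift extends to an automorphism σ, and every binary sequence on the orbit
-- (σ^i a_0), i ∈ ℤ, is cut out by some θ(x; c). For the Rudin–Shapiro sequence all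
-- correlations vanish: this gives wideness, and the frequencies along the orbit,
-- which are countably additive on definable sets by saturation, extend to an
-- invariant measure that is not almost periodic.

open import Defs
open import Axiom.ExcludedMiddle using (ExcludedMiddle)
open import Axiom.Extensionality.Propositional using (Extensionality; ∀-extensionality)
open import Level using (Level; Lift; lift; lower; _⊔_) renaming (suc to lsuc; zero to lzero)
open import Data.Bool.Base using (Bool; true; false; T; not; _∧_; _∨_; _xor_; if_then_else_)
import Data.Bool.Properties as Bool
open import Data.Bool.Solver using (module xor-∧-Solver)
open import Data.Empty using (⊥; ⊥-elim)
open import Data.Fin.Base as Fin using (Fin; zero; suc; toℕ)
import Data.Fin.Properties as Fin
open import Data.Fin.Subset using (Subset) renaming (_∈_ to _∈ˢ_)
open import Data.Integer.Base as ℤ using (ℤ; -[1+_]; 0ℤ)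
import Data.Integer.Properties as ℤ
open import Algebra.Properties.AbelianGroup ℤ.+-0-abelianGroup using () renaming (∙-cancelˡ to +-cancelˡ)
open import Data.List.Base as List using (List; []; _∷_; length; filterᵇ; applyUpTo)
import Data.List.Properties as List
import Data.List.Membership.Propositional.Properties as List
open import Data.List.Membership.Propositional using () renaming (_∈_ to _∈ᴸ_)
open import Data.List.Relation.Unary.All as All using (All; []; _∷_)
import Data.List.Relation.Unary.All.Properties as All
open import Data.List.Relation.Unary.Any as Any using (Any; here; there)
import Data.List.Relation.Unary.Any.Properties as Any
open import Data.Nat.Base as ℕ using (ℕ; zero; suc; _+_; _*_; _∸_; _^_; _≤_; _<_; z≤n; s≤s)
import Data.Nat.Properties as ℕ
import Data.Nat.Induction as ℕ
open import Data.Nat.Tactic.RingSolver using (solve-∀)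
open import Data.Product.Base using (Σ; ∃; ∃₂; _×_; _,_; proj₁; proj₂)
open import Data.Rational.Base as ℚ using (ℚ; 0ℚ; 1ℚ; ½)
import Data.Rational.Properties as ℚ
import Data.Rational.Unnormalised.Base as ℚᵘ
import Data.Rational.Unnormalised.Properties as ℚᵘ
open import Data.Rational.Solver renaming (module +-*-Solver to ℚSolver)
open import Data.Sum.Base as Sum using (_⊎_; inj₁; inj₂; [_,_]′)
import Data.Sum.Properties as Sum
open import Data.Unit.Base using (tt)
open import Data.Unit.Polymorphic using (⊤)
import Data.Vec.Base as Vec
import Data.Vec.Properties as Vec
import Data.Vec.Functional.Properties as V
import Data.Vec.Functional as V
open import Data.Vec.Functional using (Vector)
open import Function.Base using (_∘_; id; case_of_)
open import Function.Bundles using (_⇔_; _↔_; mk⇔; mk↔ₛ′; module Equivalence; module Inverse)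
open import Function.Definitions using (Injective)
open import Induction.WellFounded as WF using (WellFounded; Acc; acc)
import Relation.Binary.Construct.On as On
open import Relation.Binary.Definitions using (tri<; tri≈; tri>)
open import Relation.Binary.PropositionalEquality using (_≡_; _≢_; refl; sym; trans; cong; cong₂; subst; subst₂; module ≡-Reasoning)
open import Relation.Nullary using (¬_; ¬?; Dec; yes; no)
open import Relation.Unary using (Pred; _∈_; _≐_; ∁; ⋃; _∪_; _∩_; _∖_)

-- Smallness of a parameter set is only the absence of an injection of `Carrier M` into it, so each
-- use of saturation must exclude such injections directly. Uncountability of `M` enters here: in a
-- well-order of `M` none of whose initial segments receives `M`, a segment together with countably
-- many further names is still too small. The coheir, the back and forth and the compactness of
-- countable definable covers all rest on this. The well-ordering theorem also yields the
-- ultrafilter, which serves twice: for the average type behind the Morley sequence and for the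
-- limit frequencies of the invariant measure. Wideness asks for actual two-sided densities, hence
-- an explicit pattern; the Rudin-Shapiro recursion gives elementary o(N) bounds. As densities
-- divide by n and not by the length of the window, the pattern has density 1 and its meets with
-- translates ½, whence the constant ½. Along the forward orbit symmetric differences have frequency
-- ½, and ¼ is a threshold below it.

module Classical (em : ∀ {a} → ExcludedMiddle a) (ext : ∀ {a b} → Extensionality a b) where

  -- Classical logic, truth values and Zermelo's well-ordering theorem.

  module WellOrdering where

    private variable
      a b c : Level
      A : Set a
      B : Set b

    decide : (P : Set a) → Dec P
    decide P = em

    dne : ¬ ¬ A → A
    dne {A = A} ¬¬x with decide A
    ... | yes x = x
    ... | no ¬x = ⊥-elim (¬¬x ¬x)

    ¬∀⇒∃ : {P : A → Set b} → ¬ (∀ x → P x) → ∃ λ x → ¬ P x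
    ¬∀⇒∃ ¬all = dne λ none → ¬all λ x → dne λ ¬p → none (x , ¬p)

    ¬⇒×¬ : ¬ (A → B) → A × ¬ B
    ¬⇒×¬ f = dne (λ ¬a → f λ x → ⊥-elim (¬a (x , λ y → f λ _ → y)))

    -- Since the result is a `Bool`, a proposition of any universe level becomes something that can
    -- be counted and stored in a type in `Set`.
    ⌞_⌟ : Set a → Bool
    ⌞ P ⌟ with decide (P)
    ... | yes _ = true
    ... | no _  = false

    holds : {P : Set a} → T ⌞ P ⌟ → P
    holds {P = P} t with decide (P)
    ... | yes p = p

    true! : {P : Set a} → P → T ⌞ P ⌟
    true! {P = P} p with decide (P)
    ... | yes _ = tt
    ... | no ¬p = ¬p p

    T-ext : ∀ {x y} → (T x → T y) → (T y → T x) → x ≡ y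
    T-ext {false} {false} _ _ = refl
    T-ext {false} {true}  _ g = ⊥-elim (g tt)
    T-ext {true}  {false} f _ = ⊥-elim (f tt)
    T-ext {true}  {true}  _ _ = refl

    ⌞⌟-cong : {P : Set a} {Q : Set b} → (P → Q) → (Q → P) → ⌞ P ⌟ ≡ ⌞ Q ⌟
    ⌞⌟-cong f g = T-ext (true! ∘ f ∘ holds) (true! ∘ g ∘ holds)

    ¬T⇒T-not : ∀ {x} → ¬ T x → T (not x)
    ¬T⇒T-not {false} _ = tt
    ¬T⇒T-not {true}  f = f tt

    T-not⇒¬T : ∀ {x} → T (not x) → ¬ T x
    T-not⇒¬T {false} _ t = t

    ∨-inl : ∀ {x y} → T x → T (x ∨ y)
    ∨-inl {true} _ = tt

    ∨-inr : ∀ {x y} → T y → T (x ∨ y)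
    ∨-inr {true}  _ = tt
    ∨-inr {false} t = t

    ∨-elim : ∀ {x y} → T (x ∨ y) → T x ⊎ T y
    ∨-elim {true}  t = inj₁ tt
    ∨-elim {false} t = inj₂ t

    record WellOrder (X : Set a) : Set (lsuc lzero ⊔ a) where
      field
        _≺_      : X → X → Set
        wf       : WellFounded _≺_
        ≺-trans  : ∀ {x y z} → x ≺ y → y ≺ z → x ≺ z
        trichot  : ∀ x y → (x ≺ y) ⊎ ((x ≡ y) ⊎ (y ≺ x))

      least : (P : X → Set b) → ∃ P → ∃ λ x → P x × (∀ y → y ≺ x → ¬ P y)
      least P (x , px) = go x (wf x) px
        where
        go : ∀ x → Acc _≺_ x → P x → ∃ λ x → P x × (∀ y → y ≺ x → ¬ P y)
        go x (acc rs) px with decide (∃ λ y → y ≺ x × P y)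
        ... | yes (y , y≺x , py) = go y (rs y≺x) py
        ... | no none = x , px , λ y y≺x py → none (y , y≺x , py)

    -- Zermelo's argument: the least family of subsets closed under adjoining a
    -- chosen new element and under unions is a chain, and x ≺ y holds when the
    -- largest member avoiding y contains x.
    module Zermelo (X : Set a) where

      private
        -- Subsets with values in `Bool` stay in `Set a`, and so do families of them; hence `Tower`
        -- can be closed under arbitrary unions without raising its level.
        Sub : Set a
        Sub = X → Bool

        _⊑_ : Sub → Sub → Set a
        S ⊑ S′ = ∀ x → T (S x) → T (S′ x)

        ⊑-antisym : ∀ {S S′} → S ⊑ S′ → S′ ⊑ S → S ≡ S′
        ⊑-antisym p q = ext λ x → T-ext (p x) (q x)

        -- Excluded middle for an untruncated `∃` produces an element outside `S` or refutes that
        -- there is one. As `em` is a function, this is the choice function of Zermelo's proof.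
        new : (S : Sub) → Dec (∃ λ x → ¬ T (S x))
        new S = em

        adjoin : (S : Sub) → Dec (∃ λ x → ¬ T (S x)) → Sub
        adjoin S (yes (y , _)) x = S x ∨ ⌞ y ≡ x ⌟
        adjoin S (no _)        x = S x

        _⁺ : Sub → Sub
        S ⁺ = adjoin S (new S)

        ⁺-grow : ∀ S → S ⊑ (S ⁺)
        ⁺-grow S x t with new S
        ... | yes _ = ∨-inl t
        ... | no _  = t

        ⁺-new : ∀ S x → ¬ T (S x) → ∃ λ y → ¬ T (S y) × T ((S ⁺) y) × (∀ z → T ((S ⁺) z) → T (S z) ⊎ y ≡ z)
        ⁺-new S x ¬t with new S
        ... | yes (y , ¬y) = y , ¬y , ∨-inr {S y} (true! refl) , λ z t → Sum.map₂ holds (∨-elim t)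
        ... | no none      = ⊥-elim (none (x , ¬t))

        Union : (Sub → Bool) → Sub
        Union 𝓕 x = ⌞ (∃ λ S → T (𝓕 S) × T (S x)) ⌟

        data Tower : Sub → Set a where
          step : ∀ {S} → Tower S → Tower (S ⁺)
          sup  : ∀ 𝓕 → (∀ S → T (𝓕 S) → Tower S) → Tower (Union 𝓕)

        -- Extreme members in the sense of the Bourbaki-Witt theorem. Every member of the tower is
        -- comparable with an extreme one, and induction over the tower makes all members extreme,
        -- so the tower is a chain.
        Extreme : Sub → Set a
        Extreme S = ∀ S′ → Tower S′ → S′ ⊑ S → S′ ≢ S → (S′ ⁺) ⊑ S

        extreme-cmp : ∀ {S} → Extreme S → ∀ {S′} → Tower S′ → S′ ⊑ S ⊎ (S ⁺) ⊑ S′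
        extreme-cmp {S} e (step {S′} t) with extreme-cmp e t
        ... | inj₂ q = inj₂ λ x s → ⁺-grow S′ x (q x s)
        ... | inj₁ p with decide (S′ ≡ S)
        ...   | yes refl = inj₂ λ _ s → s
        ...   | no S′≢S  = inj₁ (e S′ t p S′≢S)
        extreme-cmp {S} e (sup 𝓕 ts) with decide (∃ λ S′ → T (𝓕 S′) × (S ⁺) ⊑ S′)
        ... | yes (S′ , f , q) = inj₂ λ x s → true! (S′ , f , q x s)
        ... | no none = inj₁ λ x t → below x (holds t)
          where
          below : ∀ x → (∃ λ S′ → T (𝓕 S′) × T (S′ x)) → T (S x)
          below x (S′ , f , s) with extreme-cmp e (ts S′ f)
          ... | inj₁ p = p x s
          ... | inj₂ q = ⊥-elim (none (S′ , f , q))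

        extreme : ∀ {S} → Tower S → Extreme S
        extreme (step {S} t) S′ t′ p S′≢ with extreme-cmp (extreme t) t′
        ... | inj₂ q = ⊥-elim (S′≢ (⊑-antisym p q))
        ... | inj₁ q with decide (S′ ≡ S)
        ...   | yes refl = λ _ s → s
        ...   | no S′≢S  = λ x s → ⁺-grow S x (extreme t S′ t′ q S′≢S x s)
        extreme (sup 𝓕 ts) S′ t′ p S′≢ x s =
          let S , S∉ = ¬∀⇒∃ {P = λ S → T (𝓕 S) → S ⊑ S′}
                         λ all → S′≢ (⊑-antisym p λ y u → let (S , f , v) = holds u in all S f y v)
              f , S⋢ = ¬⇒×¬ S∉
          in true! (S , f , smaller S f S⋢ x s)
          where
          smaller : ∀ S → T (𝓕 S) → ¬ (S ⊑ S′) → (S′ ⁺) ⊑ S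
          smaller S f S⋢ with extreme-cmp (extreme (ts S f)) t′
          ... | inj₂ q = ⊥-elim (S⋢ λ y u → q y (⁺-grow S y u))
          ... | inj₁ q = extreme (ts S f) S′ t′ q λ { refl → S⋢ λ _ u → u }

        cmp : ∀ {S S′} → Tower S → Tower S′ → S′ ⊑ S ⊎ (S ⁺) ⊑ S′
        cmp t t′ = extreme-cmp (extreme t) t′

        avoids : X → Sub → Bool
        avoids x S = ⌞ Tower S × ¬ T (S x) ⌟

        below : X → Sub
        below x = Union (avoids x)

        below-tower : ∀ x → Tower (below x)
        below-tower x = sup _ λ S t → proj₁ (holds t)

        ∉below : ∀ x → ¬ T (below x x)
        ∉below x t = let (S , f , s) = holds t in proj₂ (holds f) s

        ⊑below : ∀ {x S} → Tower S → ¬ T (S x) → S ⊑ below x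
        ⊑below {x} {S} t ¬s y s = true! (S , true! (t , ¬s) , s)

        -- The element adjoined to `below x` has to be `x`: otherwise the next stage would still
        -- avoid `x` and so lie inside `below x`, although it has just gained a new element.
        below⁺ : ∀ x → T ((below x ⁺) x) × (∀ z → T ((below x ⁺) z) → T (below x z) ⊎ x ≡ z)
        below⁺ x with ⁺-new (below x) x (∉below x)
        ... | y , ¬y , y∈ , only with decide (T ((below x ⁺) x))
        ...   | no ¬s = ⊥-elim (¬y (⊑below (step (below-tower x)) ¬s y y∈))
        ...   | yes s with only x s
        ...     | inj₁ u    = ⊥-elim (∉below x u)
        ...     | inj₂ refl = s , only

        _≺′_ : X → X → Set
        x ≺′ y = T (below y x)

        -- In the successor case a new element `x` of `S ⁺` has all its predecessors in `S`; by
        -- comparability the alternative is that `S ⁺`, which contains `x`, lies inside `below x`.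
        accessible : ∀ {S} → Tower S → ∀ x → T (S x) → Acc _≺′_ x
        accessible (sup 𝓕 ts) x u = let (S , f , s) = holds u in accessible (ts S f) x s
        accessible (step {S} t) x u with decide (T (S x))
        ... | yes s = accessible t x s
        ... | no ¬s = acc λ {y} y≺x → accessible t y (sub y y≺x)
          where
          sub : below x ⊑ S
          sub with cmp t (below-tower x)
          ... | inj₁ p = p
          ... | inj₂ q = ⊥-elim (∉below x (q x u))

        compare : ∀ x y → below y ⊑ below x ⊎ x ≺′ y
        compare x y = Sum.map₂ (λ q → q x (proj₁ (below⁺ x))) (cmp (below-tower x) (below-tower y))

        below-inj : ∀ {x y} → below x ≡ below y → x ≡ y
        below-inj {x} {y} e with proj₂ (below⁺ y) x (subst (λ S → T ((S ⁺) x)) e (proj₁ (below⁺ x)))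
        ... | inj₁ u    = ⊥-elim (∉below x (subst (λ S → T (S x)) (sym e) u))
        ... | inj₂ refl = refl

      wellOrder : WellOrder X
      wellOrder = record
        { _≺_     = _≺′_
        ; wf      = wf′
        ; ≺-trans = λ {x} {y} x≺y y≺z → ⊑below (below-tower y) (WF.wf⇒asym wf′ y≺z) x x≺y
        ; trichot = λ x y → tri x y (compare x y) (compare y x)
        }
        where
        wf′ : WellFounded _≺′_
        wf′ x = accessible (step (below-tower x)) x (proj₁ (below⁺ x))

        tri : ∀ x y → below y ⊑ below x ⊎ x ≺′ y → below x ⊑ below y ⊎ y ≺′ x →
              (x ≺′ y) ⊎ ((x ≡ y) ⊎ (y ≺′ x))
        tri x y (inj₂ x≺y) _          = inj₁ x≺y
        tri x y (inj₁ _)   (inj₂ y≺x) = inj₂ (inj₂ y≺x)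
        tri x y (inj₁ p)   (inj₁ q)   = inj₂ (inj₁ (below-inj (⊑-antisym q p)))

  open WellOrdering

  -- Cardinality along an initial well-order, and a nonprincipal ultrafilter on ℕ.

  module Cardinality where

    private variable
      a b c : Level
      A : Set a
      B : Set b

    infinite-or-listed : (P : A → Set b) →
      (∃ λ (i : ℕ → A) → Injective _≡_ _≡_ i × (∀ n → P (i n))) ⊎ (∃ λ l → ∀ x → P x → x ∈ᴸ l)
    infinite-or-listed {A = A} P with decide (∃ λ l → ∀ x → P x → x ∈ᴸ l)
    ... | yes listed = inj₂ listed
    ... | no none = inj₁ (i , inj , λ n → proj₁ (proj₂ (fresh (prefix n))))
      where
      fresh : ∀ l → ∃ λ x → P x × ¬ (x ∈ᴸ l)
      fresh l = let (x , q) = ¬∀⇒∃ λ all → none (l , all) in x , ¬⇒×¬ q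

      prefix : ℕ → List A
      prefix zero    = []
      prefix (suc n) = proj₁ (fresh (prefix n)) ∷ prefix n

      i : ℕ → A
      i n = proj₁ (fresh (prefix n))

      occurs : ∀ {m n} → m ℕ.<′ n → i m ∈ᴸ prefix n
      occurs ℕ.≤′-refl       = here refl
      occurs (ℕ.<′-step m<n) = there (occurs m<n)

      inj : Injective _≡_ _≡_ i
      inj {m} {n} e with ℕ.<-cmp m n
      ... | tri< m<n _ _ = ⊥-elim (proj₂ (proj₂ (fresh (prefix n))) (subst (_∈ᴸ prefix n) e (occurs (ℕ.<⇒<′ m<n))))
      ... | tri≈ _ m≡n _ = m≡n
      ... | tri> _ _ n<m = ⊥-elim (proj₂ (proj₂ (fresh (prefix m))) (subst (_∈ᴸ prefix m) (sym e) (occurs (ℕ.<⇒<′ n<m))))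

    -- Follow f on the orbits starting outside the range of g, and g⁻¹ elsewhere.
    module CantorBernstein {A : Set a} {B : Set b} (f : A → B) (g : B → A)
                           (f-inj : Injective _≡_ _≡_ f) (g-inj : Injective _≡_ _≡_ g) where
      private
        data Start : A → Set (a ⊔ b) where
          base : ∀ {x} → ¬ (∃ λ y → g y ≡ x) → Start x
          next : ∀ {x} → Start x → Start (g (f x))

        back : ∀ x → ¬ Start x → ∃ λ y → g y ≡ x
        back x ¬s = dne λ ¬y → ¬s (base ¬y)

        to : A → B
        to x with decide (Start x)
        ... | yes _ = f x
        ... | no ¬s = proj₁ (back x ¬s)

        back-start : ∀ {y} → Start (g y) → ∃ λ x → Start x × f x ≡ y
        back-start {y} s = go s refl
          where
          go : ∀ {z} → Start z → z ≡ g y → ∃ λ x → Start x × f x ≡ y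
          go (base ¬y) e = ⊥-elim (¬y (y , sym e))
          go (next {x} s) e = x , s , g-inj e

        from : B → A
        from y with decide (Start (g y))
        ... | yes s = proj₁ (back-start s)
        ... | no _  = g y

        to-start : ∀ {x} → Start x → to x ≡ f x
        to-start {x} s with decide (Start x)
        ... | yes _ = refl
        ... | no ¬s = ⊥-elim (¬s s)

        to-other : ∀ {x} → ¬ Start x → g (to x) ≡ x
        to-other {x} ¬s with decide (Start x)
        ... | yes s = ⊥-elim (¬s s)
        ... | no ¬s = proj₂ (back x ¬s)

        to∘from : ∀ y → to (from y) ≡ y
        to∘from y with decide (Start (g y))
        ... | yes s = let (x , sx , e) = back-start s in trans (to-start sx) e
        ... | no ¬s = g-inj (to-other ¬s)

        from-start : ∀ {y} (s : Start (g y)) → f (from y) ≡ y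
        from-start {y} s with decide (Start (g y))
        ... | yes s = proj₂ (proj₂ (back-start s))
        ... | no ¬s = ⊥-elim (¬s s)

        from-other : ∀ {y} → ¬ Start (g y) → from y ≡ g y
        from-other {y} ¬s with decide (Start (g y))
        ... | yes s = ⊥-elim (¬s s)
        ... | no _  = refl

        from∘to : ∀ x → from (to x) ≡ x
        from∘to x with decide (Start x)
        ... | yes s = f-inj (from-start (next s))
        ... | no ¬s = let (y , e) = back x ¬s in trans (from-other λ s → ¬s (subst Start e s)) e

      bijection : A ↔ B
      bijection = mk↔ₛ′ to from to∘from from∘to

    -- The order type is an initial ordinal, which takes the place of the cardinal of `X`.
    record InitialOrder (X : Set a) : Set (lsuc lzero ⊔ a) where
      field
        order : WellOrder X
      open WellOrder order public
      field
        initial : ∀ x → ¬ ∃ λ (f : X → X) → Injective _≡_ _≡_ f × (∀ y → f y ≺ x)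

    -- If some segment receives an injection of `X`, the order is pulled back along an injection
    -- into the least such segment. A segment of the new order that received `X` would yield an
    -- earlier one in the old order.
    initialOrder : (X : Set a) → InitialOrder X
    initialOrder X = choose (decide (∃ Embeds))
      where
      W = Zermelo.wellOrder X
      open WellOrder W

      Embeds : X → Set _
      Embeds x = ∃ λ (f : X → X) → Injective _≡_ _≡_ f × (∀ y → f y ≺ x)

      choose : Dec (∃ Embeds) → InitialOrder X
      choose (no none) = record { order = W ; initial = λ x e → none (x , e) }
      choose (yes some) = let (x , (f , f-inj , f≺x) , min) = least Embeds some in record
        { order = record
          { _≺_     = λ y z → f y ≺ f z
          ; wf      = On.wellFounded f wf
          ; ≺-trans = ≺-trans
          ; trichot = λ y z → Sum.map₂ (Sum.map₁ f-inj) (trichot (f y) (f z))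
          }
        ; initial = λ y (g , g-inj , g≺) → min (f y) (f≺x y) (f ∘ g , g-inj ∘ f-inj , g≺)
        }

    double-parity : ∀ (m n : ℕ) → 2 * m ≢ suc (2 * n)
    double-parity (suc m) zero    e = case trans (sym (ℕ.+-suc m (m + 0))) (ℕ.suc-injective e) of λ ()
    double-parity (suc m) (suc n) e = double-parity m n
      (ℕ.suc-injective (trans (sym (ℕ.+-suc m (m + 0))) (trans (ℕ.suc-injective e) (ℕ.+-suc (suc n) (n + 0)))))

    double-injective : ∀ {m n : ℕ} → 2 * m ≡ 2 * n → m ≡ n
    double-injective {m} {n} = ℕ.*-cancelˡ-≡ m n 2

    module Uncountable {X : Set a} (I : InitialOrder X) (seq∞ : ℕ → X) (seq∞-inj : Injective _≡_ _≡_ seq∞)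
                       (uncountable : ¬ (ℕ ↔ X)) where
      open InitialOrder I

      private
        encode : ℕ ⊎ ℕ → ℕ
        encode (inj₁ m) = 2 * m
        encode (inj₂ m) = suc (2 * m)

        encode-inj : Injective _≡_ _≡_ encode
        encode-inj {inj₁ m} {inj₁ n} e = cong inj₁ (double-injective e)
        encode-inj {inj₁ m} {inj₂ n} e = ⊥-elim (double-parity m n e)
        encode-inj {inj₂ m} {inj₁ n} e = ⊥-elim (double-parity n m (sym e))
        encode-inj {inj₂ m} {inj₂ n} e = cong inj₂ (double-injective (ℕ.suc-injective e))

      -- A finite segment would make `X` countable. An infinite one absorbs the summand ℕ as in
      -- Hilbert's hotel: along a sequence `i` inside the segment, `n` goes to `i (2 * n)` and `i n`
      -- to `i (suc (2 * n))`, so `X` would embed below `x`.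
      no-code : ∀ x → ¬ ∃ λ (h : X → ℕ ⊎ X) → Injective _≡_ _≡_ h × (∀ y z → h y ≡ inj₂ z → z ≺ x)
      no-code x (h , h-inj , h≺) with infinite-or-listed (_≺ x)
      ... | inj₂ (l , listed) = uncountable (CantorBernstein.bijection seq∞ k seq∞-inj k-inj)
        where
        pos : ∀ y (w : ℕ ⊎ X) → h y ≡ w → ℕ
        pos y (inj₁ n) e = encode (inj₁ n)
        pos y (inj₂ z) e = encode (inj₂ (toℕ (Any.index (listed z (h≺ y z e)))))

        pos-inj : ∀ y y′ w w′ (e : h y ≡ w) (e′ : h y′ ≡ w′) → pos y w e ≡ pos y′ w′ e′ → w ≡ w′
        pos-inj y y′ (inj₁ m) (inj₁ n) e e′ q = cong inj₁ (Sum.inj₁-injective (encode-inj {inj₁ m} {inj₁ n} q))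
        pos-inj y y′ (inj₁ m) (inj₂ z) e e′ q = ⊥-elim (double-parity m (toℕ (Any.index (listed z (h≺ y′ z e′)))) q)
        pos-inj y y′ (inj₂ z) (inj₁ n) e e′ q = ⊥-elim (double-parity n (toℕ (Any.index (listed z (h≺ y z e)))) (sym q))
        pos-inj y y′ (inj₂ z) (inj₂ z′) e e′ q = cong inj₂ (trans (Any.lookup-index p) (trans
            (cong (List.lookup l) (Fin.toℕ-injective (Sum.inj₂-injective (encode-inj {inj₂ (toℕ (Any.index p))} {inj₂ (toℕ (Any.index p′))} q))))
            (sym (Any.lookup-index p′))))
          where
          p  = listed z (h≺ y z e)
          p′ = listed z′ (h≺ y′ z′ e′)

        k : X → ℕ
        k y = pos y (h y) refl

        k-inj : Injective _≡_ _≡_ k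
        k-inj {y} {y′} q = h-inj (pos-inj y y′ (h y) (h y′) refl refl q)
      ... | inj₁ (i , i-inj , i≺) = initial x (k ∘ h , h-inj ∘ k-inj , λ y → k≺ (h y) (h≺ y))
        where
        k₂ : (z : X) → Dec (∃ λ n → i n ≡ z) → X
        k₂ z (yes (n , _)) = i (suc (2 * n))
        k₂ z (no _)        = z

        k : ℕ ⊎ X → X
        k (inj₁ n) = i (2 * n)
        k (inj₂ z) = k₂ z em

        k₂-even : ∀ n z d → i (2 * n) ≢ k₂ z d
        k₂-even n z (yes (m , _)) e = double-parity n m (i-inj e)
        k₂-even n z (no none)     e = none (_ , e)

        k₂-inj : ∀ z z′ d d′ → k₂ z d ≡ k₂ z′ d′ → z ≡ z′
        k₂-inj z z′ (yes (m , p)) (yes (n , q)) e =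
          trans (sym p) (trans (cong i (double-injective (ℕ.suc-injective (i-inj e)))) q)
        k₂-inj z z′ (yes (m , p)) (no none) e = ⊥-elim (none (_ , e))
        k₂-inj z z′ (no none) (yes (n , q)) e = ⊥-elim (none (_ , sym e))
        k₂-inj z z′ (no _) (no _) e = e

        k-inj : Injective _≡_ _≡_ k
        k-inj {inj₁ m} {inj₁ n} e = cong inj₁ (double-injective (i-inj e))
        k-inj {inj₁ m} {inj₂ z} e = ⊥-elim (k₂-even m z em e)
        k-inj {inj₂ z} {inj₁ n} e = ⊥-elim (k₂-even n z em (sym e))
        k-inj {inj₂ z} {inj₂ z′} e = cong inj₂ (k₂-inj z z′ em em e)

        k₂≺ : ∀ z d → z ≺ x → k₂ z d ≺ x
        k₂≺ z (yes (n , _)) _   = i≺ _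
        k₂≺ z (no _)        z≺x = z≺x

        k≺ : ∀ w → (∀ z → w ≡ inj₂ z → z ≺ x) → k w ≺ x
        k≺ (inj₁ n) _ = i≺ _
        k≺ (inj₂ z) p = k₂≺ z em (p z refl)

      -- Choosing a name for every `f y` turns an injection into the values of `g` into one into the
      -- names, which `no-code` excludes. Every smallness condition for saturation is obtained from
      -- this bound.
      few : (g : ℕ ⊎ X → X) (x : X) →
            ¬ ∃ λ (f : X → X) → Injective _≡_ _≡_ f ×
                (∀ y → (∃ λ n → g (inj₁ n) ≡ f y) ⊎ (∃ λ z → z ≺ x × g (inj₂ z) ≡ f y))
      few g x (f , f-inj , cover) = no-code x (h , inj , below)
        where
        code : ∀ y → (∃ λ n → g (inj₁ n) ≡ f y) ⊎ (∃ λ z → z ≺ x × g (inj₂ z) ≡ f y) → ℕ ⊎ X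
        code y (inj₁ (n , _)) = inj₁ n
        code y (inj₂ (z , _)) = inj₂ z

        code-g : ∀ y w → g (code y w) ≡ f y
        code-g y (inj₁ (n , e))     = e
        code-g y (inj₂ (z , _ , e)) = e

        code-below : ∀ y w z → code y w ≡ inj₂ z → z ≺ x
        code-below y (inj₂ (z , z≺x , _)) z refl = z≺x

        h : X → ℕ ⊎ X
        h y = code y (cover y)

        inj : Injective _≡_ _≡_ h
        inj {y} {y′} e = f-inj (trans (sym (code-g y (cover y))) (trans (cong g e) (code-g y′ (cover y′))))

        below : ∀ y z → h y ≡ inj₂ z → z ≺ x
        below y = code-below y (cover y)

      no-maximum : ∀ x → ∃ (x ≺_)
      no-maximum x = dne λ none → no-code x (h none , inj none , below none)
        where
        h′ : (y : X) → (y ≺ x) ⊎ ((y ≡ x) ⊎ (x ≺ y)) → ℕ ⊎ X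
        h′ y (inj₁ _) = inj₂ y
        h′ y (inj₂ _) = inj₁ 0

        h : ¬ ∃ (x ≺_) → X → ℕ ⊎ X
        h _ y = h′ y (trichot y x)

        inj′ : ¬ ∃ (x ≺_) → ∀ y y′ t t′ → h′ y t ≡ h′ y′ t′ → y ≡ y′
        inj′ none y y′ (inj₁ _) (inj₁ _) refl = refl
        inj′ none y y′ (inj₂ t) (inj₂ t′) _   = trans (eq t) (sym (eq t′))
          where
          eq : ∀ {z} → (z ≡ x) ⊎ (x ≺ z) → z ≡ x
          eq (inj₁ e)   = e
          eq (inj₂ x≺z) = ⊥-elim (none (_ , x≺z))

        inj : ∀ none → Injective _≡_ _≡_ (h none)
        inj none {y} {y′} = inj′ none y y′ _ _

        below : ∀ none y z → h none y ≡ inj₂ z → z ≺ x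
        below none y z e with trichot y x
        below none y z refl | inj₁ y≺x = y≺x

      private
        next : X → X
        next x = proj₁ (least (x ≺_) (no-maximum x))

        ≺next : ∀ x → x ≺ next x
        ≺next x = proj₁ (proj₂ (least (x ≺_) (no-maximum x)))

        next-least : ∀ x y → x ≺ y → ¬ (y ≺ next x)
        next-least x y x≺y y≺ = proj₂ (proj₂ (least (x ≺_) (no-maximum x))) y y≺ x≺y

        next-mono : ∀ {x y} → x ≺ y → next x ≢ next y
        next-mono {x} {y} x≺y e = next-least x y x≺y (subst (y ≺_) (sym e) (≺next y))

        next-inj : Injective _≡_ _≡_ next
        next-inj {x} {y} e with trichot x y
        ... | inj₁ x≺y        = ⊥-elim (next-mono x≺y e)
        ... | inj₂ (inj₁ x≡y) = x≡y
        ... | inj₂ (inj₂ y≺x) = ⊥-elim (next-mono y≺x (sym e))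

        iter : ℕ → X → X
        iter zero    x = x
        iter (suc n) x = next (iter n x)

        Limit : X → Set _
        Limit l = ∀ y → next y ≢ l

        split : ∀ x → ∃₂ λ l n → Limit l × iter n l ≡ x
        split x = go x (wf x)
          where
          go : ∀ x → Acc _≺_ x → ∃₂ λ l n → Limit l × iter n l ≡ x
          go x (acc rs) with decide (∃ λ y → next y ≡ x)
          ... | no none = x , 0 , (λ y e → none (y , e)) , refl
          ... | yes (y , refl) = let (l , n , lim , e) = go y (rs (≺next y)) in l , suc n , lim , cong next e

        iter-inj : ∀ m n {l l′} → Limit l → Limit l′ → iter m l ≡ iter n l′ → m ≡ n × l ≡ l′
        iter-inj zero    zero    _   _    e = refl , e
        iter-inj zero    (suc n) lim _    e = ⊥-elim (lim _ (sym e))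
        iter-inj (suc m) zero    _   lim′ e = ⊥-elim (lim′ _ e)
        iter-inj (suc m) (suc n) lim lim′ e =
          let (p , q) = iter-inj m n lim lim′ (next-inj e) in cong suc p , q

        bit : Bool → ℕ → ℕ
        bit false n = 2 * n
        bit true  n = suc (2 * n)

        bit-inj : ∀ b b′ {m n} → bit b m ≡ bit b′ n → b ≡ b′ × m ≡ n
        bit-inj false false e = refl , double-injective e
        bit-inj false true {m} {n} e = ⊥-elim (double-parity m n e)
        bit-inj true false {m} {n} e = ⊥-elim (double-parity n m (sym e))
        bit-inj true true e = refl , double-injective (ℕ.suc-injective e)

      -- An element is a limit (or the minimum) followed by finitely many successor steps, and λ + n
      -- is sent to λ + 2n or λ + 2n + 1 according to the bit. This is the ordinal proof of κ · 2 =
      -- κ.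
      pair : X → Bool → X
      pair x b = let (l , n , _) = split x in iter (bit b n) l

      pair-inj : ∀ {x y b c} → pair x b ≡ pair y c → x ≡ y × b ≡ c
      pair-inj {x} {y} {b} {c} e =
        let (l , n , lim , p)    = split x
            (l′ , n′ , lim′ , q) = split y
            (r , s) = iter-inj (bit b n) (bit c n′) lim lim′ e
            (u , v) = bit-inj b c r
        in trans (sym p) (trans (cong₂ iter v s) q) , u

      -- Hands each stage of the back and forth a task, an element together with a side, in such a
      -- way that every task is treated.
      schedule : ∃ λ (f : X → X × Bool) → ∀ p → ∃ λ x → f x ≡ p
      schedule = (λ x → pick x em) , λ (y , b) → pair y b , picked y b em
        where
        pick : (x : X) → Dec (∃₂ λ y b → pair y b ≡ x) → X × Bool
        pick x (yes (y , b , _)) = y , b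
        pick x (no _)            = x , false

        picked : ∀ y b d → pick (pair y b) d ≡ (y , b)
        picked y b (yes (y′ , b′ , e)) = let (p , q) = pair-inj e in cong₂ _,_ p q
        picked y b (no none)           = ⊥-elim (none (y , b , refl))

    -- Upward closure and closure under finite intersections follow from `ultra` and the meeting
    -- conditions; see `many-map` and `many-×`. The bound `n ≤ m` in `meets` expresses
    -- nonprincipality.
    record Ultrafilter : Set₁ where
      field
        Large    : (ℕ → Bool) → Set
        ultra    : ∀ S → Large S ⊎ Large (not ∘ S)
        meets    : ∀ {S S′} → Large S → Large S′ → ∀ n → ∃ λ m → n ≤ m × T (S m) × T (S′ m)
        meets₃   : ∀ {S S′ S″} → Large S → Large S′ → Large S″ → ∃ λ m → T (S m) × T (S′ m) × T (S″ m)

      Many : (ℕ → Set a) → Set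
      Many P = Large (λ n → ⌞ P n ⌟)

      many-all : {P : ℕ → Set a} (k : ℕ) → (∀ n → k ≤ n → P n) → Many P
      many-all {P = P} k p with ultra (λ n → ⌞ P n ⌟)
      ... | inj₁ u = u
      ... | inj₂ v = let (m , k≤m , t , _) = meets v v k in ⊥-elim (T-not⇒¬T t (true! (p m k≤m)))

      many-map : {P : ℕ → Set a} {Q : ℕ → Set b} → (∀ n → P n → Q n) → Many P → Many Q
      many-map {Q = Q} f u with ultra (λ n → ⌞ Q n ⌟)
      ... | inj₁ v = v
      ... | inj₂ v = let (m , _ , s , t) = meets u v 0 in ⊥-elim (T-not⇒¬T t (true! (f m (holds s))))

      many-× : {P : ℕ → Set a} {Q : ℕ → Set b} → Many P → Many Q → Many (λ n → P n × Q n)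
      many-× {P = P} {Q = Q} u v with ultra (λ n → ⌞ P n × Q n ⌟)
      ... | inj₁ w = w
      ... | inj₂ w = let (m , s , t , r) = meets₃ u v w in ⊥-elim (T-not⇒¬T r (true! (holds s , holds t)))

      many-find : {P : ℕ → Set a} → Many P → ∀ n → ∃ λ m → n ≤ m × P m
      many-find u n = let (m , n≤m , t , _) = meets u u n in m , n≤m , holds t

      many-¬ : {P : ℕ → Set a} → ¬ Many P → Many (λ n → ¬ P n)
      many-¬ {P = P} ¬u with ultra (λ n → ⌞ P n ⌟)
      ... | inj₁ u = ⊥-elim (¬u u)
      ... | inj₂ v = many-map′ v
        where
        many-map′ : Large (λ n → not ⌞ P n ⌟) → Many (λ n → ¬ P n)
        many-map′ v with ultra (λ n → ⌞ ¬ P n ⌟)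
        ... | inj₁ w = w
        ... | inj₂ w = let (m , _ , s , t) = meets v w 0 in
                       ⊥-elim (T-not⇒¬T t (true! λ p → T-not⇒¬T s (true! p)))

      many-list : {P : A → ℕ → Set b} (l : List A) → All (λ x → Many (P x)) l → Many (λ n → All (λ x → P x n) l)
      many-list [] [] = many-all 0 λ _ _ → []
      many-list (x ∷ l) (u ∷ us) = many-map (λ _ (p , ps) → p ∷ ps) (many-× u (many-list l us))

    -- Along a well-ordering of the subsets of ℕ, a subset is included when its
    -- intersections with finitely many earlier included ones are infinite.
    module NonprincipalUltrafilter where
      private
        Sub : Set
        Sub = ℕ → Bool

        open WellOrder (Zermelo.wellOrder Sub)

        Infinite : (ℕ → Set) → Set
        Infinite P = ∀ n → ∃ λ m → n ≤ m × P m

        Meet : List Sub → ℕ → Set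
        Meet l n = All (λ S → T (S n)) l

        Good : (S : Sub) → (∀ {S′} → S′ ≺ S → Set) → Set
        Good S rec = ∀ l → All (λ S′ → Σ (S′ ≺ S) rec) l → Infinite (Meet (S ∷ l))

        open WF.FixPoint wf (λ _ → Set) Good (λ S {IH} {IH′} e →
          cong (λ (r : ∀ S′ → S′ ≺ S → Set) → Good S λ {S′} → r S′) (ext λ S′ → ext λ p → e p))

        In : Sub → Set
        In = WF.All.wfRec wf _ (λ _ → Set) Good

        In⇒ : ∀ {S} → In S → ∀ l → All (λ S′ → S′ ≺ S × In S′) l → Infinite (Meet (S ∷ l))
        In⇒ {S} = subst id (unfold-wfRec {S})

        ⇒In : ∀ {S} → (∀ l → All (λ S′ → S′ ≺ S × In S′) l → Infinite (Meet (S ∷ l))) → In S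
        ⇒In {S} = subst id (sym (unfold-wfRec {S}))

        -- The latest set of a list has to come first, because the condition under which it was
        -- included speaks of all lists of earlier included sets.
        top : ∀ S l → All In (S ∷ l) → ∃₂ λ S₀ l′ → In S₀ × All (λ S′ → S′ ≺ S₀ × In S′) l′ ×
              (∀ n → Meet (S₀ ∷ l′) n → Meet (S ∷ l) n)
        top S [] (i ∷ []) = S , [] , i , [] , λ _ t → t
        top S (S₁ ∷ l) (i ∷ is) with top S₁ l is
        ... | S₀ , l′ , i₀ , is′ , sub with trichot S S₀
        ...   | inj₁ p = S₀ , S ∷ l′ , i₀ , (p , i) ∷ is′ , λ { n (u ∷ v ∷ w) → v ∷ sub n (u ∷ w) }
        ...   | inj₂ (inj₁ refl) = S₀ , l′ , i₀ , is′ , λ { n (u ∷ w) → u ∷ sub n (u ∷ w) }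
        ...   | inj₂ (inj₂ p) = S , S₀ ∷ l′ , i , (p , i₀) ∷ All.map (λ (q , j) → ≺-trans q p , j) is′ ,
                                λ { n (u ∷ w) → u ∷ sub n w }

        fip : ∀ S l → All In (S ∷ l) → Infinite (Meet (S ∷ l))
        fip S l is n = let (S₀ , l′ , i , is′ , sub) = top S l is
                           (m , n≤m , t) = In⇒ i l′ is′ n in m , n≤m , sub m t

        refuse : ∀ {S} → ¬ In S → ∃₂ λ l k → All In l × (∀ n → k ≤ n → ¬ Meet (S ∷ l) n)
        refuse ¬i =
          let (l , p) = ¬∀⇒∃ λ all → ¬i (⇒In all)
              (is , q) = ¬⇒×¬ p
              (k , r) = ¬∀⇒∃ q
          in l , k , All.map proj₂ is , λ n k≤n t → r (n , k≤n , t)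

        meet-infinite : ∀ l → All In l → Infinite (Meet l)
        meet-infinite [] _ n = n , ℕ.≤-refl , []
        meet-infinite (S ∷ l) is = fip S l is

        -- If both sets are refused, finitely many included sets have a bounded intersection with
        -- `S`, and finitely many with its complement. All of them together would then have a
        -- bounded intersection, against `meet-infinite`.
        ultra′ : ∀ S → In S ⊎ In (not ∘ S)
        ultra′ S with decide (In S)
        ... | yes i = inj₁ i
        ... | no ¬i with decide (In (not ∘ S))
        ...   | yes i = inj₂ i
        ...   | no ¬j =
          let (l , k , is , p)    = refuse ¬i
              (l′ , k′ , is′ , q) = refuse ¬j
              (m , le , t) = meet-infinite (l List.++ l′) (All.++⁺ is is′) (k ℕ.⊔ k′)
              (u , v) = All.++⁻ l t
          in case decide (T (S m)) of λ where
            (yes s) → ⊥-elim (p m (ℕ.m⊔n≤o⇒m≤o k k′ le) (s ∷ u))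
            (no ¬s) → ⊥-elim (q m (ℕ.m⊔n≤o⇒n≤o k k′ le) (¬T⇒T-not ¬s ∷ v))

      ultrafilter : Ultrafilter
      ultrafilter = record
        { Large  = In
        ; ultra  = ultra′
        ; meets  = λ i j n → case fip _ _ (i ∷ j ∷ []) n of λ { (m , n≤m , u ∷ v ∷ []) → m , n≤m , u , v }
        ; meets₃ = λ i j k → case fip _ _ (i ∷ j ∷ k ∷ []) 0 of λ { (m , _ , u ∷ v ∷ w ∷ []) → m , u , v , w }
        }

  open Cardinality

  -- Set systems: the Sauer-Shelah lemma, greedy separation and packing.

  module Shattering where

    private variable
      a b c : Level
      A : Set a
      B : Set b
      X : Set a
      Z : Set b

    𝟙 : Bool → ℕ
    𝟙 false = 0
    𝟙 true  = 1

    Cube : ℕ → Set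
    Cube N = Fin N → Bool

    card : ∀ N → (Cube N → Bool) → ℕ
    card zero    F = 𝟙 (F V.[])
    card (suc N) F = card N (λ v → F (false V.∷ v)) + card N (λ v → F (true V.∷ v))

    cube-η : ∀ {N} (v : Cube (suc N)) → (v zero V.∷ V.tail v) ≡ v
    cube-η v = ext λ { zero → refl ; (suc i) → refl }

    cube₀ : (v w : Cube 0) → v ≡ w
    cube₀ v w = ext λ ()

    card-pos : ∀ N F → 0 < card N F → ∃ λ v → T (F v)
    card-pos zero F p with F V.[] in eq
    ... | true = V.[] , subst T (sym eq) tt
    card-pos (suc N) F p with card N (λ v → F (false V.∷ v)) in eq
    ... | suc _ = let (v , t) = card-pos N (λ v → F (false V.∷ v)) (subst (0 <_) (sym eq) ℕ.z<s) in false V.∷ v , t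
    ... | zero  = let (v , t) = card-pos N (λ v → F (true V.∷ v)) p in true V.∷ v , t

    𝟙-mono : ∀ {x y} → (T x → T y) → 𝟙 x ≤ 𝟙 y
    𝟙-mono {false} {y}    _ = z≤n
    𝟙-mono {true} {false} f = ⊥-elim (f tt)
    𝟙-mono {true} {true}  f = ℕ.≤-refl

    card-mono : ∀ N {F G : Cube N → Bool} → (∀ v → T (F v) → T (G v)) → card N F ≤ card N G
    card-mono zero    f = 𝟙-mono (f V.[])
    card-mono (suc N) f = ℕ.+-mono-≤ (card-mono N (λ v → f (false V.∷ v))) (card-mono N (λ v → f (true V.∷ v)))

    interchange : ∀ p q r s → (p + q) + (r + s) ≡ (p + r) + (q + s)
    interchange = solve-∀

    𝟙-∨-∧ : ∀ x y → 𝟙 x + 𝟙 y ≡ 𝟙 (x ∨ y) + 𝟙 (x ∧ y)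
    𝟙-∨-∧ false y     = sym (ℕ.+-identityʳ (𝟙 y))
    𝟙-∨-∧ true  false = refl
    𝟙-∨-∧ true  true  = refl

    card-∨-∧ : ∀ N (F G : Cube N → Bool) → card N F + card N G ≡ card N (λ v → F v ∨ G v) + card N (λ v → F v ∧ G v)
    card-∨-∧ zero F G = 𝟙-∨-∧ (F V.[]) (G V.[])
    card-∨-∧ (suc N) F G = trans (interchange (card N λ v → F (false V.∷ v)) _ _ _)
      (trans (cong₂ _+_ (card-∨-∧ N (λ v → F (false V.∷ v)) (λ v → G (false V.∷ v)))
                        (card-∨-∧ N (λ v → F (true V.∷ v)) (λ v → G (true V.∷ v))))
             (interchange (card N λ v → F (false V.∷ v) ∨ G (false V.∷ v)) _ _ _))

    card-all : ∀ N → card N (λ _ → true) ≡ 2 ^ N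
    card-all zero    = refl
    card-all (suc N) = trans (cong₂ _+_ (card-all N) (card-all N)) (cong ((2 ^ N) +_) (sym (ℕ.+-identityʳ (2 ^ N))))

    card-none : ∀ N {F : Cube N → Bool} → (∀ v → ¬ T (F v)) → card N F ≡ 0
    card-none N {F} none with card N F in eq
    ... | zero  = refl
    ... | suc _ = let (v , t) = card-pos N F (subst (0 <_) (sym eq) ℕ.z<s) in ⊥-elim (none v t)

    card-unique : ∀ N {F : Cube N → Bool} → (∀ v w → T (F v) → T (F w) → v ≡ w) → card N F ≤ 1
    card-unique zero {F} _ with F V.[]
    ... | false = z≤n
    ... | true  = ℕ.≤-refl
    card-unique (suc N) {F} uniq with card N (λ v → F (false V.∷ v)) in eq
    ... | zero  = card-unique N λ v w s t → cong V.tail (uniq (true V.∷ v) (true V.∷ w) s t)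
    ... | suc k = subst₂ (λ p q → p + q ≤ 1) eq (sym none)
                    (subst (_≤ 1) (sym (ℕ.+-identityʳ _))
                      (card-unique N λ v w s t → cong V.tail (uniq (false V.∷ v) (false V.∷ w) s t)))
      where
      none : card N (λ v → F (true V.∷ v)) ≡ 0
      none = card-none N λ w t →
        let (v , s) = card-pos N (λ v → F (false V.∷ v)) (subst (0 <_) (sym eq) ℕ.z<s)
        in case cong (λ u → u zero) (uniq (false V.∷ v) (true V.∷ w) s t) of λ ()

    T-∧⁻ : ∀ {x y} → T (x ∧ y) → T x × T y
    T-∧⁻ {true} t = tt , t

    T-∧⁺ : ∀ {x y} → T x → T y → T (x ∧ y)
    T-∧⁺ {true} _ t = t

    -- Induction on the number of coordinates of the target: the family is split along the first
    -- coordinate of `τ v`, and within each half the fibres of the remaining coordinates are fibres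
    -- of `τ`.
    card-fibres : ∀ N R P (F : Cube N → Bool) (G : Cube R → Bool) (τ : Cube N → Cube R) →
      (∀ v → T (F v) → T (G (τ v))) → (∀ w → card N (λ v → F v ∧ ⌞ τ v ≡ w ⌟) ≤ P) → card N F ≤ card R G * P
    card-fibres N zero P F G τ FG fib with G V.[] in eq
    ... | true  = subst (card N F ≤_) (sym (ℕ.+-identityʳ P))
                    (ℕ.≤-trans (card-mono N λ v t → T-∧⁺ t (true! (cube₀ (τ v) V.[]))) (fib V.[]))
    ... | false = ℕ.≤-reflexive (card-none N λ v t →
                    subst T (trans (cong G (cube₀ (τ v) V.[])) eq) (FG v t))
    card-fibres N (suc R) P F G τ FG fib = begin
        card N F
          ≤⟨ card-mono N (λ v t → split v t (τ v zero) refl) ⟩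
        card N (λ v → F₀ v ∨ F₁ v)
          ≤⟨ ℕ.m≤m+n _ _ ⟩
        card N (λ v → F₀ v ∨ F₁ v) + card N (λ v → F₀ v ∧ F₁ v)
          ≡⟨ card-∨-∧ N F₀ F₁ ⟨
        card N F₀ + card N F₁
          ≤⟨ ℕ.+-mono-≤ (half false) (half true) ⟩
        card R (λ v → G (false V.∷ v)) * P + card R (λ v → G (true V.∷ v)) * P
          ≡⟨ ℕ.*-distribʳ-+ P (card R (λ v → G (false V.∷ v))) _ ⟨
        (card R (λ v → G (false V.∷ v)) + card R (λ v → G (true V.∷ v))) * P ∎
      where
      open ℕ.≤-Reasoning
      Fᵇ : Bool → Cube N → Bool
      Fᵇ x v = F v ∧ ⌞ τ v zero ≡ x ⌟
      F₀ = Fᵇ false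
      F₁ = Fᵇ true

      split : ∀ v → T (F v) → ∀ x → τ v zero ≡ x → T (F₀ v ∨ F₁ v)
      split v t false e = ∨-inl (T-∧⁺ t (true! e))
      split v t true  e = ∨-inr {F₀ v} (T-∧⁺ t (true! e))

      half : ∀ x → card N (Fᵇ x) ≤ card R (λ v → G (x V.∷ v)) * P
      half x = card-fibres N R P (Fᵇ x) (λ v → G (x V.∷ v)) (λ v → V.tail (τ v))
        (λ v t → let (f , e) = T-∧⁻ {F v} t in
           subst (T ∘ G) (trans (sym (cube-η (τ v))) (cong (V._∷ V.tail (τ v)) (holds e))) (FG v f))
        (λ w → ℕ.≤-trans
           (card-mono N λ v t → let (s , e′) = T-∧⁻ {Fᵇ x v} t
                                    (f , e) = T-∧⁻ {F v} s in
              T-∧⁺ f (true! (trans (sym (cube-η (τ v))) (cong₂ V._∷_ (holds e) (holds e′)))))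
           (fib (x V.∷ w)))

    -- The sum of the binomial coefficients C(N, i) over i < d, by Pascal's rule.
    Φ : ℕ → ℕ → ℕ
    Φ zero    N       = 0
    Φ (suc d) zero    = 1
    Φ (suc d) (suc N) = Φ (suc d) N + Φ d N

    Φ-bound : ∀ d N → Φ d N ≤ suc N ^ d
    Φ-bound zero N = z≤n
    Φ-bound (suc d) zero = ℕ.≤-reflexive (sym (ℕ.^-zeroˡ (suc d)))
    Φ-bound (suc d) (suc N) = begin
      Φ (suc d) N + Φ d N          ≤⟨ ℕ.+-mono-≤ (Φ-bound (suc d) N) (Φ-bound d N) ⟩
      suc N * suc N ^ d + suc N ^ d ≡⟨ ℕ.+-comm (suc N * suc N ^ d) _ ⟩
      suc (suc N) * suc N ^ d      ≤⟨ ℕ.*-monoʳ-≤ (suc (suc N)) (ℕ.^-monoˡ-≤ d (ℕ.n≤1+n (suc N))) ⟩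
      suc (suc N) * suc (suc N) ^ d ∎
      where open ℕ.≤-Reasoning

    Shattered : ∀ {N} → (Cube N → Bool) → ℕ → Set
    Shattered {N} F d = ∃ λ (pos : Fin d → Fin N) → ∀ (S : Cube d) → ∃ λ v → T (F v) × (∀ i → v (pos i) ≡ S i)

    -- Write F₀ and F₁ for the two halves along the first coordinate. If F₀ ∪ F₁ exceeds its bound,
    -- induct on it. Otherwise F₀ ∩ F₁ is large and shatters `d` coordinates; the first one can be
    -- added, because every vector of the intersection extends by both of its values.
    sauer : ∀ d N (F : Cube N → Bool) → Φ d N < card N F → Shattered F d
    sauer zero N F p = (λ ()) , λ S → let (v , t) = card-pos N F p in v , t , λ ()
    sauer (suc d) zero F p with F V.[]
    ... | true  = ⊥-elim (ℕ.n≮n 1 p)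
    sauer (suc d) (suc N) F p with Φ (suc d) N ℕ.<? card N (λ v → F (false V.∷ v) ∨ F (true V.∷ v))
    ... | yes q = let (pos , sh) = sauer (suc d) N _ q in suc ∘ pos , λ S →
            let (v , t , e) = sh S in case ∨-elim {F (false V.∷ v)} t of λ where
              (inj₁ s) → false V.∷ v , s , e
              (inj₂ s) → true V.∷ v , s , e
    ... | no ¬q = let (pos , sh) = sauer d N (λ v → F (false V.∷ v) ∧ F (true V.∷ v)) q in
                  zero V.∷ (suc ∘ pos) , λ S →
                    let (v , t , e) = sh (V.tail S); (s , u) = T-∧⁻ {F (false V.∷ v)} t in
                    pick S v s u e (S zero) refl
      where
      q : Φ d N < card N (λ v → F (false V.∷ v) ∧ F (true V.∷ v))
      q = ℕ.+-cancelˡ-< (Φ (suc d) N) _ _ (ℕ.<-≤-trans p (ℕ.≤-trans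
            (ℕ.≤-reflexive (card-∨-∧ N (λ v → F (false V.∷ v)) (λ v → F (true V.∷ v))))
            (ℕ.+-monoˡ-≤ _ (ℕ.≮⇒≥ ¬q))))

      pick : ∀ {pos : Fin d → Fin N} S v → T (F (false V.∷ v)) → T (F (true V.∷ v)) → (∀ i → v (pos i) ≡ V.tail S i) →
             ∀ x → S zero ≡ x → ∃ λ v → T (F v) × (∀ i → v ((zero V.∷ (suc ∘ pos)) i) ≡ S i)
      pick S v s u e false q = false V.∷ v , s , λ { zero → sym q ; (suc i) → e i }
      pick S v s u e true  q = true V.∷ v , u , λ { zero → sym q ; (suc i) → e i }

    n<2^n : ∀ n → n < 2 ^ n
    n<2^n zero    = ℕ.≤-refl
    n<2^n (suc n) = begin
      suc (suc n)       ≤⟨ ℕ.+-mono-≤ {1} {2 ^ n} (ℕ.m^n>0 2 n) (n<2^n n) ⟩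
      2 ^ n + 2 ^ n     ≡⟨ cong ((2 ^ n) +_) (ℕ.+-identityʳ (2 ^ n)) ⟨
      2 * 2 ^ n         ∎
      where open ℕ.≤-Reasoning

    -- With N = 2^j − 1 the claim becomes a linear bound on 2^j, and j = 2i makes 2^j a square.
    poly<exp : ∀ c k → ∃ λ N → (c * suc N) ^ k < 2 ^ N
    poly<exp c k = ℕ.pred (2 ^ j) , (begin-strict
        (c * suc (ℕ.pred (2 ^ j))) ^ k ≡⟨ cong (λ n → (c * n) ^ k) (ℕ.suc-pred (2 ^ j) ⦃ ℕ.m^n≢0 2 j ⦄) ⟩
        (c * 2 ^ j) ^ k                ≤⟨ ℕ.^-monoˡ-≤ k (ℕ.*-monoˡ-≤ (2 ^ j) (ℕ.<⇒≤ (n<2^n c))) ⟩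
        (2 ^ c * 2 ^ j) ^ k            ≡⟨ cong (_^ k) (ℕ.^-distribˡ-+-* 2 c j) ⟨
        (2 ^ (c + j)) ^ k              ≡⟨ ℕ.^-*-assoc 2 (c + j) k ⟩
        2 ^ ((c + j) * k)              <⟨ ℕ.^-monoʳ-< 2 (s≤s (s≤s z≤n)) lin ⟩
        2 ^ ℕ.pred (2 ^ j)             ∎)
      where
      open ℕ.≤-Reasoning
      i = c * k + 2 * k + 1
      j = i + i

      lin : (c + j) * k < ℕ.pred (2 ^ j)
      lin = ℕ.suc[m]≤n⇒m≤pred[n] (begin-strict
        -- For the chosen `i`, the added bracket completes the sum to (i + 1)² exactly.
        suc ((c + j) * k)                ≤⟨ ℕ.m≤m+n _ _ ⟩
        suc ((c + j) * k) + (i * c * k + 2 * (c * k) + 6 * k + 2) <⟨ ℕ.≤-refl ⟩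
        suc (suc ((c + j) * k) + (i * c * k + 2 * (c * k) + 6 * k + 2)) ≡⟨ square c k ⟩
        suc i * suc i                    ≤⟨ ℕ.*-mono-≤ (n<2^n i) (n<2^n i) ⟩
        2 ^ i * 2 ^ i                    ≡⟨ ℕ.^-distribˡ-+-* 2 i i ⟨
        2 ^ j                            ∎)
        where
        square : ∀ c k → let i = c * k + 2 * k + 1 in
          suc (suc ((c + (i + i)) * k) + (i * c * k + 2 * (c * k) + 6 * k + 2)) ≡ suc i * suc i
        square = solve-∀

    tally : (A → Bool) → List A → ℕ
    tally p []      = 0
    tally p (x ∷ l) = 𝟙 (p x) + tally p l

    -- Greedy covering: some point removes at least an `m`-th part of the remaining items, so `m`
    -- rounds halve them and `t * m` points deal with fewer than 2^t items.
    module Greedy {X : Set a} {Z : Set b} (sep : Z → X → Bool) (Ok : Z → Set c) (m : ℕ)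
                  (good : ∀ P → All Ok P → ∃ λ x → length P ≤ m * tally (λ z → sep z x) P) where

      private
        rest : X → List Z → List Z
        rest x []      = []
        rest x (z ∷ P) = if sep z x then rest x P else z ∷ rest x P

        rest-length : ∀ x P → length (rest x P) + tally (λ z → sep z x) P ≡ length P
        rest-length x [] = refl
        rest-length x (z ∷ P) with sep z x
        ... | true  = trans (ℕ.+-suc _ _) (cong suc (rest-length x P))
        ... | false = cong suc (rest-length x P)

        rest-ok : ∀ x P → All Ok P → All Ok (rest x P)
        rest-ok x [] [] = []
        rest-ok x (z ∷ P) (o ∷ os) with sep z x
        ... | true  = rest-ok x P os
        ... | false = o ∷ rest-ok x P os

        restAll : List X → List Z → List Z
        restAll []       P = P
        restAll (x ∷ xs) P = restAll xs (rest x P)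

        restAll-ok : ∀ xs P → All Ok P → All Ok (restAll xs P)
        restAll-ok []       P os = os
        restAll-ok (x ∷ xs) P os = restAll-ok xs (rest x P) (rest-ok x P os)

        Separated : List X → Z → Set _
        Separated xs z = Any (λ x → T (sep z x)) xs

        unrest : ∀ x {Q : Z → Set a} P → (∀ z → T (sep z x) → Q z) → All Q (rest x P) → All Q P
        unrest x [] f _ = []
        unrest x (z ∷ P) f qs with sep z x in eq
        unrest x (z ∷ P) f qs       | true  = f z (subst T (sym eq) tt) ∷ unrest x P f qs
        unrest x (z ∷ P) f (q ∷ qs) | false = q ∷ unrest x P f qs

        restAll-sep : ∀ xs P → length (restAll xs P) ≡ 0 → All (Separated xs) P
        restAll-sep [] [] _ = []
        restAll-sep (x ∷ xs) P e = unrest x P (λ _ → here) (All.map there (restAll-sep xs (rest x P) e))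

        restAll-++ : ∀ xs ys P → restAll (xs List.++ ys) P ≡ restAll ys (restAll xs P)
        restAll-++ []       ys P = refl
        restAll-++ (x ∷ xs) ys P = restAll-++ xs ys (rest x P)

        -- As long as at least `R` items remain, each round removes at least R / m of them; the
        -- second alternative records this with the denominator cleared.
        halving : ∀ R j P → All Ok P → ∃ λ xs → length xs ≡ j ×
                  (length (restAll xs P) < R ⊎ m * length (restAll xs P) + j * R ≤ m * length P)
        halving R zero P os = [] , refl , inj₂ (ℕ.≤-reflexive (ℕ.+-identityʳ _))
        halving R (suc j) P os =
          let (x , p) = good P os
              (xs , e , q) = halving R j (rest x P) (rest-ok x P os)
          in x ∷ xs , cong suc e , step x p (restAll xs (rest x P)) (shrink xs) q
          where
          shrink : ∀ {Q} xs → length (restAll xs Q) ≤ length Q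
          shrink []       = ℕ.≤-refl
          shrink {Q} (x ∷ xs) = ℕ.≤-trans (shrink xs) (ℕ.m+n≤o⇒m≤o _ (ℕ.≤-reflexive (rest-length x Q)))

          step : ∀ x → length P ≤ m * tally (λ z → sep z x) P → ∀ Q → length Q ≤ length (rest x P) →
                 (length Q < R ⊎ m * length Q + j * R ≤ m * length (rest x P)) →
                 (length Q < R ⊎ m * length Q + suc j * R ≤ m * length P)
          step x p Q _ (inj₁ lt) = inj₁ lt
          step x p Q Q≤ (inj₂ q) with length Q ℕ.<? R
          ... | yes lt = inj₁ lt
          ... | no ¬lt = inj₂ (begin
              m * length Q + (R + j * R)   ≡⟨ swap (m * length Q) R (j * R) ⟩
              (m * length Q + j * R) + R   ≤⟨ ℕ.+-mono-≤ q R≤ ⟩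
              m * length (rest x P) + m * t ≡⟨ ℕ.*-distribˡ-+ m (length (rest x P)) t ⟨
              m * (length (rest x P) + t)  ≡⟨ cong (m *_) (rest-length x P) ⟩
              m * length P                 ∎)
            where
            open ℕ.≤-Reasoning
            t = tally (λ z → sep z x) P
            swap : ∀ a b c → a + (b + c) ≡ (a + c) + b
            swap = solve-∀
            R≤ : R ≤ m * t
            R≤ = begin
              R                      ≤⟨ ℕ.≮⇒≥ ¬lt ⟩
              length Q               ≤⟨ Q≤ ⟩
              length (rest x P)      ≤⟨ ℕ.m+n≤o⇒m≤o _ (ℕ.≤-reflexive (rest-length x P)) ⟩
              length P               ≤⟨ p ⟩
              m * t                  ∎

        halve : ∀ R P → 0 < m → All Ok P → length P < 2 * R → ∃ λ xs → length xs ≡ m × length (restAll xs P) < R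
        halve R P 0<m os lt with halving R m P os
        ... | xs , e , inj₁ q = xs , e , q
        ... | xs , e , inj₂ q = xs , e , ℕ.+-cancelʳ-< R _ _ (ℕ.≤-<-trans
               (ℕ.*-cancelˡ-≤ m ⦃ ℕ.>-nonZero 0<m ⦄ (subst (_≤ m * length P) (sym (ℕ.*-distribˡ-+ m _ R)) q))
               (subst (length P <_) (cong (R +_) (ℕ.+-identityʳ R)) lt))

        halves : ∀ t P → 0 < m → All Ok P → length P < 2 ^ t → ∃ λ xs → length xs ≡ t * m × length (restAll xs P) < 1
        halves zero    P _   os lt = [] , refl , lt
        halves (suc t) P 0<m os lt =
          let (xs , e , q)  = halve (2 ^ t) P 0<m os lt
              (ys , e′ , r) = halves t (restAll xs P) 0<m (restAll-ok xs P os) q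
          in xs List.++ ys , trans (List.length-++ xs) (cong₂ _+_ e e′) ,
             subst (λ Q → length Q < 1) (sym (restAll-++ xs ys P)) r

      separate : ∀ t P → 0 < m → All Ok P → length P < 2 ^ t →
                 ∃ λ xs → length xs ≡ t * m × All (λ z → Any (λ x → T (sep z x)) xs) P
      separate t P 0<m os lt = let (xs , e , q) = halves t P 0<m os lt in
        xs , e , restAll-sep xs P (ℕ.n<1⇒n≡0 q)

    cubes : ∀ s → List (Cube s)
    cubes zero    = V.[] ∷ []
    cubes (suc s) = List.map (false V.∷_) (cubes s) List.++ List.map (true V.∷_) (cubes s)

    cubes-length : ∀ s → length (cubes s) ≡ 2 ^ s
    cubes-length zero    = refl
    cubes-length (suc s) = trans (List.length-++ (List.map (false V.∷_) (cubes s))) (cong₂ _+_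
      (trans (List.length-map _ (cubes s)) (cubes-length s))
      (trans (List.length-map _ (cubes s)) (trans (cubes-length s) (sym (ℕ.+-identityʳ (2 ^ s))))))

    ∈cubes : ∀ {s} (v : Cube s) → v ∈ᴸ cubes s
    ∈cubes {zero}  v = here (cube₀ v V.[])
    ∈cubes {suc s} v = subst (_∈ᴸ cubes (suc s)) (cube-η v) (go (v zero))
      where
      go : ∀ x → (x V.∷ V.tail v) ∈ᴸ cubes (suc s)
      go false = List.∈-++⁺ˡ (List.∈-map⁺ _ (∈cubes (V.tail v)))
      go true  = List.∈-++⁺ʳ (List.map (false V.∷_) (cubes s)) (List.∈-map⁺ _ (∈cubes (V.tail v)))

    bits : ∀ {s} → Cube s → ℕ
    bits {zero}  v = 0
    bits {suc s} v = 𝟙 (v zero) + 2 * bits (V.tail v)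

    bits-inj : ∀ {s} (v w : Cube s) → bits v ≡ bits w → v ≡ w
    bits-inj {zero}  v w _ = cube₀ v w
    bits-inj {suc s} v w e = trans (sym (cube-η v)) (trans (go (v zero) (w zero) e) (cube-η w))
      where
      go : ∀ x y → 𝟙 x + 2 * bits (V.tail v) ≡ 𝟙 y + 2 * bits (V.tail w) → (x V.∷ V.tail v) ≡ (y V.∷ V.tail w)
      go false false q = cong (false V.∷_) (bits-inj _ _ (double-injective q))
      go false true  q = ⊥-elim (double-parity (bits (V.tail v)) (bits (V.tail w)) q)
      go true  false q = ⊥-elim (double-parity (bits (V.tail w)) (bits (V.tail v)) (sym q))
      go true  true  q = cong (true V.∷_) (bits-inj _ _ (double-injective (ℕ.suc-injective q)))

    pairs : List A → List B → List (A × B)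
    pairs l l′ = List.concatMap (λ x → List.map (x ,_) l′) l

    pairs-length : (l : List A) (l′ : List B) → length (pairs l l′) ≡ length l * length l′
    pairs-length []      l′ = refl
    pairs-length (x ∷ l) l′ = trans (List.length-++ (List.map (x ,_) l′)) (cong₂ _+_ (List.length-map _ l′) (pairs-length l l′))

    ∈pairs : ∀ {l : List A} {l′ : List B} {x y} → x ∈ᴸ l → y ∈ᴸ l′ → (x , y) ∈ᴸ pairs l l′
    ∈pairs {l′ = l′} p q = List.∈-concatMap⁺ (λ x → List.map (x ,_) l′) (Any.map (λ { refl → List.∈-map⁺ _ q }) p)

    -- If among finitely many pairs of sets of the family a fixed fraction can
    -- always be separated by one point, then few points separate 2^s sets, too
    -- few for the traces to form a class of bounded VC dimension.
    packing : {X : Set a} (D : ℕ → X → Bool) (m : ℕ) → 0 < m →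
      (∀ (P : List (ℕ × ℕ)) → All (λ (i , j) → i ≢ j) P →
         ∃ λ x → length P ≤ m * tally (λ (i , j) → D i x xor D j x) P) →
      ∀ d → ∃ λ (x : Fin d → X) → ∀ (S : Cube d) → ∃ λ n → ∀ i → D n (x i) ≡ S i
    -- Among 2^s sets there are fewer than 2^(2s+1) pairs, so (2s + 1)m points separate them all.
    -- The number `s` is such that 2^s exceeds the Sauer-Shelah bound for that many points.
    packing {X = X} D m 0<m good d = let (s , small) = poly<exp (2 * m + 1) d in go s small
      where
      open ℕ.≤-Reasoning
      lin : ∀ s m → suc (suc (s + s) * m) + (m + s) ≡ (2 * m + 1) * suc s
      lin = solve-∀

      distinct? : (p : ℕ × ℕ) → Dec (proj₁ p ≢ proj₂ p)
      distinct? (i , j) = ¬? (i ℕ.≟ j)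

      codes : ∀ s → List (ℕ × ℕ)
      codes s = List.map (λ (v , w) → bits v , bits w) (pairs (cubes s) (cubes s))

      codes-length : ∀ s → length (List.filter distinct? (codes s)) < 2 ^ suc (s + s)
      codes-length s = begin-strict
        length (List.filter distinct? (codes s)) ≤⟨ List.length-filter distinct? (codes s) ⟩
        length (codes s)                         ≡⟨ List.length-map _ (pairs (cubes s) (cubes s)) ⟩
        length (pairs (cubes s) (cubes s))             ≡⟨ pairs-length (cubes s) (cubes s) ⟩
        length (cubes s) * length (cubes s)      ≡⟨ cong₂ _*_ (cubes-length s) (cubes-length s) ⟩
        2 ^ s * 2 ^ s                            ≡⟨ ℕ.^-distribˡ-+-* 2 s s ⟨
        2 ^ (s + s)                              <⟨ ℕ.^-monoʳ-< 2 (s≤s (s≤s z≤n)) (ℕ.n<1+n (s + s)) ⟩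
        2 ^ suc (s + s)                          ∎

      same : ∀ {s} (v w : Cube s) xs → (λ i → D (bits v) (List.lookup xs i)) ≡ (λ i → D (bits w) (List.lookup xs i)) →
             ¬ Any (λ x → T (D (bits v) x xor D (bits w) x)) xs
      same v w xs q p = xor-diff (cong (λ u → u (Any.index p)) q) (Any.lookup-index p)
        where
        xor-diff : ∀ {x y} → x ≡ y → ¬ T (x xor y)
        xor-diff {false} refl ()
        xor-diff {true}  refl ()

      go : ∀ s → ((2 * m + 1) * suc s) ^ d < 2 ^ s →
           ∃ λ (x : Fin d → X) → ∀ (S : Cube d) → ∃ λ n → ∀ i → D n (x i) ≡ S i
      go s small = List.lookup xs ∘ proj₁ shattered , λ S →
          let (w , t , f) = proj₂ shattered S; (v , r) = holds t in
          bits v , λ i → trans (cong (λ u → u (proj₁ shattered i)) r) (f i)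
        where
        separated = Greedy.separate (λ (i , j) x → D i x xor D j x) (λ (i , j) → i ≢ j) m good (suc (s + s))
          (List.filter distinct? (codes s)) 0<m (All.all-filter distinct? (codes s)) (codes-length s)

        xs : List X
        xs = proj₁ separated

        τ : Cube s → Cube (length xs)
        τ v i = D (bits v) (List.lookup xs i)

        τ-inj : ∀ v w → τ v ≡ τ w → v ≡ w
        τ-inj v w q with bits v ℕ.≟ bits w
        ... | yes b = bits-inj v w b
        ... | no b  = ⊥-elim (same v w xs q (All.lookup (proj₂ (proj₂ separated))
                        (List.∈-filter⁺ distinct? (List.∈-map⁺ _ (∈pairs (∈cubes v) (∈cubes w))) b)))

        G : Cube (length xs) → Bool
        G w = ⌞ ∃ (λ v → τ v ≡ w) ⌟

        big : Φ d (length xs) < card (length xs) G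
        big = begin-strict
          Φ d (length xs)               ≤⟨ Φ-bound d _ ⟩
          suc (length xs) ^ d           ≡⟨ cong (λ n → suc n ^ d) (proj₁ (proj₂ separated)) ⟩
          suc (suc (s + s) * m) ^ d     ≤⟨ ℕ.^-monoˡ-≤ d (ℕ.≤-trans (ℕ.m≤m+n _ (m + s)) (ℕ.≤-reflexive (lin s m))) ⟩
          ((2 * m + 1) * suc s) ^ d     <⟨ small ⟩
          2 ^ s                         ≡⟨ card-all s ⟨
          card s (λ _ → true)           ≤⟨ card-fibres s _ 1 (λ _ → true) G τ (λ v _ → true! (v , refl))
                                             (λ w → card-unique s λ v v′ t t′ → τ-inj v v′ (trans (holds t) (sym (holds t′)))) ⟩
          card (length xs) G * 1        ≡⟨ ℕ.*-identityʳ _ ⟩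
          card (length xs) G            ∎

        shattered : Shattered G d
        shattered = sauer d _ G big

  open Shattering

  -- Semantics of derived connectives, automorphisms, and shattering as a formula.

  module Formulas where

    private variable
      ℓ : Level
      L : Language ℓ
      n m k : ℕ

    module _ {a b : Level} {A : Set a} {B : Set b} where
      ⇒ : A ⇔ B → A → B
      ⇒ = Equivalence.to

      ⇐ : A ⇔ B → B → A
      ⇐ = Equivalence.from

    ++-∷ : ∀ {a} {A : Set a} (x : A) (v : Vector A m) (e : Vector A n) → ((x V.∷ v) V.++ e) ≡ (x V.∷ (v V.++ e))
    ++-∷ {m} {n} x v e = ext λ { zero → refl ; (suc i) → lem (Fin.splitAt m i) }
      where
      lem : (s : Fin m ⊎ Fin n) → [ x V.∷ v , e ]′ (Sum.map₁ suc s) ≡ [ v , e ]′ s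
      lem (inj₁ _) = refl
      lem (inj₂ _) = refl

    ∷-∘ : ∀ {a} {A : Set a} (x : A) (v : Vector A n) (ρ : Fin m → Fin n) → ((x V.∷ v) ∘ Fin.lift 1 ρ) ≡ (x V.∷ (v ∘ ρ))
    ∷-∘ x v ρ = ext λ { zero → refl ; (suc i) → refl }

    renameᵗ : (Fin n → Fin m) → Term L n → Term L m
    renameᵗ ρ (var i)    = var (ρ i)
    renameᵗ ρ (app f ts) = app f (λ i → renameᵗ ρ (ts i))

    rename : (Fin n → Fin m) → Formula L n → Formula L m
    rename ρ falsum      = falsum
    rename ρ (equal s t) = equal (renameᵗ ρ s) (renameᵗ ρ t)
    rename ρ (rel r ts)  = rel r (λ i → renameᵗ ρ (ts i))
    rename ρ (imp φ ψ)   = imp (rename ρ φ) (rename ρ ψ)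
    rename ρ (all φ)     = all (rename (Fin.lift 1 ρ) φ)

    conj iff : Formula L n → Formula L n → Formula L n
    conj φ ψ = neg (imp φ (neg ψ))
    iff φ ψ  = conj (imp φ ψ) (imp ψ φ)

    ex : Formula L (suc n) → Formula L n
    ex φ = neg (all (neg φ))

    exs : ∀ k → Formula L (k + n) → Formula L n
    exs zero    φ = φ
    exs (suc k) φ = exs k (ex φ)

    ⋀ : ∀ {a} {A : Set a} → List A → (A → Formula L n) → Formula L n
    ⋀ []      f = neg falsum
    ⋀ (x ∷ l) f = conj (f x) (⋀ l f)

    signed : Bool → Formula L n → Formula L n
    signed true  φ = φ
    signed false φ = neg φ

    module Semantics {L : Language ℓ} (M : Structure L) where

      eval-rename : (ρ : Fin n → Fin m) (t : Term L n) (e : Vector (Carrier M) m) →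
                    eval M e (renameᵗ ρ t) ≡ eval M (e ∘ ρ) t
      eval-rename ρ (var i)    e = refl
      eval-rename ρ (app f ts) e = cong (func M f) (ext λ i → eval-rename ρ (ts i) e)

      -- An equality of types, so that the quantifier case is an instance of extensionality for ∀.
      sat-rename : (ρ : Fin n → Fin m) (φ : Formula L n) (e : Vector (Carrier M) m) →
                   (M ⊨ rename ρ φ [ e ]) ≡ (M ⊨ φ [ e ∘ ρ ])
      sat-rename ρ falsum      e = refl
      sat-rename ρ (equal s t) e = cong₂ _≡_ (eval-rename ρ s e) (eval-rename ρ t e)
      sat-rename ρ (rel r ts)  e = cong (relation M r) (ext λ i → eval-rename ρ (ts i) e)
      sat-rename ρ (imp φ ψ)   e = cong₂ (λ P Q → P → Q) (sat-rename ρ φ e) (sat-rename ρ ψ e)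
      sat-rename ρ (all φ)     e = ∀-extensionality ext _ _ λ x →
        trans (sat-rename (Fin.lift 1 ρ) φ (x V.∷ e)) (cong (M ⊨ φ [_]) (∷-∘ x e ρ))

      sat-rename⇔ : (ρ : Fin n → Fin m) (φ : Formula L n) {e : Vector (Carrier M) m} {e′ : Vector (Carrier M) n} →
                    (∀ i → e (ρ i) ≡ e′ i) → (M ⊨ rename ρ φ [ e ]) ⇔ (M ⊨ φ [ e′ ])
      sat-rename⇔ ρ φ {e} p = mk⇔ (subst id eq) (subst id (sym eq))
        where eq = trans (sat-rename ρ φ e) (cong (M ⊨ φ [_]) (ext p))

      sat-≗ : (φ : Formula L n) {e e′ : Vector (Carrier M) n} → (∀ i → e i ≡ e′ i) → M ⊨ φ [ e ] → M ⊨ φ [ e′ ]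
      sat-≗ φ p = subst (M ⊨ φ [_]) (ext p)

      tv : Formula L n → Vector (Carrier M) n → Bool
      tv φ e = ⌞ M ⊨ φ [ e ] ⌟

      sat-neg : (φ : Formula L n) {e : Vector (Carrier M) n} → (M ⊨ neg φ [ e ]) ⇔ (¬ M ⊨ φ [ e ])
      sat-neg φ = mk⇔ (λ f p → lower (f p)) (λ f p → lift (f p))

      sat-conj : (φ ψ : Formula L n) {e : Vector (Carrier M) n} → (M ⊨ conj φ ψ [ e ]) ⇔ (M ⊨ φ [ e ] × M ⊨ ψ [ e ])
      sat-conj φ ψ = mk⇔ (λ f → dne λ g → lower (f λ p → λ q → lift (g (p , q)))) (λ (p , q) f → f p q)

      sat-iff : (φ ψ : Formula L n) {e : Vector (Carrier M) n} → (M ⊨ iff φ ψ [ e ]) ⇔ (tv φ e ≡ tv ψ e)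
      sat-iff φ ψ = mk⇔
        (λ f → let (p , q) = ⇒ (sat-conj (imp φ ψ) (imp ψ φ)) f in ⌞⌟-cong p q)
        (λ q → ⇐ (sat-conj (imp φ ψ) (imp ψ φ)) ((λ p → holds (subst T q (true! p))) , (λ p → holds (subst T (sym q) (true! p)))))

      sat-ex : (φ : Formula L (suc n)) {e : Vector (Carrier M) n} → (M ⊨ ex φ [ e ]) ⇔ (∃ λ x → M ⊨ φ [ x V.∷ e ])
      sat-ex φ = mk⇔ (λ f → dne λ g → lower (f λ x p → lift (g (x , p)))) (λ (x , p) f → f x p)

      sat-exs : ∀ k (φ : Formula L (k + n)) {e : Vector (Carrier M) n} →
                (M ⊨ exs k φ [ e ]) ⇔ (∃ λ (v : Vector (Carrier M) k) → M ⊨ φ [ v V.++ e ])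
      sat-exs zero    φ = mk⇔ (λ p → V.[] , p) proj₂
      sat-exs (suc k) φ {e} = mk⇔
        (λ p → let (v , q) = ⇒ (sat-exs k (ex φ)) p
                   (x , r) = ⇒ (sat-ex φ) q
               in x V.∷ v , subst (M ⊨ φ [_]) (sym (++-∷ x v e)) r)
        (λ (v , p) → ⇐ (sat-exs k (ex φ)) (V.tail v , ⇐ (sat-ex φ) (v zero ,
           subst (M ⊨ φ [_]) (trans (cong (V._++ e) (sym (ext {f = v zero V.∷ V.tail v} λ { zero → refl ; (suc i) → refl }))) (++-∷ (v zero) (V.tail v) e)) p)))

      sat-⋀ : ∀ {a} {A : Set a} (l : List A) (f : A → Formula L n) {e : Vector (Carrier M) n} →
              (M ⊨ ⋀ l f [ e ]) ⇔ (∀ {x} → x ∈ᴸ l → M ⊨ f x [ e ])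
      sat-⋀ []      f = mk⇔ (λ _ ()) (λ _ p → p)
      sat-⋀ (x ∷ l) f = mk⇔
        (λ p → let (q , r) = ⇒ (sat-conj (f x) (⋀ l f)) p in λ { (here refl) → q ; (there i) → ⇒ (sat-⋀ l f) r i })
        (λ p → ⇐ (sat-conj (f x) (⋀ l f)) (p (here refl) , ⇐ (sat-⋀ l f) (λ i → p (there i))))

      tv-true : (φ : Formula L n) {e : Vector (Carrier M) n} → tv φ e ≡ true → M ⊨ φ [ e ]
      tv-true φ q = holds (subst T (sym q) tt)

      true-tv : (φ : Formula L n) {e : Vector (Carrier M) n} → M ⊨ φ [ e ] → tv φ e ≡ true
      true-tv φ p = T-ext (λ _ → tt) (λ _ → true! p)

      tv-false : (φ : Formula L n) {e : Vector (Carrier M) n} → tv φ e ≡ false → ¬ M ⊨ φ [ e ]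
      tv-false φ q p = subst T q (true! p)

      false-tv : (φ : Formula L n) {e : Vector (Carrier M) n} → ¬ M ⊨ φ [ e ] → tv φ e ≡ false
      false-tv φ ¬p = T-ext (λ t → ¬p (holds t)) (λ ())

      sat-signed : ∀ b (φ : Formula L n) {e : Vector (Carrier M) n} → (M ⊨ signed b φ [ e ]) ⇔ (tv φ e ≡ b)
      sat-signed true  φ = mk⇔ (true-tv φ) (tv-true φ)
      sat-signed false φ = mk⇔ (λ f → false-tv φ (⇒ (sat-neg φ) f)) (λ q → ⇐ (sat-neg φ) (tv-false φ q))

      module Automorphism (σ : Aut M) where
        open Inverse (bij σ) using (to; from; strictlyInverseˡ; strictlyInverseʳ)

        to-injective : ∀ {x y} → to x ≡ to y → x ≡ y
        to-injective {x} {y} e = trans (sym (strictlyInverseʳ x)) (trans (cong from e) (strictlyInverseʳ y))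

        eval-aut : (t : Term L n) (e : Vector (Carrier M) n) → to (eval M e t) ≡ eval M (to ∘ e) t
        eval-aut (var i)    e = refl
        eval-aut (app f ts) e = trans (preservesFun σ f _) (cong (func M f) (ext λ i → eval-aut (ts i) e))

        sat-aut : (φ : Formula L n) {e : Vector (Carrier M) n} → (M ⊨ φ [ e ]) ⇔ (M ⊨ φ [ to ∘ e ])
        sat-aut falsum      = mk⇔ id id
        sat-aut (equal s t) {e} = mk⇔
          (λ p → trans (sym (eval-aut s e)) (trans (cong to p) (eval-aut t e)))
          (λ p → to-injective (trans (eval-aut s e) (trans p (sym (eval-aut t e)))))
        sat-aut (rel r ts)  {e} = mk⇔
          (λ p → subst (relation M r) (ext λ i → eval-aut (ts i) e) (⇒ (preservesRel σ r _) p))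
          (λ p → ⇐ (preservesRel σ r _) (subst (relation M r) (sym (ext λ i → eval-aut (ts i) e)) p))
        sat-aut (imp φ ψ)   = mk⇔ (λ f p → ⇒ (sat-aut ψ) (f (⇐ (sat-aut φ) p))) (λ f p → ⇐ (sat-aut ψ) (f (⇒ (sat-aut φ) p)))
        sat-aut (all φ)     {e} = mk⇔
          (λ f y → sat-≗ φ (λ { zero → strictlyInverseˡ y ; (suc i) → refl }) (⇒ (sat-aut φ) (f (from y))))
          (λ f x → ⇐ (sat-aut φ) (sat-≗ φ (λ { zero → refl ; (suc i) → refl }) (f (to x))))

    Shatters : {L : Language ℓ} (M : Structure L) {q : ℕ} → Formula L (suc q) → ∀ {n} → (Fin n → Carrier M) → Set ℓ
    Shatters M {q} θ {n} a = ∀ (S : Cube n) → ∃ λ (c : Vector (Carrier M) q) → ∀ i → Semantics.tv M θ (a i V.∷ c) ≡ S i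

    -- Only as a formula can shattering be carried between models of a complete theory and passed on
    -- to a Morley sequence. The parameters are quantified in front of the free variables, hence the
    -- environment `c V.++ a`.
    shatter : ∀ {q} → Formula L (suc q) → ∀ n → Formula L n
    shatter {q = q} θ n = ⋀ (cubes n) λ S → exs q (⋀ (List.allFin n) λ i →
      signed (S i) (rename ((q Fin.↑ʳ i) V.∷ (Fin._↑ˡ n)) θ))

    module _ {L : Language ℓ} (M : Structure L) where
      open Semantics M

      tv-rename : (ρ : Fin n → Fin m) (φ : Formula L n) {e : Vector (Carrier M) m} {e′ : Vector (Carrier M) n} →
                  (∀ i → e (ρ i) ≡ e′ i) → tv (rename ρ φ) e ≡ tv φ e′
      tv-rename ρ φ p = ⌞⌟-cong (⇒ (sat-rename⇔ ρ φ p)) (⇐ (sat-rename⇔ ρ φ p))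

      sat-shatter : ∀ {q} (θ : Formula L (suc q)) n {a : Fin n → Carrier M} → (M ⊨ shatter θ n [ a ]) ⇔ Shatters M θ a
      sat-shatter {q} θ n {a} = mk⇔
        (λ p S → let (c , r) = ⇒ (sat-exs q _) (⇒ (sat-⋀ (cubes n) _) p (∈cubes S)) in
           c , λ i → trans (sym (env c i)) (⇒ (sat-signed (S i) _) (⇒ (sat-⋀ (List.allFin n) _) r (List.∈-allFin i))))
        (λ p → ⇐ (sat-⋀ (cubes n) _) λ {S} _ → let (c , r) = p S in
           ⇐ (sat-exs q _) (c , ⇐ (sat-⋀ (List.allFin n) _) λ {i} _ → ⇐ (sat-signed (S i) _) (trans (env c i) (r i))))
        where
        env : ∀ c i → tv (rename ((q Fin.↑ʳ i) V.∷ (Fin._↑ˡ n)) θ) (c V.++ a) ≡ tv θ (a i V.∷ c)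
        env c i = tv-rename _ θ λ { zero → V.lookup-++ʳ c a i ; (suc j) → V.lookup-++ˡ c a j }

      subset : ∀ {n} → Cube n → Subset n
      subset = Vec.tabulate

      ∈subset : ∀ {n} (S : Cube n) i → (i ∈ˢ subset S) ⇔ T (S i)
      ∈subset S i = mk⇔
        (λ p → subst T (trans (sym (Vec.[]=⇒lookup p)) (Vec.lookup∘tabulate S i)) tt)
        (λ t → Vec.lookup⇒[]= i _ (trans (Vec.lookup∘tabulate S i) (T-ext (λ _ → tt) (λ _ → t))))

      ip⇒shatters : ∀ p q (φ : Formula L (p + q)) → FormulaIP M p q φ → ∀ n →
        ∃ λ (a : Fin n → Vector (Carrier M) p) → ∀ (S : Cube n) → ∃ λ (b : Vector (Carrier M) q) → ∀ i → tv φ (a i V.++ b) ≡ S i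
      ip⇒shatters p q φ ip n = let (a , b , f) = ip n in a , λ S → b (subset S) , λ i →
        T-ext (λ t → ⇒ (∈subset S i) (⇒ (f i (subset S)) (holds t))) (λ t → true! (⇐ (f i (subset S)) (⇐ (∈subset S i) t)))

      shatters⇒ip : ∀ q (θ : Formula L (suc q)) → (∀ n → ∃ λ (a : Fin n → Carrier M) → Shatters M θ a) → FormulaIP M 1 q θ
      shatters⇒ip q θ sh n = let (a , f) = sh n in (λ i _ → a i) , (λ S → proj₁ (f (Vec.lookup S))) , λ i S →
        let (c , r) = f (Vec.lookup S)
            eq : tv θ ((λ (_ : Fin 1) → a i) V.++ c) ≡ Vec.lookup S i
            eq = trans (cong (tv θ) (ext λ { zero → refl ; (suc j) → refl })) (r i)
        in mk⇔ (λ p → Vec.lookup⇒[]= i S (trans (sym eq) (true-tv θ p)))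
               (λ p → tv-true θ (trans eq (Vec.[]=⇒lookup p)))

  open Formulas

  -- Reduction of the independence property to formulas in a single variable.

  module SingleVariable where

    private variable
      ℓ : Level
      a b : Level
      A : Set a
      B : Set b
      n m k : ℕ

    tuples : ∀ d → List A → List (Fin d → A)
    tuples zero    l = V.[] ∷ []
    tuples (suc d) l = List.map (λ (x , t) → x V.∷ t) (pairs l (tuples d l))

    tuples-length : ∀ d (l : List A) → length (tuples d l) ≡ length l ^ d
    tuples-length zero    l = refl
    tuples-length (suc d) l = trans (List.length-map _ (pairs l (tuples d l)))
      (trans (pairs-length l (tuples d l)) (cong (length l *_) (tuples-length d l)))

    ∈tuples : ∀ {d} {l : List A} (t : Fin d → A) → (∀ i → t i ∈ᴸ l) → t ∈ᴸ tuples d l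
    ∈tuples {d = zero}  t p = here (ext λ ())
    ∈tuples {d = suc d} {l} t p = subst (_∈ᴸ tuples (suc d) l) (ext λ { zero → refl ; (suc i) → refl })
      (List.∈-map⁺ (λ (x , t) → x V.∷ t) (∈pairs (p zero) (∈tuples (V.tail t) (λ i → p (suc i)))))

    ShattersAll : {A : Set a} {B : Set b} → (A → B → Bool) → Set (a ⊔ b)
    ShattersAll {A = A} {B = B} R = ∀ n → ∃ λ (y : Fin n → B) → ∀ (S : Cube n) → ∃ λ x → ∀ i → R x (y i) ≡ S i

    -- The points are indexed by all patterns, and the i-th set is given by the i-th coordinate.
    dualise : (R : A → B → Bool) → ShattersAll R → ShattersAll (λ y x → R x y)
    dualise R sh n =
      let (y , f) = sh (length (cubes n))
          x : Fin n → _
          x i = proj₁ (f λ k → List.lookup (cubes n) k i)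
      in x , λ S → let k = Any.index (∈cubes S) in
           y k , λ i → trans (proj₂ (f λ k → List.lookup (cubes n) k i) k) (cong (λ v → v i) (sym (Any.lookup-index (∈cubes S))))

    -- Serves to treat the first variable as a parameter, and to let `exs m` quantify the rest of
    -- the left block while that variable stays free.
    rotate : ∀ {L : Language ℓ} m {n} → Formula L (suc m + n) → Formula L (m + suc n)
    rotate m {n} = rename (((m Fin.↑ʳ zero) V.∷ (Fin._↑ˡ suc n)) V.++ (λ j → m Fin.↑ʳ suc j))

    module Rotation {L : Language ℓ} (M : Structure L) where
      open Semantics M

      private
        C = Carrier M

      tv-rename-++ : (v : Fin m → Fin k) (w : Fin n → Fin k) (φ : Formula L (m + n)) {e : Vector C k} (x : Vector C m) (y : Vector C n) →
                     (∀ i → e (v i) ≡ x i) → (∀ j → e (w j) ≡ y j) → tv (rename (v V.++ w) φ) e ≡ tv φ (x V.++ y)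
      tv-rename-++ {m = m} v w φ {e} x y p q = tv-rename M (v V.++ w) φ lookup
        where
        lookup : ∀ i → e ((v V.++ w) i) ≡ (x V.++ y) i
        lookup i with Fin.splitAt m i
        ... | inj₁ i = p i
        ... | inj₂ j = q j

      rotate-tv : (φ : Formula L (suc m + n)) (x : C) (v : Vector C m) (w : Vector C n) →
                  tv (rotate m φ) (v V.++ (x V.∷ w)) ≡ tv φ ((x V.∷ v) V.++ w)
      rotate-tv φ x v w = tv-rename-++ _ _ φ (x V.∷ v) w
        (λ { zero → V.lookup-++ʳ v (x V.∷ w) zero ; (suc i) → V.lookup-++ˡ v (x V.∷ w) i })
        (λ j → V.lookup-++ʳ v (x V.∷ w) (suc j))

      sat-rotate : (φ : Formula L (suc m + n)) (x : C) (v : Vector C m) (w : Vector C n) →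
                   (M ⊨ rotate m φ [ v V.++ (x V.∷ w) ]) ⇔ (M ⊨ φ [ (x V.∷ v) V.++ w ])
      sat-rotate {m = m} φ x v w = mk⇔
        (λ p → tv-true φ (trans (sym (rotate-tv φ x v w)) (true-tv (rotate m φ) p)))
        (λ p → tv-true (rotate m φ) (trans (rotate-tv φ x v w) (true-tv φ p)))

    module OneVariable {L : Language ℓ} (M : Structure L) where
      open Semantics M
      open Rotation M

      private
        C = Carrier M

      realises : ∀ p q → Formula L (p + q) → Vector C p → Vector C q → Bool
      realises p q φ x y = tv φ (x V.++ y)

      -- The induction step: x = (x₁, x₂) with x₁ one variable. If φ(x₁, –; y) does
      -- not shatter d points and θ(x₁; ȳ, z̄, w) := ∃x₂ ⋀ᵢ φ(x₁x₂, yᵢ) ↔ φ(w, zᵢ) has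
      -- bounded VC dimension, then the set of φ-patterns over N points is a union of
      -- polynomially many classes, one for each θ-type of x₁, and each class, having
      -- the same projections to d points as that of a single x₁, has polynomial size.
      module Step (p q d : ℕ) (φ : Formula L (suc p + q)) where

        r = d * q + (d * q + suc p)

        flat : (Fin d → Vector C q) → Vector C (d * q)
        flat y k = let (i , j) = Fin.remQuot q k in y i j

        params : (Fin d → Vector C q) → (Fin d → Vector C q) → Vector C (suc p) → Vector C r
        params y z w = flat y V.++ (flat z V.++ w)

        yᵢ zᵢ : Fin d → Fin q → Fin r
        yᵢ i j = Fin.combine i j Fin.↑ˡ (d * q + suc p)
        zᵢ i j = (d * q) Fin.↑ʳ (Fin.combine i j Fin.↑ˡ suc p)

        wⱼ : Fin (suc p) → Fin r
        wⱼ j = (d * q) Fin.↑ʳ ((d * q) Fin.↑ʳ j)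

        flat-combine : ∀ y i j → flat y (Fin.combine i j) ≡ y i j
        flat-combine y i j = cong (λ (i , j) → y i j) (Fin.remQuot-combine i j)

        α β : Fin d → Fin (suc p + q) → Fin (p + suc r)
        α i = ((p Fin.↑ʳ zero) V.∷ (Fin._↑ˡ suc r)) V.++ (λ j → p Fin.↑ʳ suc (yᵢ i j))
        β i = (λ j → p Fin.↑ʳ suc (wⱼ j)) V.++ (λ j → p Fin.↑ʳ suc (zᵢ i j))

        θ : Formula L (suc r)
        θ = exs p (⋀ (List.allFin d) λ i → iff (rename (α i) φ) (rename (β i) φ))

        module _ (y z : Fin d → Vector C q) (w : Vector C (suc p)) (x₁ : C) where
          private
            env : Vector C p → Vector C (p + suc r)
            env x₂ = x₂ V.++ (x₁ V.∷ params y z w)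

            α-tv : ∀ x₂ i → tv (rename (α i) φ) (env x₂) ≡ tv φ ((x₁ V.∷ x₂) V.++ y i)
            α-tv x₂ i = tv-rename-++ _ _ φ (x₁ V.∷ x₂) (y i)
              (λ { zero → V.lookup-++ʳ x₂ (x₁ V.∷ params y z w) zero ; (suc i) → V.lookup-++ˡ x₂ (x₁ V.∷ params y z w) i })
              (λ j → trans (V.lookup-++ʳ x₂ (x₁ V.∷ params y z w) (suc (yᵢ i j)))
                       (trans (V.lookup-++ˡ (flat y) (flat z V.++ w) (Fin.combine i j)) (flat-combine y i j)))

            β-tv : ∀ x₂ i → tv (rename (β i) φ) (env x₂) ≡ tv φ (w V.++ z i)
            β-tv x₂ i = tv-rename-++ _ _ φ w (z i)
              (λ j → trans (V.lookup-++ʳ x₂ (x₁ V.∷ params y z w) (suc (wⱼ j)))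
                       (trans (V.lookup-++ʳ (flat y) (flat z V.++ w) ((d * q) Fin.↑ʳ j)) (V.lookup-++ʳ (flat z) w j)))
              (λ j → trans (V.lookup-++ʳ x₂ (x₁ V.∷ params y z w) (suc (zᵢ i j)))
                       (trans (V.lookup-++ʳ (flat y) (flat z V.++ w) (Fin.combine i j Fin.↑ˡ suc p))
                         (trans (V.lookup-++ˡ (flat z) w (Fin.combine i j)) (flat-combine z i j))))

          sat-θ : (M ⊨ θ [ x₁ V.∷ params y z w ]) ⇔ (∃ λ x₂ → ∀ i → tv φ ((x₁ V.∷ x₂) V.++ y i) ≡ tv φ (w V.++ z i))
          sat-θ = mk⇔
            (λ s → let (x₂ , t) = ⇒ (sat-exs p _) s in x₂ , λ i →
               trans (sym (α-tv x₂ i)) (trans (⇒ (sat-iff (rename (α i) φ) (rename (β i) φ)) (⇒ (sat-⋀ (List.allFin d) _) t (List.∈-allFin i))) (β-tv x₂ i)))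
            (λ (x₂ , f) → ⇐ (sat-exs p _) (x₂ , ⇐ (sat-⋀ (List.allFin d) _) λ {i} _ →
               ⇐ (sat-iff (rename (α i) φ) (rename (β i) φ)) (trans (α-tv x₂ i) (trans (f i) (sym (β-tv x₂ i))))))

        -- As φ(w, -) takes both truth values on `zz`, a pattern `S` is itself encoded by
        -- parameters, namely `zz ∘ S`. The hypothesis `no-d` bounds the fibres of the type map `τ`,
        -- and `no-D` the number of its values.
        module Count
          (no-d : ∀ (x₁ : C) (y : Fin d → Vector C q) → ¬ (∀ (S : Cube d) → ∃ λ x₂ → ∀ i → tv φ ((x₁ V.∷ x₂) V.++ y i) ≡ S i))
          (D : ℕ)
          (no-D : ∀ (u : Fin D → Vector C r) → ¬ (∀ (S : Cube D) → ∃ λ x₁ → ∀ i → tv θ (x₁ V.∷ u i) ≡ S i))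
          (w : Vector C (suc p)) (zz : Bool → Vector C q) (zz-tv : ∀ b → tv φ (w V.++ zz b) ≡ b)
          (N : ℕ) (y : Fin N → Vector C q) (x : Cube N → Vector C (suc p)) (xy : ∀ S i → tv φ (x S V.++ y i) ≡ S i)
          where

          codes : List ((Fin d → Fin N) × Cube d)
          codes = pairs (tuples d (List.allFin N)) (cubes d)

          R = length codes

          R-value : R ≡ N ^ d * 2 ^ d
          R-value = trans (pairs-length (tuples d (List.allFin N)) (cubes d))
            (cong₂ _*_ (trans (tuples-length d (List.allFin N)) (cong (_^ d) (List.length-tabulate id))) (cubes-length d))

          param : (Fin d → Fin N) × Cube d → Vector C r
          param (t , S) = params (y ∘ t) (zz ∘ S) w

          x₁ : Cube N → C
          x₁ S = x S zero

          x₂ : Cube N → Vector C p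
          x₂ S = V.tail (x S)

          xy′ : ∀ S i → tv φ ((x₁ S V.∷ x₂ S) V.++ y i) ≡ S i
          xy′ S i = trans (cong (λ v → tv φ (v V.++ y i)) (ext λ { zero → refl ; (suc j) → refl })) (xy S i)

          τ : Cube N → Cube R
          τ S k = tv θ (x₁ S V.∷ param (List.lookup codes k))

          G : Cube R → Bool
          G v = ⌞ ∃ (λ S → τ S ≡ v) ⌟

          G-small : card R G ≤ Φ D R
          G-small = ℕ.≮⇒≥ λ lt → let (pos , sh) = sauer D R G lt in
            no-D (λ i → param (List.lookup codes (pos i))) λ S →
              let (v , t , e) = sh S; (S′ , q) = holds t in x₁ S′ , λ i → trans (cong (λ v → v (pos i)) q) (e i)

          -- A large fibre would shatter some `d` of the points. Each pattern on them is realised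
          -- with some first coordinate `x₁ S₁`; its `θ`-type agrees with that of `x₁ S₀`, so the
          -- pattern is also realised with the fixed first coordinate `x₁ S₀`, which `no-d`
          -- excludes.
          fibre-small : ∀ v → card N (λ S → true ∧ ⌞ τ S ≡ v ⌟) ≤ Φ d N
          fibre-small v = ℕ.≮⇒≥ λ lt →
            let (pos , sh) = sauer d N _ lt
                (S₀ , t₀ , _) = sh (λ _ → true)
            in no-d (x₁ S₀) (y ∘ pos) λ S →
              let (S₁ , t₁ , e) = sh S
                  member = ∈pairs (∈tuples pos (λ i → List.∈-allFin (pos i))) (∈cubes S)
                  k = Any.index member
                  same : tv θ (x₁ S₁ V.∷ param (pos , S)) ≡ tv θ (x₁ S₀ V.∷ param (pos , S))
                  same = subst (λ u → tv θ (x₁ S₁ V.∷ param u) ≡ tv θ (x₁ S₀ V.∷ param u)) (sym (Any.lookup-index member))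
                           (cong (λ v → v k) (trans (holds t₁) (sym (holds t₀))))
                  true₁ = ⇐ (sat-θ (y ∘ pos) (zz ∘ S) w (x₁ S₁)) (x₂ S₁ , λ i →
                            trans (xy′ S₁ (pos i)) (trans (e i) (sym (zz-tv (S i)))))
                  (x₂′ , f) = ⇒ (sat-θ (y ∘ pos) (zz ∘ S) w (x₁ S₀)) (tv-true θ (trans (sym same) (true-tv θ true₁)))
              in x₂′ , λ i → trans (f i) (zz-tv (S i))

          bound : 2 ^ N ≤ Φ D (N ^ d * 2 ^ d) * Φ d N
          bound = begin
            2 ^ N                     ≡⟨ card-all N ⟨
            card N (λ _ → true)       ≤⟨ card-fibres N R (Φ d N) (λ _ → true) G τ (λ S _ → true! (S , refl)) fibre-small ⟩
            card R G * Φ d N          ≤⟨ ℕ.*-monoˡ-≤ (Φ d N) G-small ⟩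
            Φ D R * Φ d N             ≡⟨ cong (λ R → Φ D R * Φ d N) R-value ⟩
            Φ D (N ^ d * 2 ^ d) * Φ d N ∎
            where open ℕ.≤-Reasoning

      private
        ^-distribʳ-* : ∀ d m n → (m * n) ^ d ≡ m ^ d * n ^ d
        ^-distribʳ-* zero    m n = refl
        ^-distribʳ-* (suc d) m n = trans (cong (m * n *_) (^-distribʳ-* d m n)) (swap m n (m ^ d) (n ^ d))
          where
          swap : ∀ a b c d → a * b * (c * d) ≡ a * c * (b * d)
          swap = solve-∀

      Φ-product : ∀ D d N → Φ D (N ^ d * 2 ^ d) * Φ d N ≤ (2 * suc N) ^ (suc d * D + d)
      Φ-product D d N = begin
          Φ D (N ^ d * 2 ^ d) * Φ d N            ≤⟨ ℕ.*-mono-≤ (Φ-bound D (N ^ d * 2 ^ d)) (Φ-bound d N) ⟩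
          suc (N ^ d * 2 ^ d) ^ D * suc N ^ d    ≤⟨ ℕ.*-mono-≤ (ℕ.^-monoˡ-≤ D small) (ℕ.^-monoˡ-≤ d (ℕ.m≤n*m (suc N) 2)) ⟩
          (K ^ suc d) ^ D * K ^ d                ≡⟨ cong (_* K ^ d) (ℕ.^-*-assoc K (suc d) D) ⟩
          K ^ (suc d * D) * K ^ d                ≡⟨ ℕ.^-distribˡ-+-* K (suc d * D) d ⟨
          K ^ (suc d * D + d)                    ∎
        where
        open ℕ.≤-Reasoning
        K = 2 * suc N
        small : suc (N ^ d * 2 ^ d) ≤ K ^ suc d
        small = begin
          1 + N ^ d * 2 ^ d             ≤⟨ ℕ.+-mono-≤ (ℕ.m^n>0 K d) (ℕ.*-monoˡ-≤ (2 ^ d) (ℕ.^-monoˡ-≤ d (ℕ.n≤1+n N))) ⟩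
          K ^ d + suc N ^ d * 2 ^ d     ≡⟨ cong (K ^ d +_) (trans (ℕ.*-comm (suc N ^ d) (2 ^ d)) (sym (^-distribʳ-* d 2 (suc N)))) ⟩
          K ^ d + K ^ d                 ≡⟨ cong (K ^ d +_) (ℕ.+-identityʳ (K ^ d)) ⟨
          2 * K ^ d                     ≤⟨ ℕ.*-monoˡ-≤ (K ^ d) (ℕ.m≤m*n 2 (suc N)) ⟩
          K * K ^ d                     ∎

      OneVariableIP : Set ℓ
      OneVariableIP = ∃₂ λ q (θ : Formula L (suc q)) → ∀ n → ∃ λ (a : Fin n → C) → Shatters M θ a

      one-variable : ∀ {q} (θ : Formula L (suc q)) → ShattersAll (λ x (y : Vector C q) → tv θ (x V.∷ y)) → OneVariableIP
      one-variable {q} θ sh = q , θ , dualise (λ x y → tv θ (x V.∷ y)) sh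

      -- If the formula still shatters after `x₁` has moved among the parameters, induct. If not,
      -- some `d` bounds the patterns over each fixed `x₁`, and then `θ` must shatter in its single
      -- variable: otherwise `Count.bound` contradicts `poly<exp`.
      reduce : ∀ p q (φ : Formula L (suc p + q)) → ShattersAll (realises (suc p) q φ) → OneVariableIP
      reduce zero q φ sh = one-variable φ λ n → let (y , f) = sh n in y , λ S → let (x , e) = f S in
        x zero , λ i → trans (cong (tv φ) (ext λ { zero → refl ; (suc j) → refl })) (e i)
      reduce (suc p) q φ sh with decide (ShattersAll (realises (suc p) (suc q) (rotate (suc p) φ)))
      ... | yes sh′ = reduce p (suc q) (rotate (suc p) φ) sh′
      ... | no ¬sh′ = let (d , no-d) = ¬∀⇒∃ ¬sh′ in bounded d (λ x₁ y h → no-d ((λ i → x₁ V.∷ y i) , λ S →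
            let (x₂ , e) = h S in x₂ , λ i → trans (rotate-tv φ x₁ x₂ (y i)) (e i)))
        where
        bounded : ∀ d → (∀ (x₁ : C) (y : Fin d → Vector C q) →
                    ¬ (∀ (S : Cube d) → ∃ λ x₂ → ∀ i → tv φ ((x₁ V.∷ x₂) V.++ y i) ≡ S i)) → OneVariableIP
        bounded d no-d with decide (ShattersAll (λ x (u : Vector C (Step.r (suc p) q d φ)) → tv (Step.θ (suc p) q d φ) (x V.∷ u)))
        ... | yes shθ = one-variable (Step.θ (suc p) q d φ) shθ
        ... | no ¬shθ =
          let (D , no-D) = ¬∀⇒∃ ¬shθ
              (z , f) = sh 2
              (w , e) = f (true V.∷ false V.∷ V.[])
              (N , lt) = poly<exp 2 (suc d * D + d)
              (y , g) = sh N
          in ⊥-elim (ℕ.<⇒≱ lt (ℕ.≤-trans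
               (Step.Count.bound (suc p) q d φ no-d
                 D (λ u h → no-D (u , h)) w (λ { true → z zero ; false → z (suc zero) }) (λ { true → e zero ; false → e (suc zero) })
                 N y (λ S → proj₁ (g S)) (λ S → proj₂ (g S)))
               (Φ-product D d N)))

      ip⇒one-variable : ∀ p q (φ : Formula L (p + q)) → FormulaIP M p q φ → OneVariableIP
      ip⇒one-variable zero q φ ip =
        -- Two points in zero variables coincide, so no formula tells them apart.
        let (x , f) = ip⇒shatters M 0 q φ ip 2
            (b , e) = f (true V.∷ false V.∷ V.[])
        in case trans (sym (e zero)) (trans (cong (λ v → tv φ (v V.++ b)) (ext {f = x zero} {g = x (suc zero)} λ ())) (e (suc zero))) of λ ()
      ip⇒one-variable (suc p) q φ ip = reduce p q φ (dualise (λ y x → realises (suc p) q φ x y) (ip⇒shatters M (suc p) q φ ip))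

  open SingleVariable

  -- Saturation, and the extension of elementary maps to automorphisms.

  module Automorphisms where

    private variable
      ℓ : Level
      n m k : ℕ

    module Saturation {L : Language ℓ} (M : Structure L) (saturated : Saturated M) where

      private
        C = Carrier M

      -- Finitely many conditions have indices below some `N`, so finite satisfiability of a
      -- countable type only has to be checked on initial segments.
      realise-chain : (A : Pred C ℓ) → Smaller M A → (k : ℕ → ℕ) (Δ : ∀ i → Formula L (suc (k i))) (c : ∀ i → Vector C (k i)) →
        (∀ i j → c i j ∈ A) → (∀ N → ∃ λ x → ∀ i → i ≤ N → M ⊨ Δ i [ x V.∷ c i ]) → ∃ λ x → ∀ i → M ⊨ Δ i [ x V.∷ c i ]
      realise-chain A small k Δ c c∈ fin =
        let (x , f) = saturated A small p finite in x , λ i → f (formula i) (i , refl)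
        where
        formula : ℕ → ParamFormula M A
        formula i = k i , Δ i , c i , c∈ i

        p : Pred (ParamFormula M A) ℓ
        p φ = ∃ λ i → formula i ≡ φ

        bound : ∀ Φ → All p Φ → ∃ λ N → All (λ φ → ∃ λ i → i ≤ N × formula i ≡ φ) Φ
        bound [] [] = 0 , []
        bound (φ ∷ Φ) ((i , e) ∷ ps) = let (N , qs) = bound Φ ps in
          i ℕ.⊔ N , (i , ℕ.m≤m⊔n i N , e) ∷ All.map (λ (j , j≤N , e) → j , ℕ.≤-trans j≤N (ℕ.m≤n⊔m i N) , e) qs

        finite : ∀ Φ → All p Φ → ∃ λ x → All (λ φ → x ∈ Solutions M A φ) Φ
        finite Φ ps = let (N , qs) = bound Φ ps; (x , f) = fin N in
          x , All.map (λ { (i , i≤N , refl) → f i i≤N }) qs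

    -- Back and forth along a well-order whose initial segments are small.
    module Homogeneity {L : Language ℓ} (M : Structure L) (saturated : Saturated M)
                       (seq∞ : ℕ → Carrier M) (seq∞-inj : Injective _≡_ _≡_ seq∞) (uncountable : ¬ (ℕ ↔ Carrier M)) where
      open Semantics M
      open Rotation M

      private
        C = Carrier M

      I : InitialOrder C
      I = initialOrder C

      open InitialOrder I
      open Uncountable I seq∞ seq∞-inj uncountable

      countable-smaller : (g : ℕ → C) (A : Pred C ℓ) → (∀ x → x ∈ A → ∃ λ n → g n ≡ x) → Smaller M A
      countable-smaller g A cover (f , f-inj , f∈) =
        few [ g , id ]′ (nonempty M) (f , f-inj , λ y → inj₁ (cover (f y) (f∈ y)))

      module _ {J : Set ℓ} where

        Elem : (u v : J → C) → Set ℓ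
        Elem u v = ∀ {k} (ψ : Formula L k) (t : Fin k → J) → M ⊨ ψ [ u ∘ t ] → M ⊨ ψ [ v ∘ t ]

        Elem-sym : ∀ {u v} → Elem u v → Elem v u
        Elem-sym e ψ t p = dne λ ¬q → ⇒ (sat-neg ψ) (e (neg ψ) t (⇐ (sat-neg ψ) ¬q)) p

        Matches : (u v : J → C) (y w : C) → Set ℓ
        Matches u v y w = ∀ {k} (ψ : Formula L (suc k)) (t : Fin k → J) → M ⊨ ψ [ y V.∷ (u ∘ t) ] → M ⊨ ψ [ w V.∷ (v ∘ t) ]

        Matches-sym : ∀ {u v y w} → Matches u v y w → Matches v u w y
        Matches-sym e ψ t p = dne λ ¬q → ⇒ (sat-neg ψ) (e (neg ψ) t (⇐ (sat-neg ψ) ¬q)) p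

        -- Finitely many conditions satisfied by `y` over `u` merge into one formula. Its
        -- existential closure holds at `u`, hence at `v`, and a witness there meets all of them;
        -- saturation over the range of `v` does the rest.
        extend : (u v : J → C) → Elem u v → Smaller M (λ x → ∃ λ j → v j ≡ x) → ∀ y → ∃ (Matches u v y)
        extend u v e small y =
          let (w , f) = saturated A small p finite in
          w , λ {k} ψ t s → f (k , ψ , v ∘ t , λ i → t i , refl) (t , (λ _ → refl) , s)
          where
          A : Pred C ℓ
          A x = ∃ λ j → v j ≡ x

          p : Pred (ParamFormula M A) ℓ
          p (k , ψ , c , _) = ∃ λ (t : Fin k → J) → (∀ i → v (t i) ≡ c i) × M ⊨ ψ [ y V.∷ (u ∘ t) ]

          merge : ∀ Φ → All p Φ → ∃ λ k → Σ (Formula L (suc k)) λ χ → ∃ λ (t : Fin k → J) →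
                  M ⊨ χ [ y V.∷ (u ∘ t) ] × (∀ x → M ⊨ χ [ x V.∷ (v ∘ t) ] → All (λ φ → x ∈ Solutions M A φ) Φ)
          merge [] [] = 0 , neg falsum , V.[] , (λ q → q) , λ x _ → []
          merge ((k₁ , ψ , c , _) ∷ Φ) ((t₁ , eq , s) ∷ ps) with merge Φ ps
          ... | k₂ , χ , t₂ , s₂ , f = k₁ + k₂ , conj (rename ρ₁ ψ) (rename ρ₂ χ) , t₁ V.++ t₂ ,
                ⇐ (sat-conj (rename ρ₁ ψ) (rename ρ₂ χ)) (⇐ (sat-rename⇔ ρ₁ ψ (left u y)) s , ⇐ (sat-rename⇔ ρ₂ χ (right u y)) s₂) ,
                λ x q → let (q₁ , q₂) = ⇒ (sat-conj (rename ρ₁ ψ) (rename ρ₂ χ)) q in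
                  sat-≗ ψ (λ { zero → refl ; (suc i) → eq i }) (⇒ (sat-rename⇔ ρ₁ ψ (left v x)) q₁) ∷
                  f x (⇒ (sat-rename⇔ ρ₂ χ (right v x)) q₂)
            where
            ρ₁ : Fin (suc k₁) → Fin (suc (k₁ + k₂))
            ρ₁ = zero V.∷ (λ i → suc (i Fin.↑ˡ k₂))
            ρ₂ : Fin (suc k₂) → Fin (suc (k₁ + k₂))
            ρ₂ = zero V.∷ (λ i → suc (k₁ Fin.↑ʳ i))

            left : (g : J → C) (x : C) → ∀ i → (x V.∷ (g ∘ (t₁ V.++ t₂))) (ρ₁ i) ≡ (x V.∷ (g ∘ t₁)) i
            left g x zero    = refl
            left g x (suc i) = cong g (V.lookup-++ˡ t₁ t₂ i)

            right : (g : J → C) (x : C) → ∀ i → (x V.∷ (g ∘ (t₁ V.++ t₂))) (ρ₂ i) ≡ (x V.∷ (g ∘ t₂)) i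
            right g x zero    = refl
            right g x (suc i) = cong g (V.lookup-++ʳ t₁ t₂ i)

          finite : ∀ Φ → All p Φ → ∃ λ x → All (λ φ → x ∈ Solutions M A φ) Φ
          finite Φ ps = let (k , χ , t , s , f) = merge Φ ps
                            (x , q) = ⇒ (sat-ex χ) (e (ex χ) t (⇐ (sat-ex χ) (y , s)))
                        in x , f x q

      module BackAndForth (u v : ℕ → C) (uv : ∀ {k} (ψ : Formula L k) (t : Fin k → ℕ) → M ⊨ ψ [ u ∘ t ] → M ⊨ ψ [ v ∘ t ]) where

        private
          -- Names of the pairs available at stage `x`: the given `u n`, `v n`, and the pairs chosen
          -- at earlier stages.
          J : C → Set ℓ
          J x = ℕ ⊎ ∃ (_≺ x)

          Rec : C → Set ℓ
          Rec x = ∀ {z} → z ≺ x → C × C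

          dom cod : ∀ x → Rec x → J x → C
          dom x rec (inj₁ n)       = u n
          dom x rec (inj₂ (z , p)) = proj₁ (rec p)
          cod x rec (inj₁ n)       = v n
          cod x rec (inj₂ (z , p)) = proj₂ (rec p)

          forth : ∀ {x} (rec : Rec x) y → Dec (∃ (Matches (dom x rec) (cod x rec) y)) → C × C
          forth rec y (yes (w , _)) = y , w
          -- A default that makes the recursion total; `good-choice` excludes this case once the
          -- earlier stages are known to be elementary.
          forth rec y (no _)        = y , y

          back : ∀ {x} (rec : Rec x) y → Dec (∃ (Matches (cod x rec) (dom x rec) y)) → C × C
          back rec y (yes (w , _)) = w , y
          back rec y (no _)        = y , y

          choose : ∀ {x} → Rec x → C × Bool → C × C
          choose rec (y , false) = forth rec y em
          choose rec (y , true)  = back rec y em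

          sched = proj₁ schedule

          step : (x : C) → Rec x → C × C
          step x rec = choose rec (sched x)

          open WF.FixPoint wf (λ _ → C × C) step (λ x {IH} {IH′} e →
            cong (λ (r : ∀ z → z ≺ x → C × C) → step x λ {z} → r z) (ext λ z → ext λ p → e p))

          P : C → C × C
          P = WF.All.wfRec wf _ (λ _ → C × C) step

          rec : ∀ x → Rec x
          rec x {z} _ = P z

          P-unfold : ∀ x → P x ≡ choose (rec x) (sched x)
          P-unfold x = unfold-wfRec

        lhs rhs : ℕ ⊎ C → C
        lhs (inj₁ n) = u n
        lhs (inj₂ z) = proj₁ (P z)
        rhs (inj₁ n) = v n
        rhs (inj₂ z) = proj₂ (P z)

        private
          Good : C → Set ℓ
          Good x = Matches (dom x (rec x)) (cod x (rec x)) (proj₁ (P x)) (proj₂ (P x))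

          Top : ∀ {k} → (Fin k → ℕ ⊎ C) → Set ℓ
          Top t = (∀ i → ∃ λ n → t i ≡ inj₁ n) ⊎
                  (∃ λ z → (∃ λ i → t i ≡ inj₂ z) × (∀ i z′ → t i ≡ inj₂ z′ → z′ ≺ z ⊎ z′ ≡ z))

          top : ∀ {k} (t : Fin k → ℕ ⊎ C) → Top t
          top {zero}  t = inj₁ λ ()
          top {suc k} t with t zero in eq | top (V.tail t)
          ... | inj₁ n | inj₁ f = inj₁ λ { zero → n , eq ; (suc i) → f i }
          ... | inj₁ n | inj₂ (z , (i , e) , max) = inj₂ (z , (suc i , e) , λ { zero z′ e′ → case trans (sym eq) e′ of λ () ; (suc i) → max i })
          ... | inj₂ y | inj₁ f = inj₂ (y , (zero , eq) , λ { zero z′ e′ → inj₂ (Sum.inj₂-injective (trans (sym e′) eq))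
                                                             ; (suc i) z′ e′ → case trans (sym (proj₂ (f i))) e′ of λ () })
          ... | inj₂ y | inj₂ (z , (i , e) , max) with trichot y z
          ...   | inj₁ y≺z = inj₂ (z , (suc i , e) , λ { zero z′ e′ → inj₁ (subst (_≺ z) (Sum.inj₂-injective (trans (sym eq) e′)) y≺z) ; (suc i) → max i })
          ...   | inj₂ (inj₁ refl) = inj₂ (z , (suc i , e) , λ { zero z′ e′ → inj₂ (Sum.inj₂-injective (trans (sym e′) eq)) ; (suc i) → max i })
          ...   | inj₂ (inj₂ z≺y) = inj₂ (y , (zero , eq) , λ { zero z′ e′ → inj₂ (Sum.inj₂-injective (trans (sym e′) eq))
                                                                ; (suc i) z′ e′ → inj₁ ([ (λ p → ≺-trans p z≺y) , (λ { refl → z≺y }) ]′ (max i z′ e′)) })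

          -- A finite tuple of names either mentions no stage or has a latest stage `z`. Occurrences
          -- of `z` go to variable zero and all other names are available at `z`, so the matching
          -- condition of that one stage suffices.
          assemble : ∀ {k} (ψ : Formula L k) (t : Fin k → ℕ ⊎ C) → (∀ i z → t i ≡ inj₂ z → Good z) → M ⊨ ψ [ lhs ∘ t ] → M ⊨ ψ [ rhs ∘ t ]
          assemble {k} ψ t good p with top t
          ... | inj₁ f = sat-≗ ψ (λ i → cong rhs (sym (proj₂ (f i)))) (uv ψ (λ i → proj₁ (f i)) (sat-≗ ψ (λ i → cong lhs (proj₂ (f i))) p))
          ... | inj₂ (z , (i₀ , e₀) , max) =
              ⇒ (sat-rename⇔ ρ ψ cod-ok) (good i₀ z e₀ (rename ρ ψ) t′ (⇐ (sat-rename⇔ ρ ψ dom-ok) p))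
            where
            locate : ∀ i w → t i ≡ w → Fin (suc k) × J z
            locate i (inj₁ n) e = suc i , inj₁ n
            locate i (inj₂ z′) e with max i z′ e
            ... | inj₁ z′≺z = suc i , inj₂ (z′ , z′≺z)
            -- The second component is a dummy, since variable zero takes its value from the pair
            -- `P z`.
            ... | inj₂ _    = zero , inj₁ 0

            ρ : Fin k → Fin (suc k)
            ρ i = proj₁ (locate i (t i) refl)

            t′ : Fin k → J z
            t′ i = proj₂ (locate i (t i) refl)

            dom-ok′ : ∀ i w (e : t i ≡ w) → t′ i ≡ proj₂ (locate i w e) →
                      (proj₁ (P z) V.∷ (dom z (rec z) ∘ t′)) (proj₁ (locate i w e)) ≡ lhs w
            dom-ok′ i (inj₁ n) e q = cong (dom z (rec z)) q
            dom-ok′ i (inj₂ z′) e q with max i z′ e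
            ... | inj₁ z′≺z = cong (dom z (rec z)) q
            ... | inj₂ refl = refl

            dom-ok : ∀ i → (proj₁ (P z) V.∷ (dom z (rec z) ∘ t′)) (ρ i) ≡ lhs (t i)
            dom-ok i = dom-ok′ i (t i) refl refl

            cod-ok′ : ∀ i w (e : t i ≡ w) → t′ i ≡ proj₂ (locate i w e) →
                      (proj₂ (P z) V.∷ (cod z (rec z) ∘ t′)) (proj₁ (locate i w e)) ≡ rhs w
            cod-ok′ i (inj₁ n) e q = cong (cod z (rec z)) q
            cod-ok′ i (inj₂ z′) e q with max i z′ e
            ... | inj₁ z′≺z = cong (cod z (rec z)) q
            ... | inj₂ refl = refl

            cod-ok : ∀ i → (proj₂ (P z) V.∷ (cod z (rec z) ∘ t′)) (ρ i) ≡ rhs (t i)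
            cod-ok i = cod-ok′ i (t i) refl refl

          embed : ∀ {x} → J x → ℕ ⊎ C
          embed (inj₁ n)       = inj₁ n
          embed (inj₂ (z , _)) = inj₂ z

          dom-embed : ∀ {x} j → dom x (rec x) j ≡ lhs (embed j)
          dom-embed (inj₁ n) = refl
          dom-embed (inj₂ z) = refl

          cod-embed : ∀ {x} j → cod x (rec x) j ≡ rhs (embed j)
          cod-embed (inj₁ n) = refl
          cod-embed (inj₂ z) = refl

          embed-≺ : ∀ {x} j z → embed {x} j ≡ inj₂ z → z ≺ x
          embed-≺ (inj₂ (z , z≺x)) z refl = z≺x

          stage : ∀ x → (∀ {z} → z ≺ x → Good z) → Elem (dom x (rec x)) (cod x (rec x))
          stage x good ψ t p = sat-≗ ψ (λ i → sym (cod-embed (t i)))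
            (assemble ψ (embed ∘ t) (λ i z e → good (embed-≺ (t i) z e)) (sat-≗ ψ (λ i → dom-embed (t i)) p))

          small : ∀ x (g : J x → C) (h : ℕ ⊎ C → C) → (∀ j → g j ≡ h (embed j)) → Smaller M (λ y → ∃ λ j → g j ≡ y)
          small x g h gh (f , f-inj , f∈) = few h x (f , f-inj , λ y → cover y (f∈ y))
            where
            cover : ∀ y → (∃ λ j → g j ≡ f y) → (∃ λ n → h (inj₁ n) ≡ f y) ⊎ (∃ λ z → z ≺ x × h (inj₂ z) ≡ f y)
            cover y (inj₁ n , e)         = inj₁ (n , trans (sym (gh (inj₁ n))) e)
            cover y (inj₂ (z , z≺x) , e) = inj₂ (z , z≺x , trans (sym (gh (inj₂ (z , z≺x)))) e)

          good-choice : ∀ x → Elem (dom x (rec x)) (cod x (rec x)) → ∀ s →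
                        let (l , r) = choose (rec x) s in Matches (dom x (rec x)) (cod x (rec x)) l r
          good-choice x e (y , false) = lem em
            where
            lem : ∀ d → let (l , r) = forth (rec x) y d in Matches (dom x (rec x)) (cod x (rec x)) l r
            lem (yes (w , m)) = m
            lem (no none) = ⊥-elim (none (extend (dom x (rec x)) (cod x (rec x)) e (small x (cod x (rec x)) rhs cod-embed) y))
          good-choice x e (y , true) = lem em
            where
            lem : ∀ d → let (l , r) = back (rec x) y d in Matches (dom x (rec x)) (cod x (rec x)) l r
            lem (yes (w , m)) = Matches-sym {u = cod x (rec x)} {dom x (rec x)} m
            lem (no none) = ⊥-elim (none (extend (cod x (rec x)) (dom x (rec x)) (Elem-sym {u = dom x (rec x)} {cod x (rec x)} e) (small x (dom x (rec x)) lhs dom-embed) y))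

          good : ∀ x → Good x
          good x = go (wf x)
            where
            go : ∀ {x} → Acc _≺_ x → Good x
            go {x} (acc rs) = subst (λ (l , r) → Matches (dom x (rec x)) (cod x (rec x)) l r) (sym (P-unfold x))
              (good-choice x (stage x λ z≺x → go (rs z≺x)) (sched x))

        elementary : Elem lhs rhs
        elementary ψ t = assemble ψ t λ i z _ → good z

        private
          forth-left : ∀ {x} (rc : Rec x) y d → proj₁ (forth rc y d) ≡ y
          forth-left rc y (yes _) = refl
          forth-left rc y (no _)  = refl

          back-right : ∀ {x} (rc : Rec x) y d → proj₂ (back rc y d) ≡ y
          back-right rc y (yes _) = refl
          back-right rc y (no _)  = refl

        lhs-onto : ∀ y → ∃ λ j → lhs j ≡ y
        lhs-onto y = let (x , e) = proj₂ schedule (y , false) in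
          inj₂ x , trans (cong proj₁ (trans (P-unfold x) (cong (choose (rec x)) e))) (forth-left (rec x) y em)

        rhs-onto : ∀ y → ∃ λ j → rhs j ≡ y
        rhs-onto y = let (x , e) = proj₂ schedule (y , true) in
          inj₂ x , trans (cong proj₂ (trans (P-unfold x) (cong (choose (rec x)) e))) (back-right (rec x) y em)

        private
          same : Formula L 2
          same = equal (var zero) (var (suc zero))

        lhs⇒rhs : ∀ j j′ → lhs j ≡ lhs j′ → rhs j ≡ rhs j′
        lhs⇒rhs j j′ = elementary same (j V.∷ j′ V.∷ V.[])

        rhs⇒lhs : ∀ j j′ → rhs j ≡ rhs j′ → lhs j ≡ lhs j′
        rhs⇒lhs j j′ = Elem-sym {u = lhs} {rhs} elementary same (j V.∷ j′ V.∷ V.[])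

        private
          to from : C → C
          to y   = rhs (proj₁ (lhs-onto y))
          from y = lhs (proj₁ (rhs-onto y))

          to-lhs : ∀ j → to (lhs j) ≡ rhs j
          to-lhs j = lhs⇒rhs (proj₁ (lhs-onto (lhs j))) j (proj₂ (lhs-onto (lhs j)))

          from-rhs : ∀ j → from (rhs j) ≡ lhs j
          from-rhs j = rhs⇒lhs (proj₁ (rhs-onto (rhs j))) j (proj₂ (rhs-onto (rhs j)))

          at : ∀ {k} (xs : Vector C k) → Fin k → ℕ ⊎ C
          at xs i = proj₁ (lhs-onto (xs i))

          lhs-at : ∀ {k} (xs : Vector C k) → lhs ∘ at xs ≡ xs
          lhs-at xs = ext λ i → proj₂ (lhs-onto (xs i))

        -- The map takes `lhs j` to `rhs j`. It does not depend on the name `j`, because coincidence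
        -- of two named elements is itself expressed by a formula.
        automorphism : Aut M
        automorphism = record
          { bij = mk↔ₛ′ to from
              (λ y → trans (to-lhs (proj₁ (rhs-onto y))) (proj₂ (rhs-onto y)))
              (λ y → trans (from-rhs (proj₁ (lhs-onto y))) (proj₂ (lhs-onto y)))
          ; preservesFun = λ f xs → elementary (equal (var zero) (app f (λ i → var (suc i))))
              (proj₁ (lhs-onto (func M f xs)) V.∷ at xs)
              (trans (proj₂ (lhs-onto (func M f xs))) (cong (func M f) (sym (lhs-at xs))))
          ; preservesRel = λ r xs → mk⇔
              (λ p → elementary (rel r var) (at xs) (subst (relation M r) (sym (lhs-at xs)) p))
              (λ p → subst (relation M r) (lhs-at xs) (Elem-sym {u = lhs} {rhs} elementary (rel r var) (at xs) p))
          }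

        automorphism-extends : ∀ n → to (u n) ≡ v n
        automorphism-extends n = to-lhs (inj₁ n)

  open Automorphisms

  -- Morley sequences, and a shift orbit on which every pattern is definable.

  module Indiscernibles where

    private variable
      ℓ : Level
      n m k : ℕ

    ++-all : ∀ {a b} {A : Set a} (P : A → Set b) (f : Vector A m) (g : Vector A n) →
             (∀ i → P (f i)) → (∀ j → P (g j)) → ∀ k → P ((f V.++ g) k)
    ++-all {m = m} P f g p q k with Fin.splitAt m k
    ... | inj₁ i = p i
    ... | inj₂ j = q j

    ++-injective⁺ : ∀ {a} {A : Set a} {f : Vector A m} {g : Vector A n} → Injective _≡_ _≡_ f → Injective _≡_ _≡_ g →
                    (∀ i j → f i ≢ g j) → Injective _≡_ _≡_ (f V.++ g)
    ++-injective⁺ {m = m} {n = n} {f = f} {g} f-inj g-inj f≢g {i} {j} e =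
      trans (sym (Fin.join-splitAt m n i)) (trans (cong (Fin.join m n) (go (Fin.splitAt m i) (Fin.splitAt m j) e)) (Fin.join-splitAt m n j))
      where
      go : ∀ s t → [ f , g ]′ s ≡ [ f , g ]′ t → s ≡ t
      go (inj₁ i) (inj₁ j) e = cong inj₁ (f-inj e)
      go (inj₁ i) (inj₂ j) e = ⊥-elim (f≢g i j e)
      go (inj₂ i) (inj₁ j) e = ⊥-elim (f≢g j i (sym e))
      go (inj₂ i) (inj₂ j) e = cong inj₂ (g-inj e)

    ++-injective⁻ : ∀ {a} {A : Set a} (f : Vector A m) (g : Vector A n) → Injective _≡_ _≡_ (f V.++ g) →
                    Injective _≡_ _≡_ f × Injective _≡_ _≡_ g × (∀ i j → f i ≢ g j)
    ++-injective⁻ {m = m} {n = n} f g inj =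
        (λ {i} {j} e → Fin.↑ˡ-injective n i j (inj (trans (V.lookup-++ˡ f g i) (trans e (sym (V.lookup-++ˡ f g j))))))
      , (λ {i} {j} e → Fin.↑ʳ-injective m i j (inj (trans (V.lookup-++ʳ f g i) (trans e (sym (V.lookup-++ʳ f g j))))))
      , λ i j e → case trans (sym (Fin.splitAt-↑ˡ m i n)) (trans (cong (Fin.splitAt m)
                    (inj (trans (V.lookup-++ˡ f g i) (trans e (sym (V.lookup-++ʳ f g j)))))) (Fin.splitAt-↑ʳ m n j)) of λ ()

    ∷-injective : ∀ {a} {A : Set a} {x : A} {f : Vector A m} → Injective _≡_ _≡_ f → (∀ i → x ≢ f i) → Injective _≡_ _≡_ (x V.∷ f)
    ∷-injective f-inj x≢ {zero}  {zero}  e = refl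
    ∷-injective f-inj x≢ {zero}  {suc j} e = ⊥-elim (x≢ j e)
    ∷-injective f-inj x≢ {suc i} {zero}  e = ⊥-elim (x≢ i (sym e))
    ∷-injective f-inj x≢ {suc i} {suc j} e = cong suc (f-inj e)

    -- The latest element comes first, so one more step of a construction is one `V.∷`.
    down : ∀ {a} {A : Set a} → (ℕ → A) → ∀ n → Vector A n
    down f zero    = V.[]
    down f (suc n) = f n V.∷ down f n

    down-all : ∀ {a b} {A : Set a} (P : A → Set b) (f : ℕ → A) n → (∀ m → m < n → P (f m)) → ∀ i → P (down f n i)
    down-all P f (suc n) p zero    = p n ℕ.≤-refl
    down-all P f (suc n) p (suc i) = down-all P f n (λ m m<n → p m (ℕ.m≤n⇒m≤1+n m<n)) i

    down-index : ∀ {m n} → m ℕ.<′ n → Fin n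
    down-index ℕ.≤′-refl       = zero
    down-index (ℕ.<′-step m<n) = suc (down-index m<n)

    down-lookup : ∀ {a} {A : Set a} (f : ℕ → A) {m n} (m<n : m ℕ.<′ n) → down f n (down-index m<n) ≡ f m
    down-lookup f ℕ.≤′-refl       = refl
    down-lookup f (ℕ.<′-step m<n) = down-lookup f m<n

    bounded : ∀ {k} (t : Fin k → ℕ) → ∃ λ N → ∀ i → t i < N
    bounded {zero}  t = 0 , λ ()
    bounded {suc k} t = let (N , p) = bounded (V.tail t) in suc (t zero) ℕ.⊔ N , λ where
      zero    → ℕ.m≤m⊔n (suc (t zero)) N
      (suc i) → ℕ.≤-trans (p i) (ℕ.m≤n⊔m (suc (t zero)) N)

    power-suc : ∀ {ℓ} {X : Set ℓ} (σ : X ↔ X) i x → Inverse.to σ ((σ ^ᶻ i) x) ≡ (σ ^ᶻ ℤ.suc i) x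
    power-suc σ (ℤ.+ n)        x = refl
    power-suc σ -[1+ zero ]    x = Inverse.strictlyInverseˡ σ _
    power-suc σ -[1+ suc n ]   x = Inverse.strictlyInverseˡ σ _

    power-+ : ∀ {ℓ} {X : Set ℓ} (σ : X ↔ X) n i x → (σ ^ᶻ (ℤ.+ n)) ((σ ^ᶻ i) x) ≡ (σ ^ᶻ (ℤ.+ n ℤ.+ i)) x
    power-+ σ zero    i x = cong (λ j → (σ ^ᶻ j) x) (sym (ℤ.+-identityˡ i))
    power-+ σ (suc n) i x = trans (cong (Inverse.to σ) (power-+ σ n i x))
      (trans (power-suc σ (ℤ.+ n ℤ.+ i) x) (cong (λ j → (σ ^ᶻ j) x) (sym (ℤ.+-assoc ℤ.1ℤ (ℤ.+ n) i))))

    power-injective : ∀ {ℓ} {X : Set ℓ} (σ : X ↔ X) n {x y} → (σ ^ᶻ (ℤ.+ n)) x ≡ (σ ^ᶻ (ℤ.+ n)) y → x ≡ y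
    power-injective σ zero    e = e
    power-injective σ (suc n) e = power-injective σ n (trans (sym (Inverse.strictlyInverseʳ σ _)) (trans (cong (Inverse.from σ) e) (Inverse.strictlyInverseʳ σ _)))

    zig : ℤ → ℤ
    zig (ℤ.+ n)   = -[1+ n ]
    zig (-[1+ n ]) = ℤ.+ suc n

    -- The order is 0, -1, 1, -2, 2, .... The `n`-th value is at least -n, so adding any `N > n`
    -- makes it nonnegative; this moves finite parts of a two-sided orbit into its forward half.
    int : ℕ → ℤ
    int zero    = 0ℤ
    int (suc n) = zig (int n)

    int-onto : ∀ i → ∃ λ n → int n ≡ i
    int-onto (ℤ.+ n)    = nonneg n
      where
      nonneg : ∀ n → ∃ λ k → int k ≡ ℤ.+ n
      nonneg zero    = 0 , refl
      nonneg (suc n) = let (k , e) = nonneg n in suc (suc k) , cong (zig ∘ zig) e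
    int-onto (-[1+ n ]) = let (k , e) = int-onto (ℤ.+ n) in suc k , cong zig e

    int-shift : ∀ n N → n < N → ∃ λ m → ℤ.+ N ℤ.+ int n ≡ ℤ.+ m
    int-shift n N n<N with int n | small n
      where
      size : ℤ → ℕ
      size (ℤ.+ m)   = m
      size (-[1+ m ]) = m

      zig-size : ∀ i → size (zig i) ≤ suc (size i)
      zig-size (ℤ.+ n)   = ℕ.n≤1+n n
      zig-size (-[1+ n ]) = ℕ.≤-refl

      small : ∀ n → size (int n) ≤ n
      small zero    = z≤n
      small (suc n) = ℕ.≤-trans (zig-size (int n)) (s≤s (small n))
    ... | ℤ.+ m   | _ = N + m , refl
    ... | -[1+ m ] | p = N ∸ suc m , ℤ.⊖-≥ (ℕ.≤-trans (s≤s p) n<N)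

    module Sequences {L : Language ℓ} (M : Structure L) (saturated : Saturated M) (uncountable : ¬ (ℕ ↔ Carrier M))
                     {q : ℕ} (θ : Formula L (suc q)) (ip : ∀ n → ∃ λ (a : Fin n → Carrier M) → Shatters M θ a) where
      open Semantics M
      open Rotation M

      private
        C = Carrier M

      shatters-injective : {a : Fin n → C} → Shatters M θ a → Injective _≡_ _≡_ a
      shatters-injective {a = a} sh {i} {j} e =
        let (c , f) = sh (λ k → ⌞ k ≡ i ⌟) in
        sym (holds (subst T (trans (sym (f i)) (trans (cong (λ x → tv θ (x V.∷ c)) e) (f j))) (true! refl)))

      infinite : ∃ λ (i : ℕ → C) → Injective _≡_ _≡_ i
      infinite with infinite-or-listed {A = C} (λ _ → ⊤ {ℓ})
      ... | inj₁ (i , inj , _) = i , inj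
      ... | inj₂ (l , listed) =
        let (a , sh) = ip (suc (length l))
            index : Fin (suc (length l)) → Fin (length l)
            index i = Any.index (listed (a i) _)
        in ⊥-elim (ℕ.n≮n (length l) (Fin.injective⇒≤ {f = index} λ {i} {j} e → shatters-injective sh
             (trans (Any.lookup-index (listed (a i) _)) (trans (cong (List.lookup l) e) (sym (Any.lookup-index (listed (a j) _)))))))

      open Homogeneity M saturated (proj₁ infinite) (proj₂ infinite) uncountable
      open Saturation M saturated

      -- Patterns given on values instead of indices are stable under reindexing.
      Free : (Fin n → C) → Set ℓ
      Free a = ∀ (S : C → Bool) → ∃ λ (c : Vector C q) → ∀ i → tv θ (a i V.∷ c) ≡ S (a i)

      free-sub : {a : Fin n → C} {d : Fin m → C} → Free a → (∀ i → ∃ λ j → a j ≡ d i) → Free d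
      free-sub fr sub S = let (c , f) = fr S in c , λ i → let (j , e) = sub i in
        subst (λ x → tv θ (x V.∷ c) ≡ S x) e (f j)

      shatters⇒free : {a : Fin n → C} → Shatters M θ a → Free a
      shatters⇒free {a = a} sh S = sh (S ∘ a)

      free⇒shatters : {a : Fin n → C} → Free a → Injective _≡_ _≡_ a → Shatters M θ a
      free⇒shatters {a = a} fr inj S = let (c , f) = fr (λ x → ⌞ (∃ λ i → a i ≡ x × T (S i)) ⌟) in
        c , λ i → trans (f i) (T-ext (λ t → let (j , e , s) = holds t in subst (T ∘ S) (inj e) s) (λ t → true! (i , refl , t)))

      shatters-sub : {a : Fin n → C} {d : Fin m → C} → Shatters M θ a → Injective _≡_ _≡_ d → (∀ i → ∃ λ j → a j ≡ d i) → Shatters M θ d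
      shatters-sub sh inj sub = free⇒shatters (free-sub (shatters⇒free sh) sub) inj

      vector-smaller : (e : Vector C n) → Smaller M (λ x → ∃ λ i → e i ≡ x)
      vector-smaller {n} e = countable-smaller g (λ x → ∃ λ i → e i ≡ x) λ x (i , p) → toℕ i , trans (g-toℕ i) p
        where
        g : ℕ → C
        g k with k ℕ.<? n
        ... | yes k<n = e (Fin.fromℕ< k<n)
        ... | no _    = nonempty M

        g-toℕ : ∀ i → g (toℕ i) ≡ e i
        g-toℕ i with toℕ i ℕ.<? n
        ... | yes p = cong e (Fin.fromℕ<-toℕ i p)
        ... | no ¬p = ⊥-elim (¬p (Fin.toℕ<n i))

      private
        Extensible : Vector C n → Set ℓ
        Extensible e = ∀ k → ∃ λ (v : Vector C k) → Shatters M θ (v V.++ e)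

        -- The type to be realised says, for each `k`, that `k` further elements complete the tuple
        -- to a shattered one.
        next : (e : Vector C n) → Extensible e → ∃ λ x → Extensible (x V.∷ e)
        next {n} e ext-e =
          let (x , f) = realise-chain (λ x → ∃ λ i → e i ≡ x) (vector-smaller e) (λ _ → n) (λ k → exs k (shatter θ (k + suc n)))
                          (λ _ → e) (λ _ j → j , refl) finite
          in x , λ k → let (v , s) = ⇒ (sat-exs k (shatter θ (k + suc n))) (f k) in v , ⇒ (sat-shatter M θ (k + suc n)) s
          where
          finite : ∀ N → ∃ λ x → ∀ k → k ≤ N → M ⊨ exs k (shatter θ (k + suc n)) [ x V.∷ e ]
          finite N =
            -- One of the `suc N` new elements plays the part of `x`; the others leave room for
            -- every `k ≤ N`.
            let (w , sh) = ext-e (suc N)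
                (w-inj , e-inj , w≢e) = ++-injective⁻ w e (shatters-injective sh)
                member-w : ∀ i → ∃ λ j → (w V.++ e) j ≡ w i
                member-w i = i Fin.↑ˡ n , V.lookup-++ˡ w e i
                member-e : ∀ i → ∃ λ j → (w V.++ e) j ≡ e i
                member-e i = suc N Fin.↑ʳ i , V.lookup-++ʳ w e i
            in w zero , λ k k≤N →
              let v : Vector C k
                  v i = w (suc (Fin.inject≤ i k≤N))
                  inj : Injective _≡_ _≡_ (v V.++ (w zero V.∷ e))
                  inj = ++-injective⁺ {f = v} (λ p → Fin.inject≤-injective k≤N k≤N _ _ (Fin.suc-injective (w-inj p)))
                          (∷-injective e-inj (w≢e zero))
                          λ { i zero p → case w-inj p of λ () ; i (suc j) p → w≢e _ j p }
              in ⇐ (sat-exs k (shatter θ (k + suc n))) (v , ⇐ (sat-shatter M θ (k + suc n)) (shatters-sub sh inj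
                   (++-all (λ x → ∃ λ j → (w V.++ e) j ≡ x) v (w zero V.∷ e) (λ i → member-w _) λ { zero → member-w zero ; (suc j) → member-e j })))

        stage : ∀ n → Σ (Vector C n) Extensible
        stage zero    = V.[] , λ k → let (a , sh) = ip (k + 0); (v , p) = split k a in v , subst (Shatters M θ) p sh
          where
          split : ∀ k (a : Vector C (k + 0)) → ∃ λ (v : Vector C k) → a ≡ (v V.++ V.[])
          split k a = (λ i → a (i Fin.↑ˡ 0)) , ext λ i → trans (cong a (sym (Fin.join-splitAt k 0 i))) (go (Fin.splitAt k i))
            where
            go : (s : Fin k ⊎ Fin 0) → a (Fin.join k 0 s) ≡ [ (λ i → a (i Fin.↑ˡ 0)) , V.[] ]′ s
            go (inj₁ i) = refl
        stage (suc n) = let (e , x) = stage n; (y , z) = next e x in y V.∷ e , z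

      shattered-sequence : ∃ λ (b : ℕ → C) → ∀ n → Shatters M θ (down b n)
      shattered-sequence = b , λ n → subst (Shatters M θ) (stage-down n) (proj₂ (proj₂ (stage n) 0))
        where
        b : ℕ → C
        b n = proj₁ (next (proj₁ (stage n)) (proj₂ (stage n)))

        stage-down : ∀ n → proj₁ (stage n) ≡ down b n
        stage-down zero    = refl
        stage-down (suc n) = cong (b n V.∷_) (stage-down n)

      sub-down : ∀ (f : ℕ → C) → (u : Fin k → ℕ) → ∃ λ N → ∀ i → ∃ λ j → down f N j ≡ f (u i)
      sub-down f u = let (N , p) = bounded u in N , λ i → down-index (ℕ.<⇒<′ (p i)) , down-lookup f (ℕ.<⇒<′ (p i))

      seq-free : (f : ℕ → C) → (∀ n → Shatters M θ (down f n)) → (u : Fin k → ℕ) → Free (f ∘ u)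
      seq-free f sh u = let (N , p) = sub-down f u in free-sub (shatters⇒free (sh N)) p

      seq-injective : (f : ℕ → C) → (∀ n → Shatters M θ (down f n)) → Injective _≡_ _≡_ f
      seq-injective f sh {m} {n} e with ℕ.<-cmp m n
      ... | tri≈ _ m≡n _ = m≡n
      ... | tri< m<n _ _ = case shatters-injective (sh (suc n)) {zero} {suc (down-index (ℕ.<⇒<′ m<n))}
                             (sym (trans (down-lookup f (ℕ.<⇒<′ m<n)) e)) of λ ()
      ... | tri> _ _ n<m = case shatters-injective (sh (suc m)) {zero} {suc (down-index (ℕ.<⇒<′ n<m))}
                             (trans e (sym (down-lookup f (ℕ.<⇒<′ n<m)))) of λ ()

      private
        first : (ℕ → C) → ∀ N → Vector C N
        first s N i = s (toℕ i)

        -- Saturation speaks of one variable, so the coordinates are found one after another; each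
        -- one found joins the parameter sequence at its front.
        realise-tuple : ∀ q (s : ℕ → C) (Γ : ∀ N → Formula L (q + N)) →
          (∀ c {N N′} → N ≤ N′ → M ⊨ Γ N′ [ c V.++ first s N′ ] → M ⊨ Γ N [ c V.++ first s N ]) →
          (∀ N → ∃ λ c → M ⊨ Γ N [ c V.++ first s N ]) → ∃ λ c → ∀ N → M ⊨ Γ N [ c V.++ first s N ]
        realise-tuple zero s Γ mono fin = V.[] , λ N → let (c , p) = fin N in subst (λ (c : Vector C 0) → M ⊨ Γ N [ c V.++ first s N ]) (ext {f = c} {g = V.[]} λ ()) p
        realise-tuple (suc q) s Γ mono fin =
          let (x , f) = realise-chain (λ x → ∃ λ n → s n ≡ x) (countable-smaller s (λ x → ∃ λ n → s n ≡ x) (λ _ p → p)) id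
                          (λ N → exs q (rotate q (Γ N))) (first s) (λ N j → toℕ j , refl) finite
              (c , g) = realise-tuple q (s′ x) Γ′ (mono′ x) λ where
                          zero    → (λ _ → nonempty M) , λ r → r
                          (suc N) → let (c , p) = ⇒ (sat-exs q (rotate q (Γ N))) (f N) in
                                    c , subst (λ v → M ⊨ rotate q (Γ N) [ c V.++ v ]) (sym (first-s′ x N)) p
          in x V.∷ c , λ N → unrotate x c N (g (suc N))
          where
          s′ : C → ℕ → C
          s′ x zero    = x
          s′ x (suc n) = s n

          first-s′ : ∀ x N → first (s′ x) (suc N) ≡ (x V.∷ first s N)
          first-s′ x N = ext λ { zero → refl ; (suc i) → refl }

          Γ′ : ∀ N → Formula L (q + N)
          -- With no parameter in view, not even the coordinate just found can be mentioned, so this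
          -- level is void.
          Γ′ zero    = neg falsum
          Γ′ (suc N) = rotate q (Γ N)

          unrotate : ∀ x c N → M ⊨ Γ′ (suc N) [ c V.++ first (s′ x) (suc N) ] → M ⊨ Γ N [ (x V.∷ c) V.++ first s N ]
          unrotate x c N p = ⇒ (sat-rotate (Γ N) x c (first s N)) (subst (λ v → M ⊨ rotate q (Γ N) [ c V.++ v ]) (first-s′ x N) p)

          rotate′ : ∀ x c N → M ⊨ Γ N [ (x V.∷ c) V.++ first s N ] → M ⊨ Γ′ (suc N) [ c V.++ first (s′ x) (suc N) ]
          rotate′ x c N p = subst (λ v → M ⊨ rotate q (Γ N) [ c V.++ v ]) (sym (first-s′ x N)) (⇐ (sat-rotate (Γ N) x c (first s N)) p)

          mono′ : ∀ x c {N N′} → N ≤ N′ → M ⊨ Γ′ N′ [ c V.++ first (s′ x) N′ ] → M ⊨ Γ′ N [ c V.++ first (s′ x) N ]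
          mono′ x c z≤n     p = λ r → r
          mono′ x c (s≤s {N} {N′} le) p = rotate′ x c N (mono (x V.∷ c) le (unrotate x c N′ p))

          finite : ∀ N → ∃ λ x → ∀ i → i ≤ N → M ⊨ exs q (rotate q (Γ i)) [ x V.∷ first s i ]
          finite N = let (c , p) = fin N in c zero , λ i i≤N → ⇐ (sat-exs q (rotate q (Γ i))) (V.tail c ,
            ⇐ (sat-rotate (Γ i) (c zero) (V.tail c) (first s i))
              (mono (c zero V.∷ V.tail c) i≤N (subst (λ c → M ⊨ Γ N [ c V.++ first s N ]) (sym (η c)) p)))
            where
            η : ∀ {k} (c : Vector C (suc k)) → (c zero V.∷ V.tail c) ≡ c
            η c = ext λ { zero → refl ; (suc j) → refl }

      module Morley (U : Ultrafilter) (b : ℕ → C) (down-shatters : ∀ n → Shatters M θ (down b n)) where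
        open Ultrafilter U

        private
          Base : List C → Pred C ℓ
          Base l x = (∃ λ j → b j ≡ x) ⊎ x ∈ᴸ l

          -- Over `b` and `l`, the element has the average type of `b` along the ultrafilter, which
          -- is finitely satisfiable in the range of `b`.
          Realises : List C → C → Set ℓ
          Realises l x = ∀ {k} (ψ : Formula L (suc k)) (c : Vector C k) → (∀ i → c i ∈ Base l) →
                         Many (λ j → M ⊨ ψ [ b j V.∷ c ]) → M ⊨ ψ [ x V.∷ c ]

          base-smaller : ∀ l → Smaller M (Base l)
          base-smaller l = countable-smaller (g l) (Base l) (covers l)
            where
            g : List C → ℕ → C
            g []      n       = b n
            g (x ∷ l) zero    = x
            g (x ∷ l) (suc n) = g l n

            covers : ∀ l x → x ∈ Base l → ∃ λ n → g l n ≡ x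
            covers []      x (inj₁ p) = p
            covers (y ∷ l) x (inj₁ p) = let (n , e) = covers l x (inj₁ p) in suc n , e
            covers (y ∷ l) x (inj₂ (here refl)) = 0 , refl
            covers (y ∷ l) x (inj₂ (there p)) = let (n , e) = covers l x (inj₂ p) in suc n , e

          average : ∀ l → ∃ (Realises l)
          average l =
            let (x , f) = saturated (Base l) (base-smaller l) p finite in
            x , λ ψ c c∈ many → f (_ , ψ , c , c∈) (lift many)
            where
            p : Pred (ParamFormula M (Base l)) ℓ
            p (k , ψ , c , _) = Lift ℓ (Many (λ j → M ⊨ ψ [ b j V.∷ c ]))

            finite : ∀ Φ → All p Φ → ∃ λ x → All (λ φ → x ∈ Solutions M (Base l) φ) Φ
            finite Φ ps = let (j , _ , q) = many-find (many-list Φ (All.map lower ps)) 0 in b j , q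

          prefix : ℕ → List C
          prefix zero    = []
          prefix (suc n) = proj₁ (average (prefix n)) ∷ prefix n

        -- A Morley sequence of the average type of (bᵢ) along the ultrafilter.
        a : ℕ → C
        a n = proj₁ (average (prefix n))

        private
          a-realises : ∀ n → Realises (prefix n) (a n)
          a-realises n = proj₂ (average (prefix n))

          a∈prefix : ∀ {m n} → m ℕ.<′ n → a m ∈ᴸ prefix n
          a∈prefix ℕ.≤′-refl       = here refl
          a∈prefix (ℕ.<′-step m<n) = there (a∈prefix m<n)

          Same : Vector C n → Vector C n → Set ℓ
          Same {n} e e′ = ∀ {k} (ψ : Formula L (n + k)) (t : Fin k → ℕ) → M ⊨ ψ [ e V.++ (b ∘ t) ] → M ⊨ ψ [ e′ V.++ (b ∘ t) ]

          realises-⇐ : ∀ {l x} → Realises l x → ∀ {k} (ψ : Formula L (suc k)) (c : Vector C k) → (∀ i → c i ∈ Base l) →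
                       M ⊨ ψ [ x V.∷ c ] → Many (λ j → M ⊨ ψ [ b j V.∷ c ])
          realises-⇐ r ψ c c∈ p = dne λ ¬many → ⇒ (sat-neg ψ) (r (neg ψ) c c∈ (many-map (λ j → ⇐ (sat-neg ψ)) (many-¬ ¬many))) p

          -- For a realisation of the average type, truth of a formula means truth at `b j` for many
          -- `j`. As `Same` admits `b j` among its parameters, the implication from `e` to `e′`
          -- applies for each such `j`.
          same-∷ : ∀ {l l′ x x′} {e e′ : Vector C n} → Realises l x → Realises l′ x′ → (∀ i → e i ∈ Base l) → (∀ i → e′ i ∈ Base l′) →
                   Same e e′ → Same (x V.∷ e) (x′ V.∷ e′)
          same-∷ {n} {l} {l′} {x} {x′} {e} {e′} r r′ e∈ e′∈ same {k} ψ t p =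
            subst (M ⊨ ψ [_]) (sym (++-∷ x′ e′ (b ∘ t)))
              (r′ ψ (e′ V.++ (b ∘ t)) (++-all (_∈ Base l′) e′ (b ∘ t) e′∈ (λ j → inj₁ (t j , refl)))
                (many-map transfer
                  (realises-⇐ r ψ (e V.++ (b ∘ t)) (++-all (_∈ Base l) e (b ∘ t) e∈ (λ j → inj₁ (t j , refl)))
                    (subst (M ⊨ ψ [_]) (++-∷ x e (b ∘ t)) p))))
            where
            shift-b : ∀ j → (b ∘ (j V.∷ t)) ≡ (b j V.∷ (b ∘ t))
            shift-b j = ext λ { zero → refl ; (suc i) → refl }

            transfer : ∀ j → M ⊨ ψ [ b j V.∷ (e V.++ (b ∘ t)) ] → M ⊨ ψ [ b j V.∷ (e′ V.++ (b ∘ t)) ]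
            transfer j s = subst (M ⊨ ψ [_]) (++-∷ (b j) e′ (b ∘ t)) (⇒ (sat-rotate ψ (b j) e′ (b ∘ t))
              (subst (λ v → M ⊨ rotate n ψ [ e′ V.++ v ]) (shift-b j) (same (rotate n ψ) (j V.∷ t)
                (subst (λ v → M ⊨ rotate n ψ [ e V.++ v ]) (sym (shift-b j))
                  (⇐ (sat-rotate ψ (b j) e (b ∘ t)) (subst (M ⊨ ψ [_]) (sym (++-∷ (b j) e (b ∘ t))) s))))))

          same-shift : ∀ n → Same (down a n) (down (a ∘ suc) n)
          same-shift zero    ψ t p = p
          same-shift (suc n) = same-∷ {l = prefix n} {l′ = prefix (suc n)} (a-realises n) (a-realises (suc n))
            (down-all (_∈ Base (prefix n)) a n (λ m m<n → inj₂ (a∈prefix (ℕ.<⇒<′ m<n))))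
            (down-all (_∈ Base (prefix (suc n))) (a ∘ suc) n (λ m m<n → inj₂ (a∈prefix (ℕ.<⇒<′ (s≤s m<n)))))
            (same-shift n)

        a-elementary : ∀ {k} (ψ : Formula L k) (t : Fin k → ℕ) → M ⊨ ψ [ a ∘ t ] → M ⊨ ψ [ a ∘ suc ∘ t ]
        a-elementary {k} ψ t p =
          let (N , t<N) = bounded t
              ρ : Fin k → Fin (N + 0)
              ρ i = down-index (ℕ.<⇒<′ (t<N i)) Fin.↑ˡ 0
              env : ∀ (f : ℕ → C) i → (down f N V.++ (b ∘ V.[])) (ρ i) ≡ f (t i)
              env f i = trans (V.lookup-++ˡ (down f N) (b ∘ V.[]) _) (down-lookup f (ℕ.<⇒<′ (t<N i)))
          in ⇒ (sat-rename⇔ ρ ψ (env (a ∘ suc))) (same-shift N (rename ρ ψ) V.[] (⇐ (sat-rename⇔ ρ ψ (env a)) p))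

        private
          -- The elements of `a` are replaced one at a time by `b j` for many `j`, until only tuples
          -- from `b` remain.
          generic : ∀ n {k} (χ : Formula L (n + k)) (s : Fin k → ℕ) →
            (∀ (u : Fin n → ℕ) → Injective _≡_ _≡_ u → (∀ i j → u i ≢ s j) → M ⊨ χ [ (b ∘ u) V.++ (b ∘ s) ]) →
            M ⊨ χ [ down a n V.++ (b ∘ s) ]
          generic zero    χ s all-b = all-b V.[] (λ {}) (λ ())
          generic (suc n) χ s all-b = subst (M ⊨ χ [_]) (sym (++-∷ (a n) (down a n) (b ∘ s)))
            (a-realises n χ (down a n V.++ (b ∘ s))
              (++-all (_∈ Base (prefix n)) (down a n) (b ∘ s) (down-all (_∈ Base (prefix n)) a n (λ m m<n → inj₂ (a∈prefix (ℕ.<⇒<′ m<n)))) (λ j → inj₁ (s j , refl)))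
              -- Beyond the indices in `s` every `j` is new, so the indices of the final tuple are
              -- distinct.
              (many-all (proj₁ (bounded s)) λ j N≤j → subst (M ⊨ χ [_]) (++-∷ (b j) (down a n) (b ∘ s))
                (⇒ (sat-rotate χ (b j) (down a n) (b ∘ s))
                  (subst (λ v → M ⊨ rotate n χ [ down a n V.++ v ]) (cons j s) (generic n (rotate n χ) (j V.∷ s) λ u u-inj u≢ →
                    subst (λ v → M ⊨ rotate n χ [ (b ∘ u) V.++ v ]) (sym (cons j s)) (⇐ (sat-rotate χ (b j) (b ∘ u) (b ∘ s))
                      (subst (λ v → M ⊨ χ [ v V.++ (b ∘ s) ]) (cons j u)
                        (all-b (j V.∷ u) (∷-injective u-inj (λ i e → u≢ i zero (sym e)))
                          λ { zero i e → ℕ.<⇒≱ (proj₂ (bounded s) i) (subst (_ ≤_) e N≤j) ; (suc i) j → u≢ i (suc j) }))))))))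
            where
            cons : ∀ {k} j (s : Fin k → ℕ) → (b ∘ (j V.∷ s)) ≡ (b j V.∷ (b ∘ s))
            cons j s = ext λ { zero → refl ; (suc i) → refl }

        a-shatters : ∀ n → Shatters M θ (down a n)
        a-shatters n = ⇒ (sat-shatter M θ n) (⇒ (sat-rename⇔ (Fin._↑ˡ 0) (shatter θ n) (V.lookup-++ˡ (down a n) (b ∘ V.[])) )
          (generic n (rename (Fin._↑ˡ 0) (shatter θ n)) V.[] λ u u-inj _ →
            ⇐ (sat-rename⇔ (Fin._↑ˡ 0) (shatter θ n) (V.lookup-++ˡ (b ∘ u) (b ∘ V.[])))
              (⇐ (sat-shatter M θ n) (free⇒shatters (seq-free b down-shatters u) (λ e → u-inj (seq-injective b down-shatters e))))))


      module Orbit (a : ℕ → C) (a-shatters : ∀ n → Shatters M θ (down a n)) (σ : Aut M)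
                   (σ-a : ∀ n → Inverse.to (bij σ) (a n) ≡ a (suc n)) where
        open Inverse (bij σ) using (to; from; strictlyInverseˡ; strictlyInverseʳ)

        orbit : ℤ → C
        orbit i = (bij σ ^ᶻ i) (a 0)

        orbit-ℕ : ∀ n → orbit (ℤ.+ n) ≡ a n
        orbit-ℕ zero    = refl
        orbit-ℕ (suc n) = trans (cong to (orbit-ℕ n)) (σ-a n)

        private
          iterate : ℕ → C → C
          iterate zero    x = x
          iterate (suc n) x = iterate n (to x)

          iterate-orbit : ∀ n i → iterate n (orbit i) ≡ orbit (ℤ.+ n ℤ.+ i)
          iterate-orbit zero    i = cong orbit (sym (ℤ.+-identityˡ i))
          iterate-orbit (suc n) i = trans (cong (iterate n) (power-suc (bij σ) i (a 0))) (trans (iterate-orbit n (ℤ.suc i))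
            (cong orbit (trans (sym (ℤ.+-assoc (ℤ.+ n) ℤ.1ℤ i)) (cong (λ k → ℤ.+ k ℤ.+ i) (ℕ.+-comm n 1)))))

        orbit-injective : Injective _≡_ _≡_ orbit
        orbit-injective {i} {j} e =
          let (m , p) = int-onto i; (n , r) = int-onto j
              N = suc (m + n)
              (k , k-eq) = int-shift m N (s≤s (ℕ.m≤m+n m n))
              (l , l-eq) = int-shift n N (s≤s (ℕ.m≤n+m n m))
              k-eq′ : ℤ.+ N ℤ.+ i ≡ ℤ.+ k
              k-eq′ = trans (cong (ℤ._+_ (ℤ.+ N)) (sym p)) k-eq
              l-eq′ : ℤ.+ N ℤ.+ j ≡ ℤ.+ l
              l-eq′ = trans (cong (ℤ._+_ (ℤ.+ N)) (sym r)) l-eq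
              k≡l : k ≡ l
              k≡l = seq-injective a a-shatters (begin
                a k                    ≡⟨ orbit-ℕ k ⟨
                orbit (ℤ.+ k)          ≡⟨ cong orbit k-eq′ ⟨
                orbit (ℤ.+ N ℤ.+ i)    ≡⟨ iterate-orbit N i ⟨
                iterate N (orbit i)    ≡⟨ cong (iterate N) e ⟩
                iterate N (orbit j)    ≡⟨ iterate-orbit N j ⟩
                orbit (ℤ.+ N ℤ.+ j)    ≡⟨ cong orbit l-eq′ ⟩
                orbit (ℤ.+ l)          ≡⟨ orbit-ℕ l ⟩
                a l                    ∎)
          in +-cancelˡ (ℤ.+ N) i j (trans k-eq′ (trans (cong ℤ.+_ k≡l) (sym l-eq′)))
          where open ≡-Reasoning

        private
          free-to : {e : Fin n → C} → Free (to ∘ e) → Free e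
          free-to {e = e} fr S = let (c , f) = fr (S ∘ from) in from ∘ c , λ i → begin
              tv θ (e i V.∷ (from ∘ c))            ≡⟨ ⌞⌟-cong (⇒ (Automorphism.sat-aut σ θ)) (⇐ (Automorphism.sat-aut σ θ)) ⟩
              tv θ (to ∘ (e i V.∷ (from ∘ c)))     ≡⟨ cong (tv θ) (ext λ { zero → refl ; (suc j) → strictlyInverseˡ (c j) }) ⟩
              tv θ (to (e i) V.∷ c)                ≡⟨ f i ⟩
              S (from (to (e i)))                  ≡⟨ cong S (strictlyInverseʳ (e i)) ⟩
              S (e i)                              ∎
            where open ≡-Reasoning

          free-iterate : ∀ N {e : Fin n → C} → Free (iterate N ∘ e) → Free e
          free-iterate zero    fr = fr
          free-iterate (suc N) fr = free-to (free-iterate N fr)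

          -- Freeness pulls back along `σ`, so a finite part of the orbit may be pushed forward
          -- until all its indices are nonnegative, where it consists of elements of `a`.
          orbit-free : ∀ N → Free (λ (i : Fin N) → orbit (int (toℕ i)))
          orbit-free N = free-iterate N (subst Free (ext λ i → let (m , e) = int-shift (toℕ i) N (Fin.toℕ<n i) in
              sym (trans (iterate-orbit N (int (toℕ i))) (trans (cong orbit e) (orbit-ℕ m))))
            (seq-free a a-shatters (λ i → proj₁ (int-shift (toℕ i) N (Fin.toℕ<n i)))))

        -- The pattern is rewritten as a set `values` of elements, which injectivity of the orbit
        -- permits. Freeness realises its finite parts, and saturation finds one parameter tuple for
        -- all of them.
        realise-pattern : ∀ (I : ℤ → Bool) → ∃ λ (c : Vector C q) → ∀ i → tv θ (orbit i V.∷ c) ≡ I i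
        realise-pattern I =
          let (c , f) = realise-tuple q s Γ (λ c {N} {N′} le p → ⇐ (sat-Γ N c) λ i →
                          subst₂ (λ x y → tv θ (s x V.∷ c) ≡ I (int y)) (Fin.toℕ-inject≤ i le) (Fin.toℕ-inject≤ i le) (⇒ (sat-Γ N′ c) p (Fin.inject≤ i le)))
                        (λ N → let (c , g) = orbit-free N values in c , ⇐ (sat-Γ N c) λ i → trans (g i) (values-orbit (int (toℕ i))))
          in c , λ i → let (n , e) = int-onto i in
               subst (λ i → tv θ (orbit i V.∷ c) ≡ I i) e
                 (subst₂ (λ x y → tv θ (s x V.∷ c) ≡ I (int y)) (Fin.toℕ-fromℕ n) (Fin.toℕ-fromℕ n) (⇒ (sat-Γ (suc n) c) (f (suc n)) (Fin.fromℕ n)))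
          where
          s : ℕ → C
          s n = orbit (int n)

          values : C → Bool
          values x = ⌞ (∃ λ i → orbit i ≡ x × T (I i)) ⌟

          values-orbit : ∀ i → values (orbit i) ≡ I i
          values-orbit i = T-ext (λ t → let (j , e , r) = holds t in subst (T ∘ I) (orbit-injective e) r) (λ t → true! (i , refl , t))

          Γ : ∀ N → Formula L (q + N)
          Γ N = ⋀ (List.allFin N) λ i → signed (I (int (toℕ i))) (rename ((q Fin.↑ʳ i) V.∷ (Fin._↑ˡ N)) θ)

          env : ∀ N c i → tv (rename ((q Fin.↑ʳ i) V.∷ (Fin._↑ˡ N)) θ) (c V.++ first s N) ≡ tv θ (s (toℕ i) V.∷ c)
          env N c i = tv-rename M _ θ λ { zero → V.lookup-++ʳ c (first s N) i ; (suc j) → V.lookup-++ˡ c (first s N) j }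

          sat-Γ : ∀ N c → (M ⊨ Γ N [ c V.++ first s N ]) ⇔ (∀ i → tv θ (s (toℕ i) V.∷ c) ≡ I (int (toℕ i)))
          sat-Γ N c = mk⇔
            (λ p i → trans (sym (env N c i)) (⇒ (sat-signed (I (int (toℕ i))) _) (⇒ (sat-⋀ (List.allFin N) _) p (List.∈-allFin i))))
            (λ f → ⇐ (sat-⋀ (List.allFin N) _) λ {i} _ → ⇐ (sat-signed (I (int (toℕ i))) _) (trans (env N c i) (f i)))

      ShiftOrbit : Set ℓ
      ShiftOrbit = ∃ λ (σ : Aut M) → ∃ λ (x : C) → Injective _≡_ _≡_ (λ i → (bij σ ^ᶻ i) x) ×
        (∀ (I : ℤ → Bool) → ∃ λ (c : Vector C q) → ∀ i → tv θ ((bij σ ^ᶻ i) x V.∷ c) ≡ I i)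

      shift-orbit : ShiftOrbit
      shift-orbit =
        let (b , b-sh) = shattered-sequence
            a     = Morley.a NonprincipalUltrafilter.ultrafilter b b-sh
            a-sh  = Morley.a-shatters NonprincipalUltrafilter.ultrafilter b b-sh
        in extend-shift a a-sh (Morley.a-elementary NonprincipalUltrafilter.ultrafilter b b-sh)
        where
        extend-shift : (a : ℕ → C) → (∀ n → Shatters M θ (down a n)) →
          (∀ {k} (ψ : Formula L k) (t : Fin k → ℕ) → M ⊨ ψ [ a ∘ t ] → M ⊨ ψ [ a ∘ suc ∘ t ]) → ShiftOrbit
        extend-shift a a-sh el = finish (BackAndForth.automorphism a (a ∘ suc) el) (BackAndForth.automorphism-extends a (a ∘ suc) el)
          where
          finish : (σ : Aut M) → (∀ n → Inverse.to (bij σ) (a n) ≡ a (suc n)) → ShiftOrbit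
          finish σ σ-a = σ , a 0 , Orbit.orbit-injective a a-sh σ σ-a , Orbit.realise-pattern a a-sh σ σ-a

  open Indiscernibles

  -- Balance and correlations of the Rudin-Shapiro sequence.

  module RudinShapiro where

    private variable
      g h : ℕ → Bool

    cnt : (ℕ → Bool) → ℕ → ℕ
    cnt g zero    = 0
    cnt g (suc n) = cnt g n + 𝟙 (g n)

    cnt-cong : (∀ i → g i ≡ h i) → ∀ N → cnt g N ≡ cnt h N
    cnt-cong e zero    = refl
    cnt-cong e (suc N) = cong₂ _+_ (cnt-cong e N) (cong 𝟙 (e N))

    cnt-front : ∀ g N → cnt g (suc N) ≡ 𝟙 (g 0) + cnt (g ∘ suc) N
    cnt-front g zero    = sym (ℕ.+-identityʳ _)
    cnt-front g (suc N) = trans (cong (_+ 𝟙 (g (suc N))) (cnt-front g N)) (ℕ.+-assoc (𝟙 (g 0)) _ _)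

    𝟙≤1 : ∀ x → 𝟙 x ≤ 1
    𝟙≤1 false = z≤n
    𝟙≤1 true  = ℕ.≤-refl

    cnt-split : ∀ g m N → cnt g (m + N) ≡ cnt g m + cnt (λ i → g (m + i)) N
    cnt-split g m zero    = trans (cong (cnt g) (ℕ.+-identityʳ m)) (sym (ℕ.+-identityʳ _))
    cnt-split g m (suc N) = trans (cong (cnt g) (ℕ.+-suc m N))
      (trans (cong (_+ 𝟙 (g (m + N))) (cnt-split g m N)) (ℕ.+-assoc (cnt g m) _ _))

    cnt-≤ : ∀ g N → cnt g N ≤ N
    cnt-≤ g zero    = z≤n
    cnt-≤ g (suc N) = subst (cnt g (suc N) ≤_) (ℕ.+-comm N 1) (ℕ.+-mono-≤ (cnt-≤ g N) (𝟙≤1 (g N)))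

    cnt-mono : (∀ i → T (g i) → T (h i)) → ∀ N → cnt g N ≤ cnt h N
    cnt-mono f zero    = z≤n
    cnt-mono f (suc N) = ℕ.+-mono-≤ (cnt-mono f N) (𝟙-mono (f N))

    cnt-shift-≤ : ∀ g t N → cnt (λ i → g (t + i)) N ≤ cnt g N + t
    cnt-shift-≤ g t N = begin
      cnt (λ i → g (t + i)) N              ≤⟨ ℕ.m≤n+m _ (cnt g t) ⟩
      cnt g t + cnt (λ i → g (t + i)) N    ≡⟨ cnt-split g t N ⟨
      cnt g (t + N)                        ≡⟨ cong (cnt g) (ℕ.+-comm t N) ⟩
      cnt g (N + t)                        ≡⟨ cnt-split g N t ⟩
      cnt g N + cnt (λ i → g (N + i)) t    ≤⟨ ℕ.+-monoʳ-≤ (cnt g N) (cnt-≤ _ t) ⟩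
      cnt g N + t                          ∎
      where open ℕ.≤-Reasoning

    cnt-shift-≥ : ∀ g t N → cnt g N ≤ cnt (λ i → g (t + i)) N + t
    cnt-shift-≥ g t N = begin
      cnt g N                              ≤⟨ ℕ.m≤m+n _ _ ⟩
      cnt g N + cnt (λ i → g (N + i)) t    ≡⟨ cnt-split g N t ⟨
      cnt g (N + t)                        ≡⟨ cong (cnt g) (ℕ.+-comm N t) ⟩
      cnt g (t + N)                        ≡⟨ cnt-split g t N ⟩
      cnt g t + cnt (λ i → g (t + i)) N    ≤⟨ ℕ.+-monoˡ-≤ _ (cnt-≤ g t) ⟩
      t + cnt (λ i → g (t + i)) N          ≡⟨ ℕ.+-comm t _ ⟩
      cnt (λ i → g (t + i)) N + t          ∎
      where open ℕ.≤-Reasoning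

    cnt-not : ∀ g N → cnt g N + cnt (not ∘ g) N ≡ N
    cnt-not g zero    = refl
    cnt-not g (suc N) = trans (interchange (cnt g N) (𝟙 (g N)) (cnt (not ∘ g) N) _)
      (trans (cong₂ _+_ (cnt-not g N) (one (g N))) (ℕ.+-comm N 1))
      where
      one : ∀ x → 𝟙 x + 𝟙 (not x) ≡ 1
      one false = refl
      one true  = refl

    cnt-xor : ∀ g h N → cnt g N + cnt h N ≡ 2 * cnt (λ i → g i ∧ h i) N + cnt (λ i → g i xor h i) N
    cnt-xor g h zero    = refl
    cnt-xor g h (suc N) = trans (interchange (cnt g N) (𝟙 (g N)) (cnt h N) _)
      (trans (cong₂ _+_ (cnt-xor g h N) (one (g N) (h N)))
        (rearrange (cnt (λ i → g i ∧ h i) N) (cnt (λ i → g i xor h i) N) (𝟙 (g N ∧ h N)) (𝟙 (g N xor h N))))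
      where
      one : ∀ x y → 𝟙 x + 𝟙 y ≡ 2 * 𝟙 (x ∧ y) + 𝟙 (x xor y)
      one false y     = refl
      one true  false = refl
      one true  true  = refl
      rearrange : ∀ a b c d → (2 * a + b) + (2 * c + d) ≡ 2 * (a + c) + (b + d)
      rearrange = solve-∀

    -- By recursion, so that `cnt g (dbl (suc N))` unfolds by two terms.
    dbl : ℕ → ℕ
    dbl zero    = zero
    dbl (suc n) = suc (suc (dbl n))

    dbl-value : ∀ n → dbl n ≡ n + n
    dbl-value zero    = refl
    dbl-value (suc n) = cong suc (trans (cong suc (dbl-value n)) (sym (ℕ.+-suc n n)))

    dbl-+ : ∀ m n → dbl m + dbl n ≡ dbl (m + n)
    dbl-+ zero    n = refl
    dbl-+ (suc m) n = cong (λ k → suc (suc k)) (dbl-+ m n)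

    odd : ℕ → Bool
    odd zero    = false
    odd (suc n) = not (odd n)

    odd-dbl : ∀ n → odd (dbl n) ≡ false
    odd-dbl zero    = refl
    odd-dbl (suc n) = trans (Bool.not-involutive (odd (dbl n))) (odd-dbl n)

    odd-+ : ∀ m n → odd (m + n) ≡ odd m xor odd n
    odd-+ zero    n = refl
    odd-+ (suc m) n = trans (cong not (odd-+ m n)) (not-xor (odd m) (odd n))
      where
      not-xor : ∀ x y → not (x xor y) ≡ not x xor y
      not-xor false y = refl
      not-xor true  y = Bool.not-involutive y

    data Halved : ℕ → Set where
      even : ∀ m → Halved (dbl m)
      odd′ : ∀ m → Halved (suc (dbl m))

    halved : ∀ n → Halved n
    halved zero    = even 0
    halved (suc n) with halved n
    ... | even m = odd′ m
    ... | odd′ m = even (suc m)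

    cnt-dbl : ∀ g N → cnt g (dbl N) ≡ cnt (g ∘ dbl) N + cnt (g ∘ suc ∘ dbl) N
    cnt-dbl g zero    = refl
    cnt-dbl g (suc N) = trans (cong (λ x → x + 𝟙 (g (dbl N)) + 𝟙 (g (suc (dbl N)))) (cnt-dbl g N))
      (rearrange (cnt (g ∘ dbl) N) (cnt (g ∘ suc ∘ dbl) N) _ _)
      where
      rearrange : ∀ a b c d → (a + b) + c + d ≡ (a + c) + (b + d)
      rearrange = solve-∀

    -- The discrepancy ∣N − 2 cnt g N∣ is at most e.
    Balanced : (ℕ → Bool) → ℕ → ℕ → Set
    Balanced g N e = 2 * cnt g N ≤ N + e × N ≤ 2 * cnt g N + e

    balanced-mono : ∀ {N e e′} → e ≤ e′ → Balanced g N e → Balanced g N e′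
    balanced-mono {N = N} le (p , q) = ℕ.≤-trans p (ℕ.+-monoʳ-≤ N le) , ℕ.≤-trans q (ℕ.+-monoʳ-≤ _ le)

    balanced-cong : (∀ i → g i ≡ h i) → ∀ {N e} → Balanced g N e → Balanced h N e
    balanced-cong {g} {h} eq {N} {e} = subst (λ c → 2 * c ≤ N + e × N ≤ 2 * c + e) (cnt-cong eq N)

    balanced-not : ∀ {N e} → Balanced g N e → Balanced (not ∘ g) N e
    balanced-not {g} {N} {e} (p , q) =
        ℕ.+-cancelˡ-≤ (2 * x) _ _ (begin
          2 * x + 2 * y    ≡⟨ ℕ.*-distribˡ-+ 2 x y ⟨
          2 * (x + y)      ≡⟨ cong (2 *_) xy ⟩
          2 * N            ≡⟨ cong (N +_) (ℕ.+-identityʳ N) ⟩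
          N + N            ≤⟨ ℕ.+-monoˡ-≤ N q ⟩
          2 * x + e + N    ≡⟨ swap (2 * x) e N ⟩
          2 * x + (N + e)  ∎)
      , ℕ.+-cancelˡ-≤ (2 * x) _ _ (begin
          2 * x + N            ≤⟨ ℕ.+-monoˡ-≤ N p ⟩
          N + e + N            ≡⟨ dup N e ⟩
          2 * N + e            ≡⟨ cong (λ z → 2 * z + e) xy ⟨
          2 * (x + y) + e      ≡⟨ expand x y e ⟩
          2 * x + (2 * y + e)  ∎)
      where
      open ℕ.≤-Reasoning
      x = cnt g N
      y = cnt (not ∘ g) N
      xy : x + y ≡ N
      xy = cnt-not g N
      swap : ∀ a b c → a + b + c ≡ a + (c + b)
      swap = solve-∀
      dup : ∀ a b → a + b + a ≡ 2 * a + b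
      dup = solve-∀
      expand : ∀ a b c → 2 * (a + b) + c ≡ 2 * a + (2 * b + c)
      expand = solve-∀

    balanced-xor : ∀ p {N e} → Balanced g N e → Balanced (λ i → g i xor p) N e
    balanced-xor {g} false = balanced-cong λ i → sym (Bool.xor-identityʳ (g i))
    balanced-xor {g} true  b = balanced-cong (λ i → sym (xor-true (g i))) (balanced-not b)
      where
      xor-true : ∀ x → x xor true ≡ not x
      xor-true false = refl
      xor-true true  = refl

    balanced-dbl : ∀ {N e e′} → Balanced (g ∘ dbl) N e → Balanced (g ∘ suc ∘ dbl) N e′ → Balanced g (dbl N) (e + e′)
    balanced-dbl {g} {N} {e} {e′} (p , q) (p′ , q′) = subst (λ M → 2 * cnt g (dbl N) ≤ M + (e + e′) × M ≤ 2 * cnt g (dbl N) + (e + e′)) (sym (dbl-value N))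
      ( (begin
          2 * cnt g (dbl N)            ≡⟨ cong (2 *_) (cnt-dbl g N) ⟩
          2 * (x + y)                  ≡⟨ ℕ.*-distribˡ-+ 2 x y ⟩
          2 * x + 2 * y                ≤⟨ ℕ.+-mono-≤ p p′ ⟩
          (N + e) + (N + e′)           ≡⟨ interchange N e N e′ ⟩
          (N + N) + (e + e′)           ∎)
      , (begin
          N + N                        ≤⟨ ℕ.+-mono-≤ q q′ ⟩
          (2 * x + e) + (2 * y + e′)   ≡⟨ interchange (2 * x) e (2 * y) e′ ⟩
          (2 * x + 2 * y) + (e + e′)   ≡⟨ cong (_+ (e + e′)) (ℕ.*-distribˡ-+ 2 x y) ⟨
          2 * (x + y) + (e + e′)       ≡⟨ cong (λ z → 2 * z + (e + e′)) (cnt-dbl g N) ⟨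
          2 * cnt g (dbl N) + (e + e′) ∎))
      where
      open ℕ.≤-Reasoning
      x = cnt (g ∘ dbl) N
      y = cnt (g ∘ suc ∘ dbl) N

    balanced-suc : ∀ {N e} → Balanced g N e → Balanced g (suc N) (suc e)
    balanced-suc {g} {N} {e} (p , q) = step (g N)
      where
      step : ∀ x → 2 * (cnt g N + 𝟙 x) ≤ suc N + suc e × suc N ≤ 2 * (cnt g N + 𝟙 x) + suc e
      step false = subst (λ c → 2 * c ≤ suc N + suc e × suc N ≤ 2 * c + suc e) (sym (ℕ.+-identityʳ (cnt g N)))
        (ℕ.≤-trans p (ℕ.+-mono-≤ (ℕ.n≤1+n N) (ℕ.n≤1+n e)) , subst (suc N ≤_) (sym (ℕ.+-suc _ e)) (s≤s q))
      step true  = subst₂ _≤_ (sym (two (cnt g N))) (sym (cong suc (ℕ.+-suc N e))) (s≤s (s≤s p)) ,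
                     subst (suc N ≤_) (sym (three (cnt g N) e)) (s≤s (ℕ.m≤n⇒m≤1+n (ℕ.m≤n⇒m≤1+n q)))
        where
        two : ∀ c → 2 * (c + 1) ≡ suc (suc (2 * c))
        two = solve-∀
        three : ∀ c e → 2 * (c + 1) + suc e ≡ suc (suc (suc (2 * c + e)))
        three = solve-∀

    balanced-self : ∀ g N → Balanced g N N
    balanced-self g N = ℕ.≤-trans (ℕ.*-monoʳ-≤ 2 (cnt-≤ g N)) (ℕ.≤-reflexive (cong (N +_) (ℕ.+-identityʳ N))) , ℕ.m≤n+m N _

    -- The discrepancy is o(N).
    SmallAt : (ℕ → Bool) → ℕ → Set
    SmallAt g k = ∃ λ K → ∀ N → ∃ λ e → Balanced g N e × k * e ≤ N + K

    Small : (ℕ → Bool) → Set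
    Small g = ∀ k → SmallAt g k

    -- The discrepancies of the even and the odd half add up, and a constant flip does not change
    -- them. The extra `k` in the constant pays for the last term when the length is odd.
    small-dbl : ∀ p q {X Y : ℕ → Bool} → Small X → Small Y → (∀ i → g (dbl i) ≡ X i xor p) → (∀ i → g (suc (dbl i)) ≡ Y i xor q) → Small g
    small-dbl {g} p q {X} {Y} sX sY eX eY k =
      let (K₁ , bX) = sX k; (K₂ , bY) = sY k in K₁ + K₂ + k , λ N → go K₁ K₂ bX bY (halved N)
      where
      step : ∀ {N e e′} → Balanced X N e → Balanced Y N e′ → Balanced g (dbl N) (e + e′)
      step {N} b b′ = balanced-dbl {g} {N} (balanced-cong (λ i → sym (eX i)) {N} (balanced-xor {X} p {N} b))
                                         (balanced-cong (λ i → sym (eY i)) {N} (balanced-xor {Y} q {N} b′))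

      go : ∀ K₁ K₂ → (∀ N → ∃ λ e → Balanced X N e × k * e ≤ N + K₁) → (∀ N → ∃ λ e → Balanced Y N e × k * e ≤ N + K₂) →
           ∀ {N} → Halved N → ∃ λ e → Balanced g N e × k * e ≤ N + (K₁ + K₂ + k)
      go K₁ K₂ p q (even M) = let (e , b , le) = p M; (e′ , b′ , le′) = q M in e + e′ , step {M} b b′ , (begin
          k * (e + e′)               ≡⟨ ℕ.*-distribˡ-+ k e e′ ⟩
          k * e + k * e′             ≤⟨ ℕ.+-mono-≤ le le′ ⟩
          (M + K₁) + (M + K₂)        ≡⟨ interchange M K₁ M K₂ ⟩
          (M + M) + (K₁ + K₂)        ≡⟨ cong (_+ (K₁ + K₂)) (dbl-value M) ⟨
          dbl M + (K₁ + K₂)          ≤⟨ ℕ.+-monoʳ-≤ (dbl M) (ℕ.m≤m+n (K₁ + K₂) k) ⟩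
          dbl M + (K₁ + K₂ + k)      ∎)
        where open ℕ.≤-Reasoning
      go K₁ K₂ p q (odd′ M) = let (e , b , le) = p M; (e′ , b′ , le′) = q M in suc (e + e′) , balanced-suc {g} {dbl M} (step {M} b b′) , (begin
          k * suc (e + e′)           ≡⟨ expand k e e′ ⟩
          k * e + k * e′ + k         ≤⟨ ℕ.+-monoˡ-≤ k (ℕ.+-mono-≤ le le′) ⟩
          (M + K₁) + (M + K₂) + k    ≡⟨ rearrange M K₁ K₂ k ⟩
          (M + M) + (K₁ + K₂ + k)    ≡⟨ cong (_+ (K₁ + K₂ + k)) (dbl-value M) ⟨
          dbl M + (K₁ + K₂ + k)      ≤⟨ ℕ.n≤1+n _ ⟩
          suc (dbl M) + (K₁ + K₂ + k) ∎)
        where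
        open ℕ.≤-Reasoning
        expand : ∀ k e f → k * suc (e + f) ≡ k * e + k * f + k
        expand = solve-∀
        rearrange : ∀ m a b k → (m + a) + (m + b) + k ≡ (m + m) + (a + b + k)
        rearrange = solve-∀

    -- With discrepancy at most `N`, every sequence satisfies `SmallAt g 1`; gaining a factor of two
    -- repeatedly reaches every `k`.
    small-double : (∀ k → SmallAt g k → SmallAt g (2 * k)) → Small g
    small-double {g} double k = let (K , p) = powers k in K , λ N → let (e , b , le) = p N in
        e , b , ℕ.≤-trans (ℕ.*-monoˡ-≤ e (ℕ.<⇒≤ (n<2^n k))) le
      where
      powers : ∀ j → SmallAt g (2 ^ j)
      powers zero    = 0 , λ N → N , balanced-self g N , ℕ.≤-refl
      powers (suc j) = double (2 ^ j) (powers j)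

    private
      -- The first argument is fuel for the repeated halving of the second; any fuel at least `n`
      -- gives the same value, by `F-fuel`.
      F : ℕ → ℕ → Bool
      F zero    n = false
      F (suc k) n = F k ℕ.⌊ n /2⌋ xor (odd n ∧ odd ℕ.⌊ n /2⌋)

      F-zero : ∀ k → F k 0 ≡ false
      F-zero zero    = refl
      F-zero (suc k) = cong (_xor false) (F-zero k)

      half-≤ : ∀ {n k} → n ≤ suc k → ℕ.⌊ n /2⌋ ≤ k
      half-≤ {zero}  _        = z≤n
      half-≤ {suc n} (s≤s le) = ℕ.≤-trans (ℕ.s≤s⁻¹ (ℕ.⌊n/2⌋<n n)) le

      F-fuel : ∀ k k′ n → n ≤ k → n ≤ k′ → F k n ≡ F k′ n
      F-fuel zero    k′       zero z≤n _   = sym (F-zero k′)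
      F-fuel (suc k) zero     zero _   z≤n = F-zero (suc k)
      F-fuel (suc k) (suc k′) n    p   q   = cong (_xor (odd n ∧ odd ℕ.⌊ n /2⌋)) (F-fuel k k′ _ (half-≤ p) (half-≤ q))

    -- The Rudin–Shapiro sequence: the parity of the number of blocks 11 in the binary expansion.
    rs : ℕ → Bool
    rs n = F n n

    private
      rs-unfold : ∀ n → rs n ≡ rs ℕ.⌊ n /2⌋ xor (odd n ∧ odd ℕ.⌊ n /2⌋)
      rs-unfold n = trans (F-fuel n (suc n) n ℕ.≤-refl (ℕ.n≤1+n n))
        (cong (_xor (odd n ∧ odd ℕ.⌊ n /2⌋)) (F-fuel n ℕ.⌊ n /2⌋ ℕ.⌊ n /2⌋ (ℕ.⌊n/2⌋≤n n) ℕ.≤-refl))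

      half-dbl : ∀ i → ℕ.⌊ dbl i /2⌋ ≡ i
      half-dbl zero    = refl
      half-dbl (suc i) = cong suc (half-dbl i)

      half-suc-dbl : ∀ i → ℕ.⌊ suc (dbl i) /2⌋ ≡ i
      half-suc-dbl zero    = refl
      half-suc-dbl (suc i) = cong suc (half-suc-dbl i)

    rs-even : ∀ i → rs (dbl i) ≡ rs i
    rs-even i = trans (rs-unfold (dbl i)) (trans (cong₂ (λ h o → rs h xor (o ∧ odd ℕ.⌊ dbl i /2⌋)) (half-dbl i) (odd-dbl i)) (Bool.xor-identityʳ (rs i)))

    rs-odd : ∀ i → rs (suc (dbl i)) ≡ rs i xor odd i
    rs-odd i = trans (rs-unfold (suc (dbl i))) (cong₂ (λ h o → rs h xor (not o ∧ odd h)) (half-suc-dbl i) (odd-dbl i))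

    -- With signs r(i) = ±1 these are r(i) r(i + n) and (-1)^i r(i) r(i + n). The second is forced
    -- by the factor (-1)^i in r(2i + 1); together they are closed under halving `i` and `n`.
    corr twist : ℕ → ℕ → Bool
    corr n i  = rs i xor rs (i + n)
    twist n i = odd i xor corr n i

    private
      rs-even-+ : ∀ i n → rs (dbl i + dbl n) ≡ rs (i + n)
      rs-even-+ i n = trans (cong rs (dbl-+ i n)) (rs-even (i + n))

      rs-odd-+ : ∀ i n → rs (suc (dbl i + dbl n)) ≡ rs (i + n) xor (odd i xor odd n)
      rs-odd-+ i n = trans (cong (rs ∘ suc) (dbl-+ i n)) (trans (rs-odd (i + n)) (cong (rs (i + n) xor_) (odd-+ i n)))

      rs-next-+ : ∀ i n → rs (suc (dbl i) + suc (dbl n)) ≡ rs (i + suc n)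
      rs-next-+ i n = trans (cong (rs ∘ suc) (ℕ.+-suc (dbl i) (dbl n)))
        (trans (cong (λ k → rs (suc (suc k))) (dbl-+ i n)) (trans (rs-even (suc (i + n))) (cong rs (sym (ℕ.+-suc i n)))))

      open xor-∧-Solver using (solve; _:+_; _:=_; con)

      corr-even-even : ∀ n i → corr (dbl n) (dbl i) ≡ corr n i xor false
      corr-even-even n i = trans (cong₂ _xor_ (rs-even i) (rs-even-+ i n)) (sym (Bool.xor-identityʳ _))

      corr-even-odd : ∀ n i → corr (dbl n) (suc (dbl i)) ≡ corr n i xor odd n
      corr-even-odd n i = trans (cong₂ _xor_ (rs-odd i) (rs-odd-+ i n))
        (solve 4 (λ a b o p → (a :+ o) :+ (b :+ (o :+ p)) := (a :+ b) :+ p) refl (rs i) (rs (i + n)) (odd i) (odd n))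

      corr-odd-even : ∀ n i → corr (suc (dbl n)) (dbl i) ≡ twist n i xor odd n
      corr-odd-even n i = trans (cong₂ _xor_ (rs-even i) (trans (cong rs (ℕ.+-suc (dbl i) (dbl n))) (rs-odd-+ i n)))
        (solve 4 (λ a b o p → a :+ (b :+ (o :+ p)) := (o :+ (a :+ b)) :+ p) refl (rs i) (rs (i + n)) (odd i) (odd n))

      corr-odd-odd : ∀ n i → corr (suc (dbl n)) (suc (dbl i)) ≡ twist (suc n) i xor false
      corr-odd-odd n i = trans (cong₂ _xor_ (rs-odd i) (rs-next-+ i n))
        (solve 3 (λ a b o → (a :+ o) :+ b := (o :+ (a :+ b)) :+ con false) refl (rs i) (rs (i + suc n)) (odd i))

      twist-even : ∀ m i → twist m (dbl i) ≡ corr m (dbl i)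
      twist-even m i = cong (_xor corr m (dbl i)) (odd-dbl i)

      twist-odd : ∀ m i → twist m (suc (dbl i)) ≡ corr m (suc (dbl i)) xor true
      twist-odd m i = trans (cong (λ o → not o xor corr m (suc (dbl i))) (odd-dbl i)) (Bool.xor-comm true (corr m (suc (dbl i))))

      xor-true : ∀ x p → (x xor p) xor true ≡ x xor (p xor true)
      xor-true x p = Bool.xor-assoc x p true

      odd-balanced : ∀ N → Balanced odd N 1
      odd-balanced N = go (halved N)
        where
        exact : ∀ M → Balanced odd (dbl M) 0
        exact zero    = z≤n , z≤n
        exact (suc M) = let (p , q) = exact M in
          subst₂ (λ x y → 2 * (cnt odd (dbl M) + 𝟙 x + 𝟙 (not y)) ≤ suc (suc (dbl M)) + 0 × suc (suc (dbl M)) ≤ 2 * (cnt odd (dbl M) + 𝟙 x + 𝟙 (not y)) + 0)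
            (sym (odd-dbl M)) (sym (odd-dbl M))
            ( subst (_≤ suc (suc (dbl M)) + 0) (sym (two (cnt odd (dbl M)))) (s≤s (s≤s p))
            , subst (λ z → suc (suc (dbl M)) ≤ z + 0) (sym (two (cnt odd (dbl M)))) (s≤s (s≤s q)))
          where
          two : ∀ c → 2 * (c + 0 + 1) ≡ suc (suc (2 * c))
          two = solve-∀

        go : ∀ {N} → Halved N → Balanced odd N 1
        go (even M) = balanced-mono {odd} {dbl M} z≤n (exact M)
        go (odd′ M) = balanced-suc {odd} {dbl M} (exact M)

      twist-zero-balanced : ∀ N → Balanced (twist 0) N 1
      twist-zero-balanced N = balanced-cong {odd} {twist 0} (λ i → sym (trans (cong (odd i xor_) (trans (cong (λ j → rs i xor rs j) (ℕ.+-identityʳ i)) (Bool.xor-same (rs i)))) (Bool.xor-identityʳ (odd i)))) {N} (odd-balanced N)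

      twist-zero : Small (twist 0)
      twist-zero k = k , λ N → 1 , twist-zero-balanced N , subst (_≤ N + k) (sym (ℕ.*-identityʳ k)) (ℕ.m≤n+m k N)

      -- twist 1 occurs in its own recursion, but only once, so that its discrepancy grows like log N.
      twist-one : Small (twist 1)
      twist-one = small-double λ k (K , p) → 2 * K + 4 * k , λ N → go k K p (halved N)
        where
        step : ∀ {N e} → Balanced (twist 1) N e → Balanced (twist 1) (dbl N) (1 + e)
        step {N} b = balanced-dbl {twist 1} {N}
          (balanced-cong {twist 0} {twist 1 ∘ dbl} (λ i → sym (trans (twist-even 1 i) (trans (corr-odd-even 0 i) (Bool.xor-identityʳ (twist 0 i))))) {N} (twist-zero-balanced N))
          (balanced-cong {λ i → twist 1 i xor true} (λ i → sym (trans (twist-odd 1 i) (trans (cong (_xor true) (corr-odd-odd 0 i)) (xor-true (twist 1 i) false)))) {N} (balanced-xor {twist 1} true {N} b))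

        go : ∀ k K → (∀ N → ∃ λ e → Balanced (twist 1) N e × k * e ≤ N + K) → ∀ {N} → Halved N →
             ∃ λ e → Balanced (twist 1) N e × 2 * k * e ≤ N + (2 * K + 4 * k)
        go k K p (even M) = let (e , b , le) = p M in 1 + e , step {M} b , (begin
            2 * k * (1 + e)              ≡⟨ expand k e ⟩
            2 * (k * e) + 2 * k          ≤⟨ ℕ.+-monoˡ-≤ (2 * k) (ℕ.*-monoʳ-≤ 2 le) ⟩
            2 * (M + K) + 2 * k          ≤⟨ ℕ.m≤m+n _ (2 * k) ⟩
            2 * (M + K) + 2 * k + 2 * k  ≡⟨ collect M K k ⟩
            (M + M) + (2 * K + 4 * k)    ≡⟨ cong (_+ (2 * K + 4 * k)) (dbl-value M) ⟨
            dbl M + (2 * K + 4 * k)      ∎)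
          where
          open ℕ.≤-Reasoning
          expand : ∀ k e → 2 * k * (1 + e) ≡ 2 * (k * e) + 2 * k
          expand = solve-∀
          collect : ∀ m a k → 2 * (m + a) + 2 * k + 2 * k ≡ (m + m) + (2 * a + 4 * k)
          collect = solve-∀
        go k K p (odd′ M) = let (e , b , le) = p M in suc (1 + e) , balanced-suc {twist 1} {dbl M} (step {M} b) , (begin
            2 * k * suc (1 + e)          ≡⟨ expand k e ⟩
            2 * (k * e) + 4 * k          ≤⟨ ℕ.+-monoˡ-≤ (4 * k) (ℕ.*-monoʳ-≤ 2 le) ⟩
            2 * (M + K) + 4 * k          ≡⟨ collect M K k ⟩
            (M + M) + (2 * K + 4 * k)    ≡⟨ cong (_+ (2 * K + 4 * k)) (dbl-value M) ⟨
            dbl M + (2 * K + 4 * k)      ≤⟨ ℕ.n≤1+n _ ⟩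
            suc (dbl M) + (2 * K + 4 * k) ∎)
          where
          open ℕ.≤-Reasoning
          expand : ∀ k e → 2 * k * suc (1 + e) ≡ 2 * (k * e) + 4 * k
          expand = solve-∀
          collect : ∀ m a k → 2 * (m + a) + 4 * k ≡ (m + m) + (2 * a + 4 * k)
          collect = solve-∀

      both : ∀ m → Small (twist m) → Small (twist (suc m)) → Small (corr (suc (dbl m))) × Small (twist (suc (dbl m)))
      both m s s′ = small-dbl (odd m) false s s′ (corr-odd-even m) (corr-odd-odd m) ,
        small-dbl (odd m) (false xor true) s s′ (λ i → trans (twist-even (suc (dbl m)) i) (corr-odd-even m i))
          (λ i → trans (twist-odd (suc (dbl m)) i) (trans (cong (_xor true) (corr-odd-odd m i)) (xor-true (twist (suc m) i) false)))

      -- The recursion passes to shifts about half as large. The exception is shift 1, where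
      -- `twist 1` reappears on the right; there `twist-one` provides the base.
      corr-twist : ∀ n → Acc _<_ n → Small (corr (suc n)) × Small (twist (suc n))
      corr-twist n (acc rec) = go (halved (suc n)) refl
        where
        go : ∀ {m} → Halved m → m ≡ suc n → Small (corr m) × Small (twist m)
        go (even (suc m)) e = let (s , _) = corr-twist m (rec (subst (m <_) (ℕ.suc-injective e) (s≤s (ℕ.≤-trans (ℕ.m≤m+n m m) (ℕ.≤-reflexive (sym (dbl-value m))))))) in
          small-dbl false (odd (suc m)) s s (corr-even-even (suc m)) (corr-even-odd (suc m)) ,
          small-dbl false (odd (suc m) xor true) s s (λ i → trans (twist-even (dbl (suc m)) i) (corr-even-even (suc m) i))
            (λ i → trans (twist-odd (dbl (suc m)) i) (trans (cong (_xor true) (corr-even-odd (suc m) i)) (xor-true (corr (suc m) i) (odd (suc m)))))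
        go (odd′ zero) e = both zero twist-zero twist-one
        go (odd′ (suc m)) e =
          let (_ , s)  = corr-twist m (rec (subst (m <_) (ℕ.suc-injective e) (ℕ.≤-trans (s≤s (ℕ.≤-trans (ℕ.m≤m+n m m) (ℕ.≤-reflexive (sym (dbl-value m))))) (ℕ.n≤1+n _))))
              (_ , s′) = corr-twist (suc m) (rec (subst (suc m <_) (ℕ.suc-injective e) (s≤s (s≤s (ℕ.≤-trans (ℕ.m≤m+n m m) (ℕ.≤-reflexive (sym (dbl-value m))))))))
          in both (suc m) s s′

    corr-small : ∀ n → Small (corr (suc n))
    corr-small n = proj₁ (corr-twist n (ℕ.<-wellFounded n))

    -- With t i = rs i xor odd i, doubling maps (cnt rs, cnt t) to (cnt rs + cnt t, cnt rs + cnt (not t)).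
    rs-small : Small rs
    rs-small = small-double λ k (K , p) → 4 * K + 6 * k , λ N → go k K p (halved N)
      where
      open ℕ.≤-Reasoning
      t : ℕ → Bool
      t i = rs i xor odd i

      t-even : ∀ i → t (dbl i) ≡ rs i
      t-even i = trans (cong₂ _xor_ (rs-even i) (odd-dbl i)) (Bool.xor-identityʳ (rs i))

      t-odd : ∀ i → t (suc (dbl i)) ≡ not (t i)
      t-odd i = trans (cong₂ (λ x o → x xor not o) (rs-odd i) (odd-dbl i)) (Bool.xor-comm (t i) true)

      quadruple : ∀ N → cnt rs (dbl (dbl N)) ≡ 2 * cnt rs N + N
      quadruple N = begin-equality
        cnt rs (dbl (dbl N))
          ≡⟨ cnt-dbl rs (dbl N) ⟩
        cnt (rs ∘ dbl) (dbl N) + cnt (rs ∘ suc ∘ dbl) (dbl N)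
          ≡⟨ cong₂ _+_ (cnt-cong rs-even (dbl N)) (cnt-cong rs-odd (dbl N)) ⟩
        cnt rs (dbl N) + cnt t (dbl N)
          ≡⟨ cong₂ _+_ (cnt-dbl rs N) (cnt-dbl t N) ⟩
        (cnt (rs ∘ dbl) N + cnt (rs ∘ suc ∘ dbl) N) + (cnt (t ∘ dbl) N + cnt (t ∘ suc ∘ dbl) N)
          ≡⟨ cong₂ _+_ (cong₂ _+_ (cnt-cong rs-even N) (cnt-cong rs-odd N)) (cong₂ _+_ (cnt-cong t-even N) (cnt-cong t-odd N)) ⟩
        (cnt rs N + cnt t N) + (cnt rs N + cnt (not ∘ t) N)
          ≡⟨ interchange (cnt rs N) (cnt t N) (cnt rs N) (cnt (not ∘ t) N) ⟩
        (cnt rs N + cnt rs N) + (cnt t N + cnt (not ∘ t) N)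
          ≡⟨ cong₂ _+_ (cong (cnt rs N +_) (sym (ℕ.+-identityʳ (cnt rs N)))) (cnt-not t N) ⟩
        2 * cnt rs N + N ∎

      -- While the length quadruples the discrepancy only doubles, because `t` and its complement
      -- together contribute exactly `N`. This is the gain that `small-double` asks for.
      step : ∀ {N e} → Balanced rs N e → Balanced rs (dbl (dbl N)) (e + e)
      step {N} {e} (p , q) = subst₂ (λ c M → 2 * c ≤ M + (e + e) × M ≤ 2 * c + (e + e)) (sym (quadruple N))
        (sym (trans (dbl-value (dbl N)) (cong₂ _+_ (dbl-value N) (dbl-value N))))
        ( (begin
            2 * (2 * x + N)              ≡⟨ four x N ⟩
            2 * (2 * x) + 2 * N          ≤⟨ ℕ.+-monoˡ-≤ (2 * N) (ℕ.*-monoʳ-≤ 2 p) ⟩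
            2 * (N + e) + 2 * N          ≡⟨ five N e ⟩
            N + N + (N + N) + (e + e)    ∎)
        , (begin
            N + N + (N + N)              ≡⟨ six N ⟩
            2 * N + 2 * N                ≤⟨ ℕ.+-monoˡ-≤ (2 * N) (ℕ.*-monoʳ-≤ 2 q) ⟩
            2 * (2 * x + e) + 2 * N      ≡⟨ seven x e N ⟩
            2 * (2 * x + N) + (e + e)    ∎))
        where
        x = cnt rs N
        four : ∀ x n → 2 * (2 * x + n) ≡ 2 * (2 * x) + 2 * n
        four = solve-∀
        five : ∀ n e → 2 * (n + e) + 2 * n ≡ n + n + (n + n) + (e + e)
        five = solve-∀
        six : ∀ n → n + n + (n + n) ≡ 2 * n + 2 * n
        six = solve-∀
        seven : ∀ x e n → 2 * (2 * x + e) + 2 * n ≡ 2 * (2 * x + n) + (e + e)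
        seven = solve-∀

      bound : ∀ k K M e r → r ≤ 3 → k * e ≤ M + K → 2 * k * (r + (e + e)) ≤ r + dbl (dbl M) + (4 * K + 6 * k)
      bound k K M e r r≤3 le = begin
        2 * k * (r + (e + e))           ≤⟨ ℕ.*-monoʳ-≤ (2 * k) (ℕ.+-monoˡ-≤ (e + e) r≤3) ⟩
        2 * k * (3 + (e + e))           ≡⟨ expand k e ⟩
        4 * (k * e) + 6 * k             ≤⟨ ℕ.+-monoˡ-≤ (6 * k) (ℕ.*-monoʳ-≤ 4 le) ⟩
        4 * (M + K) + 6 * k             ≡⟨ collect M K k ⟩
        (M + M + (M + M)) + (4 * K + 6 * k) ≡⟨ cong (_+ (4 * K + 6 * k)) (trans (dbl-value (dbl M)) (cong₂ _+_ (dbl-value M) (dbl-value M))) ⟨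
        dbl (dbl M) + (4 * K + 6 * k)   ≤⟨ ℕ.+-monoˡ-≤ (4 * K + 6 * k) (ℕ.m≤n+m (dbl (dbl M)) r) ⟩
        r + dbl (dbl M) + (4 * K + 6 * k) ∎
        where
        expand : ∀ k e → 2 * k * (3 + (e + e)) ≡ 4 * (k * e) + 6 * k
        expand = solve-∀
        collect : ∀ m a k → 4 * (m + a) + 6 * k ≡ (m + m + (m + m)) + (4 * a + 6 * k)
        collect = solve-∀

      Goal : ℕ → ℕ → ℕ → Set
      Goal k K N = ∃ λ e → Balanced rs N e × 2 * k * e ≤ N + (4 * K + 6 * k)

      plus : ∀ N {e} r → Balanced rs N e → Balanced rs (r + N) (r + e)
      plus N zero    b = b
      plus N (suc r) b = balanced-suc {rs} {r + N} (plus N r b)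

      at : ∀ k K → (∀ N → ∃ λ e → Balanced rs N e × k * e ≤ N + K) → ∀ M r → r ≤ 3 → Goal k K (r + dbl (dbl M))
      at k K p M r r≤3 = let (e , b , le) = p M in
        r + (e + e) , plus (dbl (dbl M)) r (step {M} b) , bound k K M e r r≤3 le

      go : ∀ k K → (∀ N → ∃ λ e → Balanced rs N e × k * e ≤ N + K) → ∀ {N} → Halved N → Goal k K N
      go k K p (even m) with halved m
      ... | even M = at k K p M 0 z≤n
      ... | odd′ M = at k K p M 2 (s≤s (s≤s z≤n))
      go k K p (odd′ m) with halved m
      ... | even M = at k K p M 1 (s≤s z≤n)
      ... | odd′ M = at k K p M 3 ℕ.≤-refl

    -- q · g N / N tends to 1.
    Near : ℕ → (ℕ → ℕ) → Set
    Near q g = ∀ k → ∃ λ K → ∀ N → k * (q * g N) ≤ k * N + N + K × k * N ≤ k * (q * g N) + N + K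

    small⇒near : Small g → Near 2 (cnt g)
    small⇒near {g} s k = let (K , p) = s k in K , λ N → let (e , (b , b′) , le) = p N in
        (begin
          k * (2 * cnt g N)      ≤⟨ ℕ.*-monoʳ-≤ k b ⟩
          k * (N + e)            ≡⟨ ℕ.*-distribˡ-+ k N e ⟩
          k * N + k * e          ≤⟨ ℕ.+-monoʳ-≤ (k * N) le ⟩
          k * N + (N + K)        ≡⟨ ℕ.+-assoc (k * N) N K ⟨
          k * N + N + K          ∎)
      , (begin
          k * N                  ≤⟨ ℕ.*-monoʳ-≤ k b′ ⟩
          k * (2 * cnt g N + e)  ≡⟨ ℕ.*-distribˡ-+ k (2 * cnt g N) e ⟩
          k * (2 * cnt g N) + k * e          ≤⟨ ℕ.+-monoʳ-≤ (k * (2 * cnt g N)) le ⟩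
          k * (2 * cnt g N) + (N + K)        ≡⟨ ℕ.+-assoc (k * (2 * cnt g N)) N K ⟨
          k * (2 * cnt g N) + N + K          ∎)
      where open ℕ.≤-Reasoning

    near-perturb : ∀ q C {u v : ℕ → ℕ} → (∀ N → u N ≤ v N + C) → (∀ N → v N ≤ u N + C) → Near q u → Near q v
    near-perturb q C {u} {v} uv vu near k = let (K , p) = near k in K + k * (q * C) , λ N → let (b , b′) = p N in
        (begin
          k * (q * v N)                            ≤⟨ ℕ.*-monoʳ-≤ k (ℕ.*-monoʳ-≤ q (vu N)) ⟩
          k * (q * (u N + C))                      ≡⟨ expand k q (u N) C ⟩
          k * (q * u N) + k * (q * C)              ≤⟨ ℕ.+-monoˡ-≤ (k * (q * C)) b ⟩
          k * N + N + K + k * (q * C)              ≡⟨ ℕ.+-assoc (k * N + N) K _ ⟩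
          k * N + N + (K + k * (q * C))            ∎)
      , (begin
          k * N                                    ≤⟨ b′ ⟩
          k * (q * u N) + N + K                    ≤⟨ ℕ.+-monoˡ-≤ K (ℕ.+-monoˡ-≤ N (ℕ.*-monoʳ-≤ k (ℕ.*-monoʳ-≤ q (uv N)))) ⟩
          k * (q * (v N + C)) + N + K              ≡⟨ collect k q (v N) C N K ⟩
          k * (q * v N) + N + (K + k * (q * C))    ∎)
      where
      open ℕ.≤-Reasoning
      expand : ∀ k q u c → k * (q * (u + c)) ≡ k * (q * u) + k * (q * c)
      expand = solve-∀
      collect : ∀ k q v c n a → k * (q * (v + c)) + n + a ≡ k * (q * v) + n + (a + k * (q * c))
      collect = solve-∀

    both-set : ℕ → ℕ → Bool
    both-set n i = rs i ∧ rs (i + n)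

    near-shift : ∀ n → Near 2 (cnt λ i → rs (i + n))
    near-shift n = near-perturb 2 n
      (λ N → subst (λ c → cnt rs N ≤ c + n) (cnt-cong (λ i → cong rs (ℕ.+-comm n i)) N) (cnt-shift-≥ rs n N))
      (λ N → subst (_≤ cnt rs N + n) (cnt-cong (λ i → cong rs (ℕ.+-comm n i)) N) (cnt-shift-≤ rs n N))
      (small⇒near rs-small)

    -- From 4 z + 2 w = 2 x + 2 y for the counts of the conjunction, the correlation and both sequences.
    near-both : ∀ n → Near 4 (cnt (both-set (suc n)))
    near-both n k =
      -- Three errors are combined, so each input is taken at precision `3 * k`.
      let (K₁ , p) = small⇒near rs-small (3 * k)
          (K₂ , q) = near-shift (suc n) (3 * k)
          (K₃ , r) = small⇒near (corr-small n) (3 * k)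
      in K₁ + K₂ + K₃ , λ N → bounds K₁ K₂ K₃ N (cnt rs N) (cnt (λ i → rs (i + suc n)) N) (cnt (both-set (suc n)) N) (cnt (corr (suc n)) N)
           (cnt-xor rs (λ i → rs (i + suc n)) N) (p N) (q N) (r N)
      where
      open ℕ.≤-Reasoning
      bounds : ∀ K₁ K₂ K₃ N x y z w → x + y ≡ 2 * z + w →
        (3 * k * (2 * x) ≤ 3 * k * N + N + K₁ × 3 * k * N ≤ 3 * k * (2 * x) + N + K₁) →
        (3 * k * (2 * y) ≤ 3 * k * N + N + K₂ × 3 * k * N ≤ 3 * k * (2 * y) + N + K₂) →
        (3 * k * (2 * w) ≤ 3 * k * N + N + K₃ × 3 * k * N ≤ 3 * k * (2 * w) + N + K₃) →
        k * (4 * z) ≤ k * N + N + (K₁ + K₂ + K₃) × k * N ≤ k * (4 * z) + N + (K₁ + K₂ + K₃)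
      bounds K₁ K₂ K₃ N x y z w eq (p , p′) (q , q′) (r , r′) =
          ℕ.*-cancelˡ-≤ 3 (ℕ.+-cancelʳ-≤ (3 * k * (2 * w)) _ _ (begin
            3 * (k * (4 * z)) + 3 * k * (2 * w)             ≡⟨ a₁ k z w ⟩
            6 * k * (2 * z + w)                             ≡⟨ cong (6 * k *_) eq ⟨
            6 * k * (x + y)                                 ≡⟨ a₂ k x y ⟩
            3 * k * (2 * x) + 3 * k * (2 * y)               ≤⟨ ℕ.+-mono-≤ p q ⟩
            (3 * k * N + N + K₁) + (3 * k * N + N + K₂)     ≤⟨ ℕ.+-monoʳ-≤ (3 * k * N + N + K₁) (ℕ.+-monoˡ-≤ K₂ (ℕ.+-monoˡ-≤ N r′)) ⟩
            (3 * k * N + N + K₁) + (3 * k * (2 * w) + N + K₃ + N + K₂) ≤⟨ ℕ.m≤m+n _ (2 * (K₁ + K₂ + K₃)) ⟩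
            (3 * k * N + N + K₁) + (3 * k * (2 * w) + N + K₃ + N + K₂) + 2 * (K₁ + K₂ + K₃) ≡⟨ a₃ k N K₁ K₂ K₃ w ⟩
            3 * (k * N + N + (K₁ + K₂ + K₃)) + 3 * k * (2 * w)     ∎))
        , ℕ.*-cancelˡ-≤ 3 (ℕ.+-cancelʳ-≤ (3 * k * N) _ _ (begin
            3 * (k * N) + 3 * k * N                         ≡⟨ cong (_+ 3 * k * N) (sym (ℕ.*-assoc 3 k N)) ⟩
            3 * k * N + 3 * k * N                           ≤⟨ ℕ.+-mono-≤ p′ q′ ⟩
            (3 * k * (2 * x) + N + K₁) + (3 * k * (2 * y) + N + K₂) ≡⟨ b₁ k x y N K₁ K₂ ⟩
            6 * k * (x + y) + (2 * N + K₁ + K₂)             ≡⟨ cong (λ s → 6 * k * s + (2 * N + K₁ + K₂)) eq ⟩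
            6 * k * (2 * z + w) + (2 * N + K₁ + K₂)         ≡⟨ b₂ k z w (2 * N + K₁ + K₂) ⟩
            3 * (k * (4 * z)) + (2 * N + K₁ + K₂) + 3 * k * (2 * w) ≤⟨ ℕ.+-monoʳ-≤ (3 * (k * (4 * z)) + (2 * N + K₁ + K₂)) r ⟩
            3 * (k * (4 * z)) + (2 * N + K₁ + K₂) + (3 * k * N + N + K₃) ≤⟨ ℕ.m≤m+n _ (2 * (K₁ + K₂ + K₃)) ⟩
            3 * (k * (4 * z)) + (2 * N + K₁ + K₂) + (3 * k * N + N + K₃) + 2 * (K₁ + K₂ + K₃) ≡⟨ b₃ k z N K₁ K₂ K₃ ⟩
            3 * (k * (4 * z) + N + (K₁ + K₂ + K₃)) + 3 * k * N ∎))
        where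
        a₁ : ∀ k z w → 3 * (k * (4 * z)) + 3 * k * (2 * w) ≡ 6 * k * (2 * z + w)
        a₁ = solve-∀
        a₂ : ∀ k x y → 6 * k * (x + y) ≡ 3 * k * (2 * x) + 3 * k * (2 * y)
        a₂ = solve-∀
        a₃ : ∀ k n a b c w → (3 * k * n + n + a) + (3 * k * (2 * w) + n + c + n + b) + 2 * (a + b + c) ≡ 3 * (k * n + n + (a + b + c)) + 3 * k * (2 * w)
        a₃ = solve-∀
        b₁ : ∀ k x y n a b → (3 * k * (2 * x) + n + a) + (3 * k * (2 * y) + n + b) ≡ 6 * k * (x + y) + (2 * n + a + b)
        b₁ = solve-∀
        b₂ : ∀ k z w s → 6 * k * (2 * z + w) + s ≡ 3 * (k * (4 * z)) + s + 3 * k * (2 * w)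
        b₂ = solve-∀
        b₃ : ∀ k z n a b c → 3 * (k * (4 * z)) + (2 * n + a + b) + (3 * k * n + n + c) + 2 * (a + b + c) ≡ 3 * (k * (4 * z) + n + (a + b + c)) + 3 * k * n
        b₃ = solve-∀

    -- Reflection about -½ makes a shift produce the same one-sided correlations on both half-lines,
    -- apart from finitely many positions near 0.
    RS : ℤ → Bool
    RS (ℤ.+ i)   = rs i
    RS -[1+ i ] = rs i

    length-filter-applyUpTo : (p : ℤ → Bool) (f : ℕ → ℤ) → ∀ N → length (filterᵇ p (applyUpTo f N)) ≡ cnt (p ∘ f) N
    length-filter-applyUpTo p f zero    = refl
    length-filter-applyUpTo p f (suc N) with p (f 0) in eq
    ... | true  = trans (cong suc (length-filter-applyUpTo p (f ∘ suc) N))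
                    (sym (trans (cnt-front (p ∘ f) N) (cong (λ x → 𝟙 x + cnt (p ∘ f ∘ suc) N) eq)))
    ... | false = trans (length-filter-applyUpTo p (f ∘ suc) N)
                    (sym (trans (cnt-front (p ∘ f) N) (cong (λ x → 𝟙 x + cnt (p ∘ f ∘ suc) N) eq)))

    count-window : ∀ J N → count J N ≡ cnt (λ k → J (ℤ.+ k ℤ.- ℤ.+ N)) (suc (2 * N))
    count-window J N = trans (cong (length ∘ filterᵇ J) (List.map-upTo (λ k → ℤ.+ k ℤ.- ℤ.+ N) (suc (2 * N))))
      (length-filter-applyUpTo J (λ k → ℤ.+ k ℤ.- ℤ.+ N) (suc (2 * N)))

    count-sides : ∀ J N → count J N ≡ cnt (J ∘ -[1+_]) N + cnt (J ∘ ℤ.+_) (suc N)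
    count-sides J N = begin
      count J N
        ≡⟨ count-window J N ⟩
      cnt (J ∘ window) (suc (2 * N))
        ≡⟨ cong (cnt (J ∘ window)) (trans (cong suc (cong (N +_) (ℕ.+-identityʳ N))) (sym (ℕ.+-suc N N))) ⟩
      cnt (J ∘ window) (N + suc N)
        ≡⟨ cnt-split (J ∘ window) N (suc N) ⟩
      cnt (J ∘ window) N + cnt (λ i → J (window (N + i))) (suc N)
        ≡⟨ cong₂ _+_ (negative N) (cnt-cong (λ i → cong J (positive i)) (suc N)) ⟩
      cnt (J ∘ -[1+_]) N + cnt (J ∘ ℤ.+_) (suc N) ∎
      where
      open ≡-Reasoning
      window : ℕ → ℤ
      window k = ℤ.+ k ℤ.- ℤ.+ N

      positive : ∀ i → window (N + i) ≡ ℤ.+ i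
      positive i = trans (ℤ.m-n≡m⊖n (N + i) N) (trans (ℤ.⊖-≥ (ℕ.m≤m+n N i)) (cong ℤ.+_ (ℕ.m+n∸m≡n N i)))

      negative : ∀ N → cnt (λ k → J (ℤ.+ k ℤ.- ℤ.+ N)) N ≡ cnt (J ∘ -[1+_]) N
      negative zero    = refl
      negative (suc N) = trans (cnt-front (λ k → J (ℤ.+ k ℤ.- ℤ.+ suc N)) N)
        (trans (ℕ.+-comm (𝟙 (J -[1+ N ])) _) (cong (_+ 𝟙 (J -[1+ N ]))
          (trans (cnt-cong (λ k → cong J (trans (ℤ.[1+m]⊖[1+n]≡m⊖n k N) (sym (ℤ.m-n≡m⊖n k N)))) N) (negative N))))

    -- About half of the 2N + 1 points of the window lie in `RS`, but densities divide by `N`, so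
    -- the limit is 1. For the same reason the meets with translates come out as ½.
    near-RS : Near 1 (count RS)
    near-RS k = let (K , p) = small⇒near rs-small k in
      K + k , λ N → let (b , b′) = p N in subst (λ c → k * (1 * c) ≤ k * N + N + (K + k) × k * N ≤ k * (1 * c) + N + (K + k))
        (sym (count-sides RS N)) (bounds K N (cnt rs N) (𝟙 (rs N)) (𝟙≤1 (rs N)) b b′)
      where
      open ℕ.≤-Reasoning
      bounds : ∀ K N x d → d ≤ 1 → k * (2 * x) ≤ k * N + N + K → k * N ≤ k * (2 * x) + N + K →
        k * (1 * (x + (x + d))) ≤ k * N + N + (K + k) × k * N ≤ k * (1 * (x + (x + d))) + N + (K + k)
      bounds K N x d d≤1 b b′ =
          (begin
            k * (1 * (x + (x + d)))      ≡⟨ c₁ k x d ⟩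
            k * (2 * x) + k * d          ≤⟨ ℕ.+-mono-≤ b (ℕ.*-monoʳ-≤ k d≤1) ⟩
            k * N + N + K + k * 1        ≡⟨ c₂ (k * N + N) K k ⟩
            k * N + N + (K + k)          ∎)
        , (begin
            k * N                        ≤⟨ b′ ⟩
            k * (2 * x) + N + K          ≤⟨ ℕ.m≤m+n _ (k * d + k) ⟩
            k * (2 * x) + N + K + (k * d + k) ≡⟨ c₃ k x d N K ⟩
            k * (1 * (x + (x + d))) + N + (K + k) ∎)
        where
        c₁ : ∀ k x d → k * (1 * (x + (x + d))) ≡ k * (2 * x) + k * d
        c₁ = solve-∀
        c₂ : ∀ s a k → s + a + k * 1 ≡ s + (a + k)
        c₂ = solve-∀
        c₃ : ∀ k x d n a → k * (2 * x) + n + a + (k * d + k) ≡ k * (1 * (x + (x + d))) + n + (a + k)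
        c₃ = solve-∀

    RS-meet : ℤ → ℤ → Bool
    RS-meet n i = RS i ∧ shift RS n i

    private
      -- One half-line carries `both-set (suc n)` itself, the other carries it after a delay of
      -- `suc n` terms. The delay and the one extra point of the window cost only a constant.
      near-sides : ∀ (u v : ℕ → Bool) n → (∀ j → u j ≡ both-set (suc n) j) → (∀ j → v (suc n + j) ≡ both-set (suc n) j) →
        ∀ (w : ℕ → ℕ) → (∀ N → cnt u N + cnt v N ≤ w N) → (∀ N → w N ≤ cnt u N + cnt v N + 1) → Near 2 w
      near-sides u v n eu ev w lo hi = near-perturb 2 (1 + suc n) {λ N → 2 * z N}
          (λ N → begin
            2 * z N                      ≡⟨ cong (z N +_) (ℕ.+-identityʳ (z N)) ⟩
            z N + z N                    ≤⟨ ℕ.+-mono-≤ (ℕ.≤-reflexive (sym (cnt-cong eu N))) (ℕ.≤-trans (ℕ.≤-reflexive (sym (cnt-cong ev N))) (cnt-shift-≤ v (suc n) N)) ⟩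
            cnt u N + (cnt v N + suc n)  ≡⟨ ℕ.+-assoc (cnt u N) (cnt v N) (suc n) ⟨
            cnt u N + cnt v N + suc n    ≤⟨ ℕ.+-mono-≤ (lo N) (ℕ.n≤1+n (suc n)) ⟩
            w N + (1 + suc n)            ∎)
          (λ N → begin
            w N                          ≤⟨ hi N ⟩
            cnt u N + cnt v N + 1        ≤⟨ ℕ.+-monoˡ-≤ 1 (ℕ.+-mono-≤ (ℕ.≤-reflexive (cnt-cong eu N)) (ℕ.≤-trans (cnt-shift-≥ v (suc n) N) (ℕ.≤-reflexive (cong (_+ suc n) (cnt-cong ev N))))) ⟩
            z N + (z N + suc n) + 1      ≡⟨ rearrange (z N) (suc n) ⟩
            2 * z N + (1 + suc n)        ∎)
          λ k → let (K , p) = near-both n k in K , λ N → subst (λ c → k * c ≤ k * N + N + K × k * N ≤ k * c + N + K) (four (z N)) (p N)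
        where
        open ℕ.≤-Reasoning
        z : ℕ → ℕ
        z = cnt (both-set (suc n))
        four : ∀ z → 4 * z ≡ 2 * (2 * z)
        four = solve-∀
        rearrange : ∀ z s → z + (z + s) + 1 ≡ 2 * z + (1 + s)
        rearrange = solve-∀

      sides-≤ : ∀ J N → cnt (J ∘ -[1+_]) N + cnt (J ∘ ℤ.+_) N ≤ count J N
      sides-≤ J N = ℕ.≤-trans (ℕ.+-monoʳ-≤ (cnt (J ∘ -[1+_]) N) (ℕ.m≤m+n (cnt (J ∘ ℤ.+_) N) _)) (ℕ.≤-reflexive (sym (count-sides J N)))

      sides-≥ : ∀ J N → count J N ≤ cnt (J ∘ -[1+_]) N + cnt (J ∘ ℤ.+_) N + 1
      sides-≥ J N = ℕ.≤-trans (ℕ.≤-reflexive (trans (count-sides J N) (sym (ℕ.+-assoc (cnt (J ∘ -[1+_]) N) _ _))))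
        (ℕ.+-monoʳ-≤ (cnt (J ∘ -[1+_]) N + cnt (J ∘ ℤ.+_) N) (𝟙≤1 (J (ℤ.+ N))))

      sub-nonneg : ∀ m j → ℤ.+ (suc m + j) ℤ.- ℤ.+ suc m ≡ ℤ.+ j
      sub-nonneg m j = trans (ℤ.m-n≡m⊖n (suc m + j) (suc m)) (trans (ℤ.⊖-≥ (ℕ.m≤m+n (suc m) j)) (cong ℤ.+_ (ℕ.m+n∸m≡n (suc m) j)))

      add-negative : ∀ m j → -[1+ suc m + j ] ℤ.+ ℤ.+ suc m ≡ -[1+ j ]
      add-negative m j = trans (ℤ.[1+m]⊖[1+n]≡m⊖n m (suc (m + j)))
        (trans (ℤ.⊖-< (s≤s (ℕ.m≤m+n m j))) (cong (λ k → ℤ.- ℤ.+ k) (trans (ℕ.+-∸-assoc 1 (ℕ.m≤m+n m j)) (cong suc (ℕ.m+n∸m≡n m j)))))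

      meet-comm : ∀ m j → rs (suc m + j) ∧ rs j ≡ both-set (suc m) j
      meet-comm m j = trans (Bool.∧-comm (rs (suc m + j)) (rs j)) (cong (λ i → rs j ∧ rs i) (ℕ.+-comm (suc m) j))

    near-RS-meet : ∀ n → n ≢ 0ℤ → Near 2 (count (RS-meet n))
    near-RS-meet (ℤ.+ zero)  n≢0 = ⊥-elim (n≢0 refl)
    near-RS-meet (ℤ.+ suc m) _ = near-sides (J ∘ -[1+_]) (J ∘ ℤ.+_) m
        (λ j → cong (λ i → rs j ∧ rs i) (sym (ℕ.+-suc j m)))
        (λ j → trans (cong (λ i → rs (suc m + j) ∧ RS i) (sub-nonneg m j)) (meet-comm m j))
        (count J) (sides-≤ J) (sides-≥ J)
      where J = RS-meet (ℤ.+ suc m)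
    near-RS-meet -[1+ m ] _ = near-sides (J ∘ ℤ.+_) (J ∘ -[1+_]) m
        (λ j → refl)
        (λ j → trans (cong (λ i → rs (suc m + j) ∧ RS i) (add-negative m j)) (meet-comm m j))
        (count J)
        (λ N → subst (_≤ count J N) (ℕ.+-comm (cnt (J ∘ -[1+_]) N) _) (sides-≤ J N))
        (λ N → subst (λ c → count J N ≤ c + 1) (ℕ.+-comm (cnt (J ∘ -[1+_]) N) _) (sides-≥ J N))
      where J = RS-meet -[1+ m ]

    -- One-sided, because the invariant measure will count visits along the forward orbit.
    near-RS-xor : ∀ n → Near 2 (cnt λ i → RS (ℤ.+ i ℤ.- ℤ.+ suc n) xor RS (ℤ.+ i))
    near-RS-xor n = near-perturb 2 (suc n)
      (λ N → subst (_≤ cnt v N + suc n) (cnt-cong ev N) (cnt-shift-≤ v (suc n) N))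
      (λ N → subst (λ c → cnt v N ≤ c + suc n) (cnt-cong ev N) (cnt-shift-≥ v (suc n) N))
      (small⇒near (corr-small n))
      where
      v : ℕ → Bool
      v i = RS (ℤ.+ i ℤ.- ℤ.+ suc n) xor RS (ℤ.+ i)

      ev : ∀ i → v (suc n + i) ≡ corr (suc n) i
      ev i = cong₂ (λ x j → RS x xor rs j) (sub-nonneg n i) (ℕ.+-comm (suc n) i)

  open RudinShapiro

  -- Comparison of reals, densities, and infima of cuts.

  module Reals where

    open ℚSolver using (solve; _:+_; _:-_; _:*_; _:=_)

    <⇒≱ᵠ : ∀ {p q} → p ℚ.< q → ¬ q ℚ.≤ p
    <⇒≱ᵠ lt le = ℚ.<-irrefl refl (ℚ.<-≤-trans lt le)

    0≤-diff : ∀ {p q} → p ℚ.≤ q → 0ℚ ℚ.≤ q ℚ.- p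
    0≤-diff {p} {q} le = subst (ℚ._≤ q ℚ.- p) (ℚ.+-inverseʳ p) (ℚ.+-monoˡ-≤ (ℚ.- p) le)

    -- Linear inequalities are checked by exhibiting q − p as a sum of nonnegative differences.
    lin₁ : ∀ {a b p q} → a ℚ.≤ b → p ℚ.+ (b ℚ.- a) ≡ q → p ℚ.≤ q
    lin₁ {p = p} {q} le refl = subst (ℚ._≤ q) (ℚ.+-identityʳ p) (ℚ.+-monoʳ-≤ p (0≤-diff le))

    lin₂ : ∀ {a b c d p q} → a ℚ.≤ b → c ℚ.≤ d → p ℚ.+ ((b ℚ.- a) ℚ.+ (d ℚ.- c)) ≡ q → p ℚ.≤ q
    lin₂ {p = p} {q} le le′ refl = subst (ℚ._≤ q) (ℚ.+-identityʳ p) (ℚ.+-monoʳ-≤ p (ℚ.+-mono-≤ (0≤-diff le) (0≤-diff le′)))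

    half : ∀ η → 0ℚ ℚ.< η → ∃ λ δ → 0ℚ ℚ.< δ × δ ℚ.+ δ ≡ η
    half η 0<η = ½ ℚ.* η , subst (ℚ._< ½ ℚ.* η) (ℚ.*-zeroʳ ½) (ℚ.*-monoʳ-<-pos ½ 0<η) ,
      trans (sym (ℚ.*-distribʳ-+ η ½ ½)) (ℚ.*-identityˡ η)

    <-+ : ∀ p {η} → 0ℚ ℚ.< η → p ℚ.< p ℚ.+ η
    <-+ p {η} 0<η = subst (ℚ._< p ℚ.+ η) (ℚ.+-identityʳ p) (ℚ.+-monoʳ-< p 0<η)

    ≤-from-η : ∀ {p q} → (∀ η → 0ℚ ℚ.< η → p ℚ.≤ q ℚ.+ η) → p ℚ.≤ q
    ≤-from-η {p} {q} f = ℚ.≮⇒≥ λ q<p →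
      let 0<d = subst (ℚ._< p ℚ.- q) (ℚ.+-inverseʳ q) (ℚ.+-monoˡ-< (ℚ.- q) q<p)
          (δ , 0<δ , e) = half (p ℚ.- q) 0<d
      in <⇒≱ᵠ (<-+ (q ℚ.+ δ) 0<δ) (subst (ℚ._≤ q ℚ.+ δ) (trans (back p q) (trans (cong (q ℚ.+_) (sym e)) (sym (ℚ.+-assoc q δ δ)))) (f δ 0<δ))
      where
      back : ∀ p q → p ≡ q ℚ.+ (p ℚ.- q)
      back = solve 2 (λ p q → p := q :+ (p :- q)) refl

    ι : ℕ → ℚ
    ι zero    = 0ℚ
    ι (suc n) = 1ℚ ℚ.+ ι n

    ι-+ : ∀ m n → ι (m + n) ≡ ι m ℚ.+ ι n
    ι-+ zero    n = sym (ℚ.+-identityˡ (ι n))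
    ι-+ (suc m) n = trans (cong (1ℚ ℚ.+_) (ι-+ m n)) (sym (ℚ.+-assoc 1ℚ (ι m) (ι n)))

    ι-* : ∀ m n → ι (m * n) ≡ ι m ℚ.* ι n
    ι-* zero    n = sym (ℚ.*-zeroˡ (ι n))
    ι-* (suc m) n = trans (ι-+ n (m * n)) (trans (cong (ι n ℚ.+_) (ι-* m n)) (expand (ι n) (ι m)))
      where
      expand : ∀ n m → n ℚ.+ m ℚ.* n ≡ (1ℚ ℚ.+ m) ℚ.* n
      expand n m = trans (cong (ℚ._+ m ℚ.* n) (sym (ℚ.*-identityˡ n))) (sym (ℚ.*-distribʳ-+ n 1ℚ m))

    0<1 : 0ℚ ℚ.< 1ℚ
    0<1 = ℚ.positive⁻¹ 1ℚ

    0≤ι : ∀ n → 0ℚ ℚ.≤ ι n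
    0≤ι zero    = ℚ.≤-refl
    0≤ι (suc n) = ℚ.+-mono-≤ (ℚ.<⇒≤ 0<1) (0≤ι n)

    ι-mono : ∀ {m n} → m ≤ n → ι m ℚ.≤ ι n
    ι-mono {n = n} z≤n = 0≤ι n
    ι-mono (s≤s le)    = ℚ.+-monoʳ-≤ 1ℚ (ι-mono le)

    0<ι : ∀ n → 0ℚ ℚ.< ι (suc n)
    0<ι n = ℚ.<-≤-trans 0<1 (subst (ℚ._≤ ι (suc n)) (ℚ.+-identityʳ 1ℚ) (ℚ.+-monoʳ-≤ 1ℚ (0≤ι n)))

    ι-cancel : ∀ {m n} → ι m ℚ.≤ ι n → m ≤ n
    ι-cancel {m} {n} le with m ℕ.≤? n
    ... | yes m≤n = m≤n
    ... | no m≰n  = ⊥-elim (<⇒≱ᵠ (subst (ℚ._< ι (suc n)) (ℚ.+-identityˡ (ι n)) (ℚ.+-monoˡ-< (ι n) 0<1)) (ℚ.≤-trans (ι-mono (ℕ.≰⇒> m≰n)) le))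

    private
      ι-/ : ∀ n → ι n ≡ ℤ.+ n ℚ./ 1
      ι-/ zero    = refl
      ι-/ (suc n) = trans (cong (1ℚ ℚ.+_) (ι-/ n)) (ℚ.toℚᵘ-injective (ℚᵘ.≃-trans (ℚ.toℚᵘ-homo-+ 1ℚ (ℤ.+ n ℚ./ 1))
        (ℚᵘ.≃-trans (ℚᵘ.+-congʳ (ℚᵘ.mkℚᵘ (ℤ.+ 1) 0) (ℚ.toℚᵘ-fromℚᵘ (ℚᵘ.mkℚᵘ (ℤ.+ n) 0)))
          (ℚᵘ.≃-trans (ℚᵘ.*≡* (cong (λ z → z ℤ.* ℤ.+ 1) (cong (λ z → ℤ.+ 1 ℤ.+ z) (ℤ.*-identityʳ (ℤ.+ n)))))
            (ℚᵘ.≃-sym (ℚ.toℚᵘ-fromℚᵘ (ℚᵘ.mkℚᵘ (ℤ.+ suc n) 0)))))))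

    /-ι : ∀ a n → (ℤ.+ a ℚ./ suc n) ℚ.* ι (suc n) ≡ ι a
    /-ι a n = trans (cong ((ℤ.+ a ℚ./ suc n) ℚ.*_) (ι-/ (suc n))) (trans (ℚ.toℚᵘ-injective
      (ℚᵘ.≃-trans (ℚ.toℚᵘ-homo-* (ℤ.+ a ℚ./ suc n) (ℤ.+ suc n ℚ./ 1))
        (ℚᵘ.≃-trans (ℚᵘ.*-cong (ℚ.toℚᵘ-fromℚᵘ (ℚᵘ.mkℚᵘ (ℤ.+ a) n)) (ℚ.toℚᵘ-fromℚᵘ (ℚᵘ.mkℚᵘ (ℤ.+ suc n) 0)))
          (ℚᵘ.≃-trans (ℚᵘ.*≡* (trans (ℤ.*-identityʳ (ℤ.+ a ℤ.* ℤ.+ suc n)) (cong (λ k → ℤ.+ a ℤ.* ℤ.+ k) (sym (ℕ.*-identityʳ (suc n))))))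
            (ℚᵘ.≃-sym (ℚ.toℚᵘ-fromℚᵘ (ℚᵘ.mkℚᵘ (ℤ.+ a) 0))))))) (sym (ι-/ a)))

    *-mono-≤ : ∀ {p q r} → 0ℚ ℚ.≤ r → p ℚ.≤ q → p ℚ.* r ℚ.≤ q ℚ.* r
    *-mono-≤ {r = r} 0≤r le = ℚ.*-monoʳ-≤-nonNeg r ⦃ ℚ.nonNegative 0≤r ⦄ le

    *-cancel-≤ : ∀ {p q r} → 0ℚ ℚ.< r → p ℚ.* r ℚ.≤ q ℚ.* r → p ℚ.≤ q
    *-cancel-≤ {r = r} 0<r le = ℚ.*-cancelʳ-≤-pos r ⦃ ℚ.positive 0<r ⦄ le

    archimedean : ∀ ε → 0ℚ ℚ.< ε → ∃ λ n → 1ℚ ℚ.≤ ι n ℚ.* ε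
    archimedean ε 0<ε = go ε (ℚ.positive 0<ε)
      where
      go : ∀ ε → ℚ.Positive ε → ∃ λ n → 1ℚ ℚ.≤ ι n ℚ.* ε
      go ε@(ℚ.mkℚ (ℤ.+ suc a) d _) _ = suc d , subst₂ ℚ._≤_ (ℚ.+-identityʳ 1ℚ)
        (trans (sym (/-ι (suc a) d)) (trans (cong (ℚ._* ι (suc d)) (ℚ.↥p/↧p≡p ε)) (ℚ.*-comm ε (ι (suc d)))))
        (ι-mono (s≤s (z≤n {a})))

    archimedean′ : ∀ ε → 0ℚ ℚ.< ε → ∀ c → ∃ λ n → ι c ℚ.≤ ι n ℚ.* ε
    archimedean′ ε 0<ε c = let (n , p) = archimedean ε 0<ε in c * n ,
      subst₂ ℚ._≤_ (ℚ.*-identityˡ (ι c)) (trans (swap (ι n) ε (ι c)) (cong (ℚ._* ε) (sym (ι-* c n)))) (*-mono-≤ (0≤ι c) p)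
      where
      swap : ∀ n e c → n ℚ.* e ℚ.* c ≡ c ℚ.* n ℚ.* e
      swap = solve 3 (λ n e c → n :* e :* c := c :* n :* e) refl

    ceiling : ∀ q → ∃ λ n → q ℚ.≤ ι n
    ceiling q@(ℚ.mkℚ -[1+ a ] d _) = 0 , ℚ.<⇒≤ (ℚ.negative⁻¹ q)
    ceiling q@(ℚ.mkℚ (ℤ.+ a) d _) = a , *-cancel-≤ (0<ι d) (subst₂ ℚ._≤_
      (trans (sym (/-ι a d)) (cong (ℚ._* ι (suc d)) (ℚ.↥p/↧p≡p q))) (ι-* a (suc d)) (ι-mono (ℕ.m≤m*n a (suc d))))

    infix 4 _≼_

    -- On Cauchy sequences this is ≤ between reals. It makes sense for all rational sequences, so
    -- sums, multiples and constants need no Cauchy proofs.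
    record _≼_ (s t : ℕ → ℚ) : Set where
      constructor ≼-mk
      field eventually : ∀ η → 0ℚ ℚ.< η → ∃ λ N → ∀ n → N ≤ n → s n ℚ.≤ t n ℚ.+ η

    open _≼_

    κ : ℚ → ℕ → ℚ
    κ q _ = q

    _⊕_ : (ℕ → ℚ) → (ℕ → ℚ) → ℕ → ℚ
    (s ⊕ t) n = s n ℚ.+ t n

    private variable
      s t u v : ℕ → ℚ

    ≼-ev : ∀ N → (∀ n → N ≤ n → s n ℚ.≤ t n) → s ≼ t
    ≼-ev N f = ≼-mk λ η 0<η → N , λ n N≤n → ℚ.≤-trans (f n N≤n) (ℚ.<⇒≤ (<-+ _ 0<η))

    ≼-pt : (∀ n → s n ℚ.≤ t n) → s ≼ t
    ≼-pt f = ≼-ev 0 λ n _ → f n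

    ≼-eq : (∀ n → s n ≡ t n) → s ≼ t
    ≼-eq f = ≼-pt λ n → ℚ.≤-reflexive (f n)

    ≼-trans : s ≼ t → t ≼ u → s ≼ u
    ≼-trans {s} {t} {u} f g = ≼-mk λ η 0<η →
      let (δ , 0<δ , e) = half η 0<η
          (N , p) = eventually f δ 0<δ; (N′ , q) = eventually g δ 0<δ
      in N ℕ.⊔ N′ , λ n le → subst (s n ℚ.≤_) (trans (ℚ.+-assoc (u n) δ δ) (cong (u n ℚ.+_) e))
           (ℚ.≤-trans (p n (ℕ.m⊔n≤o⇒m≤o N N′ le)) (ℚ.+-monoˡ-≤ δ (q n (ℕ.m⊔n≤o⇒n≤o N N′ le))))

    ≼-⊕ : s ≼ t → u ≼ v → (s ⊕ u) ≼ (t ⊕ v)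
    ≼-⊕ {s} {t} {u} {v} f g = ≼-mk λ η 0<η →
      let (δ , 0<δ , e) = half η 0<η
          (N , p) = eventually f δ 0<δ; (N′ , q) = eventually g δ 0<δ
      in N ℕ.⊔ N′ , λ n le → subst (s n ℚ.+ u n ℚ.≤_) (trans (swap (t n) δ (v n)) (cong ((t n ℚ.+ v n) ℚ.+_) e))
           (ℚ.+-mono-≤ (p n (ℕ.m⊔n≤o⇒m≤o N N′ le)) (q n (ℕ.m⊔n≤o⇒n≤o N N′ le)))
      where
      swap : ∀ t d v → (t ℚ.+ d) ℚ.+ (v ℚ.+ d) ≡ (t ℚ.+ v) ℚ.+ (d ℚ.+ d)
      swap = solve 3 (λ t d v → (t :+ d) :+ (v :+ d) := (t :+ v) :+ (d :+ d)) refl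

    ≼-neg : s ≼ t → (λ n → ℚ.- t n) ≼ (λ n → ℚ.- s n)
    ≼-neg {s} {t} f = ≼-mk λ η 0<η → let (N , p) = eventually f η 0<η in N , λ n le → lin₁ (p n le) (swap (s n) (t n) η)
      where
      swap : ∀ s t e → ℚ.- t ℚ.+ ((t ℚ.+ e) ℚ.- s) ≡ ℚ.- s ℚ.+ e
      swap = solve 3 (λ s t e → (:- t) :+ ((t :+ e) :- s) := (:- s) :+ e) refl
        where open ℚSolver using (:-_)

    ≼-κ : ∀ {p q} → κ p ≼ κ q → p ℚ.≤ q
    ≼-κ f = ≤-from-η λ η 0<η → let (N , p) = eventually f η 0<η in p N ℕ.≤-refl

    κ-mono : ∀ {p q} → p ℚ.≤ q → κ p ≼ κ q
    κ-mono le = ≼-pt λ _ → le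

    private
      ∣∣-bounds : ∀ p {ε} → ℚ.∣ p ∣ ℚ.< ε → p ℚ.< ε × ℚ.- p ℚ.< ε
      ∣∣-bounds p lt with ℚ.∣p∣≡p∨∣p∣≡-p p
      ... | inj₁ e = subst (ℚ._< _) e lt , ℚ.≤-<-trans (ℚ.≤-trans (ℚ.neg-antimono-≤ (ℚ.∣p∣≡p⇒0≤p e)) (ℚ.∣p∣≡p⇒0≤p e)) (subst (ℚ._< _) e lt)
      ... | inj₂ e = ℚ.≤-<-trans p≤-p (subst (ℚ._< _) e lt) , subst (ℚ._< _) e lt
        where
        0≤-p : 0ℚ ℚ.≤ ℚ.- p
        0≤-p = subst (0ℚ ℚ.≤_) e (ℚ.0≤∣p∣ p)
        p≤-p : p ℚ.≤ ℚ.- p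
        p≤-p = lin₂ 0≤-p 0≤-p (ident p)
          where
          open ℚSolver using (:-_; con)
          ident : ∀ p → p ℚ.+ ((ℚ.- p ℚ.- 0ℚ) ℚ.+ (ℚ.- p ℚ.- 0ℚ)) ≡ ℚ.- p
          ident = solve 1 (λ p → p :+ (((:- p) :- con 0ℚ) :+ ((:- p) :- con 0ℚ)) := (:- p)) refl

      ∣∣-< : ∀ p {ε} → p ℚ.< ε → ℚ.- p ℚ.< ε → ℚ.∣ p ∣ ℚ.< ε
      ∣∣-< p lt lt′ with ℚ.∣p∣≡p∨∣p∣≡-p p
      ... | inj₁ e = subst (ℚ._< _) (sym e) lt
      ... | inj₂ e = subst (ℚ._< _) (sym e) lt′

      ∣-∣-≤ : ∀ p q {ε} → ℚ.∣ p ℚ.- q ∣ ℚ.< ε → p ℚ.≤ q ℚ.+ ε × q ℚ.≤ p ℚ.+ ε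
      ∣-∣-≤ p q {ε} lt = let (a , b) = ∣∣-bounds (p ℚ.- q) lt in
        lin₁ (ℚ.<⇒≤ a) (one p q ε) , lin₁ (ℚ.<⇒≤ b) (two p q ε)
        where
        open ℚSolver using (:-_)
        one : ∀ p q e → p ℚ.+ (e ℚ.- (p ℚ.- q)) ≡ q ℚ.+ e
        one = solve 3 (λ p q e → p :+ (e :- (p :- q)) := q :+ e) refl
        two : ∀ p q e → q ℚ.+ (e ℚ.- ℚ.- (p ℚ.- q)) ≡ p ℚ.+ e
        two = solve 3 (λ p q e → q :+ (e :- (:- (p :- q))) := p :+ e) refl

    ≃⇒≼ : ∀ x y → x ≃ y → seq x ≼ seq y
    ≃⇒≼ x y e = ≼-mk λ η 0<η → let (N , p) = e η 0<η in N , λ n le → proj₁ (∣-∣-≤ (seq x n) (seq y n) (p n le))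

    ≃⇒≽ : ∀ x y → x ≃ y → seq y ≼ seq x
    ≃⇒≽ x y e = ≼-mk λ η 0<η → let (N , p) = e η 0<η in N , λ n le → proj₂ (∣-∣-≤ (seq x n) (seq y n) (p n le))

    ≼⇒≃ : ∀ x y → seq x ≼ seq y → seq y ≼ seq x → x ≃ y
    ≼⇒≃ x y f g ε 0<ε =
      let (δ , 0<δ , e) = half ε 0<ε
          (N , p) = eventually f δ 0<δ; (N′ , q) = eventually g δ 0<δ
          δ<ε = subst (δ ℚ.<_) e (<-+ δ 0<δ)
      in N ℕ.⊔ N′ , λ n le → ∣∣-< _
           (ℚ.≤-<-trans (lin₁ (p n (ℕ.m⊔n≤o⇒m≤o N N′ le)) (one (seq x n) (seq y n) δ)) δ<ε)
           (ℚ.≤-<-trans (lin₁ (q n (ℕ.m⊔n≤o⇒n≤o N N′ le)) (two (seq x n) (seq y n) δ)) δ<ε)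
      where
      open ℚSolver using (:-_)
      one : ∀ x y d → (x ℚ.- y) ℚ.+ ((y ℚ.+ d) ℚ.- x) ≡ d
      one = solve 3 (λ x y d → (x :- y) :+ ((y :+ d) :- x) := d) refl
      two : ∀ x y d → ℚ.- (x ℚ.- y) ℚ.+ ((x ℚ.+ d) ℚ.- y) ≡ d
      two = solve 3 (λ x y d → (:- (x :- y)) :+ ((x :+ d) :- y) := d) refl

    ≼⇒≤ᴿ : ∀ x y → seq x ≼ seq y → x ≤ᴿ y
    ≼⇒≤ᴿ x y f (ε , 0<ε , N , p) =
      let (δ , 0<δ , e) = half ε 0<ε
          (N′ , q) = eventually f δ 0<δ
          n = N ℕ.⊔ N′
      in <⇒≱ᵠ (subst (seq y n ℚ.+ δ ℚ.<_) (trans (ℚ.+-assoc (seq y n) δ δ) (cong (seq y n ℚ.+_) e)) (<-+ (seq y n ℚ.+ δ) 0<δ))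
           (ℚ.≤-trans (p n (ℕ.m≤m⊔n N N′)) (q n (ℕ.m≤n⊔m N N′)))

    <ᴿ⇒≼ : ∀ x y → x <ᴿ y → seq x ≼ seq y
    <ᴿ⇒≼ x y (ε , 0<ε , N , p) = ≼-ev N λ n le → ℚ.≤-trans (ℚ.<⇒≤ (<-+ (seq x n) 0<ε)) (p n le)

    approx : ∀ x δ → 0ℚ ℚ.< δ → ∃ λ r → κ r ≼ seq x × seq x ≼ κ (r ℚ.+ δ)
    approx x δ 0<δ =
      let (γ , 0<γ , e) = half δ 0<δ
          (N , p) = cauchy x γ 0<γ
      in seq x N ℚ.- γ ,
         ≼-ev N (λ n le → lin₁ (proj₂ (∣-∣-≤ (seq x n) (seq x N) (p n N le ℕ.≤-refl))) (one (seq x N) γ (seq x n))) ,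
         ≼-ev N (λ n le → lin₁ (proj₁ (∣-∣-≤ (seq x n) (seq x N) (p n N le ℕ.≤-refl)))
                            (trans (two (seq x n) γ (seq x N)) (cong (λ d → seq x N ℚ.- γ ℚ.+ d) e)))
      where
      one : ∀ a g b → (a ℚ.- g) ℚ.+ ((b ℚ.+ g) ℚ.- a) ≡ b
      one = solve 3 (λ a g b → (a :- g) :+ ((b :+ g) :- a) := b) refl
      two : ∀ b g a → b ℚ.+ ((a ℚ.+ g) ℚ.- b) ≡ a ℚ.- g ℚ.+ (g ℚ.+ g)
      two = solve 3 (λ b g a → b :+ ((a :+ g) :- b) := a :- g :+ (g :+ g)) refl

    ≼-<-≼ : ∀ x y {p q} → seq x ≼ κ p → p ℚ.< q → κ q ≼ seq y → x <ᴿ y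
    ≼-<-≼ x y {p} {q} f p<q g =
      let 0<d = subst (ℚ._< q ℚ.- p) (ℚ.+-inverseʳ p) (ℚ.+-monoˡ-< (ℚ.- p) p<q)
          (δ , 0<δ , e) = half (q ℚ.- p) 0<d
          (γ , 0<γ , e′) = half δ 0<δ
          (N , a) = eventually f γ 0<γ; (N′ , b) = eventually g γ 0<γ
      in δ , 0<δ , N ℕ.⊔ N′ , λ n le → lin₂ (a n (ℕ.m⊔n≤o⇒m≤o N N′ le)) (b n (ℕ.m⊔n≤o⇒n≤o N N′ le))
           (trans (ident (seq x n) δ p γ (seq y n) q) (trans (cong₂ (λ h d → seq y n ℚ.+ (δ ℚ.+ h) ℚ.- d) e′ (sym e)) (cancel (seq y n) δ)))
      where
      ident : ∀ x δ p γ y q → (x ℚ.+ δ) ℚ.+ (((p ℚ.+ γ) ℚ.- x) ℚ.+ ((y ℚ.+ γ) ℚ.- q)) ≡ y ℚ.+ (δ ℚ.+ (γ ℚ.+ γ)) ℚ.- (q ℚ.- p)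
      ident = solve 6 (λ x δ p γ y q → (x :+ δ) :+ (((p :+ γ) :- x) :+ ((y :+ γ) :- q)) := y :+ (δ :+ (γ :+ γ)) :- (q :- p)) refl
      cancel : ∀ y δ → y ℚ.+ (δ ℚ.+ δ) ℚ.- (δ ℚ.+ δ) ≡ y
      cancel = solve 2 (λ y δ → y :+ (δ :+ δ) :- (δ :+ δ) := y) refl

    ≼-η : (∀ δ → 0ℚ ℚ.< δ → s ≼ (t ⊕ κ δ)) → s ≼ t
    ≼-η {s} {t} f = ≼-mk λ η 0<η →
      let (δ , 0<δ , e) = half η 0<η; (N , p) = eventually (f δ 0<δ) δ 0<δ in
      N , λ n le → subst (s n ℚ.≤_) (trans (ℚ.+-assoc (t n) δ δ) (cong (t n ℚ.+_) e)) (p n le)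

    -- Since `≤ᴿ` is a negation, rational approximations are compared: if that of `x` exceeded that
    -- of `y` by more than `δ`, then `y <ᴿ x` would hold with an explicit gap.
    ≤ᴿ⇒≼ : ∀ x y → x ≤ᴿ y → seq x ≼ seq y
    ≤ᴿ⇒≼ x y x≤y = ≼-η λ η 0<η →
      let (δ , 0<δ , e) = half η 0<η
          (a , a≼x , x≼a) = approx x δ 0<δ
          (b , b≼y , y≼b) = approx y δ 0<δ
          a≤ : a ℚ.≤ b ℚ.+ δ
          a≤ = ℚ.≮⇒≥ λ lt → x≤y (≼-<-≼ y x y≼b lt a≼x)
      in ≼-trans {seq x} {κ (a ℚ.+ δ)} x≼a (≼-trans {κ (a ℚ.+ δ)} {κ (b ℚ.+ η)}
           (κ-mono (lin₁ a≤ (trans (move a b δ) (cong (b ℚ.+_) e)))) (≼-⊕ {κ b} {seq y} {κ η} {κ η} b≼y (≼-pt λ _ → ℚ.≤-refl)))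
      where
      move : ∀ a b d → (a ℚ.+ d) ℚ.+ ((b ℚ.+ d) ℚ.- a) ≡ b ℚ.+ (d ℚ.+ d)
      move = solve 3 (λ a b d → (a :+ d) :+ ((b :+ d) :- a) := b :+ (d :+ d)) refl

    0<ᴿ⇒κ : ∀ ε → 0ℝ <ᴿ ε → ∃ λ δ → 0ℚ ℚ.< δ × κ δ ≼ seq ε
    0<ᴿ⇒κ ε (δ , 0<δ , N , p) = δ , 0<δ , ≼-ev N λ n le → subst (ℚ._≤ seq ε n) (ℚ.+-identityˡ δ) (p n le)

    hasLimit : ∀ (x : ℕ → ℝ) l → (∀ δ → 0ℚ ℚ.< δ → ∃ λ N → ∀ n → N ≤ n → seq (x n) ≼ (seq l ⊕ κ δ) × seq l ≼ (seq (x n) ⊕ κ δ)) → HasLimit x l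
    hasLimit x l f ε 0<ε =
      let (ε₀ , 0<ε₀ , le) = 0<ᴿ⇒κ ε 0<ε
          (δ , 0<δ , e) = half ε₀ 0<ε₀
          (N , p) = f δ 0<δ
          δ<ε₀ = subst (δ ℚ.<_) e (<-+ δ 0<δ)
      in N , λ n N≤n → let (a , b) = p n N≤n in
           ≼-<-≼ (x n -ᴿ l) ε (sub (seq (x n)) (seq l) δ a) δ<ε₀ le , ≼-<-≼ (l -ᴿ x n) ε (sub (seq l) (seq (x n)) δ b) δ<ε₀ le
      where
      sub : ∀ s t δ → s ≼ (t ⊕ κ δ) → (λ n → s n ℚ.+ ℚ.- t n) ≼ κ δ
      sub s t δ f = ≼-mk λ η 0<η → let (N , p) = eventually f η 0<η in N , λ n le → lin₁ (p n le) (ident (s n) (t n) δ η)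
        where
        ident : ∀ s t d e → (s ℚ.- t) ℚ.+ ((t ℚ.+ d) ℚ.+ e ℚ.- s) ≡ d ℚ.+ e
        ident = solve 4 (λ s t d e → (s :- t) :+ ((t :+ d) :+ e :- s) := d :+ e) refl

    hasLimit⁻¹ : ∀ (x : ℕ → ℝ) l → HasLimit x l → ∀ δ → 0ℚ ℚ.< δ →
                 ∃ λ N → ∀ n → N ≤ n → seq (x n) ≼ (seq l ⊕ κ δ) × seq l ≼ (seq (x n) ⊕ κ δ)
    hasLimit⁻¹ x l lim δ 0<δ =
      let (N , p) = lim (fromℚ δ) (δ , 0<δ , 0 , λ n _ → ℚ.≤-reflexive (ℚ.+-identityˡ δ)) in
      N , λ n le → let (a , b) = p n le in
        add (seq (x n)) (seq l) (<ᴿ⇒≼ (x n -ᴿ l) (fromℚ δ) a) , add (seq l) (seq (x n)) (<ᴿ⇒≼ (l -ᴿ x n) (fromℚ δ) b)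
      where
      add : ∀ s t → (λ n → s n ℚ.+ ℚ.- t n) ≼ κ δ → s ≼ (t ⊕ κ δ)
      add s t f = ≼-mk λ η 0<η → let (N , p) = eventually f η 0<η in N , λ n le → lin₁ (p n le) (ident (s n) (t n) δ η)
        where
        ident : ∀ s t d e → s ℚ.+ (d ℚ.+ e ℚ.- (s ℚ.- t)) ≡ (t ℚ.+ d) ℚ.+ e
        ident = solve 4 (λ s t d e → s :+ (d :+ e :- (s :- t)) := (t :+ d) :+ e) refl

    near⇒density : ∀ q (J : ℤ → Bool) r → r ℚ.* ι (suc q) ≡ 1ℚ → Near (suc q) (count J) → HasDensity J (fromℚ r)
    near⇒density q J r rq near = hasLimit (λ n → fromℚ (ℤ.+ count J (suc n) ℚ./ suc n)) (fromℚ r) λ δ 0<δ →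
      -- Once `K ≤ N`, the error `N + K` is at most 2N; divided by kN it has to stay within `δ`.
      let (k , 2≤) = archimedean′ δ 0<δ 2
          (K , p) = near k
      in K , λ n K≤n → let (b , b′) = p (suc n); c = count J (suc n); x = ℤ.+ c ℚ./ suc n in
           ≼-pt (λ _ → upper δ k c n K x 2≤ (/-ι c n) (ℕ.≤-trans K≤n (ℕ.n≤1+n n)) b) ,
           ≼-pt (λ _ → lower′ δ k c n K x 2≤ (/-ι c n) (ℕ.≤-trans K≤n (ℕ.n≤1+n n)) b′)
      where
      open ℚ.≤-Reasoning
      Q = ι (suc q)

      1≤Q : 1ℚ ℚ.≤ Q
      1≤Q = subst (ℚ._≤ Q) (ℚ.+-identityʳ 1ℚ) (ℚ.+-monoʳ-≤ 1ℚ (0≤ι q))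

      two : ∀ k N → k * N + N + N ≡ k * N + 2 * N
      two = solve-∀

      scale : ∀ δ k n → ι 2 ℚ.≤ ι k ℚ.* δ → ι 2 ℚ.* ι (suc n) ℚ.≤ δ ℚ.* (ι k ℚ.* Q ℚ.* ι (suc n))
      scale δ k n 2≤ = begin
        ι 2 ℚ.* ι (suc n)                    ≤⟨ *-mono-≤ (0≤ι (suc n)) 2≤ ⟩
        ι k ℚ.* δ ℚ.* ι (suc n)              ≡⟨ ℚ.*-identityˡ _ ⟨
        1ℚ ℚ.* (ι k ℚ.* δ ℚ.* ι (suc n))     ≤⟨ *-mono-≤ nonneg 1≤Q ⟩
        Q ℚ.* (ι k ℚ.* δ ℚ.* ι (suc n))      ≡⟨ swap Q (ι k) δ (ι (suc n)) ⟩
        δ ℚ.* (ι k ℚ.* Q ℚ.* ι (suc n))      ∎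
        where
        nonneg : 0ℚ ℚ.≤ ι k ℚ.* δ ℚ.* ι (suc n)
        nonneg = ℚ.≤-trans (subst (ℚ._≤ ι 2 ℚ.* ι (suc n)) (ℚ.*-zeroˡ (ι (suc n))) (*-mono-≤ (0≤ι (suc n)) (0≤ι 2))) (*-mono-≤ (0≤ι (suc n)) 2≤)
        swap : ∀ a b c d → a ℚ.* (b ℚ.* c ℚ.* d) ≡ c ℚ.* (b ℚ.* a ℚ.* d)
        swap = solve 4 (λ a b c d → a :* (b :* c :* d) := c :* (b :* a :* d)) refl

      cancelled : ∀ δ k n {x y} → ι 2 ℚ.≤ ι k ℚ.* δ → x ℚ.* (ι k ℚ.* Q ℚ.* ι (suc n)) ℚ.≤ y ℚ.* (ι k ℚ.* Q ℚ.* ι (suc n)) → x ℚ.≤ y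
      cancelled δ zero    n 2≤ le = ⊥-elim (<⇒≱ᵠ (0<ι 1) (subst (ι 2 ℚ.≤_) (ℚ.*-zeroˡ δ) 2≤))
      cancelled δ (suc k) n 2≤ le = *-cancel-≤ (ℚ.positive⁻¹ _ ⦃ ℚ.pos*pos⇒pos (ι (suc k) ℚ.* Q)
        ⦃ ℚ.pos*pos⇒pos (ι (suc k)) ⦃ ℚ.positive (0<ι k) ⦄ Q ⦃ ℚ.positive (0<ι q) ⦄ ⦄ (ι (suc n)) ⦃ ℚ.positive (0<ι n) ⦄ ⦄) le

      value : ∀ k c n {x} → x ℚ.* ι (suc n) ≡ ι c → x ℚ.* (ι k ℚ.* Q ℚ.* ι (suc n)) ≡ ι (k * (suc q * c))
      value k c n {x} e = trans (swap x (ι k) Q (ι (suc n))) (trans (cong (ι k ℚ.* Q ℚ.*_) e)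
        (trans (ℚ.*-assoc (ι k) Q (ι c)) (sym (trans (ι-* k (suc q * c)) (cong (ι k ℚ.*_) (ι-* (suc q) c))))))
        where
        swap : ∀ x k q n → x ℚ.* (k ℚ.* q ℚ.* n) ≡ k ℚ.* q ℚ.* (x ℚ.* n)
        swap = solve 4 (λ x k q n → x :* (k :* q :* n) := k :* q :* (x :* n)) refl

      main : ∀ k n → r ℚ.* (ι k ℚ.* Q ℚ.* ι (suc n)) ≡ ι (k * suc n)
      main k n = trans (swap r (ι k) Q (ι (suc n))) (trans (cong (ℚ._* (ι k ℚ.* ι (suc n))) rq)
        (trans (ℚ.*-identityˡ _) (sym (ι-* k (suc n)))))
        where
        swap : ∀ r k q n → r ℚ.* (k ℚ.* q ℚ.* n) ≡ r ℚ.* q ℚ.* (k ℚ.* n)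
        swap = solve 4 (λ r k q n → r :* (k :* q :* n) := r :* q :* (k :* n)) refl

      upper : ∀ δ k c n K x → ι 2 ℚ.≤ ι k ℚ.* δ → x ℚ.* ι (suc n) ≡ ι c → K ≤ suc n →
              k * (suc q * c) ≤ k * suc n + suc n + K → x ℚ.≤ r ℚ.+ δ
      upper δ k c n K x 2≤ e K≤ b = cancelled δ k n 2≤ (begin
        x ℚ.* (ι k ℚ.* Q ℚ.* ι (suc n))                    ≡⟨ value k c n {x} e ⟩
        ι (k * (suc q * c))                                ≤⟨ ι-mono (ℕ.≤-trans b (ℕ.≤-trans (ℕ.+-monoʳ-≤ _ K≤) (ℕ.≤-reflexive (two k (suc n))))) ⟩
        ι (k * suc n + 2 * suc n)                          ≡⟨ ι-+ (k * suc n) (2 * suc n) ⟩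
        ι (k * suc n) ℚ.+ ι (2 * suc n)                    ≡⟨ cong₂ ℚ._+_ (sym (main k n)) (ι-* 2 (suc n)) ⟩
        r ℚ.* (ι k ℚ.* Q ℚ.* ι (suc n)) ℚ.+ ι 2 ℚ.* ι (suc n) ≤⟨ ℚ.+-monoʳ-≤ (r ℚ.* (ι k ℚ.* Q ℚ.* ι (suc n))) (scale δ k n 2≤) ⟩
        r ℚ.* (ι k ℚ.* Q ℚ.* ι (suc n)) ℚ.+ δ ℚ.* (ι k ℚ.* Q ℚ.* ι (suc n)) ≡⟨ ℚ.*-distribʳ-+ _ r δ ⟨
        (r ℚ.+ δ) ℚ.* (ι k ℚ.* Q ℚ.* ι (suc n))            ∎)

      lower′ : ∀ δ k c n K x → ι 2 ℚ.≤ ι k ℚ.* δ → x ℚ.* ι (suc n) ≡ ι c → K ≤ suc n →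
              k * suc n ≤ k * (suc q * c) + suc n + K → r ℚ.≤ x ℚ.+ δ
      lower′ δ k c n K x 2≤ e K≤ b = cancelled δ k n 2≤ (begin
        r ℚ.* (ι k ℚ.* Q ℚ.* ι (suc n))                    ≡⟨ main k n ⟩
        ι (k * suc n)                                      ≤⟨ ι-mono (ℕ.≤-trans b (ℕ.≤-trans (ℕ.+-monoʳ-≤ _ K≤) (ℕ.≤-reflexive (ℕ.+-assoc (k * (suc q * c)) (suc n) (suc n))))) ⟩
        ι (k * (suc q * c) + (suc n + suc n))              ≡⟨ cong (λ m → ι (k * (suc q * c) + (suc n + m))) (sym (ℕ.+-identityʳ (suc n))) ⟩
        ι (k * (suc q * c) + 2 * suc n)                    ≡⟨ ι-+ (k * (suc q * c)) (2 * suc n) ⟩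
        ι (k * (suc q * c)) ℚ.+ ι (2 * suc n)              ≡⟨ cong₂ ℚ._+_ (sym (value k c n {x} e)) (ι-* 2 (suc n)) ⟩
        x ℚ.* (ι k ℚ.* Q ℚ.* ι (suc n)) ℚ.+ ι 2 ℚ.* ι (suc n) ≤⟨ ℚ.+-monoʳ-≤ (x ℚ.* (ι k ℚ.* Q ℚ.* ι (suc n))) (scale δ k n 2≤) ⟩
        x ℚ.* (ι k ℚ.* Q ℚ.* ι (suc n)) ℚ.+ δ ℚ.* (ι k ℚ.* Q ℚ.* ι (suc n)) ≡⟨ ℚ.*-distribʳ-+ _ x δ ⟨
        (x ℚ.+ δ) ℚ.* (ι k ℚ.* Q ℚ.* ι (suc n))            ∎)

    RS-wide : Wide (fromℚ ½) RS
    RS-wide n n≢0 = fromℚ 1ℚ , fromℚ ½ , near⇒density 0 RS 1ℚ refl near-RS , near⇒density 1 (RS-meet n) ½ refl (near-RS-meet n n≢0) ,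
      ≼⇒≤ᴿ (fromℚ ½) (fromℚ 1ℚ -ᴿ fromℚ ½) (≼-pt λ _ → ℚ.≤-refl)

    pow : ℕ → ℚ
    pow zero    = 1ℚ
    pow (suc n) = ½ ℚ.* pow n

    0<pow : ∀ n → 0ℚ ℚ.< pow n
    0<pow zero    = 0<1
    0<pow (suc n) = subst (ℚ._< ½ ℚ.* pow n) (ℚ.*-zeroʳ ½) (ℚ.*-monoʳ-<-pos ½ (0<pow n))

    pow-halves : ∀ n → pow (suc n) ℚ.+ pow (suc n) ≡ pow n
    pow-halves n = trans (sym (ℚ.*-distribʳ-+ (pow n) ½ ½)) (ℚ.*-identityˡ (pow n))

    private
      pow-bound : ∀ n → ι (suc n) ℚ.* pow n ℚ.≤ 1ℚ
      pow-bound zero    = ℚ.≤-refl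
      pow-bound (suc n) = ℚ.≤-trans (lin₁ (subst (ℚ._≤ ι (suc n) ℚ.* pow (suc n)) (ℚ.*-identityˡ (pow (suc n))) (*-mono-≤ (ℚ.<⇒≤ (0<pow (suc n))) one≤))
          (trans (ident (ι (suc n)) (pow (suc n))) (cong (ι (suc n) ℚ.*_) (pow-halves n)))) (pow-bound n)
        where
        one≤ : 1ℚ ℚ.≤ ι (suc n)
        one≤ = subst (ℚ._≤ ι (suc n)) (ℚ.+-identityʳ 1ℚ) (ℚ.+-monoʳ-≤ 1ℚ (0≤ι n))
        ident : ∀ m p → (1ℚ ℚ.+ m) ℚ.* p ℚ.+ (m ℚ.* p ℚ.- p) ≡ m ℚ.* (p ℚ.+ p)
        ident m p = trans (cong (ℚ._+ (m ℚ.* p ℚ.- p)) (trans (ℚ.*-distribʳ-+ p 1ℚ m) (cong (ℚ._+ m ℚ.* p) (ℚ.*-identityˡ p)))) (rest m p)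
          where
          rest : ∀ m p → (p ℚ.+ m ℚ.* p) ℚ.+ (m ℚ.* p ℚ.- p) ≡ m ℚ.* (p ℚ.+ p)
          rest = solve 2 (λ m p → (p :+ m :* p) :+ (m :* p :- p) := m :* (p :+ p)) refl

    pow-small : ∀ ε → 0ℚ ℚ.< ε → ∃ λ N → ∀ n → N ≤ n → pow n ℚ.≤ ε
    pow-small ε 0<ε = let (N , p) = archimedean ε 0<ε in N , λ n N≤n →
      *-cancel-≤ (0<ι n) (subst₂ ℚ._≤_ (ℚ.*-comm (ι (suc n)) (pow n)) (ℚ.*-comm (ι (suc n)) ε)
        (ℚ.≤-trans (pow-bound n) (ℚ.≤-trans p (*-mono-≤ (ℚ.<⇒≤ 0<ε) (ι-mono (ℕ.m≤n⇒m≤1+n N≤n))))))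

    leastℕ : (P : ℕ → Set) → ∃ P → ∃ λ n → P n × (∀ m → m < n → ¬ P m)
    leastℕ P (n , p) = go n (ℕ.<-wellFounded n) p
      where
      go : ∀ n → Acc _<_ n → P n → ∃ λ n → P n × (∀ m → m < n → ¬ P m)
      go n (acc rec) p with decide (∃ λ m → m < n × P m)
      ... | yes (m , m<n , q) = go m (rec m<n) q
      ... | no none = n , p , λ m m<n q → none (m , m<n , q)

    record Cut (P : ℚ → Set) : Set where
      field
        upward : ∀ {r s} → r ℚ.≤ s → P r → P s
        one    : P 1ℚ
        nonneg : ∀ {r} → r ℚ.< 0ℚ → ¬ P r

      -- Take the least multiple of `δ` in the cut, which exists because some multiple reaches 1.
      near : ∀ δ → 0ℚ ℚ.< δ → ∃ λ r → P r × ¬ P (r ℚ.- δ)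
      near δ 0<δ =
        let (k , 1≤) = archimedean δ 0<δ
            (m , p , min) = leastℕ (λ m → P (ι m ℚ.* δ)) (k , upward 1≤ one)
        in ι m ℚ.* δ , p , before m min
        where
        before : ∀ m → (∀ j → j < m → ¬ P (ι j ℚ.* δ)) → ¬ P (ι m ℚ.* δ ℚ.- δ)
        before zero    min = nonneg (subst (ℚ._< 0ℚ) (sym (trans (cong (ℚ._- δ) (ℚ.*-zeroˡ δ)) (ℚ.+-identityˡ (ℚ.- δ)))) (ℚ.neg-antimono-< 0<δ))
        before (suc m) min p = min m ℕ.≤-refl (subst P (trans (cong (ℚ._- δ) (trans (ℚ.*-distribʳ-+ δ 1ℚ (ι m)) (cong (ℚ._+ ι m ℚ.* δ) (ℚ.*-identityˡ δ)))) (ident δ (ι m ℚ.* δ))) p)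
          where
          ident : ∀ d m → (d ℚ.+ m) ℚ.- d ≡ m
          ident = solve 2 (λ d m → (d :+ m) :- d := m) refl

      private
        q : ℕ → ℚ
        q n = proj₁ (near (pow n) (0<pow n))

        above : ∀ {r s} → P r → ¬ P s → s ℚ.≤ r
        above p ¬p = ℚ.≮⇒≥ λ r<s → ¬p (upward (ℚ.<⇒≤ r<s) p)

        q-near : ∀ m n → q m ℚ.≤ q n ℚ.+ pow m
        q-near m n = lin₁ (above (proj₁ (proj₂ (near (pow n) (0<pow n)))) (proj₂ (proj₂ (near (pow m) (0<pow m))))) (ident (q m) (q n) (pow m))
          where
          ident : ∀ m n p → m ℚ.+ (n ℚ.- (m ℚ.- p)) ≡ n ℚ.+ p
          ident = solve 3 (λ m n p → m :+ (n :- (m :- p)) := n :+ p) refl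

      infimum : ℝ
      infimum = mkℝ q λ ε 0<ε →
        let (δ , 0<δ , e) = half ε 0<ε
            (N , small) = pow-small δ 0<δ
            δ<ε = subst (δ ℚ.<_) e (<-+ δ 0<δ)
        in N , λ m n N≤m N≤n → ∣∣-< (q m ℚ.- q n)
             (ℚ.≤-<-trans (lin₁ (ℚ.≤-trans (q-near m n) (ℚ.+-monoʳ-≤ (q n) (small m N≤m))) (one′ (q m) (q n) δ)) δ<ε)
             (ℚ.≤-<-trans (lin₁ (ℚ.≤-trans (q-near n m) (ℚ.+-monoʳ-≤ (q m) (small n N≤n))) (two′ (q m) (q n) δ)) δ<ε)
        where
        open ℚSolver using (:-_)
        one′ : ∀ m n d → (m ℚ.- n) ℚ.+ ((n ℚ.+ d) ℚ.- m) ≡ d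
        one′ = solve 3 (λ m n d → (m :- n) :+ ((n :+ d) :- m) := d) refl
        two′ : ∀ m n d → ℚ.- (m ℚ.- n) ℚ.+ ((m ℚ.+ d) ℚ.- n) ≡ d
        two′ = solve 3 (λ m n d → (:- (m :- n)) :+ ((m :+ d) :- n) := d) refl

      infimum-≤ : ∀ {r} → P r → seq infimum ≼ κ r
      infimum-≤ {r} p = ≼-mk λ η 0<η → let (N , small) = pow-small η 0<η in N , λ n N≤n →
        lin₂ (above p (proj₂ (proj₂ (near (pow n) (0<pow n))))) (small n N≤n) (ident (q n) (pow n) r η)
        where
        ident : ∀ q p r e → q ℚ.+ ((r ℚ.- (q ℚ.- p)) ℚ.+ (e ℚ.- p)) ≡ r ℚ.+ e
        ident = solve 4 (λ q p r e → q :+ ((r :- (q :- p)) :+ (e :- p)) := r :+ e) refl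

      infimum-≥ : ∀ {r} → ¬ P r → κ r ≼ seq infimum
      infimum-≥ ¬p = ≼-pt λ n → above (proj₁ (proj₂ (near (pow n) (0<pow n)))) ¬p

    -- A bounded nondecreasing sequence: growth by ε infinitely often would be unbounded.
    bounded-tail : (S : ℕ → ℚ) (C : ℕ) → (∀ n → S n ℚ.≤ S (suc n)) → 0ℚ ℚ.≤ S 0 → (∀ n → S n ℚ.≤ ι C) →
                   ∀ ε → 0ℚ ℚ.< ε → ∃ λ n → ∀ m → n ≤ m → S m ℚ.≤ S n ℚ.+ ε
    bounded-tail S C mono 0≤S bound ε 0<ε = dne λ none →
      let step : ∀ n → ∃ λ m → S n ℚ.+ ε ℚ.< S m
          step n = let (m , p) = ¬∀⇒∃ λ all → none (n , all); (_ , q) = ¬⇒×¬ p in m , ℚ.≰⇒> q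
          grow : ∀ j → ∃ λ n → ι j ℚ.* ε ℚ.≤ S n
          grow = λ j → iterate step j
          (k , big) = archimedean′ ε 0<ε (suc C)
          (n , p) = grow k
      in ℕ.n≮n C (ι-cancel (ℚ.≤-trans big (ℚ.≤-trans p (bound n))))
      where
      iterate : (∀ n → ∃ λ m → S n ℚ.+ ε ℚ.< S m) → ∀ j → ∃ λ n → ι j ℚ.* ε ℚ.≤ S n
      iterate step zero    = 0 , subst (ℚ._≤ S 0) (sym (ℚ.*-zeroˡ ε)) 0≤S
      iterate step (suc j) = let (n , p) = iterate step j; (m , q) = step n in
        m , ℚ.≤-trans (lin₁ p (trans (cong (ℚ._+ (S n ℚ.- ι j ℚ.* ε)) (trans (ℚ.*-distribʳ-+ ε 1ℚ (ι j)) (cong (ℚ._+ ι j ℚ.* ε) (ℚ.*-identityˡ ε))))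
          (ident (ι j ℚ.* ε) ε (S n)))) (ℚ.<⇒≤ q)
        where
        ident : ∀ j e s → (e ℚ.+ j) ℚ.+ (s ℚ.- j) ≡ s ℚ.+ e
        ident = solve 3 (λ j e s → (e :+ j) :+ (s :- j) := s :+ e) refl

  open Reals

  -- An invariant measure from frequencies along an orbit.

  module Measure where

    private variable
      ℓ : Level

    open ℚSolver using (solve; _:+_; _:-_; _:*_; _:=_)

    zag : ℕ × ℕ → ℕ × ℕ
    zag (zero , b)  = suc b , zero
    zag (suc a , b) = a , suc b

    -- Cantor's enumeration along the diagonals.
    unpair : ℕ → ℕ × ℕ
    unpair zero    = zero , zero
    unpair (suc n) = zag (unpair n)

    unpair-onto : ∀ a b → ∃ λ n → unpair n ≡ (a , b)
    unpair-onto a b = along b a (start (a + b))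
      where
      along : ∀ b a → (∃ λ n → unpair n ≡ (a + b , zero)) → ∃ λ n → unpair n ≡ (a , b)
      along zero    a (n , e) = n , trans e (cong (_, zero) (ℕ.+-identityʳ a))
      along (suc b) a (n , e) = let (m , p) = along b (suc a) (n , trans e (cong (_, zero) (ℕ.+-suc a b))) in suc m , cong zag p

      start : ∀ s → ∃ λ n → unpair n ≡ (s , zero)
      start zero    = 0 , refl
      start (suc s) = let (m , p) = along s 0 (start s) in suc m , cong zag p

    module Definable {L : Language ℓ} (M : Structure L) (A : Pred (Carrier M) ℓ) where
      open Semantics M

      private
        C = Carrier M

      def-≐ : {B B′ : Pred C ℓ} → B ≐ B′ → Def M A B → Def M A B′
      def-≐ (f , g) (φ , p , q) = φ , (λ x → p (g x)) , (λ x → f (q x))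

      def-∁ : {B : Pred C ℓ} → Def M A B → Def M A (∁ B)
      def-∁ ((k , φ , c , c∈) , p , q) = (k , neg φ , c , c∈) ,
        (λ ¬b → ⇐ (sat-neg φ) λ s → ¬b (q s)) , (λ s b → ⇒ (sat-neg φ) s (p b))

      def-∪ : {B B′ : Pred C ℓ} → Def M A B → Def M A B′ → Def M A (B ∪ B′)
      def-∪ {B} {B′} ((k , φ , c , c∈) , p , q) ((k′ , ψ , d , d∈) , p′ , q′) =
          (k + k′ , imp (neg (rename ρ φ)) (rename ρ′ ψ) , c V.++ d , ++-all (_∈ A) c d c∈ d∈) ,
          (λ { {x} (inj₁ b)  → λ s → ⊥-elim (⇒ (sat-neg (rename ρ φ)) s (⇐ (sat-rename⇔ ρ φ (left x)) (p b)))
             ; {x} (inj₂ b′) → λ _ → ⇐ (sat-rename⇔ ρ′ ψ (right x)) (p′ b′) }) ,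
          λ {x} s → cases x s
        where
        ρ : Fin (suc k) → Fin (suc (k + k′))
        ρ = zero V.∷ (λ i → suc (i Fin.↑ˡ k′))
        ρ′ : Fin (suc k′) → Fin (suc (k + k′))
        ρ′ = zero V.∷ (λ i → suc (k Fin.↑ʳ i))

        left : ∀ x i → (x V.∷ (c V.++ d)) (ρ i) ≡ (x V.∷ c) i
        left x zero    = refl
        left x (suc i) = V.lookup-++ˡ c d i

        right : ∀ x i → (x V.∷ (c V.++ d)) (ρ′ i) ≡ (x V.∷ d) i
        right x zero    = refl
        right x (suc i) = V.lookup-++ʳ c d i

        cases : ∀ x → M ⊨ imp (neg (rename ρ φ)) (rename ρ′ ψ) [ x V.∷ (c V.++ d) ] → x ∈ (B ∪ B′)
        cases x s with decide (x ∈ B)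
        ... | yes b = inj₁ b
        ... | no ¬b = inj₂ (q′ (⇒ (sat-rename⇔ ρ′ ψ (right x)) (s (⇐ (sat-neg (rename ρ φ)) λ t → ¬b (q (⇒ (sat-rename⇔ ρ φ (left x)) t))))))

      def-∅ : Def M A (λ _ → Lift ℓ ⊥)
      def-∅ = (0 , falsum , V.[] , λ ()) , (λ { (lift ()) }) , (λ { (lift ()) })

      def-∖ : {B B′ : Pred C ℓ} → Def M A B → Def M A B′ → Def M A (B ∖ B′)
      def-∖ {B} {B′} d d′ = def-≐ ((λ {x} ¬u → dne (λ ¬b → ¬u (inj₁ ¬b)) , (λ b′ → ¬u (inj₂ b′))) , λ { (b , ¬b′) (inj₁ ¬b) → ¬b b ; (b , ¬b′) (inj₂ b′) → ¬b′ b′ })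
        (def-∁ (def-∪ (def-∁ d) d′))

      def-△ : {B B′ : Pred C ℓ} → Def M A B → Def M A B′ → Def M A (B △ B′)
      def-△ d d′ = def-∪ (def-∖ d d′) (def-∖ d′ d)

    cnt-disjoint : ∀ (g h k : ℕ → Bool) → (∀ i → T (g i) → T (k i)) → (∀ i → T (h i) → T (k i)) → (∀ i → T (g i) → ¬ T (h i)) →
                   ∀ N → cnt g N + cnt h N ≤ cnt k N
    cnt-disjoint g h k gk hk gh zero    = z≤n
    cnt-disjoint g h k gk hk gh (suc N) = ℕ.≤-trans (ℕ.≤-reflexive (interchange (cnt g N) (𝟙 (g N)) (cnt h N) (𝟙 (h N))))
      (ℕ.+-mono-≤ (cnt-disjoint g h k gk hk gh N) (one (g N) (h N) (k N) (gk N) (hk N) (gh N)))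
      where
      one : ∀ x y z → (T x → T z) → (T y → T z) → (T x → ¬ T y) → 𝟙 x + 𝟙 y ≤ 𝟙 z
      one false y     z     _ f _ = 𝟙-mono f
      one true  false z     f _ _ = 𝟙-mono {true} {z} f
      one true  true  z     _ _ f = ⊥-elim (f tt tt)

    cnt-∪ : ∀ (g h k : ℕ → Bool) → (∀ i → T (k i) → T (g i) ⊎ T (h i)) → ∀ N → cnt k N ≤ cnt g N + cnt h N
    cnt-∪ g h k f zero    = z≤n
    cnt-∪ g h k f (suc N) = ℕ.≤-trans (ℕ.+-mono-≤ (cnt-∪ g h k f N) (one (g N) (h N) (k N) (f N)))
      (ℕ.≤-reflexive (interchange (cnt g N) (cnt h N) (𝟙 (g N)) (𝟙 (h N))))
      where
      one : ∀ x y z → (T z → T x ⊎ T y) → 𝟙 z ≤ 𝟙 x + 𝟙 y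
      one x     y     false f = z≤n
      one true  y     true  f = s≤s z≤n
      one false true  true  f = s≤s z≤n
      one false false true  f = case f tt of λ { (inj₁ ()) ; (inj₂ ()) }

    ⌞⌟-yes : {P : Set ℓ} → P → ⌞ P ⌟ ≡ true
    ⌞⌟-yes p = T-ext (λ _ → tt) (λ _ → true! p)

    ⌞⌟-no : {P : Set ℓ} → ¬ P → ⌞ P ⌟ ≡ false
    ⌞⌟-no ¬p = T-ext (λ t → ¬p (holds t)) (λ ())

    △-xor : (P Q : Set ℓ) → ⌞ (P × ¬ Q) ⊎ (Q × ¬ P) ⌟ ≡ ⌞ P ⌟ xor ⌞ Q ⌟
    △-xor P Q = cases em em
      where
      cases : Dec P → Dec Q → ⌞ (P × ¬ Q) ⊎ (Q × ¬ P) ⌟ ≡ ⌞ P ⌟ xor ⌞ Q ⌟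
      cases (yes p) (yes q) = trans (⌞⌟-no λ { (inj₁ (_ , ¬q)) → ¬q q ; (inj₂ (_ , ¬p)) → ¬p p }) (sym (cong₂ _xor_ (⌞⌟-yes p) (⌞⌟-yes q)))
      cases (yes p) (no ¬q) = trans (⌞⌟-yes (inj₁ (p , ¬q))) (sym (cong₂ _xor_ (⌞⌟-yes p) (⌞⌟-no ¬q)))
      cases (no ¬p) (yes q) = trans (⌞⌟-yes (inj₂ (q , ¬p))) (sym (cong₂ _xor_ (⌞⌟-no ¬p) (⌞⌟-yes q)))
      cases (no ¬p) (no ¬q) = trans (⌞⌟-no λ { (inj₁ (p , _)) → ¬p p ; (inj₂ (q , _)) → ¬q q }) (sym (cong₂ _xor_ (⌞⌟-no ¬p) (⌞⌟-no ¬q)))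

    qsum : (ℕ → ℚ) → ℕ → ℚ
    qsum r zero    = 0ℚ
    qsum r (suc n) = qsum r n ℚ.+ r n

    qsum-split : ∀ r n K → qsum r (n + K) ≡ qsum r n ℚ.+ qsum (λ k → r (n + k)) K
    qsum-split r n zero    = trans (cong (qsum r) (ℕ.+-identityʳ n)) (sym (ℚ.+-identityʳ (qsum r n)))
    qsum-split r n (suc K) = trans (cong (qsum r) (ℕ.+-suc n K)) (trans (cong (ℚ._+ r (n + K)) (qsum-split r n K)) (ℚ.+-assoc (qsum r n) _ _))

    qsum-pow : ∀ δ n → qsum (λ k → δ ℚ.* pow (suc k)) n ℚ.+ δ ℚ.* pow n ≡ δ
    qsum-pow δ zero    = trans (ℚ.+-identityˡ _) (ℚ.*-identityʳ δ)
    qsum-pow δ (suc n) = trans (ℚ.+-assoc (qsum (λ k → δ ℚ.* pow (suc k)) n) _ _) (trans (cong (qsum (λ k → δ ℚ.* pow (suc k)) n ℚ.+_)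
      (trans (sym (ℚ.*-distribˡ-+ δ (pow (suc n)) (pow (suc n)))) (cong (δ ℚ.*_) (pow-halves n)))) (qsum-pow δ n))

    Before : ∀ {ℓ} {C : Set ℓ} → (ℕ → Pred C ℓ) → ℕ → Pred C ℓ
    Before B N x = ∃ λ k → k < N × x ∈ B k

    -- The closure of the definable sets for the distance Cov (B △ D).
    module Approximation {ℓ′} {L : Language ℓ} (M : Structure L) (A : Pred (Carrier M) ℓ) (Cov : Pred (Carrier M) ℓ → ℚ → Set ℓ′)
      (cov-mono : ∀ {B B′ r} → (∀ {x} → x ∈ B → x ∈ B′) → Cov B′ r → Cov B r)
      (cov-up : ∀ {r s B} → r ℚ.≤ s → Cov B r → Cov B s)
      (cov-∪ : ∀ {B r B′ s} → Cov B r → Cov B′ s → Cov (B ∪ B′) (r ℚ.+ s))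
      (cov-∅ : ∀ {B} → (∀ {x} → ¬ (x ∈ B)) → Cov B 0ℚ) where
      open Definable M A

      private
        C = Carrier M

        variable
          B B′ : Pred C ℓ

      𝓛 : Pred C ℓ → Set (lsuc ℓ ⊔ ℓ′)
      𝓛 B = ∀ δ → 0ℚ ℚ.< δ → ∃ λ D → Def M A D × Cov (B △ D) δ

      𝓛-def : Def M A B → 𝓛 B
      𝓛-def {B} d δ 0<δ = B , d , cov-up {B = B △ B} (ℚ.<⇒≤ 0<δ) (cov-∅ {B △ B} λ { (inj₁ (b , ¬b)) → ¬b b ; (inj₂ (b , ¬b)) → ¬b b })

      𝓛-≐ : B ≐ B′ → 𝓛 B → 𝓛 B′
      𝓛-≐ {B} {B′} (f , g) l δ 0<δ = let (D , d , cov) = l δ 0<δ in D , d ,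
        cov-mono {B′ △ D} {B △ D} (λ { (inj₁ (b , ¬d)) → inj₁ (g b , ¬d) ; (inj₂ (d , ¬b)) → inj₂ (d , λ b → ¬b (f b)) }) cov

      𝓛-∁ : 𝓛 B → 𝓛 (∁ B)
      𝓛-∁ {B} l δ 0<δ = let (D , d , cov) = l δ 0<δ in ∁ D , def-∁ d ,
        cov-mono {∁ B △ ∁ D} {B △ D} (λ { (inj₁ (¬b , ¬¬d)) → inj₂ (dne ¬¬d , ¬b) ; (inj₂ (¬d , ¬¬b)) → inj₁ (dne ¬¬b , ¬d) }) cov

      𝓛-∪ : 𝓛 B → 𝓛 B′ → 𝓛 (B ∪ B′)
      𝓛-∪ {B} {B′} l l′ δ 0<δ =
        let (γ , 0<γ , e) = half δ 0<δ
            (D , d , cov) = l γ 0<γ; (D′ , d′ , cov′) = l′ γ 0<γ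
        in D ∪ D′ , def-∪ d d′ , cov-mono {(B ∪ B′) △ (D ∪ D′)} {(B △ D) ∪ (B′ △ D′)}
             (λ { (inj₁ (inj₁ b , ¬d)) → inj₁ (inj₁ (b , λ d → ¬d (inj₁ d)))
                ; (inj₁ (inj₂ b , ¬d)) → inj₂ (inj₁ (b , λ d → ¬d (inj₂ d)))
                ; (inj₂ (inj₁ d , ¬b)) → inj₁ (inj₂ (d , λ b → ¬b (inj₁ b)))
                ; (inj₂ (inj₂ d , ¬b)) → inj₂ (inj₂ (d , λ b → ¬b (inj₂ b))) })
             (subst (Cov ((B △ D) ∪ (B′ △ D′))) e (cov-∪ {B △ D} {B′ = B′ △ D′} cov cov′))

      𝓛-∖ : 𝓛 B → 𝓛 B′ → 𝓛 (B ∖ B′)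
      𝓛-∖ {B} {B′} l l′ = 𝓛-≐ {∁ (∁ B ∪ B′)} {B ∖ B′}
        ((λ {x} ¬u → dne (λ ¬b → ¬u (inj₁ ¬b)) , (λ b′ → ¬u (inj₂ b′))) , λ { (b , ¬b′) (inj₁ ¬b) → ¬b b ; (b , ¬b′) (inj₂ b′) → ¬b′ b′ })
        (𝓛-∁ {∁ B ∪ B′} (𝓛-∪ {∁ B} {B′} (𝓛-∁ {B} l) l′))

      𝓛-Before : (B : ℕ → Pred C ℓ) → (∀ k → 𝓛 (B k)) → ∀ n → 𝓛 (Before B n)
      𝓛-Before B l zero    = 𝓛-≐ {λ _ → Lift ℓ ⊥} {Before B 0} ((λ { (lift ()) }) , λ { (_ , () , _) }) (𝓛-def def-∅)
      𝓛-Before B l (suc n) = 𝓛-≐ {Before B n ∪ B n} {Before B (suc n)}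
        ( (λ { (inj₁ (i , lt , b)) → i , ℕ.m≤n⇒m≤1+n lt , b ; (inj₂ b) → n , ℕ.≤-refl , b })
        , (λ (i , i<n , d) → case ℕ.m≤n⇒m<n∨m≡n (ℕ.s≤s⁻¹ i<n) of λ { (inj₁ lt) → inj₁ (i , lt , d) ; (inj₂ refl) → inj₂ d }))
        (𝓛-∪ {Before B n} {B n} (𝓛-Before B l n) (l n))

      fresh : (ℕ → Pred C ℓ) → ℕ → Pred C ℓ
      fresh B k = B k ∖ Before B k

      fresh-disjoint : ∀ (B : ℕ → Pred C ℓ) i j → i ≢ j → ∀ {x} → x ∈ fresh B i → ¬ (x ∈ fresh B j)
      fresh-disjoint B i j i≢j (b , ¬b) (b′ , ¬b′) with ℕ.<-cmp i j
      ... | tri< i<j _ _ = ¬b′ (i , i<j , b)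
      ... | tri≈ _ i≡j _ = i≢j i≡j
      ... | tri> _ _ j<i = ¬b (j , j<i , b′)

      fresh-covers : ∀ (B : ℕ → Pred C ℓ) {x} → x ∈ ⋃ ℕ B → ∃ λ k → x ∈ fresh B k
      fresh-covers B {x} (k , b) = go k (ℕ.<-wellFounded k) b
        where
        go : ∀ k → Acc _<_ k → x ∈ B k → ∃ λ k → x ∈ fresh B k
        go k (acc rec) b with decide (x ∈ Before B k)
        ... | yes (j , j<k , b′) = go j (rec j<k) b′
        ... | no ¬b = k , b , ¬b

      𝓛-fresh : (B : ℕ → Pred C ℓ) → (∀ k → 𝓛 (B k)) → ∀ k → 𝓛 (fresh B k)
      𝓛-fresh B l k = 𝓛-∖ {B k} {Before B k} (l k) (𝓛-Before B l k)

      -- Up to a small tail the union is a finite union of its disjoint pieces. Smallness of tails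
      -- is assumed here, because it comes from superadditivity for the orbit measure and from
      -- countable additivity when a measure is given.
      𝓛-⋃ : (B : ℕ → Pred C ℓ) → (∀ k → 𝓛 (B k)) →
            (∀ δ → 0ℚ ℚ.< δ → ∃ λ n → Cov (λ x → ∃ λ k → n ≤ k × x ∈ fresh B k) δ) → 𝓛 (⋃ ℕ B)
      𝓛-⋃ B l tails δ 0<δ =
        let (γ , 0<γ , e) = half δ 0<δ
            (n , small) = tails γ 0<γ
            (E , def , near) = 𝓛-Before (fresh B) (𝓛-fresh B l) n γ 0<γ
        in E , def , cov-mono {⋃ ℕ B △ E} {(Before (fresh B) n △ E) ∪ (λ x → ∃ λ k → n ≤ k × x ∈ fresh B k)} (sub n E)
             (subst (Cov _) e (cov-∪ {Before (fresh B) n △ E} {B′ = λ x → ∃ λ k → n ≤ k × x ∈ fresh B k} near small))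
        where
        sub : ∀ n E {x} → x ∈ (⋃ ℕ B △ E) → x ∈ ((Before (fresh B) n △ E) ∪ (λ x → ∃ λ k → n ≤ k × x ∈ fresh B k))
        sub n E (inj₁ (b , ¬e)) = let (k , d) = fresh-covers B b in case k ℕ.<? n of λ where
          (yes k<n) → inj₁ (inj₁ ((k , k<n , d) , ¬e))
          (no ¬k<n) → inj₂ (k , ℕ.≮⇒≥ ¬k<n , d)
        sub n E (inj₂ (e , ¬b)) = inj₁ (inj₂ (e , λ (k , _ , d) → ¬b (k , proj₁ d)))

    -- Frequencies along the orbit of a, taken along an ultrafilter, form a finitely
    -- additive σ-invariant measure on all subsets of M. On definable sets it is
    -- countably additive, because by saturation a definable set covered by countably
    -- many definable sets is covered by finitely many of them; μ is the associated
    -- outer measure.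
    module OrbitMeasure {L : Language ℓ} (M : Structure L) (saturated : Saturated M)
      (countable : (g : ℕ → Carrier M) (A : Pred (Carrier M) ℓ) → (∀ x → x ∈ A → ∃ λ n → g n ≡ x) → Smaller M A)
      (U : Ultrafilter) (σ : Aut M) (a : Carrier M) where
      open Semantics M
      open Ultrafilter U
      open Saturation M saturated

      private
        C = Carrier M

        Full : Pred C ℓ
        Full _ = ⊤

        variable
          B B′ : Pred C ℓ
          r s : ℚ

      open Definable M Full
      open Inverse (bij σ) using (to; from; strictlyInverseˡ; strictlyInverseʳ)

      𝒜 : Pred (Pred C ℓ) (lsuc ℓ)
      𝒜 = Generated (Def M Full)

      orb : ℕ → C
      orb n = (bij σ ^ᶻ (ℤ.+ n)) a

      visits : Pred C ℓ → ℕ → ℕ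
      visits B = cnt (λ i → ⌞ orb i ∈ B ⌟)

      -- The limit frequency of B is at most r.
      infixr 4 _,_
      record Freq (B : Pred C ℓ) (r : ℚ) : Set where
        constructor _,_
        field
          -- Tolerating boundedly many further visits makes the notion invariant under a step along
          -- the orbit.
          offset : ℕ
          often  : Many (λ N → ι (visits B N) ℚ.≤ r ℚ.* ι N ℚ.+ ι offset)

      visits-mono : (∀ {x} → x ∈ B → x ∈ B′) → ∀ N → visits B N ≤ visits B′ N
      visits-mono f = cnt-mono λ i t → true! (f {orb i} (holds t))

      freq-mono : (∀ {x} → x ∈ B → x ∈ B′) → Freq B′ r → Freq B r
      freq-mono {B} {B′} f (c , many) = c , many-map (λ N → ℚ.≤-trans (ι-mono (visits-mono {B} {B′} f N))) many

      freq-up : r ℚ.≤ s → Freq B r → Freq B s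
      freq-up le (c , many) = c , many-map (λ N p → ℚ.≤-trans p (ℚ.+-monoˡ-≤ (ι c) (*-mono-≤ (0≤ι N) le))) many

      freq-∪ : Freq B r → Freq B′ s → Freq (B ∪ B′) (r ℚ.+ s)
      freq-∪ {B} {r} {B′} {s} (c , many) (c′ , many′) = c + c′ , many-map (λ N (p , q) → begin
          ι (visits (B ∪ B′) N)                       ≤⟨ ι-mono (cnt-∪ (λ i → ⌞ orb i ∈ B ⌟) (λ i → ⌞ orb i ∈ B′ ⌟) _ (λ i t → Sum.map true! true! (holds t)) N) ⟩
          ι (visits B N + visits B′ N)                ≡⟨ ι-+ (visits B N) (visits B′ N) ⟩
          ι (visits B N) ℚ.+ ι (visits B′ N)          ≤⟨ ℚ.+-mono-≤ p q ⟩
          (r ℚ.* ι N ℚ.+ ι c) ℚ.+ (s ℚ.* ι N ℚ.+ ι c′) ≡⟨ ident r s (ι N) (ι c) (ι c′) ⟩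
          (r ℚ.+ s) ℚ.* ι N ℚ.+ (ι c ℚ.+ ι c′)        ≡⟨ cong ((r ℚ.+ s) ℚ.* ι N ℚ.+_) (ι-+ c c′) ⟨
          (r ℚ.+ s) ℚ.* ι N ℚ.+ ι (c + c′)            ∎) (many-× many many′)
        where
        open ℚ.≤-Reasoning
        ident : ∀ r s n c d → (r ℚ.* n ℚ.+ c) ℚ.+ (s ℚ.* n ℚ.+ d) ≡ (r ℚ.+ s) ℚ.* n ℚ.+ (c ℚ.+ d)
        ident = solve 5 (λ r s n c d → (r :* n :+ c) :+ (s :* n :+ d) := (r :+ s) :* n :+ (c :+ d)) refl

      freq-∅ : (∀ {x} → ¬ (x ∈ B)) → Freq B 0ℚ
      freq-∅ {B} none = 0 , many-all 0 λ N _ → ℚ.≤-reflexive (trans (cong ι (zero-visits N)) (sym (trans (ℚ.+-identityʳ _) (ℚ.*-zeroˡ (ι N)))))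
        where
        zero-visits : ∀ N → visits B N ≡ 0
        zero-visits zero    = refl
        zero-visits (suc N) = cong₂ _+_ (zero-visits N) (cong 𝟙 (T-ext {⌞ orb N ∈ B ⌟} {false} (λ t → none (holds t)) (λ ())))

      slope : ∀ c → Many (λ N → ι N ℚ.* s ℚ.≤ r ℚ.* ι N ℚ.+ ι c) → s ℚ.≤ r
      slope {s} {r} c many = ℚ.≮⇒≥ λ r<s →
        let 0<d = subst (ℚ._< s ℚ.- r) (ℚ.+-inverseʳ r) (ℚ.+-monoˡ-< (ℚ.- r) r<s)
            (k , big) = archimedean′ (s ℚ.- r) 0<d (suc c)
            (N , k≤N , p) = many-find many k
        in ℕ.n≮n c (ι-cancel (begin
             ι (suc c)                     ≤⟨ big ⟩
             ι k ℚ.* (s ℚ.- r)             ≤⟨ *-mono-≤ (ℚ.<⇒≤ 0<d) (ι-mono k≤N) ⟩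
             ι N ℚ.* (s ℚ.- r)             ≤⟨ lin₁ p (ident (ι N) s r (ι c)) ⟩
             ι c                           ∎))
        where
        open ℚ.≤-Reasoning
        ident : ∀ n s r c → n ℚ.* (s ℚ.- r) ℚ.+ ((r ℚ.* n ℚ.+ c) ℚ.- n ℚ.* s) ≡ c
        ident = solve 4 (λ n s r c → n :* (s :- r) :+ ((r :* n :+ c) :- n :* s) := c) refl

      freq-nonneg : Freq B r → 0ℚ ℚ.≤ r
      freq-nonneg {B} (c , many) = slope c (many-map (λ N p → ℚ.≤-trans (subst (ℚ._≤ ι (visits B N)) (sym (ℚ.*-zeroʳ (ι N))) (0≤ι (visits B N))) p) many)

      freq-full : Freq Full r → 1ℚ ℚ.≤ r
      freq-full {r} (c , many) = slope c (many-map (λ N → subst (ℚ._≤ r ℚ.* ι N ℚ.+ ι c) (trans (cong ι (all-visits N)) (sym (ℚ.*-identityʳ (ι N))))) many)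
        where
        all-visits : ∀ N → visits Full N ≡ N
        all-visits zero    = refl
        all-visits (suc N) = trans (cong₂ _+_ (all-visits N) (cong 𝟙 (T-ext {⌞ orb N ∈ Full ⌟} {true} (λ _ → tt) (λ _ → true! _)))) (ℕ.+-comm N 1)

      freq-one : Freq B 1ℚ
      freq-one {B} = 0 , many-all 0 λ N _ → ℚ.≤-trans (ι-mono (cnt-≤ _ N)) (ℚ.≤-reflexive (sym (trans (ℚ.+-identityʳ _) (ℚ.*-identityˡ (ι N)))))

      -- By the ultrafilter, failure of the bound `s` is the opposite inequality for many `N`, which
      -- can be subtracted from the bound on the union. This is where finite additivity of limit
      -- frequencies comes from.
      freq-∖ : Freq (B ∪ B′) r → ¬ Freq B s → Freq (B′ ∖ B) (r ℚ.- s)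
      freq-∖ {B} {B′} {r} {s} (c , many) ¬freq = c , many-map (λ N (p , ¬q) → begin
          ι (visits (B′ ∖ B) N)           ≤⟨ lin₂ (ℚ.≤-trans (subst (ℚ._≤ ι (visits (B ∪ B′) N)) (ι-+ (visits B N) (visits (B′ ∖ B) N)) (ι-mono (disjoint N))) p)
                                               (ℚ.<⇒≤ (ℚ.≰⇒> ¬q)) (ident (ι (visits (B′ ∖ B) N)) (ι (visits B N)) r s (ι N) (ι c)) ⟩
          (r ℚ.- s) ℚ.* ι N ℚ.+ ι c       ∎) (many-× many (many-¬ λ m → ¬freq (0 , m)))
        where
        open ℚ.≤-Reasoning
        disjoint : ∀ N → visits B N + visits (B′ ∖ B) N ≤ visits (B ∪ B′) N
        disjoint = cnt-disjoint _ _ _ (λ i t → true! (inj₁ (holds t))) (λ i t → true! (inj₂ (proj₁ (holds t)))) (λ i t u → proj₂ (holds u) (holds t))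
        ident : ∀ y x r s n c → y ℚ.+ (((r ℚ.* n ℚ.+ c) ℚ.- (x ℚ.+ y)) ℚ.+ (x ℚ.- (s ℚ.* n ℚ.+ 0ℚ))) ≡ (r ℚ.- s) ℚ.* n ℚ.+ c
        ident = solve 6 (λ y x r s n c → y :+ (((r :* n :+ c) :- (x :+ y)) :+ (x :- (s :* n :+ con 0ℚ))) := (r :- s) :* n :+ c) refl
          where open ℚSolver using (con)

      -- B has outer measure at most r.
      record Cov (B : Pred C ℓ) (r : ℚ) : Set (lsuc ℓ) where
        constructor _,_
        field
          sets   : ℕ → Pred C ℓ
          covers : (∀ k → Def M Full (sets k)) × (∀ {x} → x ∈ B → ∃ λ k → x ∈ sets k) × (∀ N → Freq (Before sets N) r)

      open Cov

      compactness : (D : ℕ → Pred C ℓ) → (∀ k → Def M Full (D k)) → Def M Full B → (∀ {x} → x ∈ B → ∃ λ k → x ∈ D k) →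
                    ∃ λ N → ∀ {x} → x ∈ B → x ∈ Before D N
      compactness {B} D defs ((k₀ , φ₀ , c₀ , _) , p₀ , q₀) cover = dne λ none →
        let (x , f) = realise-chain A small k Δ c (λ i j → i , j , refl) λ N →
              let (x , b , ¬before) = fails none N in x , λ where
                zero    _   → p₀ b
                (suc i) i<N → ⇐ (sat-neg (proj₁ (proj₂ (proj₁ (defs i))))) λ s → ¬before (i , i<N , proj₂ (proj₂ (defs i)) s)
            (i , d) = cover (q₀ (f 0))
        in ⇒ (sat-neg (proj₁ (proj₂ (proj₁ (defs i))))) (f (suc i)) (proj₁ (proj₂ (defs i)) d)
        where
        k : ℕ → ℕ
        k zero    = k₀
        k (suc i) = proj₁ (proj₁ (defs i))

        Δ : ∀ i → Formula L (suc (k i))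
        Δ zero    = φ₀
        Δ (suc i) = neg (proj₁ (proj₂ (proj₁ (defs i))))

        c : ∀ i → Vector C (k i)
        c zero    = c₀
        c (suc i) = proj₁ (proj₂ (proj₂ (proj₁ (defs i))))

        A : Pred C ℓ
        A x = ∃ λ i → ∃ λ j → c i j ≡ x

        entry : ℕ × ℕ → C
        entry (i , j) with j ℕ.<? k i
        ... | yes j<k = c i (Fin.fromℕ< j<k)
        ... | no _    = nonempty M

        entry-toℕ : ∀ i j → entry (i , toℕ j) ≡ c i j
        entry-toℕ i j with toℕ j ℕ.<? k i
        ... | yes p = cong (c i) (Fin.fromℕ<-toℕ j p)
        ... | no ¬p = ⊥-elim (¬p (Fin.toℕ<n j))

        small : Smaller M A
        small = countable (entry ∘ unpair) A λ x (i , j , e) → let (n , p) = unpair-onto i (toℕ j) in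
          n , trans (cong entry p) (trans (entry-toℕ i j) e)

        fails : ¬ (∃ λ N → ∀ {x} → x ∈ B → x ∈ Before D N) → ∀ N → ∃ λ x → x ∈ B × ¬ (x ∈ Before D N)
        fails none N = let (x , p) = ¬∀⇒∃ {P = λ x → x ∈ B → x ∈ Before D N} (λ all → none (N , λ {x} → all x)) in x , ¬⇒×¬ p

      cov-mono : (∀ {x} → x ∈ B → x ∈ B′) → Cov B′ r → Cov B r
      cov-mono f (D , defs , cover , freq) = D , defs , (λ b → cover (f b)) , freq

      cov-up : r ℚ.≤ s → Cov B r → Cov B s
      cov-up {B = B} le (D , defs , cover , freq) = D , defs , cover , λ N → freq-up {B = Before D N} le (freq N)

      cov-def : Def M Full B → Freq B r → Cov B r
      cov-def {B} d freq = (λ _ → B) , (λ _ → d) , (λ b → 0 , b) , λ N → freq-mono {B = Before (λ _ → B) N} {B} (λ (_ , _ , b) → b) freq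

      cov-freq : Def M Full B → Cov B r → Freq B r
      cov-freq {B} d (D , defs , cover , freq) = let (N , f) = compactness D defs d cover in freq-mono {B} {Before D N} f (freq N)

      cov-one : Cov B 1ℚ
      cov-one {B} = cov-mono {B} {Full} (λ _ → _) (cov-def {Full} (def-≐ ((λ _ → _) , λ _ ()) (def-∁ def-∅)) (freq-one {Full}))

      cov-nonneg : Cov B r → 0ℚ ℚ.≤ r
      cov-nonneg (D , _ , _ , freq) = freq-nonneg {Before D 0} (freq 0)

      -- The members of all covers are listed along `unpair`. Finitely many of them lie in a square
      -- block, whose frequency is bounded by a partial sum of `r`.
      cov-⋃ : (B : ℕ → Pred C ℓ) (r : ℕ → ℚ) → (∀ k → Cov (B k) (r k)) → ∀ s → (∀ K → qsum r K ℚ.≤ s) → Cov (⋃ ℕ B) s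
      cov-⋃ B r covs s sum≤ = D′ , (λ n → let (i , j) = unpair n in proj₁ (covers (covs i)) j) , cover′ , λ N →
          let (K , p) = bound N in
          freq-mono {Before D′ N} {Block K K} (λ (n , n<N , d) → let (i<K , j<K) = p n n<N in proj₁ (unpair n) , i<K , (proj₂ (unpair n) , j<K , d))
            (freq-up {B = Block K K} (sum≤ K) (block K K))
        where
        D : ℕ → ℕ → Pred C ℓ
        D i = sets (covs i)

        D′ : ℕ → Pred C ℓ
        D′ n = let (i , j) = unpair n in D i j

        cover′ : ∀ {x} → x ∈ ⋃ ℕ B → ∃ λ n → x ∈ D′ n
        cover′ {x} (i , b) = let (j , d) = proj₁ (proj₂ (covers (covs i))) b; (n , e) = unpair-onto i j in
          n , subst (λ (i , j) → x ∈ D i j) (sym e) d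

        Block : ℕ → ℕ → Pred C ℓ
        Block K K′ = Before (λ i → Before (D i) K′) K

        block : ∀ K K′ → Freq (Block K K′) (qsum r K)
        block zero    K′ = freq-∅ {Block 0 K′} λ { (_ , () , _) }
        block (suc K) K′ = freq-mono {Block (suc K) K′} {Block K K′ ∪ Before (D K) K′}
          (λ (i , i<K , d) → case ℕ.m≤n⇒m<n∨m≡n (ℕ.s≤s⁻¹ i<K) of λ { (inj₁ lt) → inj₁ (i , lt , d) ; (inj₂ refl) → inj₂ d })
          (freq-∪ {Block K K′} {B′ = Before (D K) K′} (block K K′) (proj₂ (proj₂ (covers (covs K))) K′))

        bound : ∀ N → ∃ λ K → ∀ n → n < N → proj₁ (unpair n) < K × proj₂ (unpair n) < K
        bound zero    = 0 , λ _ ()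
        bound (suc N) = let (K , p) = bound N; (i , j) = unpair N in suc (i + j) + K , λ n n<N →
          case ℕ.m≤n⇒m<n∨m≡n (ℕ.s≤s⁻¹ n<N) of λ where
            (inj₁ lt)   → let (a , b) = p n lt in ℕ.≤-trans a (ℕ.m≤n+m K _) , ℕ.≤-trans b (ℕ.m≤n+m K _)
            (inj₂ refl) → s≤s (ℕ.≤-trans (ℕ.m≤m+n i j) (ℕ.m≤m+n (i + j) K)) , s≤s (ℕ.≤-trans (ℕ.m≤n+m j i) (ℕ.m≤m+n (i + j) K))

      cov-∅ : (∀ {x} → ¬ (x ∈ B)) → Cov B 0ℚ
      cov-∅ {B} none = (λ _ _ → Lift ℓ ⊥) , (λ _ → def-∅) , (λ b → ⊥-elim (none b)) , λ N → freq-∅ {Before (λ _ _ → Lift ℓ ⊥) N} λ { (_ , _ , lift ()) }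

      cov-∪ : Cov B r → Cov B′ s → Cov (B ∪ B′) (r ℚ.+ s)
      cov-∪ {B} {r} {B′} {s} cov cov′ = cov-mono {B′ = ⋃ ℕ B₂} (λ { (inj₁ b) → 0 , b ; (inj₂ b) → 1 , b }) (cov-⋃ B₂ r₂ covs (r ℚ.+ s) sums)
        where
        B₂ : ℕ → Pred C ℓ
        B₂ 0 = B
        B₂ 1 = B′
        B₂ (suc (suc _)) = λ _ → Lift ℓ ⊥

        r₂ : ℕ → ℚ
        r₂ 0 = r
        r₂ 1 = s
        r₂ (suc (suc _)) = 0ℚ

        covs : ∀ k → Cov (B₂ k) (r₂ k)
        covs 0 = cov
        covs 1 = cov′
        covs (suc (suc _)) = cov-∅ λ { (lift ()) }

        total : ∀ K → qsum r₂ (suc (suc K)) ≡ r ℚ.+ s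
        total zero    = cong (ℚ._+ s) (ℚ.+-identityˡ r)
        total (suc K) = trans (ℚ.+-identityʳ _) (total K)

        sums : ∀ K → qsum r₂ K ℚ.≤ r ℚ.+ s
        sums 0 = ℚ.+-mono-≤ (cov-nonneg {B} cov) (cov-nonneg {B′} cov′)
        sums 1 = ℚ.≤-trans (ℚ.≤-reflexive (trans (ℚ.+-identityˡ r) (sym (ℚ.+-identityʳ r)))) (ℚ.+-monoʳ-≤ r (cov-nonneg {B′} cov′))
        sums (suc (suc K)) = ℚ.≤-reflexive (total K)

      cov-Before : (B : ℕ → Pred C ℓ) (r : ℕ → ℚ) → (∀ k → Cov (B k) (r k)) → ∀ n → Cov (Before B n) (qsum r n)
      cov-Before B r covs zero    = cov-∅ λ { (_ , () , _) }
      cov-Before B r covs (suc n) = cov-mono {B′ = Before B n ∪ B n}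
        (λ (i , i<n , d) → case ℕ.m≤n⇒m<n∨m≡n (ℕ.s≤s⁻¹ i<n) of λ { (inj₁ lt) → inj₁ (i , lt , d) ; (inj₂ refl) → inj₂ d })
        (cov-∪ {Before B n} {B′ = B n} (cov-Before B r covs n) (covs n))

      cut : ∀ B → Cut (λ r → T ⌞ Cov B r ⌟)
      cut B = record
        { upward = λ le t → true! (cov-up {B = B} le (holds t))
        ; one    = true! (cov-one {B})
        ; nonneg = λ r<0 t → <⇒≱ᵠ r<0 (cov-nonneg {B} (holds t))
        }

      μ : Pred C ℓ → ℝ
      μ B = Cut.infimum (cut B)

      μ-≤ : Cov B r → seq (μ B) ≼ κ r
      μ-≤ {B} cov = Cut.infimum-≤ (cut B) (true! cov)

      μ-≥ : ¬ Cov B r → κ r ≼ seq (μ B)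
      μ-≥ {B} ¬cov = Cut.infimum-≥ (cut B) (λ t → ¬cov (holds t))

      open Approximation M Full Cov cov-mono cov-up cov-∪ cov-∅

      -- Both sets are replaced by definable ones, `D` and `E`, for which covers bound limit
      -- frequencies by compactness. Failure of a cover of `B` becomes failure of a frequency bound
      -- for `D`, and `freq-∖` applies.
      superadditive : 𝓛 B → 𝓛 B′ → (∀ {x} → x ∈ B → ¬ (x ∈ B′)) → Cov (B ∪ B′) r → ¬ Cov B s →
                      ∀ δ → 0ℚ ℚ.< δ → Cov B′ ((r ℚ.- s) ℚ.+ δ)
      superadditive {B} {B′} {r} {s} l l′ disj cov ¬cov δ 0<δ =
        -- Three halvings give 8γ = δ; the approximations below cost 6γ in all.
        let (δ₁ , 0<δ₁ , e₁) = half δ 0<δ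
            (δ₂ , 0<δ₂ , e₂) = half δ₁ 0<δ₁
            (γ , 0<γ , e₃)   = half δ₂ 0<δ₂
            (D , d , near)   = l γ 0<γ
            (E , e , near′)  = l′ γ 0<γ
            errors = cov-∪ {B △ D} {B′ = B′ △ E} near near′
            freq-union : Freq (D ∪ E) (r ℚ.+ (γ ℚ.+ γ))
            freq-union = cov-freq (def-∪ d e) (cov-mono {D ∪ E} {(B ∪ B′) ∪ ((B △ D) ∪ (B′ △ E))} (union-sub D E) (cov-∪ {B ∪ B′} {B′ = (B △ D) ∪ (B′ △ E)} cov errors))
            freq-meet : Freq (λ x → x ∈ D × x ∈ E) (γ ℚ.+ γ)
            freq-meet = cov-freq (def-≐ ((λ (u , ¬v) → u , dne (λ ¬e → ¬v (u , ¬e))) , λ (u , v) → u , λ (_ , ¬e) → ¬e v) (def-∖ d (def-∖ d e)))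
              (cov-mono {λ x → x ∈ D × x ∈ E} {(B △ D) ∪ (B′ △ E)} (meet-sub D E) errors)
            ¬freq : ¬ Freq D (s ℚ.- γ)
            ¬freq f = ¬cov (subst (Cov B) (cancel s γ) (cov-mono {B} {D ∪ (B △ D)} (approx-sub D)
              (cov-∪ {D} {B′ = B △ D} (cov-def d f) near)))
            freq-E : Freq E ((r ℚ.+ (γ ℚ.+ γ) ℚ.- (s ℚ.- γ)) ℚ.+ (γ ℚ.+ γ))
            freq-E = freq-mono {E} {(E ∖ D) ∪ (λ x → x ∈ D × x ∈ E)} (split D E)
              (freq-∪ {E ∖ D} {B′ = λ x → x ∈ D × x ∈ E} (freq-∖ {D} {E} freq-union ¬freq) freq-meet)
            γ≤ = ℚ.<⇒≤ 0<γ
        in cov-up {B = B′} (lin₂ γ≤ γ≤ (trans (ident r s γ) (cong ((r ℚ.- s) ℚ.+_) (trans (cong₂ ℚ._+_ (cong₂ ℚ._+_ e₃ e₃) (cong₂ ℚ._+_ e₃ e₃)) (trans (cong₂ ℚ._+_ e₂ e₂) e₁)))))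
             (cov-mono {B′} {E ∪ (B′ △ E)} (approx-sub′ E) (cov-∪ {E} {B′ = B′ △ E} (cov-def e freq-E) near′))
        where
        ident : ∀ r s g → ((r ℚ.+ (g ℚ.+ g) ℚ.- (s ℚ.- g)) ℚ.+ (g ℚ.+ g)) ℚ.+ g ℚ.+ ((g ℚ.- 0ℚ) ℚ.+ (g ℚ.- 0ℚ))
                ≡ (r ℚ.- s) ℚ.+ (((g ℚ.+ g) ℚ.+ (g ℚ.+ g)) ℚ.+ ((g ℚ.+ g) ℚ.+ (g ℚ.+ g)))
        ident = solve 3 (λ r s g → ((r :+ (g :+ g) :- (s :- g)) :+ (g :+ g)) :+ g :+ ((g :- con 0ℚ) :+ (g :- con 0ℚ))
                           := (r :- s) :+ (((g :+ g) :+ (g :+ g)) :+ ((g :+ g) :+ (g :+ g)))) refl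
          where open ℚSolver using (con)
        cancel : ∀ s g → s ℚ.- g ℚ.+ g ≡ s
        cancel = solve 2 (λ s g → s :- g :+ g := s) refl

        union-sub : ∀ D E {x} → x ∈ (D ∪ E) → x ∈ ((B ∪ B′) ∪ ((B △ D) ∪ (B′ △ E)))
        union-sub D E {x} (inj₁ d) with decide (x ∈ B)
        ... | yes b = inj₁ (inj₁ b)
        ... | no ¬b = inj₂ (inj₁ (inj₂ (d , ¬b)))
        union-sub D E {x} (inj₂ e) with decide (x ∈ B′)
        ... | yes b = inj₁ (inj₂ b)
        ... | no ¬b = inj₂ (inj₂ (inj₂ (e , ¬b)))

        meet-sub : ∀ D E {x} → x ∈ D × x ∈ E → x ∈ ((B △ D) ∪ (B′ △ E))
        meet-sub D E {x} (d , e) with decide (x ∈ B)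
        ... | no ¬b = inj₁ (inj₂ (d , ¬b))
        ... | yes b = inj₂ (inj₂ (e , disj b))

        approx-sub : ∀ D {x} → x ∈ B → x ∈ (D ∪ (B △ D))
        approx-sub D {x} b with decide (x ∈ D)
        ... | yes d = inj₁ d
        ... | no ¬d = inj₂ (inj₁ (b , ¬d))

        approx-sub′ : ∀ E {x} → x ∈ B′ → x ∈ (E ∪ (B′ △ E))
        approx-sub′ E {x} b with decide (x ∈ E)
        ... | yes e = inj₁ e
        ... | no ¬e = inj₂ (inj₁ (b , ¬e))

        split : ∀ D E {x} → x ∈ E → x ∈ ((E ∖ D) ∪ (λ x → x ∈ D × x ∈ E))
        split D E {x} e with decide (x ∈ D)
        ... | yes d = inj₂ (d , e)
        ... | no ¬d = inj₁ (e , ¬d)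

      module Disjoint (B : ℕ → Pred C ℓ) (l : ∀ k → 𝓛 (B k)) (disj : ∀ i j → i ≢ j → ∀ {x} → x ∈ B i → ¬ (x ∈ B j))
                      (δ : ℚ) (0<δ : 0ℚ ℚ.< δ) where

        error : ℕ → ℚ
        error k = δ ℚ.* pow (suc k)

        0<error : ∀ k → 0ℚ ℚ.< error k
        0<error k = ℚ.positive⁻¹ (error k) ⦃ ℚ.pos*pos⇒pos δ ⦃ ℚ.positive 0<δ ⦄ (pow (suc k)) ⦃ ℚ.positive (0<pow (suc k)) ⦄ ⦄

        -- A rational upper value for the measure of `B k`, correct up to `error k`, where all
        -- errors together stay within `δ`.
        w : ℕ → ℚ
        w k = proj₁ (Cut.near (cut (B k)) (error k) (0<error k))

        w-cov : ∀ k → Cov (B k) (w k)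
        w-cov k = holds (proj₁ (proj₂ (Cut.near (cut (B k)) (error k) (0<error k))))

        w-¬cov : ∀ k → ¬ Cov (B k) (w k ℚ.- error k)
        w-¬cov k cov = proj₂ (proj₂ (Cut.near (cut (B k)) (error k) (0<error k))) (true! cov)

        S E : ℕ → ℚ
        S = qsum w
        E = qsum error

        E≤δ : ∀ n → E n ℚ.≤ δ
        E≤δ n = subst (E n ℚ.≤_) (qsum-pow δ n) (subst (ℚ._≤ E n ℚ.+ δ ℚ.* pow n) (ℚ.+-identityʳ (E n)) (ℚ.+-monoʳ-≤ (E n)
          (ℚ.<⇒≤ (ℚ.positive⁻¹ (δ ℚ.* pow n) ⦃ ℚ.pos*pos⇒pos δ ⦃ ℚ.positive 0<δ ⦄ (pow n) ⦃ ℚ.positive (0<pow n) ⦄ ⦄))))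

        -- Induction by `superadditive`, which loses an arbitrarily small positive amount each time;
        -- hence the slack `η`, halved at every step.
        below : ∀ n η → 0ℚ ℚ.< η → ¬ Cov (Before B n) (S n ℚ.- E n ℚ.- η)
        below zero    η 0<η cov = <⇒≱ᵠ 0<η (lin₁ (cov-nonneg cov) (ident η))
          where
          open ℚSolver using (con)
          ident : ∀ e → e ℚ.+ ((0ℚ ℚ.- 0ℚ ℚ.- e) ℚ.- 0ℚ) ≡ 0ℚ
          ident = solve 1 (λ e → e :+ ((con 0ℚ :- con 0ℚ :- e) :- con 0ℚ) := con 0ℚ) refl
        below (suc n) η 0<η cov =
          let (γ , 0<γ , e) = half η 0<η in
          w-¬cov n (subst (Cov (B n)) (trans (cong (λ η → (S (suc n) ℚ.- E (suc n) ℚ.- η) ℚ.- (S n ℚ.- E n ℚ.- γ) ℚ.+ γ) (sym e)) (ident (S n) (w n) (E n) (error n) γ))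
            (superadditive (𝓛-Before B l n) (l n)
              (λ (i , i<n , b) → disj i n (ℕ.<⇒≢ i<n) b)
              (cov-mono {Before B n ∪ B n} {Before B (suc n)} (λ { (inj₁ (i , lt , b)) → i , ℕ.m≤n⇒m≤1+n lt , b ; (inj₂ b) → n , ℕ.≤-refl , b }) cov)
              (below n γ 0<γ) γ 0<γ))
          where
          ident : ∀ s w e d g → ((s ℚ.+ w) ℚ.- (e ℚ.+ d) ℚ.- (g ℚ.+ g)) ℚ.- (s ℚ.- e ℚ.- g) ℚ.+ g ≡ w ℚ.- d
          ident = solve 5 (λ s w e d g → ((s :+ w) :- (e :+ d) :- (g :+ g)) :- (s :- e :- g) :+ g := w :- d) refl

        S-bound : ∀ n → S n ℚ.≤ 1ℚ ℚ.+ δ ℚ.+ δ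
        S-bound n = lin₂ (ℚ.<⇒≤ (ℚ.≰⇒> λ le → below n δ 0<δ (cov-up le cov-one))) (E≤δ n) (ident (S n) (E n) δ 1ℚ)
          where
          ident : ∀ s e d o → s ℚ.+ ((o ℚ.- (s ℚ.- e ℚ.- d)) ℚ.+ (d ℚ.- e)) ≡ o ℚ.+ d ℚ.+ d
          ident = solve 4 (λ s e d o → s :+ ((o :- (s :- e :- d)) :+ (d :- e)) := o :+ d :+ d) refl

        -- By superadditivity the series Σ w converges, so its tails are small.
        tail : ∃ λ n → ∀ m → n ≤ m → Cov (λ x → ∃ λ k → m ≤ k × x ∈ B k) δ
        tail =
          let (C₁ , le₁) = ceiling (1ℚ ℚ.+ δ ℚ.+ δ)
              (n , p) = bounded-tail S C₁ (λ n → subst (ℚ._≤ S (suc n)) (ℚ.+-identityʳ (S n)) (ℚ.+-monoʳ-≤ (S n) (cov-nonneg (w-cov n))))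
                          ℚ.≤-refl (λ n → ℚ.≤-trans (S-bound n) le₁) δ 0<δ
          in n , λ m n≤m → cov-mono {λ x → ∃ λ k → m ≤ k × x ∈ B k} {⋃ ℕ (λ k → B (n + k))}
               (λ {x} (k , m≤k , b) → k ∸ n , subst (λ k → x ∈ B k) (sym (ℕ.m+[n∸m]≡n (ℕ.≤-trans n≤m m≤k))) b)
               (cov-⋃ (λ k → B (n + k)) (λ k → w (n + k)) (λ k → w-cov (n + k)) δ
                 (λ K → lin₁ (p (n + K) (ℕ.m≤m+n n K)) (trans (cong (λ s → qsum (λ k → w (n + k)) K ℚ.+ ((S n ℚ.+ δ) ℚ.- s)) (qsum-split w n K))
                   (ident (qsum (λ k → w (n + k)) K) (S n) δ))))
          where
          ident : ∀ q s d → q ℚ.+ ((s ℚ.+ d) ℚ.- (s ℚ.+ q)) ≡ d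
          ident = solve 3 (λ q s d → q :+ ((s :+ d) :- (s :+ q)) := d) refl

      -- Takes the place of Carathéodory's condition: approximability by definable sets is inherited
      -- by all of `𝒜`, and it is what `superadditive` requires.
      measurable : B ∈ 𝒜 → 𝓛 B
      measurable (gen d)      = 𝓛-def d
      measurable (compl b)    = 𝓛-∁ (measurable b)
      measurable (union {B} bs) = 𝓛-⋃ B l λ δ 0<δ →
        let (n , small) = Disjoint.tail (fresh B) (𝓛-fresh B l) (fresh-disjoint B) δ 0<δ in n , small n ℕ.≤-refl
        where
        l : ∀ n → 𝓛 (B n)
        l n = measurable (bs n)
      measurable (resp eq b)  = 𝓛-≐ eq (measurable b)

      μ-cov-cong : (∀ {r} → Cov B r → Cov B′ r) → (∀ {r} → Cov B′ r → Cov B r) → μ B ≃ μ B′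
      μ-cov-cong {B} {B′} f g = ≼⇒≃ (μ B) (μ B′) (compare g) (compare f)
        where
        compare : ∀ {B B′} → (∀ {r} → Cov B′ r → Cov B r) → seq (μ B) ≼ seq (μ B′)
        compare {B} {B′} h = ≼-η λ δ 0<δ →
          let (r , cov , ¬cov) = Cut.near (cut B′) δ 0<δ in
          ≼-trans (μ-≤ (h (holds cov))) (≼-trans (≼-eq (λ _ → ident r δ)) (≼-⊕ (μ-≥ {B′} (λ c → ¬cov (true! c))) (≼-pt λ _ → ℚ.≤-refl)))
          where
          ident : ∀ r d → r ≡ (r ℚ.- d) ℚ.+ d
          ident = solve 2 (λ r d → r := (r :- d) :+ d) refl

      module _ (B : ℕ → Pred C ℓ) (l : ∀ k → 𝓛 (B k)) (disj : ∀ i j → i ≢ j → ∀ {x} → x ∈ B i → ¬ (x ∈ B j)) where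

        -- The partial sums are bounded from above by superadditivity, through `below`. From below,
        -- the union is covered by the first `n` sets and a small tail.
        countably-additive : HasLimit (λ n → ∑< n (μ ∘ B)) (μ (⋃ ℕ B))
        countably-additive = hasLimit (λ n → ∑< n (μ ∘ B)) (μ (⋃ ℕ B)) λ ε 0<ε →
          let (δ , 0<δ , e) = half ε 0<ε in close δ 0<δ ε e
          where
          close : ∀ δ → 0ℚ ℚ.< δ → ∀ ε → δ ℚ.+ δ ≡ ε →
            ∃ λ N → ∀ n → N ≤ n → seq (∑< n (μ ∘ B)) ≼ (seq (μ (⋃ ℕ B)) ⊕ κ ε) × seq (μ (⋃ ℕ B)) ≼ (seq (∑< n (μ ∘ B)) ⊕ κ ε)
          close δ 0<δ ε e = proj₁ tail , λ n N≤n →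
              ≼-trans (sum-≤ n) (≼-trans (κ-mono (lin₁ (E≤δ n) (trans (one (S n) (E n) δ) (cong ((S n ℚ.- E n ℚ.- δ) ℚ.+_) e))))
                (≼-⊕ (μ-≥ {⋃ ℕ B} (λ cov → below n δ 0<δ (cov-mono {Before B n} {⋃ ℕ B} (λ (k , _ , b) → k , b) cov))) (≼-pt λ _ → ℚ.≤-refl))) ,
              ≼-trans (μ-≤ {⋃ ℕ B} (cov-mono {⋃ ℕ B} {Before B n ∪ (λ x → ∃ λ k → n ≤ k × x ∈ B k)} (split n)
                  (cov-∪ (cov-Before B w w-cov n) (proj₂ tail n N≤n))))
                (≼-trans (κ-mono (lin₁ (E≤δ n) (trans (two (S n) (E n) δ) (cong ((S n ℚ.- E n) ℚ.+_) e)))) (≼-⊕ (sum-≥ n) (≼-pt λ _ → ℚ.≤-refl)))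
            where
            open Disjoint B l disj δ 0<δ
            one : ∀ s e d → s ℚ.+ (d ℚ.- e) ≡ (s ℚ.- e ℚ.- d) ℚ.+ (d ℚ.+ d)
            one = solve 3 (λ s e d → s :+ (d :- e) := (s :- e :- d) :+ (d :+ d)) refl
            two : ∀ s e d → (s ℚ.+ d) ℚ.+ (d ℚ.- e) ≡ (s ℚ.- e) ℚ.+ (d ℚ.+ d)
            two = solve 3 (λ s e d → (s :+ d) :+ (d :- e) := (s :- e) :+ (d :+ d)) refl

            split : ∀ n {x} → x ∈ ⋃ ℕ B → x ∈ (Before B n ∪ (λ x → ∃ λ k → n ≤ k × x ∈ B k))
            split n (k , b) with k ℕ.<? n
            ... | yes k<n = inj₁ (k , k<n , b)
            ... | no ¬k<n = inj₂ (k , ℕ.≮⇒≥ ¬k<n , b)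

            sum-≤ : ∀ n → seq (∑< n (μ ∘ B)) ≼ κ (S n)
            sum-≤ zero    = ≼-pt λ _ → ℚ.≤-refl
            sum-≤ (suc n) = ≼-⊕ (sum-≤ n) (μ-≤ (w-cov n))

            sum-≥ : ∀ n → κ (S n ℚ.- E n) ≼ seq (∑< n (μ ∘ B))
            sum-≥ zero    = ≼-pt λ _ → ℚ.≤-refl
            sum-≥ (suc n) = ≼-trans (≼-eq λ _ → ident (S n) (w n) (E n) (error n)) (≼-⊕ (sum-≥ n) (μ-≥ {B n} (w-¬cov n)))
              where
              ident : ∀ s w e d → (s ℚ.+ w) ℚ.- (e ℚ.+ d) ≡ (s ℚ.- e) ℚ.+ (w ℚ.- d)
              ident = solve 4 (λ s w e d → (s :+ w) :- (e :+ d) := (s :- e) :+ (w :- d)) refl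

      probability : IsProbability 𝒜 μ
      probability = record
        { μ-cong   = λ {B} {B′} _ _ (f , g) → μ-cov-cong {B} {B′} (cov-mono g) (cov-mono f)
        ; nonneg   = λ {B} _ → ≼⇒≤ᴿ 0ℝ (μ B) (≼-η λ δ 0<δ → ≼-trans (≼-eq (λ _ → ident δ))
                       (≼-⊕ (μ-≥ {B} {0ℚ ℚ.- δ} (λ cov → <⇒≱ᵠ 0<δ (lin₁ (cov-nonneg cov) (ident′ δ)))) (≼-pt λ _ → ℚ.≤-refl)))
        ; total    = ≼⇒≃ (μ Full) 1ℝ (μ-≤ {Full} cov-one) (≼-η λ δ 0<δ → ≼-trans (≼-eq (λ _ → ident″ 1ℚ δ))
                       (≼-⊕ (μ-≥ {Full} {1ℚ ℚ.- δ} (λ cov → <⇒≱ᵠ 0<δ (lin₁ (freq-full (cov-freq full-def cov)) (ident‴ δ 1ℚ)))) (≼-pt λ _ → ℚ.≤-refl)))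
        ; additive = λ B bs disj → countably-additive B (λ k → measurable (bs k)) (λ i j i≢j b b′ → disj i j i≢j (b , b′))
        }
        where
        open ℚSolver using (con)
        full-def : Def M Full Full
        full-def = def-≐ ((λ _ → _) , λ { _ (lift ()) }) (def-∁ def-∅)
        ident : ∀ d → 0ℚ ≡ (0ℚ ℚ.- d) ℚ.+ d
        ident = solve 1 (λ d → con 0ℚ := (con 0ℚ :- d) :+ d) refl
        ident′ : ∀ d → d ℚ.+ ((0ℚ ℚ.- d) ℚ.- 0ℚ) ≡ 0ℚ
        ident′ = solve 1 (λ d → d :+ ((con 0ℚ :- d) :- con 0ℚ) := con 0ℚ) refl
        ident″ : ∀ o d → o ≡ (o ℚ.- d) ℚ.+ d
        ident″ = solve 2 (λ o d → o := (o :- d) :+ d) refl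
        ident‴ : ∀ d o → d ℚ.+ ((o ℚ.- d) ℚ.- o) ≡ 0ℚ
        ident‴ = solve 2 (λ d o → d :+ ((o :- d) :- o) := con 0ℚ) refl

      def-image : Def M Full B → Def M Full (image to B)
      def-image {B} ((k , φ , c , _) , p , q) = (k , φ , to ∘ c , _) ,
        (λ { {x} (b , b∈ , refl) → sat-≗ φ (λ { zero → refl ; (suc i) → refl }) (⇒ (Automorphism.sat-aut σ φ) (p b∈)) }) ,
        (λ {x} s → from x , q (⇐ (Automorphism.sat-aut σ φ) (sat-≗ φ (λ { zero → sym (strictlyInverseˡ x) ; (suc i) → refl }) s)) , strictlyInverseˡ x)

      def-preimage : Def M Full B → Def M Full (λ x → to x ∈ B)
      def-preimage {B} ((k , φ , c , _) , p , q) = (k , φ , from ∘ c , _) ,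
        (λ {x} b → ⇐ (Automorphism.sat-aut σ φ) (sat-≗ φ (λ { zero → refl ; (suc i) → sym (strictlyInverseˡ (c i)) }) (p b))) ,
        (λ {x} s → q (sat-≗ φ (λ { zero → refl ; (suc i) → strictlyInverseˡ (c i) }) (⇒ (Automorphism.sat-aut σ φ) s)))

      𝒜-image : B ∈ 𝒜 → image to B ∈ 𝒜
      𝒜-image (gen d)     = gen (def-image d)
      𝒜-image (compl {B} b)   = resp
        ( (λ {x} ¬b → from x , (λ b → ¬b (from x , b , strictlyInverseˡ x)) , strictlyInverseˡ x)
        , (λ { (y , ¬b , refl) (z , b , e) → ¬b (subst B (Automorphism.to-injective σ e) b) })) (compl (𝒜-image b))
      𝒜-image (union bs)  = resp
        ( (λ { (n , y , b , e) → y , (n , b) , e }) , (λ { (y , (n , b) , e) → n , y , b , e })) (union λ n → 𝒜-image (bs n))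
      𝒜-image (resp (f , g) b) = resp ((λ { (y , b , e) → y , f b , e }) , (λ { (y , b , e) → y , g b , e })) (𝒜-image b)

      private
        freq-one-more : (∀ N → visits B′ N ≤ visits B N + 1) → Freq B r → Freq B′ r
        freq-one-more {B′} {B} {r} le (c , often) = c + 1 , many-map (λ N p → ℚ.≤-trans (ι-mono (le N)) (ℚ.≤-trans (ℚ.≤-reflexive (ι-+ (visits B N) 1))
          (ℚ.≤-trans (ℚ.+-monoˡ-≤ (ι 1) p) (ℚ.≤-reflexive (trans (ℚ.+-assoc (r ℚ.* ι N) (ι c) (ι 1)) (cong (r ℚ.* ι N ℚ.+_) (sym (ι-+ c 1)))))))) often

        image-visits : ∀ N → visits (image to B) N ≤ visits B N + 1
        image-visits {B} N = ℕ.≤-trans (cnt-shift-≥ (λ i → ⌞ orb i ∈ image to B ⌟) 1 N)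
          (ℕ.+-monoˡ-≤ 1 (cnt-mono {λ i → ⌞ orb (suc i) ∈ image to B ⌟} {λ i → ⌞ orb i ∈ B ⌟} (λ i t → let (b , b∈ , e) = holds {P = orb (suc i) ∈ image to B} t in true! (subst B (Automorphism.to-injective σ e) b∈)) N))

        preimage-visits : ∀ N → visits (λ x → to x ∈ B) N ≤ visits B N + 1
        preimage-visits {B} N = cnt-shift-≤ (λ i → ⌞ orb i ∈ B ⌟) 1 N

      cov-image : Cov B r → Cov (image to B) r
      cov-image {B} (D , defs , cover , freq) = (λ k → image to (D k)) , (λ k → def-image (defs k)) ,
        (λ { (b , b∈ , e) → let (k , d) = cover b∈ in k , b , d , e }) ,
        λ N → freq-mono {Before (λ k → image to (D k)) N} {image to (Before D N)} (λ { (k , lt , b , d , e) → b , (k , lt , d) , e })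
                (freq-one-more {image to (Before D N)} {Before D N} (image-visits {Before D N}) (freq N))

      cov-image⁻¹ : Cov (image to B) r → Cov B r
      cov-image⁻¹ {B} (D , defs , cover , freq) = (λ k x → to x ∈ D k) , (λ k → def-preimage (defs k)) ,
        (λ {x} b → cover (x , b , refl)) ,
        λ N → freq-one-more {Before (λ k x → to x ∈ D k) N} {Before D N} (preimage-visits {Before D N}) (freq N)

      invariant : Invariant 𝒜 μ (bij σ)
      invariant {B} b = 𝒜-image b , μ-cov-cong {image to B} {B} cov-image⁻¹ cov-image

      def-power : ∀ n → Def M Full B → Def M Full (image (bij σ ^ᶻ (ℤ.+ n)) B)
      def-power {B} zero    d = def-≐ ((λ {x} b → x , b , refl) , λ { (x , b , refl) → b }) d
      def-power {B} (suc n) d = def-≐ ((λ { (x , (y , b , refl) , e) → y , b , e }) , λ { (y , b , e) → _ , (y , b , refl) , e }) (def-image (def-power n d))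

      ¼ : ℚ
      ¼ = ½ ℚ.* ½

      -- The trace of `V` on the orbit is `RS`, so `V` and its translate by a positive power differ
      -- with frequency ½ along the orbit. For definable sets a cover of size ¼ would bound that
      -- frequency.
      not-compact : ∀ {q} (θ : Formula L (suc q)) (c : Vector C q) → (∀ i → tv θ ((bij σ ^ᶻ i) a V.∷ c) ≡ RS i) → ¬ CompactSystem 𝒜 μ (bij σ)
      not-compact {q} θ c pattern-c compact =
        let (n , 1≤n , lt) = compact (fromℚ ¼) (¼ , ℚ.positive⁻¹ ¼ , 0 , λ _ _ → ℚ.≤-reflexive (ℚ.+-identityˡ ¼)) V (gen V-def)
        in ≼⇒≤ᴿ (fromℚ ¼) (μ (X n)) (μ-≥ {X n} (far n 1≤n)) lt
        where
        V : Pred C ℓ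
        V x = M ⊨ θ [ x V.∷ c ]

        V-def : Def M Full V
        V-def = (q , θ , c , _) , id , id

        X : ℕ → Pred C ℓ
        X n = image (bij σ ^ᶻ (ℤ.+ n)) V △ V

        moved : ∀ n i → ⌞ orb i ∈ image (bij σ ^ᶻ (ℤ.+ n)) V ⌟ ≡ RS (ℤ.+ i ℤ.- ℤ.+ n)
        moved n i = trans (⌞⌟-cong (λ { (b , v , e) → subst V (power-injective (bij σ) n (trans e (sym back))) v })
                                   (λ v → _ , v , back)) (pattern-c (ℤ.+ i ℤ.- ℤ.+ n))
          where
          back : (bij σ ^ᶻ (ℤ.+ n)) ((bij σ ^ᶻ (ℤ.+ i ℤ.- ℤ.+ n)) a) ≡ orb i
          back = trans (power-+ (bij σ) n (ℤ.+ i ℤ.- ℤ.+ n) a) (cong (λ j → (bij σ ^ᶻ j) a)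
            (trans (cong (λ j → ℤ.+ n ℤ.+ j) (ℤ.+-comm (ℤ.+ i) (ℤ.- ℤ.+ n))) (trans (sym (ℤ.+-assoc (ℤ.+ n) (ℤ.- ℤ.+ n) (ℤ.+ i)))
              (trans (cong (λ j → j ℤ.+ ℤ.+ i) (ℤ.+-inverseʳ (ℤ.+ n))) (ℤ.+-identityˡ (ℤ.+ i))))))

        visits-X : ∀ n i → ⌞ orb i ∈ X n ⌟ ≡ RS (ℤ.+ i ℤ.- ℤ.+ n) xor RS (ℤ.+ i)
        visits-X n i = trans (△-xor (orb i ∈ image (bij σ ^ᶻ (ℤ.+ n)) V) (orb i ∈ V)) (cong₂ _xor_ (moved n i) (pattern-c (ℤ.+ i)))

        far : ∀ n → 1 ≤ n → ¬ Cov (X n) ¼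
        far (suc n) _ cov =
          let (c₀ , often) = cov-freq (def-△ (def-power (suc n) V-def) V-def) cov
              (K , near) = near-RS-xor n 4
              -- At precision 4 the number `v` of visits satisfies 3N - K ≤ 8v, whereas the cover
              -- gives 4v ≤ N + 4c₀. Together N ≤ 8c₀ + K, so `N` is taken beyond that.
              (N , big , p) = many-find often (suc (8 * c₀ + K))
              v = visits (X (suc n)) N
              lower-bound : 4 * N ≤ 4 * (2 * v) + N + K
              lower-bound = subst (λ x → 4 * N ≤ 4 * (2 * x) + N + K) (sym (cnt-cong (visits-X (suc n)) N)) (proj₂ (near N))
              upper-bound : 4 * v ≤ N + 4 * c₀
              upper-bound = ι-cancel (subst₂ ℚ._≤_ (sym (ι-* 4 v)) (trans (quarter (ι N) (ι c₀)) (sym (trans (ι-+ N (4 * c₀)) (cong (ι N ℚ.+_) (ι-* 4 c₀)))))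
                (ℚ.*-monoˡ-≤-nonNeg (ι 4) ⦃ ℚ.nonNegative (0≤ι 4) ⦄ p))
          in ℕ.<⇒≱ big (ℕ.+-cancelˡ-≤ (3 * N) _ _ (ℕ.≤-trans (ℕ.≤-reflexive (four N)) (ℕ.≤-trans lower-bound
               (ℕ.≤-trans (ℕ.≤-reflexive (regroup v N K)) (ℕ.≤-trans (ℕ.+-monoˡ-≤ (N + K) (ℕ.*-monoʳ-≤ 2 upper-bound)) (ℕ.≤-reflexive (collect N c₀ K)))))))
          where
          four : ∀ n → 3 * n + n ≡ 4 * n
          four = solve-∀
          regroup : ∀ v n k → 4 * (2 * v) + n + k ≡ 2 * (4 * v) + (n + k)
          regroup = solve-∀
          collect : ∀ n c k → 2 * (n + 4 * c) + (n + k) ≡ 3 * n + (8 * c + k)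
          collect = solve-∀
          quarter : ∀ n c → ι 4 ℚ.* (¼ ℚ.* n ℚ.+ c) ≡ n ℚ.+ ι 4 ℚ.* c
          quarter n c = trans (ℚ.*-distribˡ-+ (ι 4) (¼ ℚ.* n) c) (cong (ℚ._+ ι 4 ℚ.* c) (trans (sym (ℚ.*-assoc (ι 4) ¼ n)) (ℚ.*-identityˡ n)))

  open Measure

  -- From wide sequences to shattering by their translates.

  module Wideness where

    private variable
      ℓ : Level

    open ℚSolver using (solve; _:+_; _:-_; _:*_; _:=_)

    -- Double counting: a pair is separated by a fraction 1/m of the points, so some
    -- point separates a fraction 1/m of the pairs.
    module _ {a} {Z : Set a} (sep : Z → ℕ → Bool) where
      private
        pairs-sum : List Z → ℕ → ℕ
        pairs-sum []      W = 0
        pairs-sum (z ∷ P) W = cnt (sep z) W + pairs-sum P W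

        points-sum : List Z → ℕ → ℕ
        points-sum P zero    = 0
        points-sum P (suc W) = points-sum P W + tally (λ z → sep z W) P

        double-count : ∀ P W → points-sum P W ≡ pairs-sum P W
        double-count P zero    = sym (zeros P)
          where
          zeros : ∀ P → pairs-sum P 0 ≡ 0
          zeros []      = refl
          zeros (z ∷ P) = zeros P
        double-count P (suc W) = trans (cong (_+ tally (λ z → sep z W) P) (double-count P W)) (step P)
          where
          step : ∀ P → pairs-sum P W + tally (λ z → sep z W) P ≡ pairs-sum P (suc W)
          step []      = refl
          step (z ∷ P) = trans (interchange (cnt (sep z) W) (pairs-sum P W) (𝟙 (sep z W)) _) (cong (cnt (sep z) W + 𝟙 (sep z W) +_) (step P))

      average : ∀ m P W → 0 < W → All (λ z → W ≤ m * cnt (sep z) W) P → ∃ λ k → length P ≤ m * tally (λ z → sep z k) P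
      average m P W 0<W big = dne λ none → ℕ.<⇒≱ (few λ k → ℕ.≰⇒> λ le → none (k , le)) (many P big)
        where
        open ℕ.≤-Reasoning
        many : ∀ P → All (λ z → W ≤ m * cnt (sep z) W) P → length P * W ≤ m * pairs-sum P W
        many [] [] = z≤n
        many (z ∷ P) (b ∷ bs) = ℕ.≤-trans (ℕ.+-mono-≤ b (many P bs)) (ℕ.≤-reflexive (sym (ℕ.*-distribˡ-+ m (cnt (sep z) W) (pairs-sum P W))))

        few : (∀ k → m * tally (λ z → sep z k) P < length P) → m * pairs-sum P W < length P * W
        few lt = begin-strict
          m * pairs-sum P W     <⟨ ℕ.m<m+n _ 0<W ⟩
          m * pairs-sum P W + W ≡⟨ cong (λ s → m * s + W) (double-count P W) ⟨
          m * points-sum P W + W ≤⟨ go W ⟩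
          length P * W          ∎
          where
          go : ∀ W → m * points-sum P W + W ≤ length P * W
          go zero    = ℕ.≤-reflexive (trans (ℕ.+-identityʳ (m * 0)) (trans (ℕ.*-zeroʳ m) (sym (ℕ.*-zeroʳ (length P)))))
          go (suc W) = begin
            m * (points-sum P W + tally (λ z → sep z W) P) + suc W ≡⟨ regroup m (points-sum P W) (tally (λ z → sep z W) P) W ⟩
            (m * points-sum P W + W) + suc (m * tally (λ z → sep z W) P) ≤⟨ ℕ.+-mono-≤ (go W) (lt W) ⟩
            length P * W + length P                              ≡⟨ trans (ℕ.+-comm (length P * W) (length P)) (sym (ℕ.*-suc (length P) W)) ⟩
            length P * suc W                                     ∎
            where
            regroup : ∀ m p t w → m * (p + t) + suc w ≡ (m * p + w) + suc (m * t)
            regroup = solve-∀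

    ∧-not⇒xor : ∀ x y → T (x ∧ not y) → T (x xor y)
    ∧-not⇒xor true false _ = tt

    module WideShatters (I : ℤ → Bool) where

      Trans : ℕ → ℤ → Bool
      Trans n i = I (i ℤ.- ℤ.+ n)

      private
        exit : ℕ → ℤ → Bool
        exit d i = I i ∧ not (I (i ℤ.- ℤ.+ suc d))

        count-exit : ∀ d N → count I N ≡ count (λ i → I i ∧ shift I (ℤ.+ suc d) i) N + count (exit d) N
        count-exit d N = trans (count-window I N) (trans (split (suc (2 * N)))
          (sym (cong₂ _+_ (count-window (λ i → I i ∧ shift I (ℤ.+ suc d) i) N) (count-window (exit d) N))))
          where
          one : ∀ x y → 𝟙 x ≡ 𝟙 (x ∧ y) + 𝟙 (x ∧ not y)
          one false y     = refl
          one true  false = refl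
          one true  true  = refl

          split : ∀ n → cnt (λ k → I (ℤ.+ k ℤ.- ℤ.+ N)) n ≡ cnt (λ k → I (ℤ.+ k ℤ.- ℤ.+ N) ∧ shift I (ℤ.+ suc d) (ℤ.+ k ℤ.- ℤ.+ N)) n + cnt (λ k → exit d (ℤ.+ k ℤ.- ℤ.+ N)) n
          split zero    = refl
          split (suc n) = trans (cong₂ _+_ (split n) (one (I (ℤ.+ n ℤ.- ℤ.+ N)) (shift I (ℤ.+ suc d) (ℤ.+ n ℤ.- ℤ.+ N))))
            (interchange (cnt (λ k → I (ℤ.+ k ℤ.- ℤ.+ N) ∧ shift I (ℤ.+ suc d) (ℤ.+ k ℤ.- ℤ.+ N)) n) (cnt (λ k → exit d (ℤ.+ k ℤ.- ℤ.+ N)) n) _ _)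

        -- By wideness the density of `I` minus its translate is at least δ₀ = 2δ. One δ is spent on
        -- replacing the two densities by finite frequencies, at a cost of γ each.
        exit-large : ∀ ε δ₀ δ → κ δ₀ ≼ seq ε → 0ℚ ℚ.< δ → δ ℚ.+ δ ≡ δ₀ → Wide ε I →
                     ∀ d → ∃ λ N₀ → ∀ N → N₀ ≤ N → δ ℚ.* ι (suc N) ℚ.≤ ι (count (exit d) (suc N))
        exit-large ε δ₀ δ κδ₀≼ε 0<δ δδ wide d =
          let (ρ , ρ′ , lim , lim′ , le) = wide (ℤ.+ suc d) (λ ())
              (γ , 0<γ , γγ) = half δ 0<δ
              (N₁ , p) = hasLimit⁻¹ (λ n → fromℚ (ℤ.+ count I (suc n) ℚ./ suc n)) ρ lim γ 0<γ
              (N₂ , q) = hasLimit⁻¹ (λ n → fromℚ (ℤ.+ count J (suc n) ℚ./ suc n)) ρ′ lim′ γ 0<γ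
              κδ₀ : κ δ₀ ≼ seq (ρ -ᴿ ρ′)
              κδ₀ = ≼-trans κδ₀≼ε (≤ᴿ⇒≼ ε (ρ -ᴿ ρ′) le)
          in N₁ ℕ.⊔ N₂ , λ N N≥ → frac N γ γγ (≼-κ (≼-trans κδ₀
               (≼-⊕ (proj₂ (p N (ℕ.m⊔n≤o⇒m≤o N₁ N₂ N≥))) (≼-neg (move (proj₁ (q N (ℕ.m⊔n≤o⇒n≤o N₁ N₂ N≥))))))))
          where
          J : ℤ → Bool
          J i = I i ∧ shift I (ℤ.+ suc d) i

          move : ∀ {x γ s} → κ x ≼ (s ⊕ κ γ) → κ (x ℚ.- γ) ≼ s
          move {x} {γ} {s} f = ≼-trans (≼-⊕ f (≼-pt {κ (ℚ.- γ)} {κ (ℚ.- γ)} λ _ → ℚ.≤-refl)) (≼-eq λ n → ident (s n) γ)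
            where
            ident : ∀ s g → (s ℚ.+ g) ℚ.+ ℚ.- g ≡ s
            ident = solve 2 (λ s g → (s :+ g) :- g := s) refl

          frac : ∀ N γ → γ ℚ.+ γ ≡ δ →
            δ₀ ℚ.≤ (ℤ.+ count I (suc N) ℚ./ suc N ℚ.+ γ) ℚ.+ ℚ.- (ℤ.+ count J (suc N) ℚ./ suc N ℚ.- γ) →
            δ ℚ.* ι (suc N) ℚ.≤ ι (count (exit d) (suc N))
          frac N γ γγ le = lin₁ (*-mono-≤ (0≤ι (suc N)) le) (begin
              δ ℚ.* n ℚ.+ (((x ℚ.+ γ) ℚ.+ ℚ.- (y ℚ.- γ)) ℚ.* n ℚ.- δ₀ ℚ.* n)
                ≡⟨ ident δ n x y γ δ₀ ⟩
              (x ℚ.* n ℚ.- y ℚ.* n) ℚ.+ (δ ℚ.+ (γ ℚ.+ γ) ℚ.- δ₀) ℚ.* n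
                ≡⟨ cong₂ (λ u v → u ℚ.+ v ℚ.* n) (cong₂ ℚ._-_ (/-ι (count I (suc N)) N) (/-ι (count J (suc N)) N)) zero-coeff ⟩
              (ι (count I (suc N)) ℚ.- ι (count J (suc N))) ℚ.+ 0ℚ ℚ.* n
                ≡⟨ cong₂ ℚ._+_ (cong (ℚ._- ι (count J (suc N))) (trans (cong ι (count-exit d (suc N))) (ι-+ (count J (suc N)) (count (exit d) (suc N))))) (ℚ.*-zeroˡ n) ⟩
              ((ι (count J (suc N)) ℚ.+ ι (count (exit d) (suc N))) ℚ.- ι (count J (suc N))) ℚ.+ 0ℚ
                ≡⟨ cancel (ι (count J (suc N))) (ι (count (exit d) (suc N))) ⟩
              ι (count (exit d) (suc N)) ∎)
            where
            open ≡-Reasoning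
            open ℚSolver using (con)
            n = ι (suc N)
            x = ℤ.+ count I (suc N) ℚ./ suc N
            y = ℤ.+ count J (suc N) ℚ./ suc N
            ident : ∀ d n x y g e → d ℚ.* n ℚ.+ (((x ℚ.+ g) ℚ.+ ℚ.- (y ℚ.- g)) ℚ.* n ℚ.- e ℚ.* n) ≡ (x ℚ.* n ℚ.- y ℚ.* n) ℚ.+ (d ℚ.+ (g ℚ.+ g) ℚ.- e) ℚ.* n
            ident = solve 6 (λ d n x y g e → d :* n :+ (((x :+ g) :- (y :- g)) :* n :- e :* n) := (x :* n :- y :* n) :+ (d :+ (g :+ g) :- e) :* n) refl
            zero-coeff : δ ℚ.+ (γ ℚ.+ γ) ℚ.- δ₀ ≡ 0ℚ
            zero-coeff = trans (cong (λ g → δ ℚ.+ g ℚ.- δ₀) γγ) (trans (cong (ℚ._- δ₀) δδ) (ℚ.+-inverseʳ δ₀))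
            cancel : ∀ a b → ((a ℚ.+ b) ℚ.- a) ℚ.+ 0ℚ ≡ b
            cancel = solve 2 (λ a b → ((a :+ b) :- a) :+ con 0ℚ := b) refl

        window : ℕ → ℕ → ℤ
        window N k = ℤ.+ k ℤ.- ℤ.+ N

        window-+ : ∀ N i k → window N (i + k) ≡ ℤ.+ i ℤ.+ window N k
        window-+ N i k = ℤ.+-assoc (ℤ.+ i) (ℤ.+ k) (ℤ.- ℤ.+ N)

        sep : ℕ → ℕ × ℕ → ℕ → Bool
        sep N (i , j) k = Trans i (window N k) xor Trans j (window N k)

        -- Translation by `i ≤ N` carries the window [-N, N] into [-N, 2N]. That larger window has
        -- 3N + 1 points and is the same for all pairs, as the averaging requires.
        separation : ∀ i d N → i ≤ N → count (exit d) N ≤ cnt (sep N (i , suc (i + d))) (suc (3 * N))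
        separation i d N i≤N = begin
          count (exit d) N                                        ≡⟨ count-window (exit d) N ⟩
          cnt (λ k → exit d (window N k)) (suc (2 * N))           ≤⟨ cnt-mono shifted (suc (2 * N)) ⟩
          cnt (λ k → sep N (i , suc (i + d)) (i + k)) (suc (2 * N)) ≤⟨ ℕ.m≤n+m _ (cnt (sep N (i , suc (i + d))) i) ⟩
          cnt (sep N (i , suc (i + d))) i + cnt (λ k → sep N (i , suc (i + d)) (i + k)) (suc (2 * N)) ≡⟨ cnt-split (sep N (i , suc (i + d))) i (suc (2 * N)) ⟨
          cnt (sep N (i , suc (i + d))) (i + suc (2 * N))         ≤⟨ ℕ.m≤m+n _ _ ⟩
          cnt (sep N (i , suc (i + d))) (i + suc (2 * N)) + cnt (λ k → sep N (i , suc (i + d)) (i + suc (2 * N) + k)) (N ∸ i) ≡⟨ cnt-split (sep N (i , suc (i + d))) (i + suc (2 * N)) (N ∸ i) ⟨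
          cnt (sep N (i , suc (i + d))) (i + suc (2 * N) + (N ∸ i)) ≡⟨ cong (cnt (sep N (i , suc (i + d)))) size ⟩
          cnt (sep N (i , suc (i + d))) (suc (3 * N))             ∎
          where
          open ℕ.≤-Reasoning
          size : i + suc (2 * N) + (N ∸ i) ≡ suc (3 * N)
          size = trans (rearrange i (2 * N) (N ∸ i)) (cong (λ m → suc (m + 2 * N)) (ℕ.m+[n∸m]≡n i≤N))
            where
            rearrange : ∀ i t s → i + suc t + s ≡ suc ((i + s) + t)
            rearrange = solve-∀

          here′ : ∀ k → window N (i + k) ℤ.- ℤ.+ i ≡ window N k
          here′ k = trans (cong (ℤ._- ℤ.+ i) (window-+ N i k)) (cancelled (ℤ.+ i) (window N k))
            where
            cancelled : ∀ x y → x ℤ.+ y ℤ.- x ≡ y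
            cancelled x y = trans (cong (ℤ._- x) (ℤ.+-comm x y)) (trans (ℤ.+-assoc y x (ℤ.- x)) (trans (cong (λ z → y ℤ.+ z) (ℤ.+-inverseʳ x)) (ℤ.+-identityʳ y)))

          there′ : ∀ k → window N (i + k) ℤ.- ℤ.+ suc (i + d) ≡ window N k ℤ.- ℤ.+ suc d
          there′ k = trans (cong (λ m → window N (i + k) ℤ.- ℤ.+ m) (sym (ℕ.+-suc i d)))
            (trans (cong (λ z → window N (i + k) ℤ.+ z) (ℤ.neg-distrib-+ (ℤ.+ i) (ℤ.+ suc d)))
              (trans (sym (ℤ.+-assoc (window N (i + k)) (ℤ.- ℤ.+ i) (ℤ.- ℤ.+ suc d))) (cong (ℤ._- ℤ.+ suc d) (here′ k))))

          shifted : ∀ k → T (exit d (window N k)) → T (sep N (i , suc (i + d)) (i + k))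
          shifted k t = subst₂ (λ x y → T (I x xor I y)) (sym (here′ k)) (sym (there′ k)) (∧-not⇒xor (I (window N k)) _ t)

      -- For large N, every pair of translates differs on a fixed fraction of [-N , 2N].
      module _ (δ : ℚ) (large : ∀ d → ∃ λ N₀ → ∀ N → N₀ ≤ N → δ ℚ.* ι (suc N) ℚ.≤ ι (count (exit d) (suc N)))
               (m : ℕ) (4≤mδ : ι 4 ℚ.≤ ι m ℚ.* δ) where
        private
          ordered : ∀ i j → i < j → ∃ λ N₀ → ∀ N → N₀ ≤ N → δ ℚ.* ι (suc N) ℚ.≤ ι (cnt (sep (suc N) (i , j)) (suc (3 * suc N)))
          ordered i j i<j with ℕ.m≤n⇒∃[o]m+o≡n i<j
          ... | d , refl = let (N₀ , p) = large d in N₀ ℕ.⊔ i , λ N le →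
                ℚ.≤-trans (p N (ℕ.m⊔n≤o⇒m≤o N₀ i le)) (ι-mono (separation i d (suc N) (ℕ.m≤n⇒m≤1+n (ℕ.m⊔n≤o⇒n≤o N₀ i le))))

          pair-large : ∀ p → proj₁ p ≢ proj₂ p → ∃ λ N₀ → ∀ N → N₀ ≤ N → δ ℚ.* ι (suc N) ℚ.≤ ι (cnt (sep (suc N) p) (suc (3 * suc N)))
          pair-large (i , j) i≢j with ℕ.<-cmp i j
          ... | tri≈ _ i≡j _ = ⊥-elim (i≢j i≡j)
          ... | tri< i<j _ _ = ordered i j i<j
          ... | tri> _ _ j<i = let (N₀ , p) = ordered j i j<i in N₀ , λ N le → ℚ.≤-trans (p N le)
                                 (ℚ.≤-reflexive (cong ι (cnt-cong (λ k → Bool.xor-comm (Trans j (window (suc N) k)) (Trans i (window (suc N) k))) (suc (3 * suc N)))))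

          list-large : ∀ P → All (λ p → proj₁ p ≢ proj₂ p) P → ∃ λ N₀ → ∀ N → N₀ ≤ N → All (λ p → δ ℚ.* ι (suc N) ℚ.≤ ι (cnt (sep (suc N) p) (suc (3 * suc N)))) P
          list-large [] [] = 0 , λ _ _ → []
          list-large (p ∷ P) (d ∷ ds) = let (N₁ , f) = pair-large p d; (N₂ , g) = list-large P ds in
            N₁ ℕ.⊔ N₂ , λ N le → f N (ℕ.m⊔n≤o⇒m≤o N₁ N₂ le) ∷ g N (ℕ.m⊔n≤o⇒n≤o N₁ N₂ le)

          0<m : ∀ k → ι 4 ℚ.≤ ι k ℚ.* δ → 0 < k
          0<m zero    le = ⊥-elim (<⇒≱ᵠ (0<ι 3) (subst (ι 4 ℚ.≤_) (ℚ.*-zeroˡ δ) le))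
          0<m (suc k) _  = s≤s z≤n

          separable : ∀ P → All (λ (i , j) → i ≢ j) P → ∃ λ x → length P ≤ m * tally (λ (i , j) → Trans i x xor Trans j x) P
          separable P ds =
            let (N , f) = list-large P ds
                (k , le) = average (sep (suc N)) m P (suc (3 * suc N)) (s≤s z≤n) (All.map (λ {p} → enough N p) (f N ℕ.≤-refl))
            in window (suc N) k , le
            where
            enough : ∀ N p → δ ℚ.* ι (suc N) ℚ.≤ ι (cnt (sep (suc N) p) (suc (3 * suc N))) → suc (3 * suc N) ≤ m * cnt (sep (suc N) p) (suc (3 * suc N))
            enough N p le = ℕ.≤-trans (ℕ.≤-trans (ℕ.m≤m+n (suc (3 * suc N)) N) (ℕ.≤-reflexive (four N))) (ι-cancel (begin
                ι (4 * suc N)                ≡⟨ ι-* 4 (suc N) ⟩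
                ι 4 ℚ.* ι (suc N)            ≤⟨ *-mono-≤ (0≤ι (suc N)) 4≤mδ ⟩
                ι m ℚ.* δ ℚ.* ι (suc N)      ≡⟨ ℚ.*-assoc (ι m) δ (ι (suc N)) ⟩
                ι m ℚ.* (δ ℚ.* ι (suc N))    ≤⟨ ℚ.*-monoˡ-≤-nonNeg (ι m) ⦃ ℚ.nonNegative (0≤ι m) ⦄ le ⟩
                ι m ℚ.* ι (cnt (sep (suc N) p) (suc (3 * suc N))) ≡⟨ ι-* m _ ⟨
                ι (m * cnt (sep (suc N) p) (suc (3 * suc N))) ∎))
              where
              open ℚ.≤-Reasoning
              four : ∀ n → suc (3 * suc n) + n ≡ 4 * suc n
              four = solve-∀

        shatter-at-scale : ∀ d → ∃ λ (x : Fin d → ℤ) → ∀ (S : Cube d) → ∃ λ n → ∀ i → Trans n (x i) ≡ S i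
        shatter-at-scale = packing Trans m (0<m m 4≤mδ) separable

      translates-shatter : ∀ ε → 0ℝ <ᴿ ε → Wide ε I → ∀ d → ∃ λ (x : Fin d → ℤ) → ∀ (S : Cube d) → ∃ λ n → ∀ i → Trans n (x i) ≡ S i
      translates-shatter ε 0<ε wide =
        let (δ₀ , 0<δ₀ , κδ₀≼ε) = 0<ᴿ⇒κ ε 0<ε
            (δ , 0<δ , δδ) = half δ₀ 0<δ₀
            -- For N ≥ 1 the common window [-N, 2N] has at most 4N points, and a pair of translates
            -- differs on at least δN of them.
            (m , 4≤mδ) = archimedean′ δ 0<δ 4
        in shatter-at-scale δ (exit-large ε δ₀ δ κδ₀≼ε 0<δ δδ wide) m 4≤mδ

  open Wideness

  -- From noncompact systems to shattering by translates of a definable set.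

  module Noncompactness where

    private variable
      ℓ : Level

    open ℚSolver using (solve; _:+_; _:-_; _:*_; _:=_)

    ≼-cancelˡ : ∀ s {t u} → (s ⊕ t) ≼ (s ⊕ u) → t ≼ u
    ≼-cancelˡ s {t} {u} f = ≼-mk λ η 0<η → let (N , p) = _≼_.eventually f η 0<η in N , λ n le → lin₁ (p n le) (ident (s n) (t n) (u n) η)
      where
      ident : ∀ s t u e → t ℚ.+ ((s ℚ.+ u) ℚ.+ e ℚ.- (s ℚ.+ t)) ≡ u ℚ.+ e
      ident = solve 4 (λ s t u e → t :+ ((s :+ u) :+ e :- (s :+ t)) := u :+ e) refl

    ≼-refl : ∀ {s} → s ≼ s
    ≼-refl = ≼-pt λ _ → ℚ.≤-refl

    module MeasureTheory {L : Language ℓ} (M : Structure L) (A : Pred (Carrier M) ℓ) (μ : Pred (Carrier M) ℓ → ℝ)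
                         (prob : IsProbability (Generated (Def M A)) μ) where
      open IsProbability prob
      open Definable M A

      private
        C = Carrier M

        𝒜 : Pred (Pred C ℓ) (lsuc ℓ)
        𝒜 = Generated (Def M A)

        ∅ : Pred C ℓ
        ∅ _ = Lift ℓ ⊥

        variable
          B B′ : Pred C ℓ

      𝐦 : Pred C ℓ → ℕ → ℚ
      𝐦 B = seq (μ B)

      two : Pred C ℓ → Pred C ℓ → ℕ → Pred C ℓ
      two B B′ 0 = B
      two B B′ 1 = B′
      two B B′ (suc (suc _)) = ∅

      two-⋃ : ⋃ ℕ (two B B′) ≐ (B ∪ B′)
      two-⋃ = (λ { (0 , b) → inj₁ b ; (1 , b) → inj₂ b ; (suc (suc _) , lift ()) }) , (λ { (inj₁ b) → 0 , b ; (inj₂ b) → 1 , b })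

      𝒜-∅ : ∅ ∈ 𝒜
      𝒜-∅ = gen def-∅

      𝒜-two : B ∈ 𝒜 → B′ ∈ 𝒜 → ∀ n → two B B′ n ∈ 𝒜
      𝒜-two b b′ 0 = b
      𝒜-two b b′ 1 = b′
      𝒜-two b b′ (suc (suc _)) = 𝒜-∅

      𝒜-∪ : B ∈ 𝒜 → B′ ∈ 𝒜 → (B ∪ B′) ∈ 𝒜
      𝒜-∪ b b′ = resp two-⋃ (union (𝒜-two b b′))

      𝒜-∖ : B ∈ 𝒜 → B′ ∈ 𝒜 → (B ∖ B′) ∈ 𝒜
      𝒜-∖ b b′ = resp ((λ {x} ¬u → dne (λ ¬b → ¬u (inj₁ ¬b)) , (λ b′ → ¬u (inj₂ b′))) , λ { (b , ¬b′) (inj₁ ¬b) → ¬b b ; (b , ¬b′) (inj₂ b′) → ¬b′ b′ })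
        (compl (𝒜-∪ (compl b) b′))

      𝒜-∩ : B ∈ 𝒜 → B′ ∈ 𝒜 → (B ∩ B′) ∈ 𝒜
      𝒜-∩ b b′ = resp ((λ (u , ¬v) → u , dne (λ ¬e → ¬v (u , ¬e))) , λ (u , v) → u , λ (_ , ¬e) → ¬e v) (𝒜-∖ b (𝒜-∖ b b′))

      𝒜-△ : B ∈ 𝒜 → B′ ∈ 𝒜 → (B △ B′) ∈ 𝒜
      𝒜-△ b b′ = 𝒜-∪ (𝒜-∖ b b′) (𝒜-∖ b′ b)

      𝒜-Before : (B : ℕ → Pred C ℓ) → (∀ n → B n ∈ 𝒜) → ∀ n → Before B n ∈ 𝒜
      𝒜-Before B bs zero    = resp ((λ { (lift ()) }) , λ { (_ , () , _) }) 𝒜-∅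
      𝒜-Before B bs (suc n) = resp
        ( (λ { (inj₁ (i , lt , b)) → i , ℕ.m≤n⇒m≤1+n lt , b ; (inj₂ b) → n , ℕ.≤-refl , b })
        , (λ (i , i<n , d) → case ℕ.m≤n⇒m<n∨m≡n (ℕ.s≤s⁻¹ i<n) of λ { (inj₁ lt) → inj₁ (i , lt , d) ; (inj₂ refl) → inj₂ d }))
        (𝒜-∪ (𝒜-Before B bs n) (bs n))

      m-≐ : B ∈ 𝒜 → B ≐ B′ → 𝐦 B ≼ 𝐦 B′
      m-≐ {B} {B′} b eq = ≃⇒≼ (μ B) (μ B′) (μ-cong b (resp eq b) eq)

      m-nonneg : B ∈ 𝒜 → κ 0ℚ ≼ 𝐦 B
      m-nonneg {B} b = ≤ᴿ⇒≼ 0ℝ (μ B) (nonneg b)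

      -- For the constant sequence ∅, the partial sums of lengths `N` and `N + 1` are both near the
      -- limit, and they differ by the measure of ∅.
      m-∅ : 𝐦 ∅ ≼ κ 0ℚ
      m-∅ = ≼-η λ ε 0<ε →
        let (δ , 0<δ , e) = half ε 0<ε
            (N , p) = hasLimit⁻¹ (λ n → ∑< n (λ _ → μ ∅)) (μ (⋃ ℕ (λ _ → ∅))) (additive (λ _ → ∅) (λ _ → 𝒜-∅) (λ _ _ _ → λ { (lift () , _) })) δ 0<δ
        in ≼-cancelˡ (seq (∑< N (λ _ → μ ∅))) (≼-trans (proj₁ (p (suc N) (ℕ.n≤1+n N)))
             (≼-trans (≼-⊕ (proj₂ (p N ℕ.≤-refl)) ≼-refl)
               (≼-eq λ n → trans (ident (seq (∑< N (λ _ → μ ∅)) n) δ) (cong (λ d → seq (∑< N (λ _ → μ ∅)) n ℚ.+ (0ℚ ℚ.+ d)) e))))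
        where
        open ℚSolver using (con)
        ident : ∀ s d → (s ℚ.+ d) ℚ.+ d ≡ s ℚ.+ (0ℚ ℚ.+ (d ℚ.+ d))
        ident = solve 2 (λ s d → (s :+ d) :+ d := s :+ (con 0ℚ :+ (d :+ d))) refl

      private
        two-disjoint : (∀ {x} → x ∈ B → ¬ (x ∈ B′)) → ∀ i j → i ≢ j → ∀ {x} → x ∈ two B B′ i × x ∈ two B B′ j → ⊥
        two-disjoint d 0 0 i≢j _ = i≢j refl
        two-disjoint d 0 1 i≢j (b , b′) = d b b′
        two-disjoint d 0 (suc (suc j)) i≢j (_ , lift ())
        two-disjoint d 1 0 i≢j (b′ , b) = d b b′
        two-disjoint d 1 1 i≢j _ = i≢j refl
        two-disjoint d 1 (suc (suc j)) i≢j (_ , lift ())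
        two-disjoint d (suc (suc i)) j i≢j (lift () , _)

        sum-two-≤ : ∀ k → seq (∑< (2 + k) (μ ∘ two B B′)) ≼ (𝐦 B ⊕ 𝐦 B′)
        sum-two-≤ {B} {B′} zero    = ≼-eq λ n → cong (ℚ._+ 𝐦 B′ n) (ℚ.+-identityˡ (𝐦 B n))
        sum-two-≤ {B} {B′} (suc k) = ≼-trans (≼-⊕ (sum-two-≤ {B} {B′} k) m-∅) (≼-eq λ n → ℚ.+-identityʳ _)

        sum-two-≥ : ∀ k → (𝐦 B ⊕ 𝐦 B′) ≼ seq (∑< (2 + k) (μ ∘ two B B′))
        sum-two-≥ {B} {B′} zero    = ≼-eq λ n → cong (ℚ._+ 𝐦 B′ n) (sym (ℚ.+-identityˡ (𝐦 B n)))
        sum-two-≥ {B} {B′} (suc k) = ≼-trans (≼-eq λ n → sym (ℚ.+-identityʳ _)) (≼-⊕ (sum-two-≥ {B} {B′} k) (m-nonneg 𝒜-∅))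

      module _ (b : B ∈ 𝒜) (b′ : B′ ∈ 𝒜) (disj : ∀ {x} → x ∈ B → ¬ (x ∈ B′)) where
        private
          close = hasLimit⁻¹ (λ n → ∑< n (μ ∘ two B B′)) (μ (⋃ ℕ (two B B′))) (additive (two B B′) (𝒜-two b b′) (two-disjoint disj))

        m-∪-≤ : 𝐦 (B ∪ B′) ≼ (𝐦 B ⊕ 𝐦 B′)
        m-∪-≤ = ≼-trans (m-≐ (𝒜-∪ b b′) (proj₂ two-⋃ , proj₁ two-⋃)) (≼-η λ δ 0<δ → let (N , p) = close δ 0<δ in
          ≼-trans (proj₂ (p (2 + N) (ℕ.m≤n+m N 2))) (≼-⊕ (sum-two-≤ {B} {B′} N) ≼-refl))

        m-∪-≥ : (𝐦 B ⊕ 𝐦 B′) ≼ 𝐦 (B ∪ B′)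
        m-∪-≥ = ≼-trans (≼-η λ δ 0<δ → let (N , p) = close δ 0<δ in
          ≼-trans (sum-two-≥ {B} {B′} N) (proj₁ (p (2 + N) (ℕ.m≤n+m N 2)))) (m-≐ (union (𝒜-two b b′)) two-⋃)

      m-mono : B ∈ 𝒜 → B′ ∈ 𝒜 → (∀ {x} → x ∈ B → x ∈ B′) → 𝐦 B ≼ 𝐦 B′
      m-mono {B} {B′} b b′ sub = ≼-trans (≼-eq λ n → sym (ℚ.+-identityʳ (𝐦 B n))) (≼-trans (≼-⊕ (≼-refl {𝐦 B}) (m-nonneg (𝒜-∖ b′ b)))
        (≼-trans (m-∪-≥ b (𝒜-∖ b′ b) (λ b (_ , ¬b) → ¬b b)) (m-≐ (𝒜-∪ b (𝒜-∖ b′ b))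
          ((λ { (inj₁ b) → sub b ; (inj₂ (b′ , _)) → b′ }) , λ {x} b′ → case decide (x ∈ B) of λ { (yes b) → inj₁ b ; (no ¬b) → inj₂ (b′ , ¬b) }))))

      m-subadditive : B ∈ 𝒜 → B′ ∈ 𝒜 → 𝐦 (B ∪ B′) ≼ (𝐦 B ⊕ 𝐦 B′)
      m-subadditive {B} {B′} b b′ = ≼-trans (m-mono (𝒜-∪ b b′) (𝒜-∪ b (𝒜-∖ b′ b))
          (λ { (inj₁ b) → inj₁ b ; {x} (inj₂ b′) → case decide (x ∈ B) of λ { (yes b) → inj₁ b ; (no ¬b) → inj₂ (b′ , ¬b) } }))
        (≼-trans (m-∪-≤ b (𝒜-∖ b′ b) (λ b (_ , ¬b) → ¬b b)) (≼-⊕ (≼-refl {𝐦 B}) (m-mono (𝒜-∖ b′ b) b′ proj₁)))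

      infixr 4 _,_
      -- `Approximation` wants a notion of size for arbitrary sets. A single measurable hull
      -- suffices, since `𝒜` is closed under unions and the measure is subadditive there.
      record Outer (B : Pred C ℓ) (r : ℚ) : Set (lsuc ℓ) where
        constructor _,_
        field
          hull  : Pred C ℓ
          bound : hull ∈ 𝒜 × (∀ {x} → x ∈ B → x ∈ hull) × 𝐦 hull ≼ κ r

      outer-m : ∀ {r} → B ∈ 𝒜 → Outer B r → 𝐦 B ≼ κ r
      outer-m b (H , h , sub , le) = ≼-trans (m-mono b h sub) le

      open Approximation M A Outer
        (λ f (H , h , sub , le) → H , h , (λ b → sub (f b)) , le)
        (λ r≤s (H , h , sub , le) → H , h , sub , ≼-trans le (κ-mono r≤s))
        (λ (H , h , sub , le) (H′ , h′ , sub′ , le′) → H ∪ H′ , 𝒜-∪ h h′ , Sum.map sub sub′ , ≼-trans (m-subadditive h h′) (≼-⊕ le le′))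
        (λ none → ∅ , 𝒜-∅ , (λ b → ⊥-elim (none b)) , m-∅) public

      private
        module Tail (B : ℕ → Pred C ℓ) (bs : ∀ n → B n ∈ 𝒜) where
          F : ℕ → Pred C ℓ
          F = fresh B

          fs : ∀ n → F n ∈ 𝒜
          fs n = 𝒜-∖ (bs n) (𝒜-Before B bs n)

          sum-≤ : ∀ n → seq (∑< n (μ ∘ F)) ≼ 𝐦 (Before F n)
          sum-≤ zero    = m-nonneg (𝒜-Before F fs 0)
          sum-≤ (suc n) = ≼-trans (≼-⊕ (sum-≤ n) ≼-refl) (≼-trans
            (m-∪-≥ (𝒜-Before F fs n) (fs n) (λ (i , i<n , f) f′ → fresh-disjoint B i n (ℕ.<⇒≢ i<n) f f′))
            (m-mono (𝒜-∪ (𝒜-Before F fs n) (fs n)) (𝒜-Before F fs (suc n))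
              (λ { (inj₁ (i , lt , b)) → i , ℕ.m≤n⇒m≤1+n lt , b ; (inj₂ b) → n , ℕ.≤-refl , b })))

          -- What lies beyond the first `n` disjoint pieces has as its measure the remainder of a
          -- convergent series.
          tails : ∀ δ → 0ℚ ℚ.< δ → ∃ λ n → Outer (λ x → ∃ λ k → n ≤ k × x ∈ F k) δ
          tails δ 0<δ =
            let (n , p) = hasLimit⁻¹ (λ n → ∑< n (μ ∘ F)) (μ (⋃ ℕ F))
                            (additive F fs (λ i j i≢j (f , f′) → fresh-disjoint B i j i≢j f f′)) δ 0<δ
                rest = 𝒜-∖ (union fs) (𝒜-Before F fs n)
            in n , (⋃ ℕ F ∖ Before F n) , rest ,
               (λ (k , n≤k , f) → (k , f) , λ (j , j<n , f′) → fresh-disjoint B j k (λ { refl → ℕ.<⇒≱ j<n n≤k }) f′ f) ,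
               ≼-cancelˡ (𝐦 (Before F n)) (≼-trans (m-∪-≥ (𝒜-Before F fs n) rest (λ f (_ , ¬f) → ¬f f))
                 (≼-trans (m-mono (𝒜-∪ (𝒜-Before F fs n) rest) (union fs) (λ { (inj₁ (k , _ , f)) → k , f ; (inj₂ (f , _)) → f }))
                   (≼-trans (proj₂ (p n ℕ.≤-refl)) (≼-⊕ (sum-≤ n) ≼-refl))))

      approximable : B ∈ 𝒜 → 𝓛 B
      approximable (gen d)        = 𝓛-def d
      approximable (compl b)      = 𝓛-∁ (approximable b)
      approximable (union {B} bs) = 𝓛-⋃ B (λ n → approximable (bs n)) (Tail.tails B bs)
      approximable (resp eq b)    = 𝓛-≐ eq (approximable b)

      -- sum-bound is integration of the counting function: the induction splits W along the first set.
      module Averaging {Z : Set} (E : Z → Pred C ℓ) (es : ∀ z → E z ∈ 𝒜) where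

        hits : List Z → C → ℕ
        hits l x = tally (λ z → ⌞ x ∈ E z ⌟) l

        sum-m : List Z → Pred C ℓ → ℕ → ℚ
        sum-m []      W = κ 0ℚ
        sum-m (z ∷ l) W = 𝐦 (E z ∩ W) ⊕ sum-m l W

        times : ℕ → (ℕ → ℚ) → ℕ → ℚ
        times k s n = ι k ℚ.* s n

        times-nonneg : ∀ k {s} → κ 0ℚ ≼ s → κ 0ℚ ≼ times k s
        times-nonneg zero    {s} p = ≼-eq λ n → sym (ℚ.*-zeroˡ (s n))
        times-nonneg (suc k) {s} p = ≼-trans (≼-⊕ p (times-nonneg k p)) (≼-eq λ n → ident (ι k) (s n))
          where
          ident : ∀ k s → s ℚ.+ k ℚ.* s ≡ (1ℚ ℚ.+ k) ℚ.* s
          ident k s = trans (cong (ℚ._+ k ℚ.* s) (sym (ℚ.*-identityˡ s))) (sym (ℚ.*-distribʳ-+ s 1ℚ k))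

        times-mono : ∀ k {s t} → s ≼ t → times k s ≼ times k t
        times-mono zero    {s} {t} p = ≼-eq λ n → trans (ℚ.*-zeroˡ (s n)) (sym (ℚ.*-zeroˡ (t n)))
        times-mono (suc k) {s} {t} p = ≼-trans (≼-eq λ n → expand (ι k) (s n)) (≼-trans (≼-⊕ p (times-mono k p)) (≼-eq λ n → sym (expand (ι k) (t n))))
          where
          expand : ∀ k s → (1ℚ ℚ.+ k) ℚ.* s ≡ s ℚ.+ k ℚ.* s
          expand k s = trans (ℚ.*-distribʳ-+ s 1ℚ k) (cong (ℚ._+ k ℚ.* s) (ℚ.*-identityˡ s))

        sum-split : ∀ l {W W₁ W₂} → W ∈ 𝒜 → W₁ ∈ 𝒜 → W₂ ∈ 𝒜 → (∀ {x} → x ∈ W → x ∈ W₁ ⊎ x ∈ W₂) → sum-m l W ≼ (sum-m l W₁ ⊕ sum-m l W₂)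
        sum-split [] _ _ _ _ = ≼-eq λ _ → refl
        sum-split (z ∷ l) {W} {W₁} {W₂} w w₁ w₂ sub = ≼-trans
          (≼-⊕ (≼-trans (m-mono (𝒜-∩ (es z) w) (𝒜-∪ (𝒜-∩ (es z) w₁) (𝒜-∩ (es z) w₂)) (λ (e , x) → Sum.map (e ,_) (e ,_) (sub x)))
                        (m-subadditive (𝒜-∩ (es z) w₁) (𝒜-∩ (es z) w₂)))
               (sum-split l w w₁ w₂ sub))
          (≼-eq λ n → ident (𝐦 (E z ∩ W₁) n) (𝐦 (E z ∩ W₂) n) (sum-m l W₁ n) (sum-m l W₂ n))
          where
          ident : ∀ a b c d → (a ℚ.+ b) ℚ.+ (c ℚ.+ d) ≡ (a ℚ.+ c) ℚ.+ (b ℚ.+ d)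
          ident = solve 4 (λ a b c d → (a :+ b) :+ (c :+ d) := (a :+ c) :+ (b :+ d)) refl

        sum-bound : ∀ l {W} → W ∈ 𝒜 → ∀ k → (∀ x → x ∈ W → hits l x ≤ k) → sum-m l W ≼ times k (𝐦 W)
        sum-bound [] w k _ = times-nonneg k (m-nonneg w)
        sum-bound (z ∷ l) {W} w k le = ≼-trans (≼-⊕ (≼-refl {𝐦 (E z ∩ W)}) (sum-split l w w₁ w₂ (λ {x} x∈ → case decide (x ∈ E z) of λ { (yes e) → inj₁ (e , x∈) ; (no ¬e) → inj₂ (x∈ , ¬e) })))
            (split k le)
          where
          w₁ : (E z ∩ W) ∈ 𝒜
          w₁ = 𝒜-∩ (es z) w
          w₂ : (W ∖ E z) ∈ 𝒜
          w₂ = 𝒜-∖ w (es z)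

          in-E : ∀ x → x ∈ E z → hits (z ∷ l) x ≡ suc (hits l x)
          in-E x e = cong (λ b → 𝟙 b + hits l x) (T-ext {y = true} (λ _ → tt) (λ _ → true! e))

          weaken : ∀ {k} x → hits (z ∷ l) x ≤ k → hits l x ≤ k
          weaken x = ℕ.≤-trans (ℕ.m≤n+m (hits l x) _)

          split : ∀ k → (∀ x → x ∈ W → hits (z ∷ l) x ≤ k) → (𝐦 (E z ∩ W) ⊕ (sum-m l (E z ∩ W) ⊕ sum-m l (W ∖ E z))) ≼ times k (𝐦 W)
          split zero le = ≼-trans (≼-⊕ (≼-trans (m-mono w₁ 𝒜-∅ (λ {x} (e , x∈) → ⊥-elim (none x e x∈))) m-∅)
              (≼-⊕ (sum-bound l w₁ 0 (λ x (e , x∈) → ⊥-elim (none x e x∈))) (sum-bound l w₂ 0 (λ x (x∈ , _) → weaken x (le x x∈)))))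
              (≼-eq λ n → ident (𝐦 (E z ∩ W) n) (𝐦 (W ∖ E z) n) (𝐦 W n))
            where
            open ℚSolver using (con)
            none : ∀ x → x ∈ E z → ¬ (x ∈ W)
            none x e x∈ = case subst (_≤ 0) (in-E x e) (le x x∈) of λ ()
            ident : ∀ a b c → 0ℚ ℚ.+ (0ℚ ℚ.* a ℚ.+ 0ℚ ℚ.* b) ≡ 0ℚ ℚ.* c
            ident = solve 3 (λ a b c → con 0ℚ :+ (con 0ℚ :* a :+ con 0ℚ :* b) := con 0ℚ :* c) refl
          -- On `E z ∩ W` one hit is due to `E z`, which leaves `k` for the rest of the list; on
          -- `W ∖ E z` the bound stays `suc k`.
          split (suc k) le = ≼-trans (≼-⊕ (≼-refl {𝐦 (E z ∩ W)})
              (≼-⊕ (sum-bound l w₁ k (λ x (e , x∈) → ℕ.s≤s⁻¹ (subst (_≤ suc k) (in-E x e) (le x x∈)))) (sum-bound l w₂ (suc k) (λ x (x∈ , _) → weaken x (le x x∈)))))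
              (≼-trans (≼-eq λ n → ident (𝐦 (E z ∩ W) n) (ι k) (𝐦 (W ∖ E z) n)) (times-mono (suc k)
                (≼-trans (m-∪-≥ w₁ w₂ (λ (e , _) (_ , ¬e) → ¬e e)) (m-mono (𝒜-∪ w₁ w₂) w (λ { (inj₁ (_ , x∈)) → x∈ ; (inj₂ (x∈ , _)) → x∈ })))))
            where
            ident : ∀ a k b → a ℚ.+ (k ℚ.* a ℚ.+ (1ℚ ℚ.+ k) ℚ.* b) ≡ (1ℚ ℚ.+ k) ℚ.* (a ℚ.+ b)
            ident a k b = trans (cong (ℚ._+ (k ℚ.* a ℚ.+ (1ℚ ℚ.+ k) ℚ.* b)) (sym (ℚ.*-identityˡ a))) (rest 1ℚ a k b)
              where
              rest : ∀ o a k b → o ℚ.* a ℚ.+ (k ℚ.* a ℚ.+ (o ℚ.+ k) ℚ.* b) ≡ (o ℚ.+ k) ℚ.* (a ℚ.+ b)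
              rest = solve 4 (λ o a k b → o :* a :+ (k :* a :+ (o :+ k) :* b) := (o :+ k) :* (a :+ b)) refl

        private
          Full : Pred C ℓ
          Full _ = ⊤

          full : Full ∈ 𝒜
          full = resp ((λ _ → _) , λ { _ (lift ()) }) (compl 𝒜-∅)

        large-sum : ∀ γ l → All (λ z → κ γ ≼ 𝐦 (E z)) l → κ (ι (length l) ℚ.* γ) ≼ sum-m l Full
        large-sum γ [] [] = ≼-eq λ _ → ℚ.*-zeroˡ γ
        large-sum γ (z ∷ l) (p ∷ ps) = ≼-trans (≼-eq λ _ → trans (ℚ.*-distribʳ-+ γ 1ℚ (ι (length l))) (cong (ℚ._+ ι (length l) ℚ.* γ) (ℚ.*-identityˡ γ)))
          (≼-⊕ (≼-trans p (m-mono (es z) (𝒜-∩ (es z) full) (λ e → e , _))) (large-sum γ l ps))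

        hits-≤-length : ∀ l x → hits l x ≤ length l
        hits-≤-length []      x = z≤n
        hits-≤-length (z ∷ l) x = ℕ.+-mono-≤ (𝟙≤1 ⌞ x ∈ E z ⌟) (hits-≤-length l x)

        -- Let `k` be the maximal number of hits. The measures add up to at least γ times the length
        -- of the list and to at most `k`, so a point attaining `k` will do.
        popular : ∀ γ m → 1ℚ ℚ.≤ ι m ℚ.* γ → ∀ l → All (λ z → κ γ ≼ 𝐦 (E z)) l → ∃ λ x → length l ≤ m * hits l x
        popular γ m 1≤mγ l big =
          let (k , upper , least-k) = leastℕ (λ k → T ⌞ (∀ x → hits l x ≤ k) ⌟) (length l , true! (hits-≤-length l))
              (x , k≤) = attained k least-k
              total-≤ : ι (length l) ℚ.* γ ℚ.≤ ι k
              total-≤ = ≼-κ (≼-trans (large-sum γ l big) (≼-trans (sum-bound l full k (λ x _ → holds upper x))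
                          (≼-trans (times-mono k (≃⇒≼ (μ Full) 1ℝ total)) (≼-eq λ _ → ℚ.*-identityʳ (ι k)))))
          in x , ι-cancel (begin
               ι (length l)                    ≡⟨ ℚ.*-identityˡ _ ⟨
               1ℚ ℚ.* ι (length l)             ≤⟨ *-mono-≤ (0≤ι (length l)) 1≤mγ ⟩
               ι m ℚ.* γ ℚ.* ι (length l)      ≡⟨ trans (ℚ.*-assoc (ι m) γ (ι (length l))) (cong (ι m ℚ.*_) (ℚ.*-comm γ (ι (length l)))) ⟩
               ι m ℚ.* (ι (length l) ℚ.* γ)    ≤⟨ ℚ.*-monoˡ-≤-nonNeg (ι m) ⦃ ℚ.nonNegative (0≤ι m) ⦄ (ℚ.≤-trans total-≤ (ι-mono k≤)) ⟩
               ι m ℚ.* ι (hits l x)            ≡⟨ ι-* m (hits l x) ⟨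
               ι (m * hits l x)                ∎)
          where
          open ℚ.≤-Reasoning
          attained : ∀ k → (∀ j → j < k → ¬ T ⌞ (∀ x → hits l x ≤ j) ⌟) → ∃ λ x → k ≤ hits l x
          attained zero    _   = nonempty M , z≤n
          attained (suc k) min = let (x , p) = ¬∀⇒∃ (λ all → min k ℕ.≤-refl (true! all)) in x , ℕ.≰⇒> p

    module NoncompactShatters {L : Language ℓ} (M : Structure L) (A : Pred (Carrier M) ℓ) (μ : Pred (Carrier M) ℓ → ℝ)
      (prob : IsProbability (Generated (Def M A)) μ) (σ : Aut M) (inv : Invariant (Generated (Def M A)) μ (bij σ)) where
      open MeasureTheory M A μ prob
      open Semantics M
      open Inverse (bij σ) using (to; from; strictlyInverseˡ)

      private
        C = Carrier M

        𝒜 : Pred (Pred C ℓ) (lsuc ℓ)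
        𝒜 = Generated (Def M A)

        pw : ℕ → C → C
        pw n = bij σ ^ᶻ (ℤ.+ n)

        variable
          B B′ : Pred C ℓ

        image-suc : ∀ n → image to (image (pw n) B) ≐ image (pw (suc n)) B
        image-suc n = (λ { (x , (y , b , refl) , e) → y , b , e }) , λ { (y , b , e) → _ , (y , b , refl) , e }

        𝒜-power : ∀ n → B ∈ 𝒜 → image (pw n) B ∈ 𝒜
        𝒜-power zero    b = resp ((λ {x} b → x , b , refl) , λ { (x , b , refl) → b }) b
        𝒜-power (suc n) b = resp (image-suc n) (proj₁ (inv (𝒜-power n b)))

        power-≤ : ∀ n → B ∈ 𝒜 → 𝐦 (image (pw n) B) ≼ 𝐦 B
        power-≤ zero    b = m-≐ (𝒜-power 0 b) ((λ { (x , b , refl) → b }) , (λ {x} b → x , b , refl))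
        power-≤ {B} (suc n) b = ≼-trans (m-≐ (𝒜-power (suc n) b) (proj₂ (image-suc n) , proj₁ (image-suc n)))
          (≼-trans (≃⇒≼ (μ (image to (image (pw n) B))) (μ (image (pw n) B)) (proj₂ (inv (𝒜-power n b)))) (power-≤ n b))

        power-≥ : ∀ n → B ∈ 𝒜 → 𝐦 B ≼ 𝐦 (image (pw n) B)
        power-≥ zero    b = m-≐ b ((λ {x} b → x , b , refl) , λ { (x , b , refl) → b })
        power-≥ {B} (suc n) b = ≼-trans (power-≥ n b) (≼-trans (≃⇒≽ (μ (image to (image (pw n) B))) (μ (image (pw n) B)) (proj₂ (inv (𝒜-power n b)))) (m-≐ (proj₁ (inv (𝒜-power n b))) (image-suc n)))

        pw-onto : ∀ n y → ∃ λ x → pw n x ≡ y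
        pw-onto zero    y = y , refl
        pw-onto (suc n) y = let (x , e) = pw-onto n (from y) in x , trans (cong to e) (strictlyInverseˡ y)

        sat-power : ∀ {k} (φ : Formula L k) n {e : Vector C k} → (M ⊨ φ [ e ]) ⇔ (M ⊨ φ [ pw n ∘ e ])
        sat-power φ zero    = mk⇔ id id
        sat-power φ (suc n) = mk⇔ (λ p → ⇒ (Automorphism.sat-aut σ φ) (⇒ (sat-power φ n) p)) (λ p → ⇐ (sat-power φ n) (⇐ (Automorphism.sat-aut σ φ) p))

      module _ {q : ℕ} (φ : Formula L (suc q)) (c : Vector C q) (c∈ : ∀ i → c i ∈ A) where

        Conj : ℕ → Pred C ℓ
        Conj n x = M ⊨ φ [ x V.∷ (pw n ∘ c) ]

        private
          image-conj : ∀ n d → image (pw n) (Conj d) ≐ Conj (n + d)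
          image-conj n d = (λ { (x , s , refl) → sat-≗ φ (env x) (⇒ (sat-power φ n) s) }) , λ {y} s → let (x , e) = pw-onto n y in
              x , ⇐ (sat-power φ n) (sat-≗ φ (λ { zero → sym e ; (suc i) → sym (power-+ (bij σ) n (ℤ.+ d) (c i)) }) s) , e
            where
            env : ∀ x i → (pw n ∘ (x V.∷ (pw d ∘ c))) i ≡ (pw n x V.∷ (pw (n + d) ∘ c)) i
            env x zero    = refl
            env x (suc i) = power-+ (bij σ) n (ℤ.+ d) (c i)

        conj-𝒜 : ∀ n → Conj n ∈ 𝒜
        conj-𝒜 n = subst (λ k → Conj k ∈ 𝒜) (ℕ.+-identityʳ n) (resp (image-conj n 0) (𝒜-power n (gen ((q , φ , c , c∈) , id , id))))

        conj-shift : ∀ {γ} i d → κ γ ≼ 𝐦 (Conj d △ Conj 0) → κ γ ≼ 𝐦 (Conj i △ Conj (i + d))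
        conj-shift i d le = ≼-trans le (≼-trans (power-≥ i diff) (m-mono (𝒜-power i diff) (𝒜-△ (conj-𝒜 i) (conj-𝒜 (i + d))) sub))
          where
          diff = 𝒜-△ (conj-𝒜 d) (conj-𝒜 0)
          at-i : ∀ {x} → x ∈ Conj 0 → pw i x ∈ Conj i
          at-i {x} s = subst (λ k → pw i x ∈ Conj k) (ℕ.+-identityʳ i) (proj₁ (image-conj i 0) (x , s , refl))
          from-i : ∀ {x} → pw i x ∈ Conj i → x ∈ Conj 0
          from-i {x} s = let (y , s′ , e) = proj₂ (image-conj i 0) (subst (λ k → pw i x ∈ Conj k) (sym (ℕ.+-identityʳ i)) s) in
            subst (_∈ Conj 0) (power-injective (bij σ) i e) s′
          at-d : ∀ {x} → x ∈ Conj d → pw i x ∈ Conj (i + d)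
          at-d {x} s = proj₁ (image-conj i d) (x , s , refl)
          from-d : ∀ {x} → pw i x ∈ Conj (i + d) → x ∈ Conj d
          from-d {x} s = let (y , s′ , e) = proj₂ (image-conj i d) s in subst (_∈ Conj d) (power-injective (bij σ) i e) s′

          sub : ∀ {y} → y ∈ image (pw i) (Conj d △ Conj 0) → y ∈ (Conj i △ Conj (i + d))
          sub (x , inj₁ (s , ¬s) , refl) = inj₂ (at-d s , λ t → ¬s (from-i t))
          sub (x , inj₂ (s , ¬s) , refl) = inj₁ (at-i s , λ t → ¬s (from-d t))

        -- `packing` for the translates of one definable set; the point that separates many pairs is
        -- the one given by `popular` for their symmetric differences.
        separated-shatter : ∀ γ → 0ℚ ℚ.< γ → (∀ d → κ γ ≼ 𝐦 (Conj (suc d) △ Conj 0)) → ∀ d → ∃ λ (x : Fin d → C) → Shatters M φ x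
        separated-shatter γ 0<γ far d =
          let (m , 1≤mγ) = archimedean γ 0<γ
              (x , sh) = packing D m (positive m 1≤mγ) (separable m 1≤mγ) d
          in x , λ S → let (n , e) = sh S in pw n ∘ c , e
          where
          D : ℕ → C → Bool
          D n x = tv φ (x V.∷ (pw n ∘ c))

          E : ℕ × ℕ → Pred C ℓ
          E (i , j) = Conj i △ Conj j

          positive : ∀ m → 1ℚ ℚ.≤ ι m ℚ.* γ → 0 < m
          positive zero    le = ⊥-elim (<⇒≱ᵠ 0<1 (subst (1ℚ ℚ.≤_) (ℚ.*-zeroˡ γ) le))
          positive (suc m) _  = s≤s z≤n

          ordered : ∀ i j → i < j → κ γ ≼ 𝐦 (Conj i △ Conj j)
          ordered i j i<j with ℕ.m≤n⇒∃[o]m+o≡n i<j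
          ... | d , refl = subst (λ k → κ γ ≼ 𝐦 (Conj i △ Conj k)) (ℕ.+-suc i d) (conj-shift i (suc d) (far d))

          large : ∀ p → proj₁ p ≢ proj₂ p → κ γ ≼ 𝐦 (E p)
          large (i , j) i≢j with ℕ.<-cmp i j
          ... | tri< i<j _ _ = ordered i j i<j
          ... | tri≈ _ i≡j _ = ⊥-elim (i≢j i≡j)
          ... | tri> _ _ j<i = ≼-trans (ordered j i j<i) (m-≐ (𝒜-△ (conj-𝒜 j) (conj-𝒜 i)) (Sum.swap , Sum.swap))

          xor-△ : ∀ {P Q : Set ℓ} → T ⌞ (P × ¬ Q) ⊎ (Q × ¬ P) ⌟ → T (⌞ P ⌟ xor ⌞ Q ⌟)
          xor-△ {P} {Q} t = subst T (△-xor P Q) t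

          tally-mono : ∀ {Z : Set} (f g : Z → Bool) l → (∀ z → T (f z) → T (g z)) → tally f l ≤ tally g l
          tally-mono f g []      h = z≤n
          tally-mono f g (z ∷ l) h = ℕ.+-mono-≤ (𝟙-mono (h z)) (tally-mono f g l h)

          separable : ∀ m → 1ℚ ℚ.≤ ι m ℚ.* γ → ∀ P → All (λ (i , j) → i ≢ j) P → ∃ λ x → length P ≤ m * tally (λ (i , j) → D i x xor D j x) P
          separable m 1≤mγ P ds =
            let (x , le) = Averaging.popular E (λ (i , j) → 𝒜-△ (conj-𝒜 i) (conj-𝒜 j)) γ m 1≤mγ P (All.map (λ {p} → large p) ds) in
            x , ℕ.≤-trans le (ℕ.*-monoʳ-≤ m (tally-mono (λ z → ⌞ x ∈ E z ⌟) (λ (i , j) → D i x xor D j x) P (λ (i , j) → xor-△)))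

      -- Replace B by a definable set D close to it: the translates of D are still far apart.
      noncompact-shatters : ¬ CompactSystem 𝒜 μ (bij σ) → ∃₂ λ q (φ : Formula L (suc q)) → ∀ d → ∃ λ (x : Fin d → C) → Shatters M φ x
      noncompact-shatters ¬compact =
        let (ε , p)   = ¬∀⇒∃ ¬compact
            (0<ε , q) = ¬⇒×¬ p
            (B , r)   = ¬∀⇒∃ q
            (b , none) = ¬⇒×¬ r
            (δ , 0<δ , κδ≼ε) = 0<ᴿ⇒κ ε 0<ε
        in approximate B b δ 0<δ λ n → ≼-trans κδ≼ε (≤ᴿ⇒≼ ε (μ (image (pw (suc n)) B △ B)) λ lt → none (suc n , s≤s z≤n , lt))
        where
        approximate : ∀ B → B ∈ 𝒜 → ∀ δ → 0ℚ ℚ.< δ → (∀ n → κ δ ≼ 𝐦 (image (pw (suc n)) B △ B)) →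
                      ∃₂ λ q (φ : Formula L (suc q)) → ∀ d → ∃ λ (x : Fin d → C) → Shatters M φ x
        approximate B b δ 0<δ far =
          -- Replacing `B` and its translate by definable sets costs η = δ/4 each, which leaves γ =
          -- δ/2.
          let (γ , 0<γ , γγ) = half δ 0<δ
              (η , 0<η , ηη) = half γ 0<γ
              (D , (((q , φ , c , c∈) , f , g)) , near) = approximable b η 0<η
              d : D ∈ 𝒜
              d = gen ((q , φ , c , c∈) , f , g)
              err : 𝐦 (B △ D) ≼ κ η
              err = outer-m (𝒜-△ b d) near
          in q , φ , separated-shatter φ c c∈ γ 0<γ λ n →
               let N = suc n
                   dN = conj-𝒜 φ c c∈ N
                   d0 = conj-𝒜 φ c c∈ 0
                   shifted = 𝒜-power N (𝒜-△ b d)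
                   rest = 𝒜-∪ (𝒜-△ dN d0) (𝒜-△ b d)
               in close γ η δ γγ ηη (≼-trans (far n) (≼-trans
                    (m-mono (𝒜-△ (𝒜-power N b) b) (𝒜-∪ shifted rest) (triangle φ c c∈ D f g N))
                    (≼-trans (m-subadditive shifted rest) (≼-⊕ (≼-trans (power-≤ N (𝒜-△ b d)) err) (≼-trans (m-subadditive (𝒜-△ dN d0) (𝒜-△ b d)) (≼-⊕ (≼-refl {𝐦 (Conj φ c c∈ N △ Conj φ c c∈ 0)}) err))))))
          where
          close : ∀ γ η δ {s} → γ ℚ.+ γ ≡ δ → η ℚ.+ η ≡ γ → κ δ ≼ (κ η ⊕ (s ⊕ κ η)) → κ γ ≼ s
          close γ η δ {s} γγ ηη le = ≼-cancelˡ (κ γ) (≼-trans (≼-eq λ _ → γγ) (≼-trans le (≼-eq λ n → trans (ident η (s n)) (cong (ℚ._+ s n) ηη))))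
            where
            ident : ∀ e s → e ℚ.+ (s ℚ.+ e) ≡ (e ℚ.+ e) ℚ.+ s
            ident = solve 2 (λ e s → e :+ (s :+ e) := (e :+ e) :+ s) refl

          triangle : ∀ {q} (φ : Formula L (suc q)) c c∈ D → (∀ {x} → x ∈ D → M ⊨ φ [ x V.∷ c ]) → (∀ {x} → M ⊨ φ [ x V.∷ c ] → x ∈ D) → ∀ N {x} →
            x ∈ (image (pw N) B △ B) → x ∈ (image (pw N) (B △ D) ∪ ((Conj φ c c∈ N △ Conj φ c c∈ 0) ∪ (B △ D)))
          triangle φ c c∈ D f g N {x} diff with pw-onto N x
          ... | y , refl = go (decide (y ∈ D)) (decide (pw N y ∈ D)) diff
            where
            member : y ∈ D → pw N y ∈ Conj φ c c∈ N
            member d = sat-≗ φ (λ { zero → refl ; (suc i) → refl }) (⇒ (sat-power φ N) (f d))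
            member⁻¹ : pw N y ∈ Conj φ c c∈ N → y ∈ D
            member⁻¹ s = g (⇐ (sat-power φ N) (sat-≗ φ (λ { zero → refl ; (suc i) → refl }) s))
            unimage : pw N y ∈ image (pw N) B → y ∈ B
            unimage (z , b , e) = subst (_∈ B) (power-injective (bij σ) N e) b

            go : Dec (y ∈ D) → Dec (pw N y ∈ D) → pw N y ∈ (image (pw N) B △ B) →
                 pw N y ∈ (image (pw N) (B △ D) ∪ ((Conj φ c c∈ N △ Conj φ c c∈ 0) ∪ (B △ D)))
            go (no ¬d) _        (inj₁ (b , ¬b)) = inj₁ (y , inj₁ (unimage b , ¬d) , refl)
            go (yes d) (yes d′) (inj₁ (b , ¬b)) = inj₂ (inj₂ (inj₂ (d′ , ¬b)))
            go (yes d) (no ¬d′) (inj₁ (b , ¬b)) = inj₂ (inj₁ (inj₁ (member d , λ s → ¬d′ (g s))))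
            go _       (no ¬d′) (inj₂ (b , ¬b)) = inj₂ (inj₂ (inj₁ (b , ¬d′)))
            go (yes d) (yes d′) (inj₂ (b , ¬b)) = inj₁ (y , inj₂ (d , λ b → ¬b (y , b , refl)) , refl)
            go (no ¬d) (yes d′) (inj₂ (b , ¬b)) = inj₂ (inj₁ (inj₂ (f d′ , λ s → ¬d (member⁻¹ s))))

  open Noncompactness

  -- Each of the four conditions against the independence property.

  module Characterisation where

    private variable
      ℓ : Level

    module Main {L : Language ℓ} (Th : Theory {L = L}) (complete : Complete Th)
                (M : Structure L) (M⊨Th : M ⊨ᵀ Th) (saturated : Saturated M) (uncountable : ¬ (ℕ ↔ Carrier M)) where

      private
        C = Carrier M

        Noncompact : Set (lsuc ℓ)
        Noncompact = ∃ λ (σ : Aut M) → Nontrivial σ × ∃ λ A → NonCompactOver M σ A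

        GlobalNoncompact : Set (lsuc ℓ)
        GlobalNoncompact = ∃ λ (σ : Aut M) → Nontrivial σ × NonCompactOver M σ (λ _ → ⊤)

      shatters⇒IP : ∀ (N : Structure L) → N ⊨ᵀ Th → ∀ {q} (φ : Formula L (suc q)) → (∀ d → ∃ λ (x : Fin d → Carrier N) → Shatters N φ x) → IP Th
      shatters⇒IP N N⊨Th {q} φ sh = 1 , q , φ , N , N⊨Th , shatters⇒ip N q φ sh

      noncompact⇒IP : Noncompact → IP Th
      noncompact⇒IP (σ , _ , A , μ , prob , inv , ¬compact) =
        let (q , φ , sh) = NoncompactShatters.noncompact-shatters M A μ prob σ inv ¬compact in shatters⇒IP M M⊨Th φ sh

      -- The common form of both notions of wideness: points and parameters on which `φ` reads off
      -- the translates of a wide sequence.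
      translates⇒IP : ∀ (N : Structure L) → N ⊨ᵀ Th → ∀ {q} (φ : Formula L (suc q)) (a : ℤ → Carrier N) (c : ℕ → Vector (Carrier N) q)
        (I : ℤ → Bool) ε → 0ℝ <ᴿ ε → Wide ε I → (∀ i n → Semantics.tv N φ (a i V.∷ c n) ≡ I (i ℤ.- ℤ.+ n)) → IP Th
      translates⇒IP N N⊨Th φ a c I ε 0<ε wide eq = shatters⇒IP N N⊨Th φ λ d →
        let (x , sh) = WideShatters.translates-shatter I ε 0<ε wide d in
        a ∘ x , λ S → let (n , e) = sh S in c n , λ i → trans (eq (x i) n) (e i)

      private
        sub-add : ∀ i (j : ℤ) → (i ℤ.- j) ℤ.+ j ≡ i
        sub-add i j = trans (ℤ.+-assoc i (ℤ.- j) j) (trans (cong (λ k → i ℤ.+ k) (ℤ.+-inverseˡ j)) (ℤ.+-identityʳ i))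

        add-sub : ∀ i (j : ℤ) → (i ℤ.+ j) ℤ.- j ≡ i
        add-sub i j = trans (ℤ.+-assoc i j (ℤ.- j)) (trans (cong (λ k → i ℤ.+ k) (ℤ.+-inverseʳ j)) (ℤ.+-identityʳ i))

      -- Injectivity of `a` turns equations between sets of elements into equations between sets of
      -- indices.
      weak⇒IP : WeakWide Th → IP Th
      weak⇒IP (N , N⊨Th , q , φ , a , c , ε , a-inj , 0<ε , translate , I , I-iff , wide) =
        translates⇒IP N N⊨Th φ a (λ n → c (ℤ.+ n)) I ε 0<ε wide λ i n → T-ext
          (λ t → let (j , e , _ , e′ , s) = proj₁ (translate (ℤ.+ n)) (i , refl , holds t) in
             subst (T ∘ I) (sym (trans (cong (ℤ._- ℤ.+ n) (a-inj e)) (add-sub j (ℤ.+ n)))) (⇐ (I-iff j) (_ , e′ , s)))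
          (λ t → let (k , e , s) = proj₂ (translate (ℤ.+ n)) (i ℤ.- ℤ.+ n , cong a (sym (sub-add i (ℤ.+ n))) , ⇒ (I-iff (i ℤ.- ℤ.+ n)) t) in
             true! (subst (λ x → N ⊨ φ [ x V.∷ c (ℤ.+ n) ]) (sym e) s))

      -- Applying σⁿ to point and parameters at once, φ(σⁱa; σⁿc) has the truth value of φ(σ^(i-n)a;
      -- c), so the parameters σⁿc define the translates.
      strong⇒IP : StrongWide Th → IP Th
      strong⇒IP (N , N⊨Th , q , φ , a , c , σ , ε , 0<ε , I , I-iff , wide) =
        translates⇒IP N N⊨Th φ (λ i → (bij σ ^ᶻ i) a) (λ n → (bij σ ^ᶻ (ℤ.+ n)) ∘ c) I ε 0<ε wide λ i n → trans
          (cong (Semantics.tv N φ) (ext λ { zero → sym (back i n) ; (suc j) → refl }))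
          (trans (sym (tv-power n (((bij σ ^ᶻ (i ℤ.- ℤ.+ n)) a) V.∷ c)))
            (T-ext (λ t → ⇐ (I-iff (i ℤ.- ℤ.+ n)) (holds t)) (λ t → true! (⇒ (I-iff (i ℤ.- ℤ.+ n)) t))))
        where
        back : ∀ i n → (bij σ ^ᶻ (ℤ.+ n)) ((bij σ ^ᶻ (i ℤ.- ℤ.+ n)) a) ≡ (bij σ ^ᶻ i) a
        back i n = trans (power-+ (bij σ) n (i ℤ.- ℤ.+ n) a) (cong (λ j → (bij σ ^ᶻ j) a) (trans (ℤ.+-comm (ℤ.+ n) (i ℤ.- ℤ.+ n)) (sub-add i (ℤ.+ n))))

        open Semantics N using (tv; module Automorphism)

        tv-power : ∀ n (e : Vector (Carrier N) (suc q)) → tv φ e ≡ tv φ (λ j → (((bij σ ^ᶻ (ℤ.+ n)) (e zero)) V.∷ ((bij σ ^ᶻ (ℤ.+ n)) ∘ V.tail e)) j)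
        tv-power n e = trans (go n) (cong (tv φ) (ext λ { zero → refl ; (suc j) → refl }))
          where
          go : ∀ n → tv φ e ≡ tv φ ((bij σ ^ᶻ (ℤ.+ n)) ∘ e)
          go zero    = refl
          go (suc n) = trans (go n) (⌞⌟-cong (⇒ (Automorphism.sat-aut σ φ)) (⇐ (Automorphism.sat-aut σ φ)))

      module FromIP (ip : IP Th) where
        private
          N = proj₁ (proj₂ (proj₂ (proj₂ ip)))

          N⊨Th : N ⊨ᵀ Th
          N⊨Th = proj₁ (proj₂ (proj₂ (proj₂ (proj₂ ip))))

          one : OneVariable.OneVariableIP N
          one = let (p , q , φ , _ , _ , f) = ip in OneVariable.ip⇒one-variable N p q φ f

          q : ℕ
          q = proj₁ one

          θ : Formula L (suc q)
          θ = proj₁ (proj₂ one)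

          sentence : ℕ → Sentence {L = L}
          sentence n = exs n (rename (Fin._↑ˡ 0) (shatter θ n))

          sat-sentence : ∀ (K : Structure L) n → (K ⊨ sentence n) ⇔ (∃ λ (a : Fin n → Carrier K) → Shatters K θ a)
          sat-sentence K n = mk⇔
            (λ s → let (v , p) = ⇒ (sat-exs n (rename (Fin._↑ˡ 0) (shatter θ n))) s in
               v , ⇒ (sat-shatter K θ n) (⇒ (sat-rename⇔ (Fin._↑ˡ 0) (shatter θ n) (V.lookup-++ˡ v V.[])) p))
            (λ (v , p) → ⇐ (sat-exs n (rename (Fin._↑ˡ 0) (shatter θ n)))
               (v , ⇐ (sat-rename⇔ (Fin._↑ˡ 0) (shatter θ n) (V.lookup-++ˡ v V.[])) (⇐ (sat-shatter K θ n) p)))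
            where open Semantics K

          -- The independence property is witnessed in some model `N`. Each finite instance is a
          -- sentence, which the complete theory decides, and so it passes to `M`.
          ip-M : ∀ n → ∃ λ (a : Fin n → C) → Shatters M θ a
          ip-M n with proj₂ complete (sentence n)
          ... | inj₁ holds-in = ⇒ (sat-sentence M n) (holds-in M M⊨Th)
          ... | inj₂ fails-in = ⊥-elim (⇒ (Semantics.sat-neg N (sentence n)) (fails-in N N⊨Th) (⇐ (sat-sentence N n) (proj₂ (proj₂ one) n)))

          countable : (g : ℕ → C) (A : Pred C ℓ) → (∀ x → x ∈ A → ∃ λ n → g n ≡ x) → Smaller M A
          countable = Homogeneity.countable-smaller M saturated (proj₁ infinite) (proj₂ infinite) uncountable
            where infinite = Sequences.infinite M saturated uncountable θ ip-M

          U : Ultrafilter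
          U = NonprincipalUltrafilter.ultrafilter

        module Witness (σ : Aut M) (a : C) (inj : Injective _≡_ _≡_ (λ i → (bij σ ^ᶻ i) a))
          (realise : ∀ (I : ℤ → Bool) → ∃ λ (c : Vector C q) → ∀ i → Semantics.tv M θ ((bij σ ^ᶻ i) a V.∷ c) ≡ I i) where
          open Semantics M

          nontrivial : Nontrivial σ
          nontrivial trivial = case inj {ℤ.+ 1} {ℤ.+ 0} (trivial a) of λ ()

          -- One parameter tuple for each translate of the pattern, found separately: weak wideness
          -- constrains only the traces on the orbit.
          c : ℤ → Vector C q
          c n = proj₁ (realise (shift RS n))

          c-pattern : ∀ n i → tv θ ((bij σ ^ᶻ i) a V.∷ c n) ≡ RS (i ℤ.- n)
          c-pattern n = proj₂ (realise (shift RS n))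

          base : ∀ i → tv θ ((bij σ ^ᶻ i) a V.∷ c 0ℤ) ≡ RS i
          base i = trans (c-pattern 0ℤ i) (cong RS (ℤ.+-identityʳ i))

          0<½ : 0ℝ <ᴿ fromℚ ½
          0<½ = ½ , ℚ.positive⁻¹ ½ , 0 , λ _ _ → ℚ.≤-reflexive (ℚ.+-identityˡ ½)

          strong : StrongWide Th
          strong = M , M⊨Th , q , θ , a , c 0ℤ , σ , fromℚ ½ , 0<½ , RS ,
            (λ i → mk⇔ (λ t → holds (subst T (sym (base i)) t)) (λ s → subst T (base i) (true! s))) , RS-wide

          member : ∀ n i → T (RS (i ℤ.- n)) → M ⊨ θ [ (bij σ ^ᶻ i) a V.∷ c n ]
          member n i t = holds (subst T (sym (c-pattern n i)) t)

          member⁻¹ : ∀ n i → M ⊨ θ [ (bij σ ^ᶻ i) a V.∷ c n ] → T (RS (i ℤ.- n))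
          member⁻¹ n i s = subst T (c-pattern n i) (true! s)

          weak : WeakWide Th
          weak = M , M⊨Th , q , θ , (λ i → (bij σ ^ᶻ i) a) , c , fromℚ ½ , inj , 0<½ ,
            (λ n → (λ { (i , e , s) → i ℤ.- n , trans e (cong (λ j → (bij σ ^ᶻ j) a) (sym (sub-add i n))) , i ℤ.- n , refl ,
                         member 0ℤ (i ℤ.- n) (subst (T ∘ RS) (sym (ℤ.+-identityʳ (i ℤ.- n))) (member⁻¹ n i s)) })
                 , (λ { (i , e , j , e′ , s) → i ℤ.+ n , e , member n (i ℤ.+ n)
                         (subst (T ∘ RS) (trans (ℤ.+-identityʳ j) (trans (inj (sym e′)) (sym (add-sub i n)))) (member⁻¹ 0ℤ j s)) })) ,
            RS , (λ i → mk⇔ (λ t → i , refl , holds (subst T (sym (base i)) t))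
                            (λ (j , e , s) → subst (T ∘ RS) (inj {j} {i} (sym e)) (subst T (base j) (true! s)))) , RS-wide

          global : GlobalNoncompact
          global = σ , nontrivial , OrbitMeasure.μ M saturated countable U σ a , OrbitMeasure.probability M saturated countable U σ a ,
            OrbitMeasure.invariant M saturated countable U σ a , OrbitMeasure.not-compact M saturated countable U σ a θ (c 0ℤ) base

        conclusions : GlobalNoncompact × WeakWide Th × StrongWide Th
        conclusions = use (Sequences.shift-orbit M saturated uncountable θ ip-M)
          where
          use : Sequences.ShiftOrbit M saturated uncountable θ ip-M → GlobalNoncompact × WeakWide Th × StrongWide Th
          use (σ , a , inj , realise) = Witness.global σ a inj realise , Witness.weak σ a inj realise , Witness.strong σ a inj realise

      equivalence : (IP Th ⇔ Noncompact) × (IP Th ⇔ GlobalNoncompact) × (IP Th ⇔ WeakWide Th) × (IP Th ⇔ StrongWide Th)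
      equivalence =
          mk⇔ (λ ip → let (σ , nt , nc) = proj₁ (FromIP.conclusions ip) in σ , nt , _ , nc) noncompact⇒IP
        , mk⇔ (proj₁ ∘ FromIP.conclusions) (λ (σ , nt , nc) → noncompact⇒IP (σ , nt , _ , nc))
        , mk⇔ (proj₁ ∘ proj₂ ∘ FromIP.conclusions) weak⇒IP
        , mk⇔ (proj₂ ∘ proj₂ ∘ FromIP.conclusions) strong⇒IP

  open Characterisation public

theorem3p12 : (∀ {a} → ExcludedMiddle a) → (∀ {a b} → Extensionality a b) →
    ∀ {ℓ} (L : Language ℓ) (Th : Theory {L = L}) → Complete Th →
    (M : Structure L) → M ⊨ᵀ Th → Saturated M → ¬ (ℕ ↔ Carrier M) →
    (IP Th ⇔ (∃ λ (σ : Aut M) → Nontrivial σ × ∃ λ A → NonCompactOver M σ A))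
    × (IP Th ⇔ (∃ λ (σ : Aut M) → Nontrivial σ × NonCompactOver M σ (λ _ → ⊤)))
    × (IP Th ⇔ WeakWide Th)
    × (IP Th ⇔ StrongWide Th)
theorem3p12 em ext L Th complete M M⊨Th saturated uncountable =
  Classical.Main.equivalence em ext Th complete M M⊨Th saturated uncountable
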